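{- Let $p$ be a prime with $p\equiv 1,7,17,23\pmod{24}$, and let $A_n=\sum_{k=0}^n\binom{2k}k\binom{2n-2k}{n-k}\binom nk^2$. If $p\equiv 1,7\pmod{24}$, so that $p=x^2+6y^2$ for some integers $x,y$, then $\sum_{n=0}^{p-1}\frac{A_n}{(-8)^n}\equiv 4x^2\pmod p$. If $p\equiv 17,23\pmod{24}$, then $\sum_{n=0}^{p-1}\frac{A_n}{(-8)^n}\equiv 0\pmod p$.
   Context: Congruences modulo $p$ are between rational numbers whose denominators are prime to $p$. -}

module Defs where

open import Data.Nat as ℕ using (ℕ; zero; suc; _^_; _%_)
open import Data.Nat.Properties using (m^n≢0)
open import Data.Nat.Combinatorics using (_C_)
open import Data.Nat.Divisibility as ℕD using ()
open import Data.Integer as ℤ using (ℤ; +_)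
open import Data.Integer.Divisibility as ℤD using ()
open import Data.Rational as ℚ using (ℚ; ↥_; ↧ₙ_; _-_; _+_; _/_)
open import Data.List using (List; map; foldr)
open import Data.Product using (_×_)
open import Relation.Nullary using (¬_)

sumℕ : ℕ → (ℕ → ℕ) → ℕ
sumℕ zero f = f 0
sumℕ (suc n) f = sumℕ n f ℕ.+ f (suc n)

sumℚ : ℕ → (ℕ → ℚ) → ℚ
sumℚ zero f = f 0
sumℚ (suc n) f = sumℚ n f + f (suc n)

A : ℕ → ℕ
A n = sumℕ n (λ k → ((2 ℕ.* k) C k) ℕ.* ((2 ℕ.* n ℕ.∸ 2 ℕ.* k) C (n ℕ.∸ k))
                     ℕ.* ((n C k) ℕ.* (n C k)))

sign : ℕ → ℤ
sign zero = + 1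
sign (suc n) = ℤ.- sign n

term : ℕ → ℚ
term n = _/_ (sign n ℤ.* + A n) (8 ^ n) {{m^n≢0 8 n}}

-- a ≡ b (mod p) for rationals: writing a - b in lowest terms, its
-- denominator is prime to p and p divides its numerator.
_≡ℚ_[mod_] : ℚ → ℚ → ℕ → Set
a ≡ℚ b [mod p ] = (¬ (p ℕD.∣ ↧ₙ (a - b))) × ((+ p) ℤD.∣ ↥ (a - b))

{-# OPTIONS --safe #-}

-- With N = (p - 1)/3 or (p - 2)/3, the Domb numbers equal Σ (-1)^k 16^(n-k) C(n+2k,3k) C(2k,k)² C(3k,k)
-- (both sides satisfy the same recurrence), and modulo p this turns Σ A_n (-8)^(-n) into
-- Σ C(2k,k)² C(3k,k) 216^(-k), which is U_N² / 8^N by Clausen's formula, where U_N is a rescaled Legendre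
-- polynomial P_N evaluated at 1/√2.
--
-- Termwise, U_N is congruent to the m-th coefficient of (1 - 4x)^(4m) (1 + 4x)^m for p = 6m + 1, and up to
-- sign and a factor 2 to that of (1 - 4x)^m (1 + 4x)^(4m+3) for p = 6m + 5. Put t = q ψ(q⁴)² / φ(q²)²
-- and G = Σ (6k+1) q^(2k(3k+1)) · φ(q), resp. G = ψ(q⁴) · Σ (-1)^k (3k+1) q^(k(3k+2)), a weight 2 form.
-- Classical theta identities express G⁶ through 1 - 4t, 1 + 4t, q/t and the logarithmic derivative b of t;
-- raising this to the power m and dropping p-th powers (x^p ≡ 1 modulo p and q^p when x(0) = 1) gives
-- G (t/q)^m ≡ b (1 - 4t)^(4m) (1 + 4t)^m, resp. b (1 - 4t)^m (1 + 4t)^(4m+3). Since b dq/q = dt/t, the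
-- coefficient of q^m in G is the wanted coefficient in x (a change of variables in a residue).
--
-- That coefficient of G sums n over representations p = n² + 6l² for p = 6m + 1, so it is ±2x; it sums over
-- representations p = 2n² + 3j² with j odd for p = 6m + 5, which do not exist when p ≡ 1, 7 (mod 8).
module Submission where

open import Algebra.Bundles using (CommutativeRing)
open import Algebra.Solver.Ring.AlmostCommutativeRing using (AlmostCommutativeRing; fromCommutativeRing; _-Raw-AlmostCommutative⟶_)
open import Data.Empty using (⊥; ⊥-elim)
open import Data.Integer as ℤ using (ℤ; +_; -[1+_]; _+_; _*_; -_; _-_; ∣_∣; _^_)
open import Data.Integer.DivMod using (a≡a%ℕn+[a/ℕn]*n; n%ℕd<d)
open import Data.Integer.Properties as ℤP using ()
open import Data.Integer.Tactic.RingSolver using (solve-∀)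
open import Data.Maybe using (Maybe; just; nothing)
open import Data.Nat as ℕ using (ℕ; zero; suc; _≤_; _<_; z≤n; s≤s; _%_; _∸_)
open import Data.Nat.Coprimality using (recompute)
open import Data.Nat.DivMod using (m≡m%n+[m/n]*n)
open import Data.Nat.Divisibility as ℕD using (divides)
open import Data.Nat.Primality using (Prime; euclidsLemma; ¬prime[0]; ¬prime[1])
open import Data.Nat.Properties as ℕP using ()
import Data.Nat.Tactic.RingSolver as ℕSolver
open import Data.Product using (_×_; _,_; proj₁; proj₂; Σ)
open import Data.Sum using (_⊎_; inj₁; inj₂; [_,_])
open import Level using (0ℓ)
open import Relation.Binary.PropositionalEquality as ≡ using (_≡_; refl; cong; cong₂; subst; module ≡-Reasoning; subst₂; _≢_)
open import Relation.Nullary using (yes; no; ¬_; contradiction)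
open import Relation.Nullary.Decidable using (from-no)

-- No infinite product occurs. All series are truncated integer series, and the theta identities
-- come from integral symmetries of plane lattices, so that every exchange of summation is finite
-- below a fixed order. The two facts that products would supply are reached otherwise: Jacobi's
-- formula for the cube of Euler's series by comparing logarithmic derivatives, and `J D` = ψ(q^D)
-- φ(-q^D)² by doubling D until all series involved are 1 to the order considered.
--
-- Truncation below q^p is also what makes x^p ≡ 1 true modulo p, and it suffices because only a
-- coefficient of index m < p is read. A relation for G⁶ is enough because 1 + 6e is a multiple of p
-- for e = m when p = 6m + 1, and for e = 5m + 4 when p = 6m + 5; the same e disposes of b.
--
-- The exponents of 1 - 4x and 1 + 4x are forced: the ratio of consecutive terms of `U N` vanishes
-- at N/2 and (N - 1)/2. One of these halves is m, and modulo p the other is 4m or 4m + 3.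

-- Formal power series over the integers, compared modulo d and up to a given order.

module PowerSeries where

  -- Congruence modulo d; for d = 0 it is equality.

  infix 4 _≡_[_]

  record _≡_[_] (a b : ℤ) (d : ℕ) : Set where
    constructor cg
    field
      quot : ℤ
      eq   : a ≡ b + quot * + d

  module _ {d : ℕ} where

    ≡⇒cg : ∀ {a b} → a ≡ b → a ≡ b [ d ]
    ≡⇒cg {a} refl = cg (+ 0) (≡.sym (≡.trans (cong (λ z → a + z) (ℤP.*-zeroˡ (+ d))) (ℤP.+-identityʳ a)))

    cg-refl : ∀ {a} → a ≡ a [ d ]
    cg-refl = ≡⇒cg refl

    cg-sym : ∀ {a b} → a ≡ b [ d ] → b ≡ a [ d ]
    cg-sym {a} {b} (cg q e) = cg (- q) (≡.trans (lem b q (+ d)) (cong (_+ - q * + d) (≡.sym e)))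
      where lem : ∀ b q d → b ≡ b + q * d + - q * d
            lem = solve-∀

    cg-trans : ∀ {a b c} → a ≡ b [ d ] → b ≡ c [ d ] → a ≡ c [ d ]
    cg-trans {a} {b} {c} (cg q refl) (cg r refl) = cg (r + q) (lem c q r (+ d))
      where lem : ∀ c q r d → c + r * d + q * d ≡ c + (r + q) * d
            lem = solve-∀

    cg-+ : ∀ {a b a′ b′} → a ≡ a′ [ d ] → b ≡ b′ [ d ] → a + b ≡ a′ + b′ [ d ]
    cg-+ {a′ = a} {b} (cg q refl) (cg r refl) = cg (q + r) (lem a b q r (+ d))
      where lem : ∀ a b q r d → a + q * d + (b + r * d) ≡ a + b + (q + r) * d
            lem = solve-∀

    cg-* : ∀ {a b a′ b′} → a ≡ a′ [ d ] → b ≡ b′ [ d ] → a * b ≡ a′ * b′ [ d ]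
    cg-* {a′ = a} {b} (cg q refl) (cg r refl) = cg (q * b + a * r + q * r * + d) (lem a b q r (+ d))
      where lem : ∀ a b q r d → (a + q * d) * (b + r * d) ≡ a * b + (q * b + a * r + q * r * d) * d
            lem = solve-∀

    cg-neg : ∀ {a b} → a ≡ b [ d ] → - a ≡ - b [ d ]
    cg-neg {b = b} (cg q refl) = cg (- q) (lem b q (+ d))
      where lem : ∀ b q d → - (b + q * d) ≡ - b + - q * d
            lem = solve-∀

  cg-0⇒≡ : ∀ {a b} → a ≡ b [ 0 ] → a ≡ b
  cg-0⇒≡ {a} {b} (cg q e) = ≡.trans e (≡.trans (cong (λ z → b + z) (ℤP.*-zeroʳ q)) (ℤP.+-identityʳ b))

  -- Without η the type checker does not compare series coefficientwise.
  record PS : Set where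
    no-eta-equality
    field at : ℕ → ℤ
  open PS public

  infixl 6 _⊕_
  infixl 7 _⊛_
  infix  8 ⊖_

  _⊕_ : PS → PS → PS
  (a ⊕ b) .at n = at a n + at b n

  ⊖_ : PS → PS
  (⊖ a) .at n = - at a n

  -- The Cauchy product with the term of index 0 of the first factor split off. No index is ever
  -- subtracted, so the ring laws are plain inductions.
  conv : (ℕ → ℤ) → (ℕ → ℤ) → ℕ → ℤ
  conv a b zero    = a 0 * b 0
  conv a b (suc n) = a 0 * b (suc n) + conv (λ i → a (suc i)) b n

  _⊛_ : PS → PS → PS
  (a ⊛ b) .at = conv (at a) (at b)

  ι : ℤ → PS
  ι x .at zero    = x
  ι x .at (suc n) = + 0

  +-rotate : ∀ x y z → x + (y + z) ≡ y + (x + z)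
  +-rotate = solve-∀

  conv-cong : ∀ {d} {a a′ b b′ : ℕ → ℤ} n → (∀ i → i ≤ n → a i ≡ a′ i [ d ]) → (∀ i → i ≤ n → b i ≡ b′ i [ d ]) →
              conv a b n ≡ conv a′ b′ n [ d ]
  conv-cong zero p q = cg-* (p 0 z≤n) (q 0 z≤n)
  conv-cong (suc n) p q = cg-+ (cg-* (p 0 z≤n) (q (suc n) ℕP.≤-refl))
    (conv-cong n (λ i i≤n → p (suc i) (s≤s i≤n)) (λ i i≤n → q i (ℕP.m≤n⇒m≤1+n i≤n)))

  conv-sucʳ : ∀ a b n → conv a b (suc n) ≡ a (suc n) * b 0 + conv a (λ i → b (suc i)) n
  conv-sucʳ a b zero = ℤP.+-comm (a 0 * b 1) (a 1 * b 0)
  conv-sucʳ a b (suc n) = ≡.trans (cong (λ z → a 0 * b (suc (suc n)) + z) (conv-sucʳ (λ i → a (suc i)) b n))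
    (+-rotate (a 0 * b (suc (suc n))) (a (suc (suc n)) * b 0) _)

  conv-comm : ∀ a b n → conv a b n ≡ conv b a n
  conv-comm a b zero = ℤP.*-comm (a 0) (b 0)
  conv-comm a b (suc n) = ≡.trans (cong₂ _+_ (ℤP.*-comm (a 0) (b (suc n))) (conv-comm (λ i → a (suc i)) b n))
    (≡.sym (conv-sucʳ b a n))

  conv-distribʳ : ∀ c a b n → conv (λ i → a i + b i) c n ≡ conv a c n + conv b c n
  conv-distribʳ c a b zero = ℤP.*-distribʳ-+ (c 0) (a 0) (b 0)
  conv-distribʳ c a b (suc n) = ≡.trans (cong₂ _+_ (ℤP.*-distribʳ-+ (c (suc n)) (a 0) (b 0)) (conv-distribʳ c (λ i → a (suc i)) (λ i → b (suc i)) n))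
    (lem (a 0 * c (suc n)) (b 0 * c (suc n)) _ _)
    where lem : ∀ x y z w → x + y + (z + w) ≡ x + z + (y + w)
          lem = solve-∀

  conv-scale : ∀ x a b n → conv (λ i → x * a i) b n ≡ x * conv a b n
  conv-scale x a b zero = ℤP.*-assoc x (a 0) (b 0)
  conv-scale x a b (suc n) = ≡.trans (cong₂ _+_ (ℤP.*-assoc x (a 0) (b (suc n))) (conv-scale x (λ i → a (suc i)) b n))
    (≡.sym (ℤP.*-distribˡ-+ x _ _))

  conv-assoc : ∀ a b c n → conv (conv a b) c n ≡ conv a (conv b c) n
  conv-assoc a b c zero = ℤP.*-assoc (a 0) (b 0) (c 0)
  conv-assoc a b c (suc n) = begin
    a 0 * b 0 * c (suc n) + conv (λ i → a 0 * b (suc i) + conv (λ i → a (suc i)) b i) c n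
      ≡⟨ cong (λ z → a 0 * b 0 * c (suc n) + z) (conv-distribʳ c (λ i → a 0 * b (suc i)) (conv (λ i → a (suc i)) b) n) ⟩
    a 0 * b 0 * c (suc n) + (conv (λ i → a 0 * b (suc i)) c n + conv (conv (λ i → a (suc i)) b) c n)
      ≡⟨ cong₂ (λ u v → a 0 * b 0 * c (suc n) + (u + v)) (conv-scale (a 0) (λ i → b (suc i)) c n) (conv-assoc (λ i → a (suc i)) b c n) ⟩
    a 0 * b 0 * c (suc n) + (a 0 * conv (λ i → b (suc i)) c n + conv (λ i → a (suc i)) (conv b c) n)
      ≡⟨ lem (a 0) (b 0) (c (suc n)) _ _ ⟩
    a 0 * (b 0 * c (suc n) + conv (λ i → b (suc i)) c n) + conv (λ i → a (suc i)) (conv b c) n ∎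
    where open ≡-Reasoning
          lem : ∀ a b c u v → a * b * c + (a * u + v) ≡ a * (b * c + u) + v
          lem = solve-∀

  conv-zeroˡ : ∀ b n → conv (λ _ → + 0) b n ≡ + 0
  conv-zeroˡ b zero = ℤP.*-zeroˡ (b 0)
  conv-zeroˡ b (suc n) = cong₂ _+_ (ℤP.*-zeroˡ (b (suc n))) (conv-zeroˡ b n)

  conv-ι : ∀ x b n → conv (at (ι x)) b n ≡ x * b n
  conv-ι x b zero = refl
  conv-ι x b (suc n) = ≡.trans (cong (λ z → x * b (suc n) + z) (conv-zeroˡ b n)) (ℤP.+-identityʳ _)

  at-ι⊛ : ∀ x b n → at (ι x ⊛ b) n ≡ x * at b n
  at-ι⊛ x b n = conv-ι x (at b) n

  infix 4 _≈[_,_]_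

  -- For d = 0 this is equality of the coefficients below q^L, for d = p the congruence under which
  -- p-th powers become trivial. The finite order L turns a sum over all integers into a finite one.
  record _≈[_,_]_ (a : PS) (d L : ℕ) (b : PS) : Set where
    constructor eqv
    field coef : ∀ n → n < L → at a n ≡ at b n [ d ]
  open _≈[_,_]_ public

  ≡⇒≈ : ∀ {d L a b} → (∀ n → at a n ≡ at b n) → a ≈[ d , L ] b
  ≡⇒≈ e = eqv (λ n _ → ≡⇒cg (e n))

  exact : ∀ {a b} n → (∀ L → a ≈[ 0 , L ] b) → at a n ≡ at b n
  exact n e = cg-0⇒≡ (coef (e (suc n)) n ℕP.≤-refl)

  reduce : ∀ {d L a b} → (∀ L → a ≈[ 0 , L ] b) → a ≈[ d , L ] b
  reduce e = ≡⇒≈ (λ n → exact n e)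

  module Ring (d L : ℕ) where

    infix 4 _≈_
    _≈_ : PS → PS → Set
    a ≈ b = a ≈[ d , L ] b

    ⊛-cong : ∀ {a a′ b b′} → a ≈ a′ → b ≈ b′ → a ⊛ b ≈ a′ ⊛ b′
    ⊛-cong p q = eqv (λ n n<L → conv-cong n (λ i i≤n → coef p i (ℕP.≤-<-trans i≤n n<L)) (λ i i≤n → coef q i (ℕP.≤-<-trans i≤n n<L)))

    commutativeRing : CommutativeRing 0ℓ 0ℓ
    commutativeRing = record
      { Carrier = PS ; _≈_ = _≈_ ; _+_ = _⊕_ ; _*_ = _⊛_ ; -_ = ⊖_ ; 0# = ι (+ 0) ; 1# = ι (+ 1)
      ; isCommutativeRing = record
        { isRing = record
          { +-isAbelianGroup = record
            { isGroup = record
              { isMonoid = record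
                { isSemigroup = record
                  { isMagma = record
                    { isEquivalence = record
                      { refl = eqv (λ _ _ → cg-refl)
                      ; sym = λ p → eqv (λ n l → cg-sym (coef p n l))
                      ; trans = λ p q → eqv (λ n l → cg-trans (coef p n l) (coef q n l)) }
                    ; ∙-cong = λ p q → eqv (λ n l → cg-+ (coef p n l) (coef q n l)) }
                  ; assoc = λ a b c → ≡⇒≈ (λ n → ℤP.+-assoc (at a n) (at b n) (at c n)) }
                ; identity = (λ a → ≡⇒≈ (λ n → ≡.trans (cong (_+ at a n) (ι0 n)) (ℤP.+-identityˡ _)))
                           , (λ a → ≡⇒≈ (λ n → ≡.trans (cong (λ z → at a n + z) (ι0 n)) (ℤP.+-identityʳ _))) }
              ; inverse = (λ a → ≡⇒≈ (λ n → ≡.trans (ℤP.+-inverseˡ (at a n)) (≡.sym (ι0 n))))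
                        , (λ a → ≡⇒≈ (λ n → ≡.trans (ℤP.+-inverseʳ (at a n)) (≡.sym (ι0 n))))
              ; ⁻¹-cong = λ p → eqv (λ n l → cg-neg (coef p n l)) }
            ; comm = λ a b → ≡⇒≈ (λ n → ℤP.+-comm (at a n) (at b n)) }
          ; *-cong = ⊛-cong
          ; *-assoc = λ a b c → ≡⇒≈ (conv-assoc (at a) (at b) (at c))
          ; *-identity = (λ a → ≡⇒≈ (id1 a)) , (λ a → ≡⇒≈ (λ n → ≡.trans (conv-comm (at a) (at (ι (+ 1))) n) (id1 a n)))
          ; distrib = (λ a b c → ≡⇒≈ (λ n → ≡.trans (conv-comm (at a) (at (b ⊕ c)) n)
                         (≡.trans (conv-distribʳ (at a) (at b) (at c) n) (cong₂ _+_ (conv-comm (at b) (at a) n) (conv-comm (at c) (at a) n)))))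
                    , (λ a b c → ≡⇒≈ (conv-distribʳ (at a) (at b) (at c))) }
        ; *-comm = λ a b → ≡⇒≈ (conv-comm (at a) (at b)) } }
      where
        ι0 : ∀ n → at (ι (+ 0)) n ≡ + 0
        ι0 zero = refl
        ι0 (suc n) = refl
        id1 : ∀ a n → at (ι (+ 1) ⊛ a) n ≡ at a n
        id1 a n = ≡.trans (at-ι⊛ (+ 1) a n) (ℤP.*-identityˡ (at a n))

    open CommutativeRing commutativeRing public
      using (setoid; isEquivalence; +-commutativeMonoid; *-commutativeMonoid; commutativeSemiring; semiring; ring)
      renaming (refl to ≈-refl; sym to ≈-sym; trans to ≈-trans; +-cong to ⊕-cong; -‿cong to ⊖-cong;
                *-comm to ⊛-comm; *-assoc to ⊛-assoc; +-comm to ⊕-comm; +-assoc to ⊕-assoc;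
                *-identityˡ to ⊛-identityˡ; *-identityʳ to ⊛-identityʳ; +-identityˡ to ⊕-identityˡ; +-identityʳ to ⊕-identityʳ;
                distribˡ to ⊛-distribˡ; distribʳ to ⊛-distribʳ; zeroˡ to ⊛-zeroˡ; zeroʳ to ⊛-zeroʳ)

    acr : AlmostCommutativeRing 0ℓ 0ℓ
    acr = fromCommutativeRing commutativeRing

    ι-homo : ℤ.+-*-rawRing -Raw-AlmostCommutative⟶ acr
    ι-homo = record
      { ⟦_⟧ = ι
      ; +-homo = λ x y → ≡⇒≈ λ { zero → refl ; (suc n) → refl }
      ; *-homo = λ x y → ≡⇒≈ λ { zero → refl ; (suc n) → ≡.sym (≡.trans (at-ι⊛ x (ι y) (suc n)) (ℤP.*-zeroʳ x)) }
      ; -‿homo = λ x → ≡⇒≈ λ { zero → refl ; (suc n) → refl }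
      ; 0-homo = ≈-refl
      ; 1-homo = ≈-refl }

    dec-ι : ∀ x y → Maybe (ι x ≈ ι y)
    dec-ι x y with x ℤ.≟ y
    ... | yes refl = just ≈-refl
    ... | no  _    = nothing

    open import Algebra.Solver.Ring ℤ.+-*-rawRing acr ι-homo dec-ι public
      using (solve; _:=_; con; _:+_; _:*_; :-_; _:-_; _:^_)

-- Sums of monomials over the integers and over the plane lattice, and their changes of variables.

module LatticeSums where

  open PowerSeries

  -- Monomials w q^e; the exponent is an integer, and a negative one gives 0.

  δℕ : ℕ → ℕ → ℤ
  δℕ zero    zero    = + 1
  δℕ zero    (suc n) = + 0
  δℕ (suc m) zero    = + 0
  δℕ (suc m) (suc n) = δℕ m n

  δ : ℤ → ℕ → ℤ
  δ (+ m)    n = δℕ m n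
  δ -[1+ m ] n = + 0

  tm : ℤ → ℤ → PS
  tm w e .at n = w * δ e n

  δℕ-low : ∀ m n → n < m → δℕ m n ≡ + 0
  δℕ-low (suc m) zero    _       = refl
  δℕ-low (suc m) (suc n) (s≤s l) = δℕ-low m n l

  δ-low : ∀ e k n → + k ℤ.≤ e → n < k → δ e n ≡ + 0
  δ-low (+ m) k n (ℤ.+≤+ k≤m) n<k = δℕ-low m n (ℕP.<-≤-trans n<k k≤m)

  tm-⊛ℕ : ∀ w v a b n → at (tm w (+ a) ⊛ tm v (+ b)) n ≡ at (tm (w * v) (+ (a ℕ.+ b))) n
  tm-⊛ℕ w v zero b zero = lem w v _
    where lem : ∀ w v x → w * + 1 * (v * x) ≡ w * v * x
          lem = solve-∀
  tm-⊛ℕ w v zero b (suc n) = ≡.trans (cong₂ _+_ (lem w v _) (vanish n)) (ℤP.+-identityʳ _)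
    where lem : ∀ w v x → w * + 1 * (v * x) ≡ w * v * x
          lem = solve-∀
          vanish : ∀ n → conv (λ i → w * + 0) (at (tm v (+ b))) n ≡ + 0
          vanish zero = cong (_* (v * δℕ b 0)) (ℤP.*-zeroʳ w)
          vanish (suc n) = cong₂ _+_ (cong (_* (v * δℕ b (suc n))) (ℤP.*-zeroʳ w)) (vanish n)
  tm-⊛ℕ w v (suc a) b zero = ≡.trans (cong (_* (v * δℕ b 0)) (ℤP.*-zeroʳ w)) (≡.sym (ℤP.*-zeroʳ (w * v)))
  tm-⊛ℕ w v (suc a) b (suc n) = ≡.trans (cong₂ _+_ (cong (_* (v * δℕ b (suc n))) (ℤP.*-zeroʳ w)) (tm-⊛ℕ w v a b n)) (ℤP.+-identityˡ _)

  2*[1+n] : ∀ n → + suc (suc (2 ℕ.* n)) ≡ + 2 * + suc n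
  2*[1+n] n = ≡.trans (cong +_ (≡.sym (ℕP.*-suc 2 n))) (ℤP.pos-* 2 (suc n))

  2*-[1+n] : ∀ n → -[1+ suc (2 ℕ.* n) ] ≡ + 2 * -[1+ n ]
  2*-[1+n] n = ≡.trans (cong -_ (2*[1+n] n)) (ℤP.neg-distribʳ-* (+ 2) (+ suc n))

  2*-[1+n]+1 : ∀ n → -[1+ 2 ℕ.* n ] ≡ + 2 * -[1+ n ] + + 1
  2*-[1+n]+1 n = cong (_+ + 1) (2*-[1+n] n)

  sumTo : ℕ → (ℤ → PS) → PS
  sumTo zero    f = f (+ 0)
  sumTo (suc B) f = sumTo B f ⊕ (f (+ suc B) ⊕ f -[1+ B ])

  module Lattice (L : ℕ) where
    open Ring 0 L public
    open import Relation.Binary.Reasoning.Setoid setoid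

    0# : PS
    0# = ι (+ 0)

    tm-⊛ : ∀ w v e f → + 0 ℤ.≤ e → + 0 ℤ.≤ f → tm w e ⊛ tm v f ≈ tm (w * v) (e + f)
    tm-⊛ w v (+ a) (+ b) _ _ = ≡⇒≈ (tm-⊛ℕ w v a b)

    tm-cong : ∀ {w v e f} → w ≡ v → e ≡ f → tm w e ≈ tm v f
    tm-cong refl refl = ≈-refl

    tm-high : ∀ w e k → + k ℤ.≤ e → L ≤ k → tm w e ≈ 0#
    tm-high w e k k≤e L≤k = eqv λ n n<L → ≡⇒cg (≡.trans (cong (w *_) (δ-low e k n k≤e (ℕP.<-≤-trans n<L L≤k))) (≡.trans (ℤP.*-zeroʳ w) (z n)))
      where z : ∀ n → + 0 ≡ at 0# n
            z zero = refl
            z (suc n) = refl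

    ⊕-zero : ∀ {a b} → a ≈ 0# → b ≈ 0# → a ⊕ b ≈ 0#
    ⊕-zero p q = ≈-trans (⊕-cong p q) (⊕-identityˡ 0#)

    ⊕-zeroʳ : ∀ {a b} → b ≈ 0# → a ⊕ b ≈ a
    ⊕-zeroʳ q = ≈-trans (⊕-cong ≈-refl q) (⊕-identityʳ _)

    interchange : ∀ a b c d → (a ⊕ b) ⊕ (c ⊕ d) ≈ (a ⊕ c) ⊕ (b ⊕ d)
    interchange = solve 4 (λ a b c d → (a :+ b) :+ (c :+ d) := (a :+ c) :+ (b :+ d)) ≈-refl

    sum-cong : ∀ B {f g} → (∀ k → f k ≈ g k) → sumTo B f ≈ sumTo B g
    sum-cong zero e = e (+ 0)
    sum-cong (suc B) e = ⊕-cong (sum-cong B e) (⊕-cong (e _) (e _))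

    sum-zero : ∀ B {f} → (∀ k → f k ≈ 0#) → sumTo B f ≈ 0#
    sum-zero zero e = e _
    sum-zero (suc B) e = ⊕-zero (sum-zero B e) (⊕-zero (e _) (e _))

    sum-⊕ : ∀ B f g → sumTo B (λ k → f k ⊕ g k) ≈ sumTo B f ⊕ sumTo B g
    sum-⊕ zero f g = ≈-refl
    sum-⊕ (suc B) f g = ≈-trans (⊕-cong (sum-⊕ B f g) (interchange _ _ _ _)) (interchange _ _ _ _)

    sum-scale : ∀ B c f → sumTo B (λ k → c ⊛ f k) ≈ c ⊛ sumTo B f
    sum-scale zero c f = ≈-refl
    sum-scale (suc B) c f = ≈-trans (⊕-cong (sum-scale B c f) (≈-sym (⊛-distribˡ c _ _))) (≈-sym (⊛-distribˡ c _ _))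

    sum-neg : ∀ B f → sumTo B (λ k → f (- k)) ≈ sumTo B f
    sum-neg zero f = ≈-refl
    sum-neg (suc B) f = ⊕-cong (sum-neg B f) (⊕-comm _ _)

    sum-swap : ∀ B C (F : ℤ → ℤ → PS) → sumTo B (λ x → sumTo C (F x)) ≈ sumTo C (λ y → sumTo B (λ x → F x y))
    sum-swap zero C F = ≈-refl
    sum-swap (suc B) C F = ≈-trans (⊕-cong (sum-swap B C F) (≈-sym (sum-⊕ C _ _))) (≈-sym (sum-⊕ C _ _))

    Bounded : ℕ → (ℤ → PS) → Set
    Bounded B f = ∀ k → B < ∣ k ∣ → f k ≈ 0#

    sum-stable+ : ∀ {B f} → Bounded B f → ∀ j → sumTo (j ℕ.+ B) f ≈ sumTo B f
    sum-stable+ b zero = ≈-refl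
    sum-stable+ {B} b (suc j) = ≈-trans (⊕-zeroʳ (⊕-zero (b _ l) (b _ l))) (sum-stable+ b j)
      where l = s≤s (ℕP.m≤n+m B j)

    sum-stable : ∀ {B C f} → Bounded B f → B ≤ C → sumTo C f ≈ sumTo B f
    sum-stable {B} {C} {f} b B≤C = subst (λ c → sumTo c f ≈ sumTo B f) (ℕP.m∸n+n≡m B≤C) (sum-stable+ b (C ℕ.∸ B))

    infix 4 _↓_
    -- Stands for the sum of f over all integers: to order L only finitely many terms survive, so
    -- one partial sum past the support determines it. Reindexing this relation hides the boundary
    -- terms that partial sums would leave.
    record _↓_ (f : ℤ → PS) (s : PS) : Set where
      constructor sum₁
      field
        bound   : ℕ
        bounded : Bounded bound f
        value   : sumTo bound f ≈ s

    ↓-at : ∀ {f s} (h : f ↓ s) {C} → Bounded C f → sumTo C f ≈ s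
    ↓-at (sum₁ B b v) {C} c = ≈-trans (≈-sym (sum-stable c (ℕP.m≤n⊔m B C))) (≈-trans (sum-stable b (ℕP.m≤m⊔n B C)) v)

    ↓-cong : ∀ {f g s} → (∀ k → f k ≈ g k) → f ↓ s → g ↓ s
    ↓-cong e (sum₁ B b v) = sum₁ B (λ k l → ≈-trans (≈-sym (e k)) (b k l)) (≈-trans (sum-cong B (λ k → ≈-sym (e k))) v)

    ↓-neg : ∀ {f s} → f ↓ s → (λ k → f (- k)) ↓ s
    ↓-neg {f} (sum₁ B b v) = sum₁ B (λ k l → b (- k) (subst (B <_) (≡.sym (ℤP.∣-i∣≡∣i∣ k)) l)) (≈-trans (sum-neg B f) v)

    -- Both sides run over -B, ..., B + 1.
    sum-suc : ∀ B f → sumTo B (λ k → f (k + + 1)) ⊕ f (- (+ B)) ≈ sumTo B f ⊕ f (+ suc B)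
    sum-suc zero f = ⊕-comm _ _
    sum-suc (suc B) f = begin
      (sumTo B f′ ⊕ (f (+ suc (B ℕ.+ 1)) ⊕ f (-[1+ B ] + + 1))) ⊕ f -[1+ B ]
        ≈⟨ ⊕-cong (⊕-cong ≈-refl (⊕-cong (≡-≈ (cong (λ z → f (+ suc z)) (ℕP.+-comm B 1))) (≡-≈ (cong f (pred B))))) ≈-refl ⟩
      (sumTo B f′ ⊕ (f (+ suc (suc B)) ⊕ f (- (+ B)))) ⊕ f -[1+ B ]
        ≈⟨ solve 4 (λ a b c d → (a :+ (b :+ c)) :+ d := (a :+ c) :+ (b :+ d)) ≈-refl _ _ _ _ ⟩
      (sumTo B f′ ⊕ f (- (+ B))) ⊕ (f (+ suc (suc B)) ⊕ f -[1+ B ])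
        ≈⟨ ⊕-cong (sum-suc B f) ≈-refl ⟩
      (sumTo B f ⊕ f (+ suc B)) ⊕ (f (+ suc (suc B)) ⊕ f -[1+ B ])
        ≈⟨ solve 4 (λ a b c d → (a :+ b) :+ (c :+ d) := (a :+ (b :+ d)) :+ c) ≈-refl _ _ _ _ ⟩
      (sumTo B f ⊕ (f (+ suc B) ⊕ f -[1+ B ])) ⊕ f (+ suc (suc B)) ∎
      where
        f′ = λ k → f (k + + 1)
        ≡-≈ : ∀ {a b} → a ≡ b → a ≈ b
        ≡-≈ refl = ≈-refl
        pred : ∀ B → -[1+ B ] + + 1 ≡ - (+ B)
        pred zero = refl
        pred (suc B) = refl

    ↓-suc : ∀ {f s} → f ↓ s → (λ k → f (k + + 1)) ↓ s
    ↓-suc {f} {s} (sum₁ B b v) = sum₁ (suc B) b′ (begin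
      sumTo (suc B) f′                    ≈⟨ ⊕-zeroʳ (b _ ℕP.≤-refl) ⟨
      sumTo (suc B) f′ ⊕ f (- (+ suc B))  ≈⟨ sum-suc (suc B) f ⟩
      sumTo (suc B) f ⊕ f (+ suc (suc B)) ≈⟨ ⊕-zeroʳ (b _ (ℕP.m≤n⇒m≤1+n ℕP.≤-refl)) ⟩
      sumTo (suc B) f                     ≈⟨ sum-stable b (ℕP.n≤1+n B) ⟩
      sumTo B f                           ≈⟨ v ⟩
      s                                   ∎)
      where
        f′ = λ k → f (k + + 1)
        b′ : Bounded (suc B) f′
        b′ (+ n) l = b (+ n + + 1) (ℕP.<-≤-trans (ℕP.<-trans ℕP.≤-refl l) (ℕP.m≤m+n n 1))
        b′ -[1+ zero ] (s≤s ())
        b′ -[1+ suc n ] (s≤s l) = b -[1+ n ] l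

    ↓-pred : ∀ {f s} → f ↓ s → (λ k → f (k - + 1)) ↓ s
    ↓-pred {f} h = ↓-cong (λ k → ≡⇒≈′ (cong f (lem k))) (↓-neg (↓-suc (↓-neg h)))
      where lem : ∀ k → - (- k + + 1) ≡ k - + 1
            lem = solve-∀
            ≡⇒≈′ : ∀ {a b} → a ≡ b → a ≈ b
            ≡⇒≈′ refl = ≈-refl

    ↓-shift : ∀ {f s} c → f ↓ s → (λ k → f (k + c)) ↓ s
    ↓-shift {f} (+ zero) h = ↓-cong (λ k → ≡⇒≈ (λ n → cong (λ z → at (f z) n) (≡.sym (ℤP.+-identityʳ k)))) h
    ↓-shift {f} (+ suc n) h = ↓-cong (λ k → ≡⇒≈ (λ i → cong (λ z → at (f z) i) (lem k (+ n)))) (↓-suc (↓-shift (+ n) h))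
      where lem : ∀ k n → k + + 1 + n ≡ k + (+ 1 + n)
            lem = solve-∀
    ↓-shift {f} -[1+ zero ] h = ↓-pred h
    ↓-shift {f} -[1+ suc n ] h = ↓-cong (λ k → ≡⇒≈ (λ i → cong (λ z → at (f z) i) (lem k -[1+ n ]))) (↓-pred (↓-shift -[1+ n ] h))
      where lem : ∀ k n → k - + 1 + n ≡ k + (- (+ 1) + n)
            lem = solve-∀

    -- The numbers 2k and 2k + 1 with k between -B and B exhaust the interval from -2B - 1 to 2B + 1
    -- except for its lowest point, which is the extra term.
    sum-parity : ∀ B f → sumTo (suc (2 ℕ.* B)) f ≈
      (sumTo B (λ k → f (+ 2 * k)) ⊕ sumTo B (λ k → f (+ 2 * k + + 1))) ⊕ f -[1+ 2 ℕ.* B ]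
    sum-parity zero f = ≈-sym (⊕-assoc _ _ _)
    sum-parity (suc B) f = begin
      sumTo (suc (2 ℕ.* suc B)) f
        ≈⟨ ≡⇒≈ (λ n → cong (λ z → at (sumTo (suc z) f) n) (ℕP.*-suc 2 B)) ⟩
      (sumTo (suc (2 ℕ.* B)) f ⊕ (f (+ suc (suc (2 ℕ.* B))) ⊕ f -[1+ suc (2 ℕ.* B) ])) ⊕ (f (+ suc (suc (suc (2 ℕ.* B)))) ⊕ f -[1+ suc (suc (2 ℕ.* B)) ])
        ≈⟨ ⊕-cong (⊕-cong (sum-parity B f) ≈-refl) ≈-refl ⟩
      (((e ⊕ o) ⊕ f -[1+ 2 ℕ.* B ]) ⊕ (f (+ suc (suc (2 ℕ.* B))) ⊕ f -[1+ suc (2 ℕ.* B) ])) ⊕ (f (+ suc (suc (suc (2 ℕ.* B)))) ⊕ f -[1+ suc (suc (2 ℕ.* B)) ])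
        ≈⟨ solve 7 (λ e o a b c d g → (((e :+ o) :+ a) :+ (b :+ c)) :+ (d :+ g) := ((e :+ (b :+ c)) :+ (o :+ (d :+ a))) :+ g) ≈-refl _ _ _ _ _ _ _ ⟩
      ((e ⊕ (f (+ suc (suc (2 ℕ.* B))) ⊕ f -[1+ suc (2 ℕ.* B) ])) ⊕ (o ⊕ (f (+ suc (suc (suc (2 ℕ.* B)))) ⊕ f -[1+ 2 ℕ.* B ]))) ⊕ f -[1+ suc (suc (2 ℕ.* B)) ]
        ≈⟨ ⊕-cong (⊕-cong (⊕-cong ≈-refl (⊕-cong (at≡ (2*[1+n] B)) (at≡ (2*-[1+n] B)))) (⊕-cong ≈-refl (⊕-cong (at≡ (o+ B)) (at≡ (2*-[1+n]+1 B))))) (at≡ (last B)) ⟩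
      (sumTo (suc B) (λ k → f (+ 2 * k)) ⊕ sumTo (suc B) (λ k → f (+ 2 * k + + 1))) ⊕ f -[1+ 2 ℕ.* suc B ] ∎
      where
        e = sumTo B (λ k → f (+ 2 * k))
        o = sumTo B (λ k → f (+ 2 * k + + 1))
        at≡ : ∀ {x y} → x ≡ y → f x ≈ f y
        at≡ refl = ≈-refl
        o+ : ∀ B → + suc (suc (suc (2 ℕ.* B))) ≡ + 2 * + suc B + + 1
        o+ B = ≡.trans (ℤP.+-comm (+ 1) (+ suc (suc (2 ℕ.* B)))) (cong (_+ + 1) (2*[1+n] B))
        last : ∀ B → -[1+ suc (suc (2 ℕ.* B)) ] ≡ -[1+ 2 ℕ.* suc B ]
        last B = cong -[1+_] (≡.sym (ℕP.*-suc 2 B))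

    sum-split : ∀ {B f} → Bounded B f → sumTo B f ≈ sumTo B (λ k → f (+ 2 * k)) ⊕ sumTo B (λ k → f (+ 2 * k + + 1))
    sum-split {B} {f} b = begin
      sumTo B f                    ≈⟨ sum-stable b (ℕP.m≤n⇒m≤1+n B≤2B) ⟨
      sumTo (suc (2 ℕ.* B)) f      ≈⟨ sum-parity B f ⟩
      _                            ≈⟨ ⊕-zeroʳ (b _ (s≤s B≤2B)) ⟩
      _                            ∎
      where B≤2B = ℕP.m≤m+n B (1 ℕ.* B)

    Bounded₂ : ℕ → (ℤ → ℤ → PS) → Set
    Bounded₂ B F = ∀ x y → B < ∣ x ∣ ⊎ B < ∣ y ∣ → F x y ≈ 0#

    sum₂To : ℕ → (ℤ → ℤ → PS) → PS
    sum₂To B F = sumTo B (λ x → sumTo B (F x))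

    infix 4 _⇓_
    -- The sum over the plane. Exchange of the coordinates, change of sign, shears (`⇓-shift`) and
    -- parity splits (`⇓-split`) act on it; every lattice symmetry used later is composed of these
    -- four.
    record _⇓_ (F : ℤ → ℤ → PS) (s : PS) : Set where
      constructor sum₂
      field
        bound   : ℕ
        bounded : Bounded₂ bound F
        value   : sum₂To bound F ≈ s

    sum₂-cong : ∀ B {F G} → (∀ x y → F x y ≈ G x y) → sum₂To B F ≈ sum₂To B G
    sum₂-cong B e = sum-cong B (λ x → sum-cong B (e x))

    row : ∀ {B F} → Bounded₂ B F → ∀ x → Bounded B (F x)
    row b x y l = b x y (inj₂ l)

    sum₂-stable : ∀ {B C F} → Bounded₂ B F → B ≤ C → sum₂To C F ≈ sum₂To B F
    sum₂-stable {B} {C} b B≤C = ≈-trans (sum-cong C (λ x → sum-stable (row b x) B≤C))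
      (sum-stable (λ x l → sum-zero B (λ y → b x y (inj₁ l))) B≤C)

    ⇓-at : ∀ {F s} → F ⇓ s → ∀ {C} → Bounded₂ C F → sum₂To C F ≈ s
    ⇓-at (sum₂ B b v) {C} c = ≈-trans (≈-sym (sum₂-stable c (ℕP.m≤n⊔m B C))) (≈-trans (sum₂-stable b (ℕP.m≤m⊔n B C)) v)

    ⇓-unique : ∀ {F s t} → F ⇓ s → F ⇓ t → s ≈ t
    ⇓-unique (sum₂ B b v) h = ≈-trans (≈-sym v) (⇓-at h b)

    ⇓-cong : ∀ {F G s} → (∀ x y → F x y ≈ G x y) → F ⇓ s → G ⇓ s
    ⇓-cong e (sum₂ B b v) = sum₂ B (λ x y l → ≈-trans (≈-sym (e x y)) (b x y l)) (≈-trans (sum₂-cong B (λ x y → ≈-sym (e x y))) v)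

    ⇓-swap : ∀ {F s} → F ⇓ s → (λ x y → F y x) ⇓ s
    ⇓-swap {F} (sum₂ B b v) = sum₂ B (λ { x y (inj₁ l) → b y x (inj₂ l) ; x y (inj₂ l) → b y x (inj₁ l) })
      (≈-trans (sum-swap B B (λ x y → F y x)) v)

    ⇓-⊕ : ∀ {F G s t} → F ⇓ s → G ⇓ t → (λ x y → F x y ⊕ G x y) ⇓ (s ⊕ t)
    ⇓-⊕ {F} {G} h@(sum₂ B b _) k@(sum₂ C c _) = sum₂ (B ℕ.⊔ C) (λ x y l → ⊕-zero (b′ x y l) (c′ x y l))
      (≈-trans (≈-trans (sum-cong (B ℕ.⊔ C) (λ x → sum-⊕ (B ℕ.⊔ C) (F x) (G x))) (sum-⊕ (B ℕ.⊔ C) _ _)) (⊕-cong (⇓-at h b′) (⇓-at k c′)))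
      where
        b′ : Bounded₂ (B ℕ.⊔ C) F
        b′ x y (inj₁ l) = b x y (inj₁ (ℕP.≤-<-trans (ℕP.m≤m⊔n B C) l))
        b′ x y (inj₂ l) = b x y (inj₂ (ℕP.≤-<-trans (ℕP.m≤m⊔n B C) l))
        c′ : Bounded₂ (B ℕ.⊔ C) G
        c′ x y (inj₁ l) = c x y (inj₁ (ℕP.≤-<-trans (ℕP.m≤n⊔m B C) l))
        c′ x y (inj₂ l) = c x y (inj₂ (ℕP.≤-<-trans (ℕP.m≤n⊔m B C) l))

    ⇓-zero : ∀ {F s} → (∀ x y → F x y ≈ 0#) → F ⇓ s → s ≈ 0#
    ⇓-zero e (sum₂ B b v) = ≈-trans (≈-sym v) (sum-zero B (λ x → sum-zero B (e x)))

    ⇓-product : ∀ {f g s t} → f ↓ s → g ↓ t → (λ x y → f x ⊛ g y) ⇓ (s ⊛ t)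
    ⇓-product {f} {g} {s} {t} h@(sum₁ B b _) k@(sum₁ C c _) = sum₂ M v (begin
      sumTo M (λ x → sumTo M (λ y → f x ⊛ g y)) ≈⟨ sum-cong M (λ x → sum-scale M (f x) g) ⟩
      sumTo M (λ x → f x ⊛ sumTo M g)           ≈⟨ sum-cong M (λ x → ⊛-comm _ _) ⟩
      sumTo M (λ x → sumTo M g ⊛ f x)           ≈⟨ sum-scale M (sumTo M g) f ⟩
      sumTo M g ⊛ sumTo M f                     ≈⟨ ⊛-comm _ _ ⟩
      sumTo M f ⊛ sumTo M g                     ≈⟨ ⊛-cong (↓-at h b′) (↓-at k c′) ⟩
      s ⊛ t                                     ∎)
      where
        M = B ℕ.⊔ C
        b′ : Bounded M f
        b′ x l = b x (ℕP.≤-<-trans (ℕP.m≤m⊔n B C) l)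
        c′ : Bounded M g
        c′ x l = c x (ℕP.≤-<-trans (ℕP.m≤n⊔m B C) l)
        v : Bounded₂ M (λ x y → f x ⊛ g y)
        v x y (inj₁ l) = ≈-trans (⊛-cong (b′ x l) ≈-refl) (⊛-zeroˡ (g y))
        v x y (inj₂ l) = ≈-trans (⊛-cong ≈-refl (c′ y l)) (⊛-zeroʳ (f x))

    ⇓-neg : ∀ {F s} → F ⇓ s → (λ x y → F x (- y)) ⇓ s
    ⇓-neg {F} (sum₂ B b v) = sum₂ B (λ { x y (inj₁ l) → b x (- y) (inj₁ l) ; x y (inj₂ l) → b x (- y) (inj₂ (subst (B <_) (≡.sym (ℤP.∣-i∣≡∣i∣ y)) l)) })
      (≈-trans (sum-cong B (λ x → sum-neg B (F x))) v)

    range : (ℤ → ℤ) → ℕ → ℕ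
    range g zero    = ∣ g (+ 0) ∣
    range g (suc B) = range g B ℕ.+ (∣ g (+ suc B) ∣ ℕ.+ ∣ g -[1+ B ] ∣)

    range-bound : ∀ g B x → ∣ x ∣ ≤ B → ∣ g x ∣ ≤ range g B
    range-bound g zero (+ zero) _ = ℕP.≤-refl
    range-bound g (suc B) x l with ∣ x ∣ ℕ.≤? B
    ... | yes l′ = ℕP.≤-trans (range-bound g B x l′) (ℕP.m≤m+n _ _)
    ... | no  l′ = top x (ℕP.≤-antisym l (ℕP.≰⇒> l′))
      where
        top : ∀ x → ∣ x ∣ ≡ suc B → ∣ g x ∣ ≤ range g (suc B)
        top (+ .(suc B)) refl = ℕP.≤-trans (ℕP.m≤m+n _ _) (ℕP.m≤n+m _ (range g B))
        top -[1+ .B ] refl = ℕP.≤-trans (ℕP.m≤n+m _ ∣ g (+ suc B) ∣) (ℕP.m≤n+m _ (range g B))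

    -- A shear permutes each row and so preserves the row sums. As g is arbitrary the support may
    -- move, but in the rows with |x| ≤ B by at most `range g B`, and the other rows are zero.
    ⇓-shift : ∀ {F s} g → F ⇓ s → (λ x y → F x (y + g x)) ⇓ s
    ⇓-shift {F} {s} g (sum₂ B b v) = sum₂ C b′ (≈-trans (sum-cong C inner) (≈-trans (sum₂-stable b (ℕP.m≤m+n B _)) v))
      where
        C = B ℕ.+ range g B
        far : ∀ x y → ∣ x ∣ ≤ B → C < ∣ y ∣ → B < ∣ y + g x ∣
        far x y lx ly = ℕP.+-cancelʳ-< (range g B) B ∣ y + g x ∣ (ℕP.<-≤-trans ly (ℕP.≤-trans
          (subst (λ z → ∣ z ∣ ≤ ∣ y + g x ∣ ℕ.+ ∣ g x ∣) (lem y (g x)) (ℤP.∣i-j∣≤∣i∣+∣j∣ (y + g x) (g x)))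
          (ℕP.+-monoʳ-≤ ∣ y + g x ∣ (range-bound g B x lx))))
          where lem : ∀ y z → y + z - z ≡ y
                lem = solve-∀
        b′ : Bounded₂ C (λ x y → F x (y + g x))
        b′ x y (inj₁ l) = b x _ (inj₁ (ℕP.≤-<-trans (ℕP.m≤m+n B _) l))
        b′ x y (inj₂ l) with ∣ x ∣ ℕ.≤? B
        ... | yes lx = b x _ (inj₂ (far x y lx l))
        ... | no  lx = b x _ (inj₁ (ℕP.≰⇒> lx))
        inner : ∀ x → sumTo C (λ y → F x (y + g x)) ≈ sumTo C (F x)
        inner x = ↓-at (↓-shift (g x) (sum₁ C (λ y l → b x y (inj₂ (ℕP.≤-<-trans (ℕP.m≤m+n B _) l))) ≈-refl)) (row b′ x)

    dbl-bound : ∀ y → ∣ y ∣ ≤ ∣ + 2 * y ∣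
    dbl-bound y = subst (∣ y ∣ ≤_) (≡.sym (ℤP.abs-* (+ 2) y)) (ℕP.m≤m+n ∣ y ∣ _)

    odd-bound : ∀ y → ∣ y ∣ ≤ ∣ + 2 * y + + 1 ∣
    odd-bound (+ n) = subst (λ z → n ≤ ∣ z + + 1 ∣) (ℤP.pos-* 2 n) (ℕP.≤-trans (ℕP.m≤m+n n _) (ℕP.m≤m+n (2 ℕ.* n) 1))
    odd-bound -[1+ n ] = subst (λ z → suc n ≤ ∣ z ∣) (2*-[1+n]+1 n) (s≤s (ℕP.m≤m+n n _))

    record Split (F : ℤ → ℤ → PS) (s : PS) : Set where
      field
        {even odd} : PS
        even-sum : (λ x y → F x (+ 2 * y)) ⇓ even
        odd-sum  : (λ x y → F x (+ 2 * y + + 1)) ⇓ odd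
        total    : s ≈ even ⊕ odd

    ⇓-split : ∀ {F s} → F ⇓ s → Split F s
    ⇓-split {F} {s} (sum₂ B b v) = record
      { even-sum = sum₂ B (λ { x y (inj₁ l) → b x _ (inj₁ l) ; x y (inj₂ l) → b x _ (inj₂ (ℕP.<-≤-trans l (dbl-bound y))) }) ≈-refl
      ; odd-sum = sum₂ B (λ { x y (inj₁ l) → b x _ (inj₁ l) ; x y (inj₂ l) → b x _ (inj₂ (ℕP.<-≤-trans l (odd-bound y))) }) ≈-refl
      ; total = ≈-trans (≈-sym v) (≈-trans (sum-cong B (λ x → sum-split (row b x))) (sum-⊕ B _ _)) }

-- Theta series and reindexing by symmetries of quadratic lattices.

module ThetaSeries where

  open PowerSeries
  open LatticeSums

  sgnℕ : ℕ → ℤ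
  sgnℕ zero    = + 1
  sgnℕ (suc n) = - sgnℕ n

  sgn : ℤ → ℤ
  sgn k = sgnℕ ∣ k ∣

  sgn-neg : ∀ k → sgn (- k) ≡ sgn k
  sgn-neg k = cong sgnℕ (ℤP.∣-i∣≡∣i∣ k)

  sgn-suc : ∀ k → sgn (+ 1 + k) ≡ - sgn k
  sgn-suc (+ n)          = refl
  sgn-suc -[1+ zero ]    = refl
  sgn-suc -[1+ suc n ]   = ≡.sym (ℤP.neg-involutive _)

  sgn-+ℕ : ∀ n k → sgn (+ n + k) ≡ sgnℕ n * sgn k
  sgn-+ℕ zero    k = ≡.trans (cong sgn (ℤP.+-identityˡ k)) (≡.sym (ℤP.*-identityˡ (sgn k)))
  sgn-+ℕ (suc n) k = ≡.trans (cong sgn (ℤP.+-assoc (+ 1) (+ n) k)) (≡.trans (sgn-suc (+ n + k))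
    (≡.trans (cong -_ (sgn-+ℕ n k)) (ℤP.neg-distribˡ-* (sgnℕ n) (sgn k))))

  sgn-+ : ∀ j k → sgn (j + k) ≡ sgn j * sgn k
  sgn-+ (+ n) k = sgn-+ℕ n k
  sgn-+ -[1+ n ] k = begin
    sgn (-[1+ n ] + k)         ≡⟨ sgn-neg (-[1+ n ] + k) ⟨
    sgn (- (-[1+ n ] + k))     ≡⟨ cong sgn (ℤP.neg-distrib-+ -[1+ n ] k) ⟩
    sgn (+ suc n + - k)        ≡⟨ sgn-+ℕ (suc n) (- k) ⟩
    sgnℕ (suc n) * sgn (- k)   ≡⟨ cong (sgnℕ (suc n) *_) (sgn-neg k) ⟩
    sgnℕ (suc n) * sgn k       ∎
    where open ≡-Reasoning

  sgnℕ² : ∀ n → sgnℕ n * sgnℕ n ≡ + 1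
  sgnℕ² zero    = refl
  sgnℕ² (suc n) = ≡.trans (lem (sgnℕ n)) (sgnℕ² n)
    where lem : ∀ x → - x * - x ≡ x * x
          lem = solve-∀

  sgn² : ∀ k → sgn k * sgn k ≡ + 1
  sgn² k = sgnℕ² ∣ k ∣

  sgn-2* : ∀ k → sgn (+ 2 * k) ≡ + 1
  sgn-2* k = ≡.trans (cong sgn (lem k)) (≡.trans (sgn-+ k k) (sgn² k))
    where lem : ∀ k → + 2 * k ≡ k + k
          lem = solve-∀

  sgn-2*+1 : ∀ k → sgn (+ 2 * k + + 1) ≡ - + 1
  sgn-2*+1 k = ≡.trans (sgn-+ (+ 2 * k) (+ 1)) (cong (_* - + 1) (sgn-2* k))

  sgn-minus : ∀ j k → sgn (j - k) ≡ sgn j * sgn k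
  sgn-minus j k = ≡.trans (sgn-+ j (- k)) (cong (sgn j *_) (sgn-neg k))

  -- Theta series Σ_{k ∈ ℤ} w(k) q^{e(k)}.

  Admissible : (ℤ → ℤ) → Set
  Admissible e = ∀ k → + ∣ k ∣ ℤ.≤ e k

  Θ : (ℤ → ℤ) → (ℤ → ℤ) → PS
  Θ w e .at n = at (sumTo n (λ k → tm (w k) (e k))) n

  private
    ≤-by : ∀ m x y {e} → e ≡ + m + + x * + y → + m ℤ.≤ e
    ≤-by m x y refl = subst (λ z → + m ℤ.≤ + m + z) (ℤP.pos-* x y) (ℤ.+≤+ (ℕP.m≤m+n m (x ℕ.* y)))

  -- Over all integers k, `tri` gives the triangular numbers, `pent` twice the generalized
  -- pentagonal numbers, `oct` the generalized octagonal numbers, once each. Completed squares: 8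
  -- tri + 1 = (4k + 1)², 12 pent + 1 = (6k + 1)², 3 oct + 1 = (3k + 1)².
  sq tri oct pent : ℤ → ℤ
  sq k   = k * k
  tri k  = k * (+ 2 * k + + 1)
  pent k = k * (+ 3 * k + + 1)
  oct k  = k * (+ 3 * k + + 2)

  sq-adm : Admissible sq
  sq-adm (+ zero)  = ℤP.≤-refl
  sq-adm (+ suc n) = ≤-by (suc n) (suc n) n (lem (+ n))
    where lem : ∀ n → (+ 1 + n) * (+ 1 + n) ≡ + 1 + n + (+ 1 + n) * n
          lem = solve-∀
  sq-adm -[1+ n ] = ≤-by (suc n) (suc n) n (lem (+ n))
    where lem : ∀ n → - (+ 1 + n) * - (+ 1 + n) ≡ + 1 + n + (+ 1 + n) * n
          lem = solve-∀

  tri-adm : Admissible tri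
  tri-adm (+ n) = ≤-by n n (n ℕ.+ n) (lem (+ n))
    where lem : ∀ n → n * (+ 2 * n + + 1) ≡ n + n * (n + n)
          lem = solve-∀
  tri-adm -[1+ n ] = ≤-by (suc n) (suc n) (n ℕ.+ n) (lem (+ n))
    where lem : ∀ n → - (+ 1 + n) * (+ 2 * - (+ 1 + n) + + 1) ≡ + 1 + n + (+ 1 + n) * (n + n)
          lem = solve-∀

  pent-adm : Admissible pent
  pent-adm (+ n) = ≤-by n n (n ℕ.+ n ℕ.+ n) (lem (+ n))
    where lem : ∀ n → n * (+ 3 * n + + 1) ≡ n + n * (n + n + n)
          lem = solve-∀
  pent-adm -[1+ n ] = ≤-by (suc n) (suc n) (n ℕ.+ n ℕ.+ suc n) (lem (+ n))
    where lem : ∀ n → - (+ 1 + n) * (+ 3 * - (+ 1 + n) + + 1) ≡ + 1 + n + (+ 1 + n) * (n + n + (+ 1 + n))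
          lem = solve-∀

  oct-adm : Admissible oct
  oct-adm (+ n) = ≤-by n n (suc (n ℕ.+ n ℕ.+ n)) (lem (+ n))
    where lem : ∀ n → n * (+ 3 * n + + 2) ≡ n + n * (+ 1 + (n + n + n))
          lem = solve-∀
  oct-adm -[1+ n ] = ≤-by (suc n) (suc n) (n ℕ.+ n ℕ.+ n) (lem (+ n))
    where lem : ∀ n → - (+ 1 + n) * (+ 3 * - (+ 1 + n) + + 2) ≡ + 1 + n + (+ 1 + n) * (n + n + n)
          lem = solve-∀

  infixl 7 _·_
  _·_ : ℤ → (ℤ → ℤ) → ℤ → ℤ
  (D · e) k = D * e k

  ·-adm : ∀ {D e} → + 1 ℤ.≤ D → Admissible e → Admissible (D · e)
  ·-adm {D} {e} p a k = ℤP.≤-trans (a k) (subst (ℤ._≤ D * e k) (ℤP.*-identityˡ (e k))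
    (ℤP.*-monoʳ-≤-nonNeg (e k) {{ℤ.nonNegative (ℤP.≤-trans (ℤ.+≤+ z≤n) (a k))}} p))

  -- Admissibility keeps the terms with |k| > n out of coefficient n, so `Θ`, which stops summing at
  -- n, agrees there with all longer partial sums.
  θ-at-high : ∀ {w e} → Admissible e → ∀ n L → n < L → at (sumTo L (λ k → tm (w k) (e k))) n ≡ at (Θ w e) n
  θ-at-high {w} {e} a n L n<L = cg-0⇒≡ (coef (sum-stable {n} {L} b (ℕP.<⇒≤ n<L)) n ℕP.≤-refl)
    where open Lattice (suc n)
          b : Bounded n (λ k → tm (w k) (e k))
          b k l = tm-high (w k) (e k) ∣ k ∣ (a k) l

  module Theta (L : ℕ) where
    open Lattice L public
    open import Relation.Binary.Reasoning.Setoid setoid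

    ≡⇒≈′ : ∀ {a b : PS} → a ≡ b → a ≈ b
    ≡⇒≈′ refl = ≈-refl

    Θ↓ : ∀ {w e} → Admissible e → (λ k → tm (w k) (e k)) ↓ Θ w e
    Θ↓ {w} {e} a = sum₁ L (λ k l → tm-high (w k) (e k) ∣ k ∣ (a k) (ℕP.<⇒≤ l)) (eqv λ n l → ≡⇒cg (θ-at-high {w} a n L l))

    adm≥0 : ∀ {e} → Admissible e → ∀ k → + 0 ℤ.≤ e k
    adm≥0 a k = ℤP.≤-trans (ℤ.+≤+ z≤n) (a k)

    Θ-product : ∀ {w v e f} → Admissible e → Admissible f → (λ x y → tm (w x * v y) (e x + f y)) ⇓ (Θ w e ⊛ Θ v f)
    Θ-product {w} {v} {e} {f} a b = ⇓-cong (λ x y → tm-⊛ (w x) (v y) (e x) (f y) (adm≥0 a x) (adm≥0 b y)) (⇓-product (Θ↓ a) (Θ↓ b))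

    tm-⊕ : ∀ w v e → tm w e ⊕ tm v e ≈ tm (w + v) e
    tm-⊕ w v e = ≡⇒≈ (λ n → ≡.sym (ℤP.*-distribʳ-+ (δ e n) w v))

    tm-0 : ∀ e → tm (+ 0) e ≈ 0#
    tm-0 e = ≡⇒≈ λ { zero → refl ; (suc n) → refl }

    tm-cancel : ∀ {w v e f} → e ≡ f → w + v ≡ + 0 → tm w e ⊕ tm v f ≈ 0#
    tm-cancel {w} {v} {e} refl h = ≈-trans (tm-⊕ w v e) (≈-trans (tm-cong h refl) (tm-0 e))

    ⇓-tm : ∀ {W W′ Q Q′ : ℤ → ℤ → ℤ} {s} → (∀ x y → W x y ≡ W′ x y) → (∀ x y → Q x y ≡ Q′ x y) →
           (λ x y → tm (W x y) (Q x y)) ⇓ s → (λ x y → tm (W′ x y) (Q′ x y)) ⇓ s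
    ⇓-tm p q = ⇓-cong (λ x y → tm-cong (p x y) (q x y))

    ⊕-inverse : ∀ {a b} → a ⊕ b ≈ 0# → a ≈ ⊖ b
    ⊕-inverse {a} {b} h = begin
      a                ≈⟨ solve 2 (λ a b → a := (a :+ b) :+ :- b) ≈-refl a b ⟩
      (a ⊕ b) ⊕ ⊖ b    ≈⟨ ⊕-cong h ≈-refl ⟩
      0# ⊕ ⊖ b         ≈⟨ ⊕-identityˡ _ ⟩
      ⊖ b              ∎

    ι-cancel : ∀ c {a} → ι (+ suc c) ⊛ a ≈ 0# → a ≈ 0#
    ι-cancel c {a} h = eqv λ n l → ≡⇒cg (≡.trans (ℤP.*-cancelˡ-≡ (+ suc c) (at a n) (+ 0)
        (≡.trans (≡.sym (at-ι⊛ (+ suc c) a n)) (≡.trans (cg-0⇒≡ (coef h n l)) (≡.trans (z n) (≡.sym (ℤP.*-zeroʳ (+ suc c))))))) (≡.sym (z n)))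
      where z : ∀ n → at 0# n ≡ + 0
            z zero = refl
            z (suc n) = refl

    self-neg : ∀ {a} → a ≈ ⊖ a → a ≈ 0#
    self-neg {a} h = ι-cancel 1 (begin
      ι (+ 2) ⊛ a    ≈⟨ solve 1 (λ a → con (+ 2) :* a := a :+ a) ≈-refl a ⟩
      a ⊕ a          ≈⟨ ⊕-cong h ≈-refl ⟩
      ⊖ a ⊕ a        ≈⟨ solve 1 (λ a → :- a :+ a := con (+ 0)) ≈-refl a ⟩
      0#             ∎)

    -- Two parametrisations of the same sum with opposite terms give s = -s, and 2 can be cancelled
    -- over the integers.
    antisymmetric : ∀ {F G s} → F ⇓ s → G ⇓ s → (∀ x y → F x y ⊕ G x y ≈ 0#) → s ≈ 0#
    antisymmetric h k e = self-neg (⊕-inverse (⇓-zero e (⇓-⊕ h k)))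

    ⇓-scale : ∀ {F s} c → F ⇓ s → (λ x y → c ⊛ F x y) ⇓ (c ⊛ s)
    ⇓-scale {F} c (sum₂ B b v) = sum₂ B (λ x y l → ≈-trans (⊛-cong ≈-refl (b x y l)) (⊛-zeroʳ c))
      (≈-trans (sum-cong B (λ x → sum-scale B c (F x))) (≈-trans (sum-scale B c _) (⊛-cong ≈-refl v)))

    record Split₁ (F : ℤ → ℤ → PS) (s : PS) : Set where
      field
        {even odd} : PS
        even-sum : (λ x y → F (+ 2 * x) y) ⇓ even
        odd-sum  : (λ x y → F (+ 2 * x + + 1) y) ⇓ odd
        total    : s ≈ even ⊕ odd

    ⇓-split₁ : ∀ {F s} → F ⇓ s → Split₁ F s
    ⇓-split₁ h = record { even-sum = ⇓-swap even-sum ; odd-sum = ⇓-swap odd-sum ; total = total }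
      where open Split (⇓-split (⇓-swap h))

    ⇓-reflect : ∀ {F s} → F ⇓ s → (λ x y → F x (- (y + + 1))) ⇓ s
    ⇓-reflect h = ⇓-shift (λ _ → + 1) (⇓-neg h)

    record Diagonals (F : ℤ → ℤ → PS) (s : PS) : Set where
      field
        {even odd} : PS
        even-sum : (λ a b → F (a + b) (a - b)) ⇓ even
        odd-sum  : (λ a b → F (a + b + + 1) (a - b)) ⇓ odd
        total    : s ≈ even ⊕ odd

    -- Sort the points (x , y) by the parity of x + y.
    diagonals : ∀ {F s} → F ⇓ s → Diagonals F s
    diagonals {F} h = record
      { even-sum = ⇓-cong (λ a b → ≡⇒≈′ (cong₂ F (ℤP.+-comm b a) (lem₀ a b))) (⇓-shift (λ a → a) (⇓-swap even-sum))
      ; odd-sum = ⇓-cong (λ a b → ≡⇒≈′ (cong₂ F (lem₁ a b) (lem₂ a b))) (⇓-shift (λ a → a + + 1) (⇓-swap odd-sum))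
      ; total = total }
      where
        open Split (⇓-split (⇓-shift (λ x → - x) h))
        lem₀ : ∀ a b → + 2 * a + - (b + a) ≡ a - b
        lem₀ = solve-∀
        lem₁ : ∀ a b → b + (a + + 1) ≡ a + b + + 1
        lem₁ = solve-∀
        lem₂ : ∀ a b → + 2 * a + + 1 + - (b + (a + + 1)) ≡ a - b
        lem₂ = solve-∀

    -- The bijection b = x - y, 4 a + 1 = (-1)^b (2 (x + y) + 1) of the plane.
    refold : ∀ {F H s t} → F ⇓ s → H ⇓ t → (∀ a c → F (a + c) (a - c) ≈ H a (+ 2 * c)) →
             (∀ a c → F (c - a) (- (a + + 1) - c) ≈ H a (+ 2 * c + + 1)) → s ≈ t
    refold {F} {H} h k e o = ≈-trans D.total (≈-trans (⊕-cong (⇓-unique D.even-sum (⇓-cong (λ a c → ≈-sym (e a c)) S.even-sum))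
        (⇓-unique odd′ (⇓-cong (λ a c → ≈-sym (o a c)) S.odd-sum))) (≈-sym S.total))
      where
        module D = Diagonals (diagonals h)
        module S = Split (⇓-split k)
        odd′ : (λ a c → F (c - a) (- (a + + 1) - c)) ⇓ D.odd
        odd′ = ⇓-cong (λ a c → ≡⇒≈′ (cong (λ z → F z (- (a + + 1) - c)) (lem a c))) (⇓-swap (⇓-reflect (⇓-swap D.odd-sum)))
          where lem : ∀ a c → - (a + + 1) + c + + 1 ≡ c - a
                lem = solve-∀

    -- The reflection y to -y - 1 exchanges even and odd y, so the two halves of the sum agree.
    fold : ∀ {G s} → G ⇓ s → (∀ x y → G x (- (y + + 1)) ≈ G x y) → Σ PS λ t → (λ x y → G x (+ 2 * y)) ⇓ t × s ≈ ι (+ 2) ⊛ t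
    fold {G} h sy = even , even-sum , ≈-trans total (≈-trans (⊕-cong ≈-refl (⇓-unique odd-sum odd′))
        (solve 1 (λ e → e :+ e := con (+ 2) :* e) ≈-refl even))
      where
        open Split (⇓-split h)
        odd′ : (λ x y → G x (+ 2 * y + + 1)) ⇓ even
        odd′ = ⇓-cong (λ x y → ≈-trans (≡⇒≈′ (cong (G x) (lem y))) (sy x _)) (⇓-reflect even-sum)
          where lem : ∀ y → + 2 * - (y + + 1) ≡ - (+ 2 * y + + 1 + + 1)
                lem = solve-∀

    -- The reflection of order two of the lattice n² + 3 m², in the
    -- coordinates n = 6 k + 1, m = 4 l + 1, has no uniform formula; the plane
    -- is first cut into four pieces according to the parities of k and its image.
    hexagonal : ∀ {F s} → F ⇓ s →
      (∀ i j → F (+ 2 * j) (+ 2 * i + j) ⊕ F (+ 2 * i) (+ 2 * j + i) ≈ 0#) →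
      (∀ i j → F (+ 2 * j) (+ 2 * i + + 1 + j) ⊕ F (+ 2 * i + + 1) (- (+ 2 * j + (i + + 1))) ≈ 0#) →
      (∀ i j → F (+ 2 * i + + 1) (- (+ 2 * j + + 1 + (i + + 1))) ⊕ F (+ 2 * j + + 1) (- (+ 2 * i + + 1 + (j + + 1))) ≈ 0#) →
      s ≈ 0#
    hexagonal {F} {s} h A B C = begin
      s                                              ≈⟨ K.total ⟩
      K.even ⊕ K.odd                                 ≈⟨ ⊕-cong E.total O.total ⟩
      (E.even ⊕ E.odd) ⊕ (O.even ⊕ O.odd)            ≈⟨ solve 4 (λ a b c d → (a :+ b) :+ (c :+ d) := (b :+ c) :+ (a :+ d)) ≈-refl _ _ _ _ ⟩
      (E.odd ⊕ O.even) ⊕ (E.even ⊕ O.odd)            ≈⟨ ⊕-zero (⇓-zero (λ j i → B i j) (⇓-⊕ E.odd-sum (⇓-swap O.even-sum)))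
                                                         (⊕-zero (antisymmetric E.even-sum (⇓-swap E.even-sum) (λ j i → A i j))
                                                                 (antisymmetric O.odd-sum (⇓-swap O.odd-sum) C)) ⟩
      0#                                             ∎
      where
        module K = Split₁ (⇓-split₁ h)
        module E = Split (⇓-split (⇓-shift (λ j → j) K.even-sum))
        module O = Split (⇓-split (⇓-shift (λ i → i + + 1) (⇓-neg K.odd-sum)))

-- Quadratic identities between theta series of weight 1/2 and 3/2.

module ThetaIdentities where

  open PowerSeries
  open LatticeSums
  open ThetaSeries

  𝟙 : ℤ → ℤ
  𝟙 _ = + 1

  -- In the variable q^D these are φ(q), φ(-q) and ψ(q) in Ramanujan's notation, Jacobi's series for
  -- the cube of Π(1 - q^n), Euler's pentagonal series for Π(1 - q^(2n)), and the series of E with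
  -- the sign replaced by 6k + 1.
  φ φ⁻ ψ J E V : ℤ → PS
  φ D  = Θ 𝟙 (D · sq)
  φ⁻ D = Θ sgn (D · sq)
  ψ D  = Θ 𝟙 (D · tri)
  J D  = Θ (λ k → + 4 * k + + 1) (D · tri)
  E D  = Θ sgn (D · pent)
  V D  = Θ (λ k → + 6 * k + + 1) (D · pent)

  V′ : PS
  V′ = Θ (λ k → sgn k * (+ 3 * k + + 1)) (+ 1 · oct)

  q : PS
  q = tm (+ 1) (+ 1)

  -- The derivation q d/dq. It multiplies each monomial by its exponent, so theta series weighted by
  -- their own exponents are derivatives.
  ∂ : PS → PS
  ∂ a .at n = + n * at a n

  module Identities (L : ℕ) where
    open Theta L public
    open import Relation.Binary.Reasoning.Setoid setoid

    ∂-cong : ∀ {a b} → a ≈ b → ∂ a ≈ ∂ b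
    ∂-cong p = eqv λ n l → cg-* (cg-refl {a = + n}) (coef p n l)

    ∂-Θ : ∀ w e → ∂ (Θ w e) ≈ Θ (λ k → e k * w k) e
    ∂-Θ w e = ≡⇒≈ (λ n → Dsum n n)
      where
        Dδ : ∀ e n → + n * δ e n ≡ e * δ e n
        Dδ (+ zero) zero = refl
        Dδ (+ zero) (suc n) = ℤP.*-zeroʳ (+ suc n)
        Dδ (+ suc m) zero = ≡.sym (ℤP.*-zeroʳ (+ suc m))
        Dδ (+ suc m) (suc n) = ≡.trans (lem (+ n) _) (≡.trans (cong (λ z → δ (+ m) n + z) (Dδ (+ m) n)) (≡.sym (lem (+ m) _)))
          where lem : ∀ n x → (+ 1 + n) * x ≡ x + n * x
                lem = solve-∀
        Dδ -[1+ m ] n = ≡.trans (ℤP.*-zeroʳ (+ n)) (≡.sym (ℤP.*-zeroʳ -[1+ m ]))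
        Dtm : ∀ w e n → + n * (w * δ e n) ≡ e * w * δ e n
        Dtm w e n = ≡.trans (lem (+ n) w _) (≡.trans (cong (w *_) (Dδ e n)) (lem′ e w _))
          where lem : ∀ n w x → n * (w * x) ≡ w * (n * x)
                lem = solve-∀
                lem′ : ∀ e w x → w * (e * x) ≡ e * w * x
                lem′ = solve-∀
        Dsum : ∀ B n → + n * at (sumTo B (λ k → tm (w k) (e k))) n ≡ at (sumTo B (λ k → tm (e k * w k) (e k))) n
        Dsum zero n = Dtm (w (+ 0)) (e (+ 0)) n
        Dsum (suc B) n = ≡.trans (lem (+ n) (at (sumTo B (λ k → tm (w k) (e k))) n) (w (+ suc B) * δ (e (+ suc B)) n) (w -[1+ B ] * δ (e -[1+ B ]) n))
          (cong₂ _+_ (Dsum B n) (cong₂ _+_ (Dtm (w (+ suc B)) (e (+ suc B)) n) (Dtm (w -[1+ B ]) (e -[1+ B ]) n)))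
          where lem : ∀ n x y z → n * (x + (y + z)) ≡ n * x + (n * y + n * z)
                lem = solve-∀

    Θ-scale : ∀ c w e → Θ (λ k → c * w k) e ≈ ι c ⊛ Θ w e
    Θ-scale c w e = ≡⇒≈ (λ n → ≡.trans (go n n) (≡.sym (at-ι⊛ c (Θ w e) n)))
      where
        go : ∀ B n → at (sumTo B (λ k → tm (c * w k) (e k))) n ≡ c * at (sumTo B (λ k → tm (w k) (e k))) n
        go zero n = ℤP.*-assoc c _ _
        go (suc B) n = ≡.trans (cong₂ _+_ (go B n) (cong₂ _+_ (ℤP.*-assoc c _ _) (ℤP.*-assoc c _ _))) (lem c _ _ _)
          where lem : ∀ c x y z → c * x + (c * y + c * z) ≡ c * (x + (y + z))
                lem = solve-∀

    Θ-odd : ∀ {w e} → Admissible e → (∀ k → w (- k) ≡ - w k) → (∀ k → e (- k) ≡ e k) → Θ w e ≈ 0#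
    Θ-odd {w} {e} a p r = self-neg (⊕-inverse (≈-trans (⊕-cong (≈-sym value) (≈-trans (≈-sym value) (≈-sym (sum-neg bound _))))
        (≈-trans (≈-sym (sum-⊕ bound _ _)) (sum-zero bound (λ k → tm-cancel (≡.sym (r k)) (≡.trans (cong (λ z → w k + z) (p k)) (ℤP.+-inverseʳ (w k))))))))
      where open _↓_ (Θ↓ {w} a)

    -- The parallelogram law for X = 4x + 1 and Y = 4y + 1: here half the sum is 4a + 1 and half the
    -- difference is 2b with b = 2c; in `tri-odd` they are -(4a + 1) and 2b with b = 2c + 1.
    tri-even : ∀ D a c → D * ((a + c) * (+ 2 * (a + c) + + 1)) + D * ((a - c) * (+ 2 * (a - c) + + 1)) ≡
           + 2 * D * (a * (+ 2 * a + + 1)) + D * (+ 2 * c * (+ 2 * c))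
    tri-even = solve-∀
    tri-odd : ∀ D a c → D * ((c - a) * (+ 2 * (c - a) + + 1)) + D * ((- (a + + 1) - c) * (+ 2 * (- (a + + 1) - c) + + 1)) ≡
           + 2 * D * (a * (+ 2 * a + + 1)) + D * ((+ 2 * c + + 1) * (+ 2 * c + + 1))
    tri-odd = solve-∀

    module _ {D : ℤ} (D≥1 : + 1 ℤ.≤ D) where

      2D≥1 : + 1 ℤ.≤ + 2 * D
      2D≥1 = ℤP.≤-trans D≥1 (subst (D ℤ.≤_) (lem D) (subst (ℤ._≤ D + D) (ℤP.+-identityʳ D) (ℤP.+-monoʳ-≤ D (ℤP.≤-trans (ℤ.+≤+ z≤n) D≥1))))
        where lem : ∀ D → D + D ≡ + 2 * D
              lem = solve-∀

      -- The substitution x = a + b, y = a - b doubles the form x² + y². On the points with x + y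
      -- odd, the reflection b to -b - 1 exchanges x and y, which fixes the exponent and flips the
      -- sign, so that half cancels.
      φφ⁻ : φ D ⊛ φ⁻ D ≈ φ⁻ (+ 2 * D) ⊛ φ⁻ (+ 2 * D)
      φφ⁻ = ≈-trans total (≈-trans (⊕-cong evens odds) (⊕-identityʳ _))
        where
          open Diagonals (diagonals (Θ-product {𝟙} {sgn} (·-adm D≥1 sq-adm) (·-adm D≥1 sq-adm)))
          evens : even ≈ φ⁻ (+ 2 * D) ⊛ φ⁻ (+ 2 * D)
          evens = ⇓-unique even-sum (⇓-tm (λ a b → ≡.sym (≡.trans (ℤP.*-identityˡ _) (sgn-minus a b))) (lem D)
                    (Θ-product {sgn} {sgn} (·-adm 2D≥1 sq-adm) (·-adm 2D≥1 sq-adm)))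
            where lem : ∀ D a b → + 2 * D * (a * a) + + 2 * D * (b * b) ≡ D * ((a + b) * (a + b)) + D * ((a - b) * (a - b))
                  lem = solve-∀
          odds : odd ≈ 0#
          odds = antisymmetric odd-sum (⇓-reflect odd-sum) (λ a b → ≈-trans (⊕-cong (tm-cong (w₁ a b) refl) (tm-cong (w₂ a b) (lem D a b)))
                   (≈-trans (tm-⊕ _ _ _) (≈-trans (tm-cong (ℤP.+-inverseʳ (sgn a * sgn b)) refl) (tm-0 _))))
            where lem : ∀ D a b → D * ((a + - (b + + 1) + + 1) * (a + - (b + + 1) + + 1)) + D * ((a - - (b + + 1)) * (a - - (b + + 1)))
                          ≡ D * ((a + b + + 1) * (a + b + + 1)) + D * ((a - b) * (a - b))
                  lem = solve-∀
                  w₁ : ∀ a b → + 1 * sgn (a - b) ≡ sgn a * sgn b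
                  w₁ a b = ≡.trans (ℤP.*-identityˡ _) (sgn-minus a b)
                  w₂ : ∀ a b → + 1 * sgn (a - - (b + + 1)) ≡ - (sgn a * sgn b)
                  w₂ a b = ≡.trans (w₁ a _) (≡.trans (cong (sgn a *_) (≡.trans (sgn-neg (b + + 1)) (≡.trans (cong sgn (ℤP.+-comm b (+ 1))) (sgn-suc b))))
                             (≡.sym (ℤP.neg-distribʳ-* (sgn a) (sgn b))))

      ψ² : ψ D ⊛ ψ D ≈ ψ (+ 2 * D) ⊛ φ D
      ψ² = refold (Θ-product {𝟙} {𝟙} (·-adm D≥1 tri-adm) (·-adm D≥1 tri-adm)) (Θ-product {𝟙} {𝟙} (·-adm 2D≥1 tri-adm) (·-adm D≥1 sq-adm))
             (λ a c → tm-cong refl (tri-even D a c)) (λ a c → tm-cong refl (tri-odd D a c))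

      -- Under the change of variables of `ψ²` the weight 4x + 1 becomes (-1)^b (4a + 1) + 2b. The
      -- second part is odd in b and sums to zero.
      Jψ : J D ⊛ ψ D ≈ J (+ 2 * D) ⊛ φ⁻ D
      Jψ = ≈-trans (refold (Θ-product {λ k → + 4 * k + + 1} {𝟙} (·-adm D≥1 tri-adm) (·-adm D≥1 tri-adm))
               (⇓-⊕ (Θ-product {λ k → + 4 * k + + 1} {sgn} (·-adm 2D≥1 tri-adm) (·-adm D≥1 sq-adm))
                    (Θ-product {𝟙} {λ k → + 2 * k} (·-adm 2D≥1 tri-adm) (·-adm D≥1 sq-adm)))
               (λ a c → ≈-trans (tm-cong (w₀ a c (sgn-2* c)) (tri-even D a c)) (≈-sym (tm-⊕ _ _ _)))
               (λ a c → ≈-trans (tm-cong (w₁ a c (sgn-2*+1 c)) (tri-odd D a c)) (≈-sym (tm-⊕ _ _ _))))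
             (⊕-zeroʳ (≈-trans (⊛-cong ≈-refl (Θ-odd (·-adm D≥1 sq-adm) lem (λ k → lem′ D k))) (⊛-zeroʳ _)))
        where
          lem : ∀ k → + 2 * - k ≡ - (+ 2 * k)
          lem = solve-∀
          lem′ : ∀ D k → D * (- k * - k) ≡ D * (k * k)
          lem′ = solve-∀
          w₀ : ∀ a c → sgn (+ 2 * c) ≡ + 1 → (+ 4 * (a + c) + + 1) * + 1 ≡ (+ 4 * a + + 1) * sgn (+ 2 * c) + + 1 * (+ 2 * (+ 2 * c))
          w₀ a c p rewrite p = go a c
            where go : ∀ a c → (+ 4 * (a + c) + + 1) * + 1 ≡ (+ 4 * a + + 1) * + 1 + + 1 * (+ 2 * (+ 2 * c))
                  go = solve-∀
          w₁ : ∀ a c → sgn (+ 2 * c + + 1) ≡ - + 1 → (+ 4 * (c - a) + + 1) * + 1 ≡ (+ 4 * a + + 1) * sgn (+ 2 * c + + 1) + + 1 * (+ 2 * (+ 2 * c + + 1))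
          w₁ a c p rewrite p = go a c
            where go : ∀ a c → (+ 4 * (c - a) + + 1) * + 1 ≡ (+ 4 * a + + 1) * - + 1 + + 1 * (+ 2 * (+ 2 * c + + 1))
                  go = solve-∀

      private
        3D≥1 = ·-adm {e = pent} D≥1 pent-adm
        -- The exponent is D(n² + 3m² - 4)/12 in the coordinates n = 6k + 1 and m = σ(4l + 1), and
        -- the reflection is (n, m) to ((3m - n)/2, (n + m)/2). The sign σ of k is a separate
        -- argument of W: on each of the three pieces it is a known constant, and antisymmetry
        -- becomes a polynomial identity.
        module Hex (W : ℤ → ℤ → ℤ → ℤ)
          (A : ∀ i j → W (+ 1) (+ 2 * j) (+ 2 * i + j) + W (+ 1) (+ 2 * i) (+ 2 * j + i) ≡ + 0)
          (B : ∀ i j → W (+ 1) (+ 2 * j) (+ 2 * i + + 1 + j) + W (- + 1) (+ 2 * i + + 1) (- (+ 2 * j + (i + + 1))) ≡ + 0)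
          (C : ∀ i j → W (- + 1) (+ 2 * i + + 1) (- (+ 2 * j + + 1 + (i + + 1))) + W (- + 1) (+ 2 * j + + 1) (- (+ 2 * i + + 1 + (j + + 1))) ≡ + 0)
          where
          Q : ℤ → ℤ → ℤ
          Q k l = D * pent k + + 2 * D * tri l

          vanish : ∀ {s} → (λ k l → tm (W (sgn k) k l) (Q k l)) ⇓ s → s ≈ 0#
          vanish h = hexagonal h
            (λ i j → tm-cancel (qA D i j) (≡.trans (cong₂ _+_ (cong (λ σ → W σ (+ 2 * j) (+ 2 * i + j)) (sgn-2* j)) (cong (λ σ → W σ (+ 2 * i) (+ 2 * j + i)) (sgn-2* i))) (A i j)))
            (λ i j → tm-cancel (qB D i j) (≡.trans (cong₂ _+_ (cong (λ σ → W σ (+ 2 * j) (+ 2 * i + + 1 + j)) (sgn-2* j)) (cong (λ σ → W σ (+ 2 * i + + 1) (- (+ 2 * j + (i + + 1)))) (sgn-2*+1 i))) (B i j)))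
            (λ i j → tm-cancel (qC D i j) (≡.trans (cong₂ _+_ (cong (λ σ → W σ (+ 2 * i + + 1) (- (+ 2 * j + + 1 + (i + + 1)))) (sgn-2*+1 i)) (cong (λ σ → W σ (+ 2 * j + + 1) (- (+ 2 * i + + 1 + (j + + 1)))) (sgn-2*+1 j))) (C i j)))
            where
              qA : ∀ D i j → D * (+ 2 * j * (+ 3 * (+ 2 * j) + + 1)) + + 2 * D * ((+ 2 * i + j) * (+ 2 * (+ 2 * i + j) + + 1)) ≡
                             D * (+ 2 * i * (+ 3 * (+ 2 * i) + + 1)) + + 2 * D * ((+ 2 * j + i) * (+ 2 * (+ 2 * j + i) + + 1))
              qA = solve-∀
              qB : ∀ D i j → D * (+ 2 * j * (+ 3 * (+ 2 * j) + + 1)) + + 2 * D * ((+ 2 * i + + 1 + j) * (+ 2 * (+ 2 * i + + 1 + j) + + 1)) ≡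
                             D * ((+ 2 * i + + 1) * (+ 3 * (+ 2 * i + + 1) + + 1)) + + 2 * D * (- (+ 2 * j + (i + + 1)) * (+ 2 * - (+ 2 * j + (i + + 1)) + + 1))
              qB = solve-∀
              qC : ∀ D i j → D * ((+ 2 * i + + 1) * (+ 3 * (+ 2 * i + + 1) + + 1)) + + 2 * D * (- (+ 2 * j + + 1 + (i + + 1)) * (+ 2 * - (+ 2 * j + + 1 + (i + + 1)) + + 1)) ≡
                             D * ((+ 2 * j + + 1) * (+ 3 * (+ 2 * j + + 1) + + 1)) + + 2 * D * (- (+ 2 * i + + 1 + (j + + 1)) * (+ 2 * - (+ 2 * i + + 1 + (j + + 1)) + + 1))
              qC = solve-∀

      -- The difference of the two sides has weight n - m in the coordinates of `Hex`, and the
      -- reflection negates it.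
      Vψ : V D ⊛ ψ (+ 2 * D) ≈ E D ⊛ J (+ 2 * D)
      Vψ = ≈-trans (⊕-inverse (vanish (⇓-cong (λ k l → tm-⊕ _ _ _) (⇓-⊕
             (Θ-product {λ k → + 6 * k + + 1} {𝟙} 3D≥1 (·-adm 2D≥1 tri-adm))
             (Θ-product {λ k → - + 1 * sgn k} {λ k → + 4 * k + + 1} 3D≥1 (·-adm 2D≥1 tri-adm))))))
           (≈-trans (⊖-cong (⊛-cong (Θ-scale (- + 1) sgn _) ≈-refl)) (solve 2 (λ e j → :- (con (- + 1) :* e :* j) := e :* j) ≈-refl _ _))
        where
          A : ∀ i j → (+ 6 * (+ 2 * j) + + 1) * + 1 + - + 1 * + 1 * (+ 4 * (+ 2 * i + j) + + 1) + ((+ 6 * (+ 2 * i) + + 1) * + 1 + - + 1 * + 1 * (+ 4 * (+ 2 * j + i) + + 1)) ≡ + 0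
          A = solve-∀
          B : ∀ i j → (+ 6 * (+ 2 * j) + + 1) * + 1 + - + 1 * + 1 * (+ 4 * (+ 2 * i + + 1 + j) + + 1) + ((+ 6 * (+ 2 * i + + 1) + + 1) * + 1 + - + 1 * - + 1 * (+ 4 * - (+ 2 * j + (i + + 1)) + + 1)) ≡ + 0
          B = solve-∀
          C : ∀ i j → (+ 6 * (+ 2 * i + + 1) + + 1) * + 1 + - + 1 * - + 1 * (+ 4 * - (+ 2 * j + + 1 + (i + + 1)) + + 1) + ((+ 6 * (+ 2 * j + + 1) + + 1) * + 1 + - + 1 * - + 1 * (+ 4 * - (+ 2 * i + + 1 + (j + + 1)) + + 1)) ≡ + 0
          C = solve-∀
          open Hex (λ σ k l → (+ 6 * k + + 1) * + 1 + - + 1 * σ * (+ 4 * l + + 1))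
            A B C

      -- Now the weight is D/4 times m(n² - m²), up to a constant the √-3 part of (n + m√-3)³. The
      -- reflection sends m to (n + m)/2, n + m to 2m and n - m to its negative, so this weight too
      -- changes sign.
      3∂EJ : ι (+ 3) ⊛ ∂ (E D) ⊛ J (+ 2 * D) ≈ E D ⊛ ∂ (J (+ 2 * D))
      3∂EJ = begin
        ι (+ 3) ⊛ ∂ (E D) ⊛ J (+ 2 * D)
          ≈⟨ ⊛-cong (≈-trans (⊛-cong ≈-refl (∂-Θ sgn _)) (≈-sym (Θ-scale (+ 3) _ _))) ≈-refl ⟩
        Θ (λ k → + 3 * (D * pent k * sgn k)) (D · pent) ⊛ J (+ 2 * D)
          ≈⟨ ⊕-inverse (vanish (⇓-cong (λ k l → tm-⊕ _ _ _) (⇓-⊕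
             (Θ-product {λ k → + 3 * (D * pent k * sgn k)} {λ k → + 4 * k + + 1} 3D≥1 (·-adm 2D≥1 tri-adm))
             (Θ-product {sgn} {λ l → - + 1 * (+ 2 * D * tri l * (+ 4 * l + + 1))} 3D≥1 (·-adm 2D≥1 tri-adm))))) ⟩
        ⊖ (E D ⊛ Θ (λ l → - + 1 * (+ 2 * D * tri l * (+ 4 * l + + 1))) ((+ 2 * D) · tri))
          ≈⟨ ⊖-cong (⊛-cong ≈-refl (≈-trans (Θ-scale (- + 1) _ _) (⊛-cong ≈-refl (≈-sym (∂-Θ (λ l → + 4 * l + + 1) _))))) ⟩
        ⊖ (E D ⊛ (ι (- + 1) ⊛ ∂ (J (+ 2 * D))))
          ≈⟨ solve 2 (λ e j → :- (e :* (con (- + 1) :* j)) := e :* j) ≈-refl _ _ ⟩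
        E D ⊛ ∂ (J (+ 2 * D)) ∎
        where
          A : ∀ D i j →
            + 3 * (D * (+ 2 * j * (+ 3 * (+ 2 * j) + + 1)) * + 1) * (+ 4 * (+ 2 * i + j) + + 1)
              + + 1 * (- + 1 * (+ 2 * D * ((+ 2 * i + j) * (+ 2 * (+ 2 * i + j) + + 1)) * (+ 4 * (+ 2 * i + j) + + 1)))
            + (+ 3 * (D * (+ 2 * i * (+ 3 * (+ 2 * i) + + 1)) * + 1) * (+ 4 * (+ 2 * j + i) + + 1)
              + + 1 * (- + 1 * (+ 2 * D * ((+ 2 * j + i) * (+ 2 * (+ 2 * j + i) + + 1)) * (+ 4 * (+ 2 * j + i) + + 1)))) ≡ + 0
          A = solve-∀
          B : ∀ D i j →
            + 3 * (D * (+ 2 * j * (+ 3 * (+ 2 * j) + + 1)) * + 1) * (+ 4 * (+ 2 * i + + 1 + j) + + 1)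
              + + 1 * (- + 1 * (+ 2 * D * ((+ 2 * i + + 1 + j) * (+ 2 * (+ 2 * i + + 1 + j) + + 1)) * (+ 4 * (+ 2 * i + + 1 + j) + + 1)))
            + (+ 3 * (D * ((+ 2 * i + + 1) * (+ 3 * (+ 2 * i + + 1) + + 1)) * - + 1) * (+ 4 * - (+ 2 * j + (i + + 1)) + + 1)
              + - + 1 * (- + 1 * (+ 2 * D * (- (+ 2 * j + (i + + 1)) * (+ 2 * - (+ 2 * j + (i + + 1)) + + 1)) * (+ 4 * - (+ 2 * j + (i + + 1)) + + 1)))) ≡ + 0
          B = solve-∀
          C : ∀ D i j →
            + 3 * (D * ((+ 2 * i + + 1) * (+ 3 * (+ 2 * i + + 1) + + 1)) * - + 1) * (+ 4 * - (+ 2 * j + + 1 + (i + + 1)) + + 1)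
              + - + 1 * (- + 1 * (+ 2 * D * (- (+ 2 * j + + 1 + (i + + 1)) * (+ 2 * - (+ 2 * j + + 1 + (i + + 1)) + + 1)) * (+ 4 * - (+ 2 * j + + 1 + (i + + 1)) + + 1)))
            + (+ 3 * (D * ((+ 2 * j + + 1) * (+ 3 * (+ 2 * j + + 1) + + 1)) * - + 1) * (+ 4 * - (+ 2 * i + + 1 + (j + + 1)) + + 1)
              + - + 1 * (- + 1 * (+ 2 * D * (- (+ 2 * i + + 1 + (j + + 1)) * (+ 2 * - (+ 2 * i + + 1 + (j + + 1)) + + 1)) * (+ 4 * - (+ 2 * i + + 1 + (j + + 1)) + + 1)))) ≡ + 0
          C = solve-∀
          open Hex (λ σ k l → + 3 * (D * pent k * σ) * (+ 4 * l + + 1) + σ * (- + 1 * (+ 2 * D * tri l * (+ 4 * l + + 1))))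
            (A D) (B D) (C D)

    1≤ : ∀ n → + 1 ℤ.≤ + suc n
    1≤ n = ℤ.+≤+ (s≤s z≤n)

    ι-tm : ∀ c w e → ι c ⊛ tm w e ≈ tm (c * w) e
    ι-tm c w e = ≡⇒≈ (λ n → ≡.trans (at-ι⊛ c (tm w e) n) (≡.sym (ℤP.*-assoc c w (δ e n))))

    -- The weight (4x + 1)(4y + 1) equals (4a + 1)² - (2b)² = 1 + 2(4 tri a) - 2(2b²). Here 4 tri a
    -- and 2b² are the exponents of ψ(q⁴) and φ(q²), so the weight is produced by derivatives.
    J₂² : J (+ 2) ⊛ J (+ 2) ≈ ψ (+ 4) ⊛ φ (+ 2) ⊕ ι (+ 2) ⊛ (∂ (ψ (+ 4)) ⊛ φ (+ 2) ⊕ ⊖ (ψ (+ 4) ⊛ ∂ (φ (+ 2))))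
    J₂² = begin
      J (+ 2) ⊛ J (+ 2)
        ≈⟨ refold (Θ-product {λ k → + 4 * k + + 1} {λ k → + 4 * k + + 1} (·-adm (1≤ 1) tri-adm) (·-adm (1≤ 1) tri-adm))
             (⇓-⊕ (⇓-⊕ (Θ-product {𝟙} {𝟙} (·-adm (1≤ 3) tri-adm) (·-adm (1≤ 1) sq-adm))
                       (Θ-product {λ k → + 2 * (+ 4 * tri k * + 1)} {𝟙} (·-adm (1≤ 3) tri-adm) (·-adm (1≤ 1) sq-adm)))
                  (Θ-product {𝟙} {λ k → - + 2 * (+ 2 * sq k * + 1)} (·-adm (1≤ 3) tri-adm) (·-adm (1≤ 1) sq-adm)))
             (λ a c → ≈-trans (tm-cong (w₀ a c) (tri-even (+ 2) a c)) (≈-sym (≈-trans (⊕-cong (tm-⊕ _ _ _) ≈-refl) (tm-⊕ _ _ _))))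
             (λ a c → ≈-trans (tm-cong (w₁ a c) (tri-odd (+ 2) a c)) (≈-sym (≈-trans (⊕-cong (tm-⊕ _ _ _) ≈-refl) (tm-⊕ _ _ _)))) ⟩
      (ψ (+ 4) ⊛ φ (+ 2) ⊕ Θ (λ k → + 2 * (+ 4 * tri k * + 1)) (+ 4 · tri) ⊛ φ (+ 2)) ⊕ ψ (+ 4) ⊛ Θ (λ k → - + 2 * (+ 2 * sq k * + 1)) (+ 2 · sq)
        ≈⟨ ⊕-cong (⊕-cong ≈-refl (⊛-cong (≈-trans (Θ-scale (+ 2) _ _) (⊛-cong ≈-refl (≈-sym (∂-Θ 𝟙 _)))) ≈-refl))
                  (⊛-cong ≈-refl (≈-trans (Θ-scale (- + 2) _ _) (⊛-cong ≈-refl (≈-sym (∂-Θ 𝟙 _))))) ⟩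
      (ψ (+ 4) ⊛ φ (+ 2) ⊕ ι (+ 2) ⊛ ∂ (ψ (+ 4)) ⊛ φ (+ 2)) ⊕ ψ (+ 4) ⊛ (ι (- + 2) ⊛ ∂ (φ (+ 2)))
        ≈⟨ solve 4 (λ p f p′ f′ → (p :* f :+ con (+ 2) :* p′ :* f) :+ p :* (con (- + 2) :* f′) := p :* f :+ con (+ 2) :* (p′ :* f :+ :- (p :* f′))) ≈-refl _ _ _ _ ⟩
      ψ (+ 4) ⊛ φ (+ 2) ⊕ ι (+ 2) ⊛ (∂ (ψ (+ 4)) ⊛ φ (+ 2) ⊕ ⊖ (ψ (+ 4) ⊛ ∂ (φ (+ 2)))) ∎
      where
        w₀ : ∀ a c → (+ 4 * (a + c) + + 1) * (+ 4 * (a - c) + + 1) ≡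
               + 1 * + 1 + + 2 * (+ 4 * (a * (+ 2 * a + + 1)) * + 1) * + 1 + + 1 * (- + 2 * (+ 2 * (+ 2 * c * (+ 2 * c)) * + 1))
        w₀ = solve-∀
        w₁ : ∀ a c → (+ 4 * (c - a) + + 1) * (+ 4 * (- (a + + 1) - c) + + 1) ≡
               + 1 * + 1 + + 2 * (+ 4 * (a * (+ 2 * a + + 1)) * + 1) * + 1 + + 1 * (- + 2 * (+ 2 * ((+ 2 * c + + 1) * (+ 2 * c + + 1)) * + 1))
        w₁ = solve-∀

    -- Each of two commuting reflections contributes a factor 2. On the remaining quarter of the
    -- points the exponent is 1 plus four times a sum of two triangular numbers.
    odd-squares : ∀ {s} → (λ a b → tm (+ 1) (+ 1 * sq (a + b + + 1) + + 1 * sq (a - b))) ⇓ s → s ≈ ι (+ 4) ⊛ (q ⊛ (ψ (+ 4) ⊛ ψ (+ 4)))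
    odd-squares {s} h = begin
      s                                                   ≈⟨ proj₂ (proj₂ first) ⟩
      ι (+ 2) ⊛ proj₁ first                               ≈⟨ ⊛-cong ≈-refl (proj₂ (proj₂ second)) ⟩
      ι (+ 2) ⊛ (ι (+ 2) ⊛ proj₁ second)                  ≈⟨ solve 1 (λ u → con (+ 2) :* (con (+ 2) :* u) := con (+ 4) :* u) ≈-refl (proj₁ second) ⟩
      ι (+ 4) ⊛ proj₁ second                              ≈⟨ ⊛-cong ≈-refl (⇓-unique (proj₁ (proj₂ second)) (⇓-cong prod (⇓-scale q (Θ-product {𝟙} {𝟙} adm adm)))) ⟩
      ι (+ 4) ⊛ (q ⊛ (ψ (+ 4) ⊛ ψ (+ 4)))                 ∎
      where
        G : ℤ → ℤ → PS
        G x y = tm (+ 1) (+ 1 * sq (x + y + + 1) + + 1 * sq (x - y))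
        symʳ : ∀ x y → + 1 * ((x + - (y + + 1) + + 1) * (x + - (y + + 1) + + 1)) + + 1 * ((x - - (y + + 1)) * (x - - (y + + 1)))
                     ≡ + 1 * ((x + y + + 1) * (x + y + + 1)) + + 1 * ((x - y) * (x - y))
        symʳ = solve-∀
        symˡ : ∀ x y → + 1 * ((- (x + + 1) + y + + 1) * (- (x + + 1) + y + + 1)) + + 1 * ((- (x + + 1) - y) * (- (x + + 1) - y))
                     ≡ + 1 * ((x + y + + 1) * (x + y + + 1)) + + 1 * ((x - y) * (x - y))
        symˡ = solve-∀
        G-symʳ : ∀ x y → G x (- (y + + 1)) ≈ G x y
        G-symʳ x y = tm-cong refl (symʳ x y)
        G-symˡ : ∀ x y → G (- (x + + 1)) y ≈ G x y
        G-symˡ x y = tm-cong refl (symˡ x y)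
        first = fold {G} h G-symʳ
        second = fold {λ y x → G x (+ 2 * y)} (⇓-swap (proj₁ (proj₂ first))) (λ y x → G-symˡ x (+ 2 * y))
        adm = ·-adm {+ 4} (1≤ 3) tri-adm
        lem : ∀ x y → + 1 + (+ 4 * (y * (+ 2 * y + + 1)) + + 4 * (x * (+ 2 * x + + 1))) ≡
                + 1 * ((+ 2 * x + + 2 * y + + 1) * (+ 2 * x + + 2 * y + + 1)) + + 1 * ((+ 2 * x - + 2 * y) * (+ 2 * x - + 2 * y))
        lem = solve-∀
        prod : ∀ y x → q ⊛ tm (+ 1) (+ 4 * tri y + + 4 * tri x) ≈ G (+ 2 * x) (+ 2 * y)
        prod y x = ≈-trans (tm-⊛ (+ 1) (+ 1) (+ 1) (+ 4 * tri y + + 4 * tri x) (ℤ.+≤+ z≤n) (ℤP.+-mono-≤ (adm≥0 adm y) (adm≥0 adm x))) (tm-cong refl (lem x y))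

    private
      square-sum : ∀ a b → + 2 * (a * a) + + 2 * (b * b) ≡ + 1 * ((a + b) * (a + b)) + + 1 * ((a - b) * (a - b))
      square-sum = solve-∀
      sq₁ = ·-adm {+ 1} (1≤ 0) sq-adm
      sq₂ = ·-adm {+ 2} (1≤ 1) sq-adm

    φ₁² : φ (+ 1) ⊛ φ (+ 1) ≈ φ (+ 2) ⊛ φ (+ 2) ⊕ ι (+ 4) ⊛ (q ⊛ (ψ (+ 4) ⊛ ψ (+ 4)))
    φ₁² = ≈-trans total (⊕-cong (⇓-unique even-sum (⇓-tm (λ _ _ → refl) square-sum (Θ-product {𝟙} {𝟙} sq₂ sq₂))) (odd-squares odd-sum))
      where open Diagonals (diagonals (Θ-product {𝟙} {𝟙} sq₁ sq₁))

    φ⁻₁² : φ⁻ (+ 1) ⊛ φ⁻ (+ 1) ≈ φ (+ 2) ⊛ φ (+ 2) ⊕ ⊖ (ι (+ 4) ⊛ (q ⊛ (ψ (+ 4) ⊛ ψ (+ 4))))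
    φ⁻₁² = begin
      φ⁻ (+ 1) ⊛ φ⁻ (+ 1)            ≈⟨ total ⟩
      even ⊕ odd                     ≈⟨ ⊕-cong (⇓-unique even-sum (⇓-tm (λ a b → ≡.sym (w₀ a b)) square-sum (Θ-product {𝟙} {𝟙} sq₂ sq₂))) ≈-refl ⟩
      φ (+ 2) ⊛ φ (+ 2) ⊕ odd        ≈⟨ solve 2 (λ x o → x :+ o := x :+ :- (con (- + 1) :* o)) ≈-refl _ odd ⟩
      φ (+ 2) ⊛ φ (+ 2) ⊕ ⊖ (ι (- + 1) ⊛ odd)
        ≈⟨ ⊕-cong ≈-refl (⊖-cong (odd-squares (⇓-cong (λ a b → ≈-trans (ι-tm _ _ _) (tm-cong (w₁ a b) refl)) (⇓-scale (ι (- + 1)) odd-sum)))) ⟩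
      φ (+ 2) ⊛ φ (+ 2) ⊕ ⊖ (ι (+ 4) ⊛ (q ⊛ (ψ (+ 4) ⊛ ψ (+ 4)))) ∎
      where
        open Diagonals (diagonals (Θ-product {sgn} {sgn} sq₁ sq₁))
        w₀ : ∀ a b → sgn (a + b) * sgn (a - b) ≡ + 1
        w₀ a b = ≡.trans (≡.sym (sgn-+ (a + b) (a - b))) (≡.trans (cong sgn (lem a b)) (sgn-2* a))
          where lem : ∀ a b → a + b + (a - b) ≡ + 2 * a
                lem = solve-∀
        w₁ : ∀ a b → - + 1 * (sgn (a + b + + 1) * sgn (a - b)) ≡ + 1
        w₁ a b = ≡.trans (cong (- + 1 *_) (≡.trans (≡.sym (sgn-+ (a + b + + 1) (a - b))) (≡.trans (cong sgn (lem a b)) (sgn-2*+1 a)))) refl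
          where lem : ∀ a b → a + b + + 1 + (a - b) ≡ + 2 * a + + 1
                lem = solve-∀

    -- With k = a + c and b = a - c on the points of even k + b the weight is 3(a + c) + 1. Adding
    -- the sum `Z` with weight 3b, which vanishes by the exchange of a and c, turns it into 6a + 1,
    -- the weight of V. The form matches that of the right side after splitting by the parity of a
    -- and a shear. The points with k + b odd contribute nothing: the three weights on an orbit of
    -- the rotation add to zero.
    V′φ⁻ : V′ ⊛ φ⁻ (+ 1) ≈ V (+ 1) ⊛ ψ (+ 2)
    V′φ⁻ = begin
      V′ ⊛ φ⁻ (+ 1)          ≈⟨ X.total ⟩
      X.even ⊕ X.odd         ≈⟨ ⊕-cong ≈-refl odd≈0 ⟩
      X.even ⊕ 0#            ≈⟨ ⊕-cong ≈-refl Z≈0 ⟨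
      X.even ⊕ Z.even        ≈⟨ M.total ⟩
      M.even ⊕ M.odd         ≈⟨ ⊕-cong (⇓-unique M.even-sum (⇓-cong (λ e c → tm-cong (w₀ e c) (q₀ e c)) (⇓-shift (λ e → e) R.even-sum)))
                                       (⇓-unique M.odd-sum (⇓-cong (λ e c → tm-cong (w₁ e c) (q₁ e c)) (⇓-shift (λ e → e + + 1) (⇓-neg R.odd-sum)))) ⟩
      R.even ⊕ R.odd         ≈⟨ R.total ⟨
      V (+ 1) ⊛ ψ (+ 2)      ∎
      where
        oct₁ = ·-adm {+ 1} (1≤ 0) oct-adm
        W₁ Q : ℤ → ℤ → ℤ
        Q k b = + 1 * oct k + + 1 * sq b
        W₁ k b = sgn k * (+ 3 * k + + 1) * sgn b
        module X = Diagonals (diagonals (Θ-product {λ k → sgn k * (+ 3 * k + + 1)} {sgn} oct₁ sq₁))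
        module Z = Diagonals (diagonals (Θ-product {𝟙} {λ b → + 3 * b} oct₁ sq₁))
        module R = Split₁ (⇓-split₁ (Θ-product {λ k → + 6 * k + + 1} {𝟙} (·-adm {+ 1} (1≤ 0) pent-adm) (·-adm {+ 2} (1≤ 1) tri-adm)))

        Z≈0 : Z.even ≈ 0#
        Z≈0 = antisymmetric Z.even-sum (⇓-swap Z.even-sum) (λ a c → tm-cancel (qe a c) (we a c))
          where
            we : ∀ a c → + 1 * (+ 3 * (a - c)) + + 1 * (+ 3 * (c - a)) ≡ + 0
            we = solve-∀
            qe : ∀ a c → + 1 * ((a + c) * (+ 3 * (a + c) + + 2)) + + 1 * ((a - c) * (a - c)) ≡
                         + 1 * ((c + a) * (+ 3 * (c + a) + + 2)) + + 1 * ((c - a) * (c - a))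
            qe = solve-∀

        -- Rotation by a third of a turn of the lattice n² + 3 b², n = 3 k + 1.
        odd≈0 : X.odd ≈ 0#
        odd≈0 = ι-cancel 2 (≈-trans (solve 1 (λ s → con (+ 3) :* s := (s :+ s) :+ s) ≈-refl X.odd)
            (⇓-zero (λ a c → ≈-trans (⊕-cong (⊕-cong ≈-refl (tm-cong refl (q-rot a c))) (tm-cong refl (q-rot² a c)))
                       (≈-trans (⊕-cong (tm-⊕ _ _ _) ≈-refl) (≈-trans (tm-⊕ _ _ _) (≈-trans (tm-cong (w-rot a c) refl) (tm-0 _)))))
              (⇓-⊕ (⇓-⊕ h (rot h)) (rot (rot h)))))
          where
            w : ∀ a c → W₁ (a + c + + 1) (a - c) ≡ - (+ 3 * (a + c + + 1) + + 1)
            w a c = ≡.trans (lem (sgn (a + c + + 1)) (+ 3 * (a + c + + 1) + + 1) (sgn (a - c))) (≡.trans (cong (_* (+ 3 * (a + c + + 1) + + 1))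
                (≡.trans (≡.sym (sgn-+ (a + c + + 1) (a - c))) (≡.trans (cong sgn (lem′ a c)) (sgn-2*+1 a)))) (ℤP.-1*i≡-i _))
              where lem : ∀ x y z → x * y * z ≡ x * z * y
                    lem = solve-∀
                    lem′ : ∀ a c → a + c + + 1 + (a - c) ≡ + 2 * a + + 1
                    lem′ = solve-∀
            h : (λ a c → tm (- (+ 3 * (a + c + + 1) + + 1)) (Q (a + c + + 1) (a - c))) ⇓ X.odd
            h = ⇓-tm w (λ _ _ → refl) X.odd-sum
            rot : ∀ {F s} → F ⇓ s → (λ a c → F c (- (a + (c + + 2)))) ⇓ s
            rot h = ⇓-swap (⇓-shift (λ c → c + + 2) (⇓-neg h))
            w-rot : ∀ a c → - (+ 3 * (a + c + + 1) + + 1) + - (+ 3 * (c + - (a + (c + + 2)) + + 1) + + 1)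
                      + - (+ 3 * (- (a + (c + + 2)) + - (c + (- (a + (c + + 2)) + + 2)) + + 1) + + 1) ≡ + 0
            w-rot = solve-∀
            q-rot : ∀ a c → + 1 * ((c + - (a + (c + + 2)) + + 1) * (+ 3 * (c + - (a + (c + + 2)) + + 1) + + 2)) + + 1 * ((c - - (a + (c + + 2))) * (c - - (a + (c + + 2))))
                      ≡ + 1 * ((a + c + + 1) * (+ 3 * (a + c + + 1) + + 2)) + + 1 * ((a - c) * (a - c))
            q-rot = solve-∀
            q-rot² : ∀ a c → Q (- (a + (c + + 2)) + - (c + (- (a + (c + + 2)) + + 2)) + + 1) (- (a + (c + + 2)) - - (c + (- (a + (c + + 2)) + + 2)))
                      ≡ Q (a + c + + 1) (a - c)
            q-rot² a c = ≡.trans (q-rot c (- (a + (c + + 2)))) (q-rot a c)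

        main : (λ a c → tm (+ 6 * a + + 1) (Q (a + c) (a - c))) ⇓ (X.even ⊕ Z.even)
        main = ⇓-cong (λ a c → ≈-trans (tm-⊕ _ _ _) (tm-cong (lem″ a c) refl)) (⇓-⊕ (⇓-tm w (λ _ _ → refl) X.even-sum) Z.even-sum)
          where
            lem″ : ∀ a c → + 3 * (a + c) + + 1 + + 1 * (+ 3 * (a - c)) ≡ + 6 * a + + 1
            lem″ = solve-∀
            w : ∀ a c → W₁ (a + c) (a - c) ≡ + 3 * (a + c) + + 1
            w a c = ≡.trans (lem (sgn (a + c)) (+ 3 * (a + c) + + 1) (sgn (a - c))) (≡.trans (cong (_* (+ 3 * (a + c) + + 1))
                (≡.trans (≡.sym (sgn-+ (a + c) (a - c))) (≡.trans (cong sgn (lem′ a c)) (sgn-2* a)))) (ℤP.*-identityˡ _))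
              where lem : ∀ x y z → x * y * z ≡ x * z * y
                    lem = solve-∀
                    lem′ : ∀ a c → a + c + (a - c) ≡ + 2 * a
                    lem′ = solve-∀
        module M = Split₁ (⇓-split₁ main)

        w₀ : ∀ e c → (+ 6 * (+ 2 * e) + + 1) * + 1 ≡ + 6 * (+ 2 * e) + + 1
        w₀ e c = ℤP.*-identityʳ _
        w₁ : ∀ e c → (+ 6 * (+ 2 * e + + 1) + + 1) * + 1 ≡ + 6 * (+ 2 * e + + 1) + + 1
        w₁ e c = ℤP.*-identityʳ _
        q₀ : ∀ e c → + 1 * (+ 2 * e * (+ 3 * (+ 2 * e) + + 1)) + + 2 * ((c + e) * (+ 2 * (c + e) + + 1)) ≡
                     + 1 * ((+ 2 * e + c) * (+ 3 * (+ 2 * e + c) + + 2)) + + 1 * ((+ 2 * e - c) * (+ 2 * e - c))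
        q₀ = solve-∀
        q₁ : ∀ e c → + 1 * ((+ 2 * e + + 1) * (+ 3 * (+ 2 * e + + 1) + + 1)) + + 2 * (- (c + (e + + 1)) * (+ 2 * - (c + (e + + 1)) + + 1)) ≡
                     + 1 * ((+ 2 * e + + 1 + c) * (+ 3 * (+ 2 * e + + 1 + c) + + 2)) + + 1 * ((+ 2 * e + + 1 - c) * (+ 2 * e + + 1 - c))
        q₁ = solve-∀

-- Inverses, logarithmic derivatives, and product relations for the weight 2 forms.

module EtaQuotients where

  open PowerSeries
  open LatticeSums
  open ThetaSeries
  open ThetaIdentities

  pow : PS → ℕ → PS
  pow x zero    = ι (+ 1)
  pow x (suc n) = x ⊛ pow x n

  -- Truncation of the geometric series in 1 - a. When a has constant term 1, coefficient n no
  -- longer changes from step n on, which is why `inv` may read it there.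
  geo : PS → ℕ → PS
  geo a zero    = ι (+ 1)
  geo a (suc n) = ι (+ 1) ⊕ (ι (+ 1) ⊕ ⊖ a) ⊛ geo a n

  inv : PS → PS
  inv a .at n = at (geo a n) n

  module _ {a : PS} (a₀ : at a 0 ≡ + 1) where

    private
      r₀ : at (ι (+ 1) ⊕ ⊖ a) 0 ≡ + 0
      r₀ = cong (λ z → + 1 - z) a₀

      conv-shift : ∀ {d} {r x y : ℕ → ℤ} n → r 0 ≡ + 0 → (∀ i → i < n → x i ≡ y i [ d ]) → conv r x n ≡ conv r y n [ d ]
      conv-shift {x = x} {y} zero e h = ≡⇒cg (≡.trans (cong (_* x 0) e) (≡.sym (cong (_* y 0) e)))
      conv-shift {r = r} {x} {y} (suc n) e h = cg-+ (≡⇒cg (≡.trans (cong (_* x (suc n)) e) (≡.sym (cong (_* y (suc n)) e))))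
        (conv-cong {a = λ i → r (suc i)} n (λ i _ → cg-refl) (λ i l → h i (s≤s l)))

      geo-step : ∀ n → geo a (suc n) ≈[ 0 , suc n ] geo a n
      geo-step zero = eqv λ { zero l → ≡⇒cg (cong (λ z → + 1 + z * + 1) r₀) ; (suc i) (s≤s ()) }
      geo-step (suc n) = eqv λ i l → cg-+ (cg-refl {a = at (ι (+ 1)) i}) (conv-shift i r₀ (λ j j<i → coef (geo-step n) j (ℕP.<-≤-trans j<i (ℕP.≤-pred l))))

      geo-stable : ∀ j n → at (geo a (j ℕ.+ n)) n ≡ at (geo a n) n
      geo-stable zero n = refl
      geo-stable (suc j) n = ≡.trans (cg-0⇒≡ (coef (geo-step (j ℕ.+ n)) n (s≤s (ℕP.m≤n+m n j)))) (geo-stable j n)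

      inv≈geo : ∀ L → inv a ≈[ 0 , suc L ] geo a L
      inv≈geo L = eqv λ n n≤L → ≡⇒cg (≡.sym (subst (λ m → at (geo a m) n ≡ at (geo a n) n) (ℕP.m∸n+n≡m (ℕP.≤-pred n≤L)) (geo-stable (L ℕ.∸ n) n)))

    ⊛-inv : ∀ L → a ⊛ inv a ≈[ 0 , L ] ι (+ 1)
    ⊛-inv zero = eqv λ n ()
    ⊛-inv (suc L) = lemma L
      where
        lemma : ∀ L → a ⊛ inv a ≈[ 0 , suc L ] ι (+ 1)
        lemma L = begin
          a ⊛ inv a                                    ≈⟨ ⊛-cong ≈-refl (inv≈geo L) ⟩
          a ⊛ geo a L                                  ≈⟨ solve 2 (λ a g → a :* g := g :- (con (+ 1) :+ (con (+ 1) :- a) :* g) :+ con (+ 1)) ≈-refl a (geo a L) ⟩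
          (geo a L ⊕ ⊖ geo a (suc L)) ⊕ ι (+ 1)        ≈⟨ ⊕-cong (⊕-cong ≈-refl (⊖-cong (geo-step L))) ≈-refl ⟩
          (geo a L ⊕ ⊖ geo a L) ⊕ ι (+ 1)              ≈⟨ solve 1 (λ g → g :- g :+ con (+ 1) := con (+ 1)) ≈-refl (geo a L) ⟩
          ι (+ 1)                                      ∎
          where open Ring 0 (suc L)
                open import Relation.Binary.Reasoning.Setoid setoid

  conv-≗ : ∀ {a c : ℕ → ℤ} → (∀ i → a i ≡ c i) → ∀ b n → conv a b n ≡ conv c b n
  conv-≗ e b zero = cong (_* b 0) (e 0)
  conv-≗ e b (suc n) = cong₂ _+_ (cong (_* b (suc n)) (e 0)) (conv-≗ (λ i → e (suc i)) b n)

  conv-leibniz : ∀ a b n → + n * conv a b n ≡ conv (λ i → + i * a i) b n + conv a (λ i → + i * b i) n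
  conv-leibniz a b zero = lem (a 0) (b 0)
    where lem : ∀ a b → + 0 * (a * b) ≡ + 0 * a * b + a * (+ 0 * b)
          lem = solve-∀
  conv-leibniz a b (suc n) = begin
    + suc n * (a 0 * b (suc n) + conv a′ b n)
      ≡⟨ lem₁ (+ n) (a 0) (b (suc n)) (conv a′ b n) ⟩
    a 0 * (+ suc n * b (suc n)) + (+ n * conv a′ b n + conv a′ b n)
      ≡⟨ cong (λ z → a 0 * (+ suc n * b (suc n)) + (z + conv a′ b n)) (conv-leibniz a′ b n) ⟩
    a 0 * (+ suc n * b (suc n)) + (conv (λ i → + i * a′ i) b n + conv a′ (λ i → + i * b i) n + conv a′ b n)
      ≡⟨ lem₂ (a 0) (b (suc n)) (+ suc n) (conv (λ i → + i * a′ i) b n) _ (conv a′ b n) ⟩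
    + 0 * a 0 * b (suc n) + (conv (λ i → + i * a′ i) b n + conv a′ b n) + (a 0 * (+ suc n * b (suc n)) + conv a′ (λ i → + i * b i) n)
      ≡⟨ cong (λ z → + 0 * a 0 * b (suc n) + z + (a 0 * (+ suc n * b (suc n)) + conv a′ (λ i → + i * b i) n))
           (≡.trans (≡.sym (conv-distribʳ b (λ i → + i * a′ i) a′ n)) (conv-≗ (λ i → lem₃ (+ i) (a′ i)) b n)) ⟩
    + 0 * a 0 * b (suc n) + conv (λ i → + suc i * a′ i) b n + (a 0 * (+ suc n * b (suc n)) + conv a′ (λ i → + i * b i) n) ∎
    where
      open ≡-Reasoning
      a′ = λ i → a (suc i)
      lem₁ : ∀ n a b c → (+ 1 + n) * (a * b + c) ≡ a * ((+ 1 + n) * b) + (n * c + c)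
      lem₁ = solve-∀
      lem₂ : ∀ a b n x y z → a * (n * b) + (x + y + z) ≡ + 0 * a * b + (x + z) + (a * (n * b) + y)
      lem₂ = solve-∀
      lem₃ : ∀ i a → i * a + a ≡ (+ 1 + i) * a
      lem₃ = solve-∀

  Θ₀ : ∀ w e D → e (+ 0) ≡ + 0 → at (Θ w (D · e)) 0 ≡ w (+ 0)
  Θ₀ w e D e₀ rewrite e₀ | ℤP.*-zeroʳ D = ℤP.*-identityʳ (w (+ 0))

  module Forms where

    a a⁻ c s G₁ G₅ : PS
    a  = φ (+ 1)
    a⁻ = φ⁻ (+ 1)
    c  = φ (+ 2)
    s  = ψ (+ 4)
    G₁ = V (+ 2) ⊛ a
    G₅ = V′ ⊛ s

  module Calculus (L : ℕ) where
    open Identities L public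
    open import Relation.Binary.Reasoning.Setoid setoid

    cancel : ∀ {a} → at a 0 ≡ + 1 → ∀ {x y} → a ⊛ x ≈ a ⊛ y → x ≈ y
    cancel {a} a₀ {x} {y} h = begin
      x                  ≈⟨ unit x ⟩
      inv a ⊛ (a ⊛ x)    ≈⟨ ⊛-cong ≈-refl h ⟩
      inv a ⊛ (a ⊛ y)    ≈⟨ unit y ⟨
      y                  ∎
      where
        unit : ∀ x → x ≈ inv a ⊛ (a ⊛ x)
        unit x = begin
          x                  ≈⟨ ⊛-identityˡ x ⟨
          ι (+ 1) ⊛ x        ≈⟨ ⊛-cong (⊛-inv a₀ L) ≈-refl ⟨
          a ⊛ inv a ⊛ x      ≈⟨ solve 3 (λ a i x → a :* i :* x := i :* (a :* x)) ≈-refl a (inv a) x ⟩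
          inv a ⊛ (a ⊛ x)    ∎

    ∂-⊛ : ∀ a b → ∂ (a ⊛ b) ≈ ∂ a ⊛ b ⊕ a ⊛ ∂ b
    ∂-⊛ a b = ≡⇒≈ (conv-leibniz (at a) (at b))

    ∂-zero : ∀ {z} → at z 0 ≡ + 1 → ∂ z ≈ 0# → z ≈ ι (+ 1)
    ∂-zero {z} z₀ h = eqv λ
      { zero l → ≡⇒cg z₀
      ; (suc n) l → ≡⇒cg (ℤP.*-cancelˡ-≡ (+ suc n) (at z (suc n)) (+ 0) (≡.trans (cg-0⇒≡ (coef h (suc n) l)) (≡.sym (ℤP.*-zeroʳ (+ suc n))))) }

    -- The quotient z = x/y has derivative zero, and over the integers this forces z to be its
    -- constant term 1.
    log-unique : ∀ {x y} → at x 0 ≡ + 1 → at y 0 ≡ + 1 → ∂ x ⊛ y ≈ x ⊛ ∂ y → x ≈ y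
    log-unique {x} {y} x₀ y₀ h = begin
      x              ≈⟨ x≈zy ⟩
      z ⊛ y          ≈⟨ ⊛-cong (∂-zero z₀ (cancel y₀ (cancel y₀ ∂z))) ≈-refl ⟩
      ι (+ 1) ⊛ y    ≈⟨ ⊛-identityˡ y ⟩
      y              ∎
      where
        z = x ⊛ inv y
        z₀ : at z 0 ≡ + 1
        z₀ = cong (_* + 1) x₀
        x≈zy : x ≈ z ⊛ y
        x≈zy = ≈-sym (begin
          x ⊛ inv y ⊛ y      ≈⟨ solve 3 (λ x i y → x :* i :* y := x :* (y :* i)) ≈-refl x (inv y) y ⟩
          x ⊛ (y ⊛ inv y)    ≈⟨ ⊛-cong ≈-refl (⊛-inv y₀ L) ⟩
          x ⊛ ι (+ 1)        ≈⟨ ⊛-identityʳ x ⟩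
          x                  ∎)
        ∂z : y ⊛ (y ⊛ ∂ z) ≈ y ⊛ (y ⊛ 0#)
        ∂z = begin
          y ⊛ (y ⊛ ∂ z)
            ≈⟨ solve 4 (λ y z z′ y′ → y :* (y :* z′) := (z′ :* y :+ z :* y′) :* y :- z :* y :* y′) ≈-refl y z (∂ z) (∂ y) ⟩
          (∂ z ⊛ y ⊕ z ⊛ ∂ y) ⊛ y ⊕ ⊖ (z ⊛ y ⊛ ∂ y)
            ≈⟨ ⊕-cong (⊛-cong (≈-sym (≈-trans (∂-cong x≈zy) (∂-⊛ z y))) ≈-refl) (⊖-cong (⊛-cong (≈-sym x≈zy) ≈-refl)) ⟩
          ∂ x ⊛ y ⊕ ⊖ (x ⊛ ∂ y)
            ≈⟨ ⊕-cong h ≈-refl ⟩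
          x ⊛ ∂ y ⊕ ⊖ (x ⊛ ∂ y)
            ≈⟨ solve 2 (λ u y → u :- u := y :* (y :* con (+ 0))) ≈-refl (x ⊛ ∂ y) y ⟩
          y ⊛ (y ⊛ 0#) ∎

    -- All terms but k = 0 have exponent at least D, hence at least L. This is where the doubling of
    -- D ends.
    Θ-high : ∀ {w e D} → Admissible e → e (+ 0) ≡ + 0 → + 1 ℤ.≤ D → + L ℤ.≤ D → w (+ 0) ≡ + 1 → Θ w (D · e) ≈ ι (+ 1)
    Θ-high {w} {e} {D} a e₀ D≥1 D≥L w₀ = ≈-trans (≈-sym (↓-at (Θ↓ {w} (·-adm D≥1 a)) b))
        (≈-trans (tm-cong w₀ (≡.trans (cong (D *_) e₀) (ℤP.*-zeroʳ D))) (≡⇒≈ λ { zero → refl ; (suc n) → refl }))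
      where
        big : ∀ k → 1 ≤ ∣ k ∣ → D ℤ.≤ D * e k
        big k l = subst (ℤ._≤ D * e k) (ℤP.*-identityʳ D)
          (ℤP.*-monoˡ-≤-nonNeg D {{ℤ.nonNegative (ℤP.≤-trans (ℤ.+≤+ z≤n) D≥1)}} (ℤP.≤-trans (ℤ.+≤+ l) (a k)))
        b : Bounded 0 (λ k → tm (w k) ((D · e) k))
        b k l = tm-high (w k) (D * e k) L (ℤP.≤-trans D≥L (big k l)) ℕP.≤-refl

    pow-cong : ∀ n {x y} → x ≈ y → pow x n ≈ pow y n
    pow-cong zero h = ≈-refl
    pow-cong (suc n) h = ⊛-cong h (pow-cong n h)

    -- J and ψ φ⁻² satisfy the same functional equation relating D to 2 D.
    J≈ψφ⁻² : ∀ {D} → + 1 ℤ.≤ D → J D ≈ ψ D ⊛ (φ⁻ D ⊛ φ⁻ D)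
    J≈ψφ⁻² {D} D≥1 = descend L D≥1 (ℤP.+-monoʳ-≤ (+ L) (ℤP.≤-trans (ℤ.+≤+ z≤n) D≥1))
      where
        -- The measure is L ≤ n + D. Since D ≥ 1, passing to 2D makes up for the unit lost from n,
        -- and at n = 0 it says D ≥ L.
        descend : ∀ n {D} → + 1 ℤ.≤ D → + L + + 0 ℤ.≤ + n + D → J D ≈ ψ D ⊛ (φ⁻ D ⊛ φ⁻ D)
        descend zero {D} D≥1 h = begin
          J D                        ≈⟨ Θ-high tri-adm refl D≥1 D≥L refl ⟩
          ι (+ 1)                    ≈⟨ solve 0 (con (+ 1) := con (+ 1) :* (con (+ 1) :* con (+ 1))) ≈-refl ⟩
          ι (+ 1) ⊛ (ι (+ 1) ⊛ ι (+ 1)) ≈⟨ ⊛-cong (Θ-high tri-adm refl D≥1 D≥L refl) (⊛-cong φ1 φ1) ⟨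
          ψ D ⊛ (φ⁻ D ⊛ φ⁻ D)        ∎
          where
            D≥L : + L ℤ.≤ D
            D≥L = subst (λ z → + z ℤ.≤ D) (ℕP.+-identityʳ L) (subst (+ L + + 0 ℤ.≤_) (ℤP.+-identityˡ D) h)
            φ1 : φ⁻ D ≈ ι (+ 1)
            φ1 = Θ-high sq-adm refl D≥1 D≥L refl
        descend (suc n) {D} D≥1 h = cancel r₀ (begin
          r ⊛ J D                                                     ≈⟨ solve 4 (λ j p f m → p :* (f :* f) :* j := j :* p :* (f :* f)) ≈-refl (J D) (ψ 2D) (φ⁻ 2D) (φ⁻ D) ⟩
          J D ⊛ ψ 2D ⊛ (φ⁻ 2D ⊛ φ⁻ 2D)                                ≈⟨ ⊛-cong ≈-refl (φφ⁻ D≥1) ⟨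
          J D ⊛ ψ 2D ⊛ (φ D ⊛ φ⁻ D)                                   ≈⟨ solve 4 (λ j p f m → j :* p :* (f :* m) := j :* (p :* f) :* m) ≈-refl (J D) (ψ 2D) (φ D) (φ⁻ D) ⟩
          J D ⊛ (ψ 2D ⊛ φ D) ⊛ φ⁻ D                                   ≈⟨ ⊛-cong (⊛-cong ≈-refl (ψ² D≥1)) ≈-refl ⟨
          J D ⊛ (ψ D ⊛ ψ D) ⊛ φ⁻ D                                    ≈⟨ solve 3 (λ j p m → j :* (p :* p) :* m := j :* p :* (p :* m)) ≈-refl (J D) (ψ D) (φ⁻ D) ⟩
          J D ⊛ ψ D ⊛ (ψ D ⊛ φ⁻ D)                                    ≈⟨ ⊛-cong (Jψ D≥1) ≈-refl ⟩
          J 2D ⊛ φ⁻ D ⊛ (ψ D ⊛ φ⁻ D)                                  ≈⟨ solve 3 (λ j m p → j :* m :* (p :* m) := j :* (p :* (m :* m))) ≈-refl (J 2D) (φ⁻ D) (ψ D) ⟩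
          J 2D ⊛ (ψ D ⊛ (φ⁻ D ⊛ φ⁻ D))                                ≈⟨ ⊛-cong (descend n (2D≥1 D≥1) h′) ≈-refl ⟩
          r ⊛ (ψ D ⊛ (φ⁻ D ⊛ φ⁻ D))                                   ∎)
          where
            2D = + 2 * D
            r = ψ 2D ⊛ (φ⁻ 2D ⊛ φ⁻ 2D)
            r₀ : at r 0 ≡ + 1
            r₀ = cong₂ _*_ (Θ₀ 𝟙 tri 2D refl) (cong₂ _*_ (Θ₀ sgn sq 2D refl) (Θ₀ sgn sq 2D refl))
            h′ : + L + + 0 ℤ.≤ + n + 2D
            h′ = ℤP.≤-trans h (subst₂ ℤ._≤_ (lem₁ (+ n) D) (lem₂ (+ n) D) (ℤP.+-monoˡ-≤ (+ n + D) D≥1))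
              where lem₁ : ∀ n D → + 1 + (n + D) ≡ + 1 + n + D
                    lem₁ = solve-∀
                    lem₂ : ∀ n D → D + (n + D) ≡ n + + 2 * D
                    lem₂ = solve-∀

    module _ {D : ℤ} (D≥1 : + 1 ℤ.≤ D) where
      private
        2D = + 2 * D
        E₀ : at (E D) 0 ≡ + 1
        E₀ = Θ₀ sgn pent D refl
        J₀ : at (J 2D) 0 ≡ + 1
        J₀ = Θ₀ (λ k → + 4 * k + + 1) tri 2D refl
        ψ₀ : at (ψ 2D) 0 ≡ + 1
        ψ₀ = Θ₀ 𝟙 tri 2D refl

      -- Jacobi's identity for the cube of Euler's series: `3∂EJ` says that both sides have the same
      -- logarithmic derivative.
      E³ : E D ⊛ (E D ⊛ E D) ≈ J 2D
      E³ = log-unique (cong₂ _*_ E₀ (cong₂ _*_ E₀ E₀)) J₀ (begin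
        ∂ (E D ⊛ (E D ⊛ E D)) ⊛ J 2D
          ≈⟨ ⊛-cong (≈-trans (∂-⊛ _ _) (⊕-cong ≈-refl (⊛-cong ≈-refl (∂-⊛ _ _)))) ≈-refl ⟩
        (∂ (E D) ⊛ (E D ⊛ E D) ⊕ E D ⊛ (∂ (E D) ⊛ E D ⊕ E D ⊛ ∂ (E D))) ⊛ J 2D
          ≈⟨ solve 3 (λ e e′ j → (e′ :* (e :* e) :+ e :* (e′ :* e :+ e :* e′)) :* j := e :* e :* (con (+ 3) :* e′ :* j)) ≈-refl (E D) (∂ (E D)) (J 2D) ⟩
        E D ⊛ E D ⊛ (ι (+ 3) ⊛ ∂ (E D) ⊛ J 2D)
          ≈⟨ ⊛-cong ≈-refl (3∂EJ D≥1) ⟩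
        E D ⊛ E D ⊛ (E D ⊛ ∂ (J 2D))
          ≈⟨ solve 2 (λ e j → e :* e :* (e :* j) := e :* (e :* e) :* j) ≈-refl (E D) (∂ (J 2D)) ⟩
        E D ⊛ (E D ⊛ E D) ⊛ ∂ (J 2D) ∎)

      -- Cubing `Vψ` turns E into J by Jacobi's identity, and J is ψ φ(-q)², so only ψ and φ(-q)
      -- remain.
      V³ : pow (V D) 3 ≈ ψ 2D ⊛ pow (φ⁻ 2D) 8
      V³ = cancel (cong₂ _*_ ψ₀ (cong₂ _*_ ψ₀ ψ₀)) (begin
        ψ 2D ⊛ (ψ 2D ⊛ ψ 2D) ⊛ pow (V D) 3
          ≈⟨ solve 2 (λ p v → p :* (p :* p) :* v :^ 3 := (v :* p) :^ 3) ≈-refl (ψ 2D) (V D) ⟩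
        pow (V D ⊛ ψ 2D) 3
          ≈⟨ pow-cong 3 (Vψ D≥1) ⟩
        pow (E D ⊛ J 2D) 3
          ≈⟨ solve 2 (λ e j → (e :* j) :^ 3 := e :* (e :* e) :* j :^ 3) ≈-refl (E D) (J 2D) ⟩
        E D ⊛ (E D ⊛ E D) ⊛ pow (J 2D) 3
          ≈⟨ ⊛-cong E³ ≈-refl ⟩
        pow (J 2D) 4
          ≈⟨ pow-cong 4 (J≈ψφ⁻² (2D≥1 D≥1)) ⟩
        pow (ψ 2D ⊛ (φ⁻ 2D ⊛ φ⁻ 2D)) 4
          ≈⟨ solve 2 (λ p m → (p :* (m :* m)) :^ 4 := p :* (p :* p) :* (p :* m :^ 8)) ≈-refl (ψ 2D) (φ⁻ 2D) ⟩
        ψ 2D ⊛ (ψ 2D ⊛ ψ 2D) ⊛ (ψ 2D ⊛ pow (φ⁻ 2D) 8) ∎)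

    open Forms

    aa⁻ : a ⊛ a⁻ ≈ φ⁻ (+ 2) ⊛ φ⁻ (+ 2)
    aa⁻ = φφ⁻ (1≤ 0)

    -- J(q²)² computed in two ways. Divided by c s it reads b = 1 + 2(∂s/s - ∂c/c), which identifies
    -- a² a⁻² as the logarithmic derivative of t = q s²/c².
    ∂-relation : c ⊛ s ⊛ (pow a 2 ⊛ pow a⁻ 2) ≈ s ⊛ c ⊕ ι (+ 2) ⊛ (∂ s ⊛ c ⊕ ⊖ (s ⊛ ∂ c))
    ∂-relation = begin
      c ⊛ s ⊛ (pow a 2 ⊛ pow a⁻ 2)
        ≈⟨ solve 4 (λ c s a b → c :* s :* (a :^ 2 :* b :^ 2) := s :* c :* (a :* b) :^ 2) ≈-refl c s a a⁻ ⟩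
      s ⊛ c ⊛ pow (a ⊛ a⁻) 2
        ≈⟨ ⊛-cong (≈-sym (ψ² (1≤ 1))) (pow-cong 2 aa⁻) ⟩
      ψ (+ 2) ⊛ ψ (+ 2) ⊛ pow (φ⁻ (+ 2) ⊛ φ⁻ (+ 2)) 2
        ≈⟨ solve 2 (λ p m → p :* p :* (m :* m) :^ 2 := (p :* (m :* m)) :* (p :* (m :* m))) ≈-refl (ψ (+ 2)) (φ⁻ (+ 2)) ⟩
      (ψ (+ 2) ⊛ (φ⁻ (+ 2) ⊛ φ⁻ (+ 2))) ⊛ (ψ (+ 2) ⊛ (φ⁻ (+ 2) ⊛ φ⁻ (+ 2)))
        ≈⟨ ⊛-cong (J≈ψφ⁻² (1≤ 1)) (J≈ψφ⁻² (1≤ 1)) ⟨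
      J (+ 2) ⊛ J (+ 2)
        ≈⟨ J₂² ⟩
      s ⊛ c ⊕ ι (+ 2) ⊛ (∂ s ⊛ c ⊕ ⊖ (s ⊛ ∂ c)) ∎

    -- All factors are brought down to a, a⁻, c and s. The multiplier a⁻⁸ a² on the left is the
    -- numerator of (1 - 4t)⁴ (1 + 4t); in `G₅-relation` it is that of (1 - 4t)⁵ (1 + 4t)².
    G₁-relation : pow G₁ 6 ⊛ (pow a⁻ 8 ⊛ pow a 2) ≈ pow s 2 ⊛ pow c 8 ⊛ (pow a 12 ⊛ pow a⁻ 12)
    G₁-relation = begin
      pow G₁ 6 ⊛ (pow a⁻ 8 ⊛ pow a 2)
        ≈⟨ solve 3 (λ v a b → (v :* a) :^ 6 :* (b :^ 8 :* a :^ 2) := (v :^ 3) :^ 2 :* (a :* b) :^ 8) ≈-refl (V (+ 2)) a a⁻ ⟩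
      pow (pow (V (+ 2)) 3) 2 ⊛ pow (a ⊛ a⁻) 8
        ≈⟨ ⊛-cong (pow-cong 2 (V³ (1≤ 1))) ≈-refl ⟩
      pow (s ⊛ pow (φ⁻ (+ 4)) 8) 2 ⊛ pow (a ⊛ a⁻) 8
        ≈⟨ solve 4 (λ s d a b → (s :* d :^ 8) :^ 2 :* (a :* b) :^ 8 := s :^ 2 :* (d :* d) :^ 8 :* (a :* b) :^ 8) ≈-refl s (φ⁻ (+ 4)) a a⁻ ⟩
      pow s 2 ⊛ pow (φ⁻ (+ 4) ⊛ φ⁻ (+ 4)) 8 ⊛ pow (a ⊛ a⁻) 8
        ≈⟨ ⊛-cong (⊛-cong ≈-refl (pow-cong 8 (φφ⁻ (1≤ 1)))) ≈-refl ⟨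
      pow s 2 ⊛ pow (c ⊛ φ⁻ (+ 2)) 8 ⊛ pow (a ⊛ a⁻) 8
        ≈⟨ solve 5 (λ s c e a b → s :^ 2 :* (c :* e) :^ 8 :* (a :* b) :^ 8 := s :^ 2 :* c :^ 8 :* (e :* e) :^ 4 :* (a :* b) :^ 8) ≈-refl s c (φ⁻ (+ 2)) a a⁻ ⟩
      pow s 2 ⊛ pow c 8 ⊛ pow (φ⁻ (+ 2) ⊛ φ⁻ (+ 2)) 4 ⊛ pow (a ⊛ a⁻) 8
        ≈⟨ ⊛-cong (⊛-cong ≈-refl (pow-cong 4 aa⁻)) ≈-refl ⟨
      pow s 2 ⊛ pow c 8 ⊛ pow (a ⊛ a⁻) 4 ⊛ pow (a ⊛ a⁻) 8
        ≈⟨ solve 4 (λ s c a b → s :^ 2 :* c :^ 8 :* (a :* b) :^ 4 :* (a :* b) :^ 8 := s :^ 2 :* c :^ 8 :* (a :^ 12 :* b :^ 12)) ≈-refl s c a a⁻ ⟩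
      pow s 2 ⊛ pow c 8 ⊛ (pow a 12 ⊛ pow a⁻ 12) ∎

    V′³ : pow V′ 3 ≈ pow c 2 ⊛ pow s 2 ⊛ (pow a 4 ⊛ a⁻)
    V′³ = cancel {pow a⁻ 3} refl (begin
      pow a⁻ 3 ⊛ pow V′ 3
        ≈⟨ solve 2 (λ b v → b :^ 3 :* v :^ 3 := (v :* b) :^ 3) ≈-refl a⁻ V′ ⟩
      pow (V′ ⊛ a⁻) 3
        ≈⟨ pow-cong 3 V′φ⁻ ⟩
      pow (V (+ 1) ⊛ ψ (+ 2)) 3
        ≈⟨ solve 2 (λ v p → (v :* p) :^ 3 := v :^ 3 :* p :^ 3) ≈-refl (V (+ 1)) (ψ (+ 2)) ⟩
      pow (V (+ 1)) 3 ⊛ pow (ψ (+ 2)) 3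
        ≈⟨ ⊛-cong (V³ (1≤ 0)) ≈-refl ⟩
      ψ (+ 2) ⊛ pow (φ⁻ (+ 2)) 8 ⊛ pow (ψ (+ 2)) 3
        ≈⟨ solve 2 (λ p e → p :* e :^ 8 :* p :^ 3 := (p :* p) :^ 2 :* (e :* e) :^ 4) ≈-refl (ψ (+ 2)) (φ⁻ (+ 2)) ⟩
      pow (ψ (+ 2) ⊛ ψ (+ 2)) 2 ⊛ pow (φ⁻ (+ 2) ⊛ φ⁻ (+ 2)) 4
        ≈⟨ ⊛-cong (pow-cong 2 (ψ² (1≤ 1))) (pow-cong 4 (≈-sym aa⁻)) ⟩
      pow (s ⊛ c) 2 ⊛ pow (a ⊛ a⁻) 4
        ≈⟨ solve 4 (λ s c a b → (s :* c) :^ 2 :* (a :* b) :^ 4 := b :^ 3 :* (c :^ 2 :* s :^ 2 :* (a :^ 4 :* b))) ≈-refl s c a a⁻ ⟩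
      pow a⁻ 3 ⊛ (pow c 2 ⊛ pow s 2 ⊛ (pow a 4 ⊛ a⁻)) ∎)

    G₅-relation : pow G₅ 6 ⊛ (pow a 4 ⊛ pow a⁻ 10) ≈ pow s 10 ⊛ pow c 4 ⊛ (pow a 12 ⊛ pow a⁻ 12)
    G₅-relation = begin
      pow G₅ 6 ⊛ (pow a 4 ⊛ pow a⁻ 10)
        ≈⟨ solve 4 (λ v s a b → (v :* s) :^ 6 :* (a :^ 4 :* b :^ 10) := (v :^ 3) :^ 2 :* s :^ 6 :* (a :^ 4 :* b :^ 10)) ≈-refl V′ s a a⁻ ⟩
      pow (pow V′ 3) 2 ⊛ pow s 6 ⊛ (pow a 4 ⊛ pow a⁻ 10)
        ≈⟨ ⊛-cong (⊛-cong (pow-cong 2 V′³) ≈-refl) ≈-refl ⟩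
      pow (pow c 2 ⊛ pow s 2 ⊛ (pow a 4 ⊛ a⁻)) 2 ⊛ pow s 6 ⊛ (pow a 4 ⊛ pow a⁻ 10)
        ≈⟨ solve 4 (λ s c a b → (c :^ 2 :* s :^ 2 :* (a :^ 4 :* b)) :^ 2 :* s :^ 6 :* (a :^ 4 :* b :^ 10) := s :^ 10 :* c :^ 4 :* (a :^ 12 :* b :^ 12)) ≈-refl s c a a⁻ ⟩
      pow s 10 ⊛ pow c 4 ⊛ (pow a 12 ⊛ pow a⁻ 12) ∎

-- Powers modulo p, the modular function t, and the residue of its powers.

module ModularFunctions where

  open PowerSeries
  open LatticeSums
  open ThetaSeries
  open ThetaIdentities
  open EtaQuotients

  cg⇒∣ : ∀ {p x} → x ≡ + 0 [ p ] → p ℕD.∣ ∣ x ∣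
  cg⇒∣ {p} {x} (cg q e) = divides ∣ q ∣ (≡.trans (cong ∣_∣ (≡.trans e (ℤP.+-identityˡ (q * + p)))) (ℤP.abs-* q (+ p)))

  ∣⇒cg : ∀ {p} x → p ℕD.∣ ∣ x ∣ → x ≡ + 0 [ p ]
  ∣⇒cg {p} (+ n) (divides k e) = cg (+ k) (≡.trans (cong +_ e) (≡.trans (ℤP.pos-* k p) (≡.sym (ℤP.+-identityˡ _))))
  ∣⇒cg {p} -[1+ n ] (divides k e) = cg (- (+ k)) (≡.trans (cong (λ z → - (+ z)) e) (≡.trans (cong -_ (ℤP.pos-* k p))
    (≡.trans (ℤP.neg-distribˡ-* (+ k) (+ p)) (≡.sym (ℤP.+-identityˡ _)))))

  cg-cancel : ∀ {p} → Prime p → ∀ c {x y} → ¬ (p ℕD.∣ ∣ c ∣) → c * x ≡ c * y [ p ] → x ≡ y [ p ]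
  cg-cancel {p} pr c {x} {y} p∤c h with euclidsLemma ∣ c ∣ ∣ x - y ∣ pr (subst (p ℕD.∣_) (ℤP.abs-* c (x - y)) (cg⇒∣ diff))
    where
      diff : c * (x - y) ≡ + 0 [ p ]
      diff = cg-trans (≡⇒cg (lem c x y)) (cg-trans (cg-+ h (cg-refl {a = - (c * y)})) (≡⇒cg (ℤP.+-inverseʳ (c * y))))
        where lem : ∀ c x y → c * (x - y) ≡ c * x + - (c * y)
              lem = solve-∀
  ... | inj₁ p∣c = contradiction p∣c p∤c
  ... | inj₂ p∣d = cg-trans (≡⇒cg (lem x y)) (cg-trans (cg-+ (∣⇒cg (x - y) p∣d) (cg-refl {a = y})) (≡⇒cg (ℤP.+-identityˡ y)))
    where lem : ∀ x y → x ≡ x - y + y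
          lem = solve-∀

  module Powers (d L : ℕ) where
    open Ring d L public
    open import Relation.Binary.Reasoning.Setoid setoid

    pow-cong′ : ∀ n {x y} → x ≈ y → pow x n ≈ pow y n
    pow-cong′ zero h = ≈-refl
    pow-cong′ (suc n) h = ⊛-cong h (pow-cong′ n h)

    pow-+ : ∀ x m n → pow x (m ℕ.+ n) ≈ pow x m ⊛ pow x n
    pow-+ x zero n = ≈-sym (⊛-identityˡ _)
    pow-+ x (suc m) n = ≈-trans (⊛-cong ≈-refl (pow-+ x m n)) (≈-sym (⊛-assoc _ _ _))

    pow-⊛ : ∀ x y n → pow (x ⊛ y) n ≈ pow x n ⊛ pow y n
    pow-⊛ x y zero = ≈-sym (⊛-identityˡ _)
    pow-⊛ x y (suc n) = ≈-trans (⊛-cong ≈-refl (pow-⊛ x y n))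
      (solve 4 (λ x y u v → x :* y :* (u :* v) := x :* u :* (y :* v)) ≈-refl x y (pow x n) (pow y n))

    pow-1 : ∀ n → pow (ι (+ 1)) n ≈ ι (+ 1)
    pow-1 zero = ≈-refl
    pow-1 (suc n) = ≈-trans (⊛-identityˡ _) (pow-1 n)

    pow-* : ∀ x m n → pow x (m ℕ.* n) ≈ pow (pow x m) n
    pow-* x zero n = ≈-sym (pow-1 n)
    pow-* x (suc m) n = ≈-trans (pow-+ x n (m ℕ.* n)) (≈-trans (⊛-cong ≈-refl (pow-* x m n)) (≈-sym (pow-⊛ x (pow x m) n)))

    pow-≡ : ∀ x {m n} → m ≡ n → pow x m ≈ pow x n
    pow-≡ x refl = ≈-refl

  pow₀ : ∀ {x} n → at x 0 ≡ + 1 → at (pow x n) 0 ≡ + 1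
  pow₀ zero h = refl
  pow₀ (suc n) h = cong₂ _*_ h (pow₀ n h)

  ∂-pow : ∀ L x n → ∂ (pow x (suc n)) ≈[ 0 , L ] ι (+ suc n) ⊛ (pow x n ⊛ ∂ x)
  ∂-pow L x zero = begin
    ∂ (x ⊛ ι (+ 1))                     ≈⟨ ∂-cong (⊛-identityʳ x) ⟩
    ∂ x                                 ≈⟨ solve 1 (λ x → x := con (+ 1) :* (con (+ 1) :* x)) ≈-refl (∂ x) ⟩
    ι (+ 1) ⊛ (ι (+ 1) ⊛ ∂ x)           ∎
    where open Calculus L
          open import Relation.Binary.Reasoning.Setoid setoid
  ∂-pow L x (suc n) = begin
    ∂ (x ⊛ pow x (suc n))
      ≈⟨ ∂-⊛ x (pow x (suc n)) ⟩
    ∂ x ⊛ pow x (suc n) ⊕ x ⊛ ∂ (pow x (suc n))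
      ≈⟨ ⊕-cong ≈-refl (⊛-cong ≈-refl (∂-pow L x n)) ⟩
    ∂ x ⊛ pow x (suc n) ⊕ x ⊛ (ι (+ suc n) ⊛ (pow x n ⊛ ∂ x))
      ≈⟨ solve 4 (λ x x′ y k → x′ :* (x :* y) :+ x :* (k :* (y :* x′)) := (con (+ 1) :+ k) :* (x :* y :* x′)) ≈-refl x (∂ x) (pow x n) (ι (+ suc n)) ⟩
    (ι (+ 1) ⊕ ι (+ suc n)) ⊛ (pow x (suc n) ⊛ ∂ x)
      ≈⟨ ⊛-cong (≡⇒≈ λ { zero → refl ; (suc i) → refl }) ≈-refl ⟩
    ι (+ suc (suc n)) ⊛ (pow x (suc n) ⊛ ∂ x) ∎
    where open Calculus L
          open import Relation.Binary.Reasoning.Setoid setoid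

  module Frobenius {p : ℕ} (pr : Prime p) where
    open Powers p p public
    open import Relation.Binary.Reasoning.Setoid setoid

    -- The derivative of x^p is divisible by p.
    pow-p : ∀ {x} → at x 0 ≡ + 1 → pow x p ≈ ι (+ 1)
    pow-p {x} x₀ = eqv (λ
      { zero _ → ≡⇒cg (pow₀ p x₀)
      ; (suc n) l → cg-cancel pr (+ suc n) (λ d → ℕP.<⇒≱ l (ℕD.∣⇒≤ d))
          (cg-trans (go p ℕP.≤-refl n) (≡⇒cg (≡.sym (ℤP.*-zeroʳ (+ suc n))))) })
      where
        go : ∀ k → k ≤ p → ∀ n → + suc n * at (pow x k) (suc n) ≡ + 0 [ k ]
        go zero _ n = ≡⇒cg (ℤP.*-zeroʳ (+ suc n))
        go (suc k) _ n = cg (at (pow x k ⊛ ∂ x) (suc n))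
          (≡.trans (exact (suc n) (λ L → ∂-pow L x k)) (≡.trans (at-ι⊛ (+ suc k) (pow x k ⊛ ∂ x) (suc n))
            (≡.trans (ℤP.*-comm (+ suc k) _) (≡.sym (ℤP.+-identityˡ _)))))

    pow-mod : ∀ {x} k r → at x 0 ≡ + 1 → pow x (k ℕ.* p ℕ.+ r) ≈ pow x r
    pow-mod {x} k r x₀ = begin
      pow x (k ℕ.* p ℕ.+ r)          ≈⟨ pow-+ x (k ℕ.* p) r ⟩
      pow x (k ℕ.* p) ⊛ pow x r      ≈⟨ ⊛-cong (≈-trans (pow-≡ x (ℕP.*-comm k p)) (≈-trans (pow-* x p k) (≈-trans (pow-cong′ k (pow-p x₀)) (pow-1 k)))) ≈-refl ⟩
      ι (+ 1) ⊛ pow x r              ≈⟨ ⊛-identityˡ _ ⟩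
      pow x r                        ∎

  -- The series t begins with q and has no inverse among power series, so it is kept as q τ with τ
  -- invertible; the inverse σ = q/t of τ takes the place of negative powers of t.
  module Modular where
    open Forms public

    u v t τ σ b X₋ X₊ : PS
    u = inv c
    v = inv s
    τ = pow s 2 ⊛ pow u 2
    σ = pow c 2 ⊛ pow v 2
    t = q ⊛ τ
    b = pow a 2 ⊛ pow a⁻ 2
    X₋ = ι (+ 1) ⊕ ι (- + 4) ⊛ t
    X₊ = ι (+ 1) ⊕ ι (+ 4) ⊛ t

  open Modular

  module ModularRelations (L : ℕ) where
    open Calculus L
    open import Relation.Binary.Reasoning.Setoid setoid

    cu : c ⊛ u ≈ ι (+ 1)
    cu = ⊛-inv refl L
    sv : s ⊛ v ≈ ι (+ 1)
    sv = ⊛-inv refl L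

    pow1 : ∀ {x} n → x ≈ ι (+ 1) → pow x n ≈ ι (+ 1)
    pow1 n h = ≈-trans (pow-cong n h) (Powers.pow-1 0 L n)

    τσ : τ ⊛ σ ≈ ι (+ 1)
    τσ = begin
      pow s 2 ⊛ pow u 2 ⊛ (pow c 2 ⊛ pow v 2)   ≈⟨ solve 4 (λ s u c v → s :^ 2 :* u :^ 2 :* (c :^ 2 :* v :^ 2) := (c :* u) :^ 2 :* (s :* v) :^ 2) ≈-refl s u c v ⟩
      pow (c ⊛ u) 2 ⊛ pow (s ⊛ v) 2             ≈⟨ ⊛-cong (pow1 2 cu) (pow1 2 sv) ⟩
      ι (+ 1) ⊛ ι (+ 1)                         ≈⟨ ⊛-identityˡ _ ⟩
      ι (+ 1)                                   ∎

    -- This and `X₋≈` are φ(±q)² = φ(q²)² ± 4q ψ(q⁴)² divided by φ(q²)².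
    X₊≈ : X₊ ≈ pow a 2 ⊛ pow u 2
    X₊≈ = begin
      ι (+ 1) ⊕ ι (+ 4) ⊛ t                                     ≈⟨ ⊕-cong (pow1 2 cu) ≈-refl ⟨
      pow (c ⊛ u) 2 ⊕ ι (+ 4) ⊛ t                               ≈⟨ solve 4 (λ c u q s → (c :* u) :^ 2 :+ con (+ 4) :* (q :* (s :^ 2 :* u :^ 2)) := (c :* c :+ con (+ 4) :* (q :* (s :* s))) :* u :^ 2) ≈-refl c u q s ⟩
      (c ⊛ c ⊕ ι (+ 4) ⊛ (q ⊛ (s ⊛ s))) ⊛ pow u 2               ≈⟨ ⊛-cong φ₁² ≈-refl ⟨
      a ⊛ a ⊛ pow u 2                                           ≈⟨ solve 2 (λ a u → a :* a :* u :^ 2 := a :^ 2 :* u :^ 2) ≈-refl a u ⟩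
      pow a 2 ⊛ pow u 2                                         ∎

    X₋≈ : X₋ ≈ pow a⁻ 2 ⊛ pow u 2
    X₋≈ = begin
      ι (+ 1) ⊕ ι (- + 4) ⊛ t                                   ≈⟨ ⊕-cong (pow1 2 cu) ≈-refl ⟨
      pow (c ⊛ u) 2 ⊕ ι (- + 4) ⊛ t                             ≈⟨ solve 4 (λ c u q s → (c :* u) :^ 2 :+ con (- + 4) :* (q :* (s :^ 2 :* u :^ 2)) := (c :* c :+ :- (con (+ 4) :* (q :* (s :* s)))) :* u :^ 2) ≈-refl c u q s ⟩
      (c ⊛ c ⊕ ⊖ (ι (+ 4) ⊛ (q ⊛ (s ⊛ s)))) ⊛ pow u 2           ≈⟨ ⊛-cong φ⁻₁² ≈-refl ⟨
      a⁻ ⊛ a⁻ ⊛ pow u 2                                         ≈⟨ solve 2 (λ a u → a :* a :* u :^ 2 := a :^ 2 :* u :^ 2) ≈-refl a⁻ u ⟩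
      pow a⁻ 2 ⊛ pow u 2                                        ∎

    G₁-equation : pow G₁ 6 ⊛ (pow X₋ 4 ⊛ pow X₊ 1) ≈ pow τ 1 ⊛ pow b 6
    G₁-equation = begin
      pow G₁ 6 ⊛ (pow X₋ 4 ⊛ pow X₊ 1)
        ≈⟨ ⊛-cong ≈-refl (⊛-cong (pow-cong 4 X₋≈) (pow-cong 1 X₊≈)) ⟩
      pow G₁ 6 ⊛ (pow (pow a⁻ 2 ⊛ pow u 2) 4 ⊛ pow (pow a 2 ⊛ pow u 2) 1)
        ≈⟨ solve 4 (λ g a b u → g :* ((b :^ 2 :* u :^ 2) :^ 4 :* (a :^ 2 :* u :^ 2) :^ 1) := g :* (b :^ 8 :* a :^ 2) :* u :^ 10) ≈-refl (pow G₁ 6) a a⁻ u ⟩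
      pow G₁ 6 ⊛ (pow a⁻ 8 ⊛ pow a 2) ⊛ pow u 10
        ≈⟨ ⊛-cong G₁-relation ≈-refl ⟩
      pow s 2 ⊛ pow c 8 ⊛ (pow a 12 ⊛ pow a⁻ 12) ⊛ pow u 10
        ≈⟨ solve 5 (λ s c a b u → s :^ 2 :* c :^ 8 :* (a :^ 12 :* b :^ 12) :* u :^ 10 := (c :* u) :^ 8 :* ((s :^ 2 :* u :^ 2) :^ 1 :* (a :^ 2 :* b :^ 2) :^ 6)) ≈-refl s c a a⁻ u ⟩
      pow (c ⊛ u) 8 ⊛ (pow τ 1 ⊛ pow b 6)
        ≈⟨ ≈-trans (⊛-cong (pow1 8 cu) ≈-refl) (⊛-identityˡ _) ⟩
      pow τ 1 ⊛ pow b 6 ∎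

    G₅-equation : pow G₅ 6 ⊛ (pow X₋ 5 ⊛ pow X₊ 2) ≈ pow τ 5 ⊛ pow b 6
    G₅-equation = begin
      pow G₅ 6 ⊛ (pow X₋ 5 ⊛ pow X₊ 2)
        ≈⟨ ⊛-cong ≈-refl (⊛-cong (pow-cong 5 X₋≈) (pow-cong 2 X₊≈)) ⟩
      pow G₅ 6 ⊛ (pow (pow a⁻ 2 ⊛ pow u 2) 5 ⊛ pow (pow a 2 ⊛ pow u 2) 2)
        ≈⟨ solve 4 (λ g a b u → g :* ((b :^ 2 :* u :^ 2) :^ 5 :* (a :^ 2 :* u :^ 2) :^ 2) := g :* (a :^ 4 :* b :^ 10) :* u :^ 14) ≈-refl (pow G₅ 6) a a⁻ u ⟩
      pow G₅ 6 ⊛ (pow a 4 ⊛ pow a⁻ 10) ⊛ pow u 14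
        ≈⟨ ⊛-cong G₅-relation ≈-refl ⟩
      pow s 10 ⊛ pow c 4 ⊛ (pow a 12 ⊛ pow a⁻ 12) ⊛ pow u 14
        ≈⟨ solve 5 (λ s c a b u → s :^ 10 :* c :^ 4 :* (a :^ 12 :* b :^ 12) :* u :^ 14 := (c :* u) :^ 4 :* ((s :^ 2 :* u :^ 2) :^ 5 :* (a :^ 2 :* b :^ 2) :^ 6)) ≈-refl s c a a⁻ u ⟩
      pow (c ⊛ u) 4 ⊛ (pow τ 5 ⊛ pow b 6)
        ≈⟨ ≈-trans (⊛-cong (pow1 4 cu) ≈-refl) (⊛-identityˡ _) ⟩
      pow τ 5 ⊛ pow b 6 ∎

    -- Since σ = q/t, this is b = q t′/t, that is b dq/q = dt/t, free of denominators. It is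
    -- `∂-relation` rewritten.
    ∂σ : ∂ σ ⊕ b ⊛ σ ≈ σ
    ∂σ = cancel {pow s 2} refl (begin
      pow s 2 ⊛ (∂ σ ⊕ b ⊛ σ)
        ≈⟨ solve 5 (λ s s′ z z′ b → s :^ 2 :* (z′ :+ b :* z) := ((s′ :* s :+ s :* s′) :* z :+ s :* s :* z′) :- con (+ 2) :* s :* s′ :* z :+ b :* (s :^ 2 :* z)) ≈-refl s (∂ s) σ (∂ σ) b ⟩
      ((∂ s ⊛ s ⊕ s ⊛ ∂ s) ⊛ σ ⊕ s ⊛ s ⊛ ∂ σ) ⊕ ⊖ (ι (+ 2) ⊛ s ⊛ ∂ s ⊛ σ) ⊕ b ⊛ (pow s 2 ⊛ σ)
        ≈⟨ ⊕-cong (⊕-cong (≈-sym (≈-trans (∂-cong (≈-sym c²≈)) (≈-trans (∂-⊛ (s ⊛ s) σ) (⊕-cong (⊛-cong (∂-⊛ s s) ≈-refl) ≈-refl)))) ≈-refl)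
                  (⊛-cong ≈-refl (≈-trans (solve 2 (λ s z → s :^ 2 :* z := s :* s :* z) ≈-refl s σ) c²≈)) ⟩
      ∂ (c ⊛ c) ⊕ ⊖ (ι (+ 2) ⊛ s ⊛ ∂ s ⊛ σ) ⊕ b ⊛ (c ⊛ c)
        ≈⟨ ⊕-cong (⊕-cong (∂-⊛ c c) ≈-refl) b-term ⟩
      (∂ c ⊛ c ⊕ c ⊛ ∂ c) ⊕ ⊖ (ι (+ 2) ⊛ s ⊛ ∂ s ⊛ σ) ⊕ (c ⊛ c ⊕ ι (+ 2) ⊛ (c ⊛ c ⊛ v ⊛ ∂ s ⊕ ⊖ (c ⊛ ∂ c)))
        ≈⟨ solve 6 (λ c c′ s s′ z v → (c′ :* c :+ c :* c′) :+ :- (con (+ 2) :* s :* s′ :* z) :+ (c :* c :+ con (+ 2) :* (c :* c :* v :* s′ :+ :- (c :* c′)))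
              := c :* c :+ con (+ 2) :* s′ :* (c :* c :* v :- s :* z)) ≈-refl c (∂ c) s (∂ s) σ v ⟩
      c ⊛ c ⊕ ι (+ 2) ⊛ ∂ s ⊛ (c ⊛ c ⊛ v ⊕ ⊖ (s ⊛ σ))
        ≈⟨ ⊕-cong ≈-refl (⊛-cong ≈-refl (⊕-cong ≈-refl (⊖-cong sσ))) ⟩
      c ⊛ c ⊕ ι (+ 2) ⊛ ∂ s ⊛ (c ⊛ c ⊛ v ⊕ ⊖ (c ⊛ c ⊛ v))
        ≈⟨ solve 3 (λ c v s′ → c :* c :+ con (+ 2) :* s′ :* (c :* c :* v :- c :* c :* v) := c :* c) ≈-refl c v (∂ s) ⟩
      c ⊛ c
        ≈⟨ c²≈ ⟨
      s ⊛ s ⊛ σ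
        ≈⟨ solve 2 (λ s z → s :* s :* z := s :^ 2 :* z) ≈-refl s σ ⟩
      pow s 2 ⊛ σ ∎)
      where
        sσ : s ⊛ σ ≈ c ⊛ c ⊛ v
        sσ = begin
          s ⊛ (pow c 2 ⊛ pow v 2)     ≈⟨ solve 3 (λ s c v → s :* (c :^ 2 :* v :^ 2) := s :* v :* (c :* c :* v)) ≈-refl s c v ⟩
          s ⊛ v ⊛ (c ⊛ c ⊛ v)         ≈⟨ ≈-trans (⊛-cong sv ≈-refl) (⊛-identityˡ _) ⟩
          c ⊛ c ⊛ v                   ∎
        c²≈ : s ⊛ s ⊛ σ ≈ c ⊛ c
        c²≈ = begin
          s ⊛ s ⊛ (pow c 2 ⊛ pow v 2)    ≈⟨ solve 3 (λ s c v → s :* s :* (c :^ 2 :* v :^ 2) := (s :* v) :^ 2 :* (c :* c)) ≈-refl s c v ⟩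
          pow (s ⊛ v) 2 ⊛ (c ⊛ c)        ≈⟨ ≈-trans (⊛-cong (pow1 2 sv) ≈-refl) (⊛-identityˡ _) ⟩
          c ⊛ c                          ∎
        b-term : b ⊛ (c ⊛ c) ≈ c ⊛ c ⊕ ι (+ 2) ⊛ (c ⊛ c ⊛ v ⊛ ∂ s ⊕ ⊖ (c ⊛ ∂ c))
        b-term = begin
          b ⊛ (c ⊛ c)
            ≈⟨ ≈-trans (⊛-cong sv ≈-refl) (⊛-identityˡ _) ⟨
          s ⊛ v ⊛ (b ⊛ (c ⊛ c))
            ≈⟨ solve 4 (λ s v b c → s :* v :* (b :* (c :* c)) := c :* v :* (c :* s :* b)) ≈-refl s v b c ⟩
          c ⊛ v ⊛ (c ⊛ s ⊛ b)
            ≈⟨ ⊛-cong ≈-refl ∂-relation ⟩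
          c ⊛ v ⊛ (s ⊛ c ⊕ ι (+ 2) ⊛ (∂ s ⊛ c ⊕ ⊖ (s ⊛ ∂ c)))
            ≈⟨ solve 5 (λ c v s s′ c′ → c :* v :* (s :* c :+ con (+ 2) :* (s′ :* c :+ :- (s :* c′)))
                  := s :* v :* (c :* c) :+ con (+ 2) :* (c :* c :* v :* s′ :+ :- (s :* v :* (c :* c′)))) ≈-refl c v s (∂ s) (∂ c) ⟩
          s ⊛ v ⊛ (c ⊛ c) ⊕ ι (+ 2) ⊛ (c ⊛ c ⊛ v ⊛ ∂ s ⊕ ⊖ (s ⊛ v ⊛ (c ⊛ ∂ c)))
            ≈⟨ ⊕-cong (one (c ⊛ c)) (⊛-cong ≈-refl (⊕-cong ≈-refl (⊖-cong (one (c ⊛ ∂ c))))) ⟩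
          c ⊛ c ⊕ ι (+ 2) ⊛ (c ⊛ c ⊛ v ⊛ ∂ s ⊕ ⊖ (c ⊛ ∂ c)) ∎
          where one : ∀ x → s ⊛ v ⊛ x ≈ x
                one x = ≈-trans (⊛-cong sv ≈-refl) (⊛-identityˡ _)

    b-∂ : ∀ k → ι (+ suc k) ⊛ (b ⊛ pow σ (suc k)) ≈ ι (+ suc k) ⊛ pow σ (suc k) ⊕ ⊖ ∂ (pow σ (suc k))
    b-∂ k = begin
      ι (+ suc k) ⊛ (b ⊛ pow σ (suc k))
        ≈⟨ solve 5 (λ n b z y z′ → n :* (b :* (z :* y)) := n :* ((z′ :+ b :* z) :* y) :- n :* (y :* z′)) ≈-refl (ι (+ suc k)) b σ (pow σ k) (∂ σ) ⟩
      ι (+ suc k) ⊛ ((∂ σ ⊕ b ⊛ σ) ⊛ pow σ k) ⊕ ⊖ (ι (+ suc k) ⊛ (pow σ k ⊛ ∂ σ))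
        ≈⟨ ⊕-cong (⊛-cong ≈-refl (⊛-cong ∂σ ≈-refl)) (⊖-cong (≈-sym (∂-pow L σ k))) ⟩
      ι (+ suc k) ⊛ pow σ (suc k) ⊕ ⊖ ∂ (pow σ (suc k)) ∎

  -- The coefficient is the residue of dt/t^(k+2), an exact differential. In coefficients: by `b-∂`,
  -- k + 1 times it is the difference of two equal numbers, as ∂ multiplies coefficient k + 1 by k +
  -- 1.
  residue : ∀ k → at (b ⊛ pow σ (suc k)) (suc k) ≡ + 0
  residue k = ℤP.*-cancelˡ-≡ (+ suc k) _ (+ 0) (begin
    + suc k * at (b ⊛ pow σ (suc k)) (suc k)                              ≡⟨ at-ι⊛ (+ suc k) (b ⊛ pow σ (suc k)) (suc k) ⟨
    at (ι (+ suc k) ⊛ (b ⊛ pow σ (suc k))) (suc k)                        ≡⟨ exact (suc k) (λ L → ModularRelations.b-∂ L k) ⟩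
    at (ι (+ suc k) ⊛ pow σ (suc k)) (suc k) - + suc k * y                ≡⟨ cong (_- + suc k * y) (at-ι⊛ (+ suc k) (pow σ (suc k)) (suc k)) ⟩
    + suc k * y - + suc k * y                                             ≡⟨ ℤP.+-inverseʳ (+ suc k * y) ⟩
    + 0                                                                   ≡⟨ ℤP.*-zeroʳ (+ suc k) ⟨
    + suc k * + 0                                                         ∎)
    where open ≡-Reasoning
          y = at (pow σ (suc k)) (suc k)

-- Change of variables from q to t in a coefficient, and the coefficients of G modulo p.

module CoefficientExtraction where

  open PowerSeries
  open LatticeSums
  open ThetaSeries
  open ThetaIdentities
  open EtaQuotients
  open ModularFunctions

  open Modular

  at-q⊛ : ∀ y n → at (q ⊛ y) (suc n) ≡ at y n
  at-q⊛ y n = ≡.trans (cong₂ _+_ (ℤP.*-zeroˡ (at y (suc n))) (go (at y) n)) (ℤP.+-identityˡ (at y n))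
    where
      go : ∀ y n → conv (λ i → at q (suc i)) y n ≡ y n
      go y zero = ℤP.*-identityˡ (y 0)
      go y (suc n) = ≡.trans (cong₂ _+_ (ℤP.*-identityˡ (y (suc n))) (conv-zeroˡ y n)) (ℤP.+-identityʳ (y (suc n)))

  at-q^⊛ : ∀ j y k → at (pow q j ⊛ y) (j ℕ.+ k) ≡ at y k
  at-q^⊛ zero y k = ≡.trans (at-ι⊛ (+ 1) y k) (ℤP.*-identityˡ _)
  at-q^⊛ (suc j) y k = ≡.trans (exact {a = q ⊛ pow q j ⊛ y} {b = q ⊛ (pow q j ⊛ y)} (suc (j ℕ.+ k)) (λ L → Ring.⊛-assoc 0 L q (pow q j) y))
    (≡.trans (at-q⊛ (pow q j ⊛ y) (j ℕ.+ k)) (at-q^⊛ j y k))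

  at-q^⊛-low : ∀ j y n → n < j → at (pow q j ⊛ y) n ≡ + 0
  at-q^⊛-low (suc j) y zero _ = refl
  at-q^⊛-low (suc j) y (suc n) (s≤s l) = ≡.trans (exact {a = q ⊛ pow q j ⊛ y} {b = q ⊛ (pow q j ⊛ y)} (suc n) (λ L → Ring.⊛-assoc 0 L q (pow q j) y))
    (≡.trans (at-q⊛ (pow q j ⊛ y) n) (at-q^⊛-low j y n l))

  lin : ℤ → PS → PS
  lin e x = ι (+ 1) ⊕ ι e ⊛ x

  -- The residue of x dt/t^(m+1) written in q, that is the coefficient of t^m in x.
  extract : ℕ → PS → ℤ
  extract m x = at (b ⊛ pow σ m ⊛ x) m

  -- For j > m the order in q is too high, for j = m the constant term of b is 1, and for j < m the
  -- vanishing `residue` applies.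
  extract-t^ : ∀ m j → extract m (pow t j) ≡ at (pow q j) m
  extract-t^ m j with j ℕ.≤? m
  ... | no j≰m = ≡.trans (exact m (λ L → move L)) (≡.trans (at-q^⊛-low j (b ⊛ pow σ m ⊛ pow τ j) m m<j) (≡.sym (≡.trans (one j m) (at-q^⊛-low j (ι (+ 1)) m m<j))))
    where
      m<j = ℕP.≰⇒> j≰m
      one : ∀ j n → at (pow q j) n ≡ at (pow q j ⊛ ι (+ 1)) n
      one j n = exact n (λ L → Ring.≈-sym 0 L (Ring.⊛-identityʳ 0 L (pow q j)))
      move : ∀ L → b ⊛ pow σ m ⊛ pow t j ≈[ 0 , L ] pow q j ⊛ (b ⊛ pow σ m ⊛ pow τ j)
      move L = ≈-trans (⊛-cong ≈-refl (pow-⊛ q τ j)) (solve 3 (λ x y z → x :* (y :* z) := y :* (x :* z)) ≈-refl (b ⊛ pow σ m) (pow q j) (pow τ j))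
        where open Powers 0 L
  ... | yes j≤m = subst (λ m → extract m (pow t j) ≡ at (pow q j) m) (ℕP.m+[n∸m]≡n j≤m) (go (m ℕ.∸ j))
    where
      const : ∀ k → at (b ⊛ pow σ k) k ≡ at (ι (+ 1)) k
      const zero = refl
      const (suc k) = residue k
      move : ∀ k L → b ⊛ pow σ (j ℕ.+ k) ⊛ pow t j ≈[ 0 , L ] pow q j ⊛ (b ⊛ pow σ k)
      move k L = begin
        b ⊛ pow σ (j ℕ.+ k) ⊛ pow t j
          ≈⟨ ⊛-cong (⊛-cong ≈-refl (pow-+ σ j k)) (pow-⊛ q τ j) ⟩
        b ⊛ (pow σ j ⊛ pow σ k) ⊛ (pow q j ⊛ pow τ j)
          ≈⟨ solve 5 (λ b sj sk qj tj → b :* (sj :* sk) :* (qj :* tj) := qj :* (b :* sk) :* (tj :* sj)) ≈-refl b (pow σ j) (pow σ k) (pow q j) (pow τ j) ⟩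
        pow q j ⊛ (b ⊛ pow σ k) ⊛ (pow τ j ⊛ pow σ j)
          ≈⟨ ⊛-cong ≈-refl (≈-trans (≈-sym (pow-⊛ τ σ j)) (≈-trans (pow-cong′ j (ModularRelations.τσ L)) (pow-1 j))) ⟩
        pow q j ⊛ (b ⊛ pow σ k) ⊛ ι (+ 1)
          ≈⟨ ⊛-identityʳ _ ⟩
        pow q j ⊛ (b ⊛ pow σ k) ∎
        where open Powers 0 L
              open import Relation.Binary.Reasoning.Setoid setoid
      go : ∀ k → extract (j ℕ.+ k) (pow t j) ≡ at (pow q j) (j ℕ.+ k)
      go k = begin
        extract (j ℕ.+ k) (pow t j)                 ≡⟨ exact (j ℕ.+ k) (move k) ⟩
        at (pow q j ⊛ (b ⊛ pow σ k)) (j ℕ.+ k)      ≡⟨ at-q^⊛ j (b ⊛ pow σ k) k ⟩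
        at (b ⊛ pow σ k) k                          ≡⟨ const k ⟩
        at (ι (+ 1)) k                              ≡⟨ at-q^⊛ j (ι (+ 1)) k ⟨
        at (pow q j ⊛ ι (+ 1)) (j ℕ.+ k)            ≡⟨ exact (j ℕ.+ k) (λ L → Ring.⊛-identityʳ 0 L (pow q j)) ⟩
        at (pow q j) (j ℕ.+ k)                      ∎
        where open ≡-Reasoning

  -- This is (1 - 4x)^M (1 + 4x)^N as an iterated product, so that linear functionals can be
  -- followed one factor at a time.
  lins : PS → ℕ → ℕ → PS
  lins x zero    N = pow (lin (+ 4) x) N
  lins x (suc M) N = lin (- + 4) x ⊛ lins x M N

  lins≈ : ∀ {d L} x M N → lins x M N ≈[ d , L ] pow (lin (- + 4) x) M ⊛ pow (lin (+ 4) x) N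
  lins≈ {d} {L} x zero N = ≈-sym (⊛-identityˡ _)
    where open Ring d L
  lins≈ {d} {L} x (suc M) N = ≈-trans (⊛-cong ≈-refl (lins≈ x M N)) (≈-sym (⊛-assoc _ _ _))
    where open Ring d L

  peel : ∀ e m j x y R → at (y ⊛ (pow x j ⊛ (lin e x ⊛ R))) m ≡ at (y ⊛ (pow x j ⊛ R)) m + e * at (y ⊛ (pow x (suc j) ⊛ R)) m
  peel e m j x y R = ≡.trans
    (exact {a = y ⊛ (pow x j ⊛ (lin e x ⊛ R))} {b = y ⊛ (pow x j ⊛ R) ⊕ ι e ⊛ (y ⊛ (pow x (suc j) ⊛ R))} m (λ L → let open Ring 0 L in
      solve 5 (λ x y z r e → y :* (z :* ((con (+ 1) :+ e :* x) :* r)) := y :* (z :* r) :+ e :* (y :* (x :* z :* r))) ≈-refl x y (pow x j) R (ι e)))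
    (cong (λ z → at (y ⊛ (pow x j ⊛ R)) m + z) (at-ι⊛ e (y ⊛ (pow x (suc j) ⊛ R)) m))

  -- Both functionals only see the expansion of lins in powers of the argument.
  extract-lins : ∀ m M N j → extract m (pow t j ⊛ lins t M N) ≡ at (ι (+ 1) ⊛ (pow q j ⊛ lins q M N)) m
  extract-lins m zero zero j = begin
    extract m (pow t j ⊛ ι (+ 1))               ≡⟨ exact {a = y ⊛ (pow t j ⊛ ι (+ 1))} {b = y ⊛ pow t j} m (λ L → let open Ring 0 L in ⊛-cong ≈-refl (⊛-identityʳ (pow t j))) ⟩
    extract m (pow t j)                         ≡⟨ extract-t^ m j ⟩
    at (pow q j) m                              ≡⟨ exact {a = ι (+ 1) ⊛ (pow q j ⊛ ι (+ 1))} {b = pow q j} m (λ L → let open Ring 0 L in ≈-trans (⊛-identityˡ _) (⊛-identityʳ (pow q j))) ⟨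
    at (ι (+ 1) ⊛ (pow q j ⊛ ι (+ 1))) m        ∎
    where open ≡-Reasoning
          y = b ⊛ pow σ m
  extract-lins m zero (suc N) j = ≡.trans (peel (+ 4) m j t (b ⊛ pow σ m) (lins t zero N))
    (≡.trans (cong₂ (λ u v → u + + 4 * v) (extract-lins m zero N j) (extract-lins m zero N (suc j))) (≡.sym (peel (+ 4) m j q (ι (+ 1)) (lins q zero N))))
  extract-lins m (suc M) N j = ≡.trans (peel (- + 4) m j t (b ⊛ pow σ m) (lins t M N))
    (≡.trans (cong₂ (λ u v → u + - + 4 * v) (extract-lins m M N j) (extract-lins m M N (suc j))) (≡.sym (peel (- + 4) m j q (ι (+ 1)) (lins q M N))))

  transfer : ∀ m M N → extract m (lins t M N) ≡ at (lins q M N) m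
  transfer m M N = begin
    at (y ⊛ lins t M N) m                       ≡⟨ exact {a = y ⊛ lins t M N} {b = y ⊛ (ι (+ 1) ⊛ lins t M N)} m (λ L → let open Ring 0 L in ⊛-cong ≈-refl (≈-sym (⊛-identityˡ (lins t M N)))) ⟩
    at (y ⊛ (ι (+ 1) ⊛ lins t M N)) m           ≡⟨ extract-lins m M N 0 ⟩
    at (ι (+ 1) ⊛ (ι (+ 1) ⊛ lins q M N)) m     ≡⟨ exact {a = ι (+ 1) ⊛ (ι (+ 1) ⊛ lins q M N)} {b = lins q M N} m (λ L → let open Ring 0 L in ≈-trans (⊛-identityˡ _) (⊛-identityˡ _)) ⟩
    at (lins q M N) m                           ∎
    where open ≡-Reasoning
          y = b ⊛ pow σ m

  module Coefficient {p : ℕ} (pr : Prime p) where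
    open Frobenius pr
    open import Relation.Binary.Reasoning.Setoid setoid

    -- G^(1 + 6 e) is a p-th power up to a power of p, and likewise for b.
    coefficient : ∀ {G} f m e M N i j k → 1 ℕ.+ 6 ℕ.* e ≡ f ℕ.* p → at G 0 ≡ + 1 → m < p →
      (∀ L → pow G 6 ⊛ (pow X₋ i ⊛ pow X₊ j) ≈[ 0 , L ] pow τ k ⊛ pow b 6) →
      Σ ℕ (λ x → i ℕ.* e ≡ x ℕ.* p ℕ.+ M) → Σ ℕ (λ x → j ℕ.* e ≡ x ℕ.* p ℕ.+ N) → Σ ℕ (λ x → k ℕ.* e ≡ x ℕ.* p ℕ.+ m) →
      at G m ≡ at (lins q M N) m [ p ]
    coefficient {G} f m e M N i j k fp G₀ m<p rel (x₁ , e₁) (x₂ , e₂) (x₃ , e₃) =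
        cg-trans (coef G≈ m m<p) (≡⇒cg (transfer m M N))
      where
        mod : ∀ {z} x r {n} → n ≡ x ℕ.* p ℕ.+ r → at z 0 ≡ + 1 → pow z n ≈ pow z r
        mod {z} x r h z₀ = ≈-trans (pow-≡ z h) (pow-mod x r z₀)
        unit : ∀ {z} → at z 0 ≡ + 1 → z ⊛ pow (pow z 6) e ≈ ι (+ 1)
        unit {z} z₀ = ≈-trans (⊛-cong ≈-refl (≈-sym (pow-* z 6 e))) (mod f 0 (≡.trans fp (≡.sym (ℕP.+-identityʳ _))) z₀)
        raised : pow (pow G 6) e ⊛ lins t M N ≈ pow τ m ⊛ pow (pow b 6) e
        raised = begin
          pow (pow G 6) e ⊛ lins t M N
            ≈⟨ ⊛-cong ≈-refl (lins≈ t M N) ⟩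
          pow (pow G 6) e ⊛ (pow X₋ M ⊛ pow X₊ N)
            ≈⟨ ⊛-cong ≈-refl (⊛-cong (mod x₁ M e₁ refl) (mod x₂ N e₂ refl)) ⟨
          pow (pow G 6) e ⊛ (pow X₋ (i ℕ.* e) ⊛ pow X₊ (j ℕ.* e))
            ≈⟨ ⊛-cong ≈-refl (⊛-cong (pow-* X₋ i e) (pow-* X₊ j e)) ⟩
          pow (pow G 6) e ⊛ (pow (pow X₋ i) e ⊛ pow (pow X₊ j) e)
            ≈⟨ ⊛-cong ≈-refl (pow-⊛ _ _ e) ⟨
          pow (pow G 6) e ⊛ pow (pow X₋ i ⊛ pow X₊ j) e
            ≈⟨ pow-⊛ _ _ e ⟨
          pow (pow G 6 ⊛ (pow X₋ i ⊛ pow X₊ j)) e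
            ≈⟨ pow-cong′ e (reduce rel) ⟩
          pow (pow τ k ⊛ pow b 6) e
            ≈⟨ pow-⊛ _ _ e ⟩
          pow (pow τ k) e ⊛ pow (pow b 6) e
            ≈⟨ ⊛-cong (≈-trans (≈-sym (pow-* τ k e)) (mod x₃ m e₃ refl)) ≈-refl ⟩
          pow τ m ⊛ pow (pow b 6) e ∎
        G≈ : G ≈ b ⊛ pow σ m ⊛ lins t M N
        G≈ = begin
          G
            ≈⟨ solve 1 (λ g → g := g :* con (+ 1) :* con (+ 1)) ≈-refl G ⟩
          G ⊛ ι (+ 1) ⊛ ι (+ 1)
            ≈⟨ ⊛-cong (⊛-cong ≈-refl (unit refl)) (≈-trans (pow-cong′ m (reduce ModularRelations.τσ)) (pow-1 m)) ⟨
          G ⊛ (b ⊛ pow (pow b 6) e) ⊛ pow (τ ⊛ σ) m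
            ≈⟨ ⊛-cong ≈-refl (pow-⊛ τ σ m) ⟩
          G ⊛ (b ⊛ pow (pow b 6) e) ⊛ (pow τ m ⊛ pow σ m)
            ≈⟨ solve 5 (λ g b be t s → g :* (b :* be) :* (t :* s) := g :* b :* s :* (t :* be)) ≈-refl G b (pow (pow b 6) e) (pow τ m) (pow σ m) ⟩
          G ⊛ b ⊛ pow σ m ⊛ (pow τ m ⊛ pow (pow b 6) e)
            ≈⟨ ⊛-cong ≈-refl raised ⟨
          G ⊛ b ⊛ pow σ m ⊛ (pow (pow G 6) e ⊛ lins t M N)
            ≈⟨ solve 5 (λ g b s ge l → g :* b :* s :* (ge :* l) := g :* ge :* (b :* s :* l)) ≈-refl G b (pow σ m) (pow (pow G 6) e) (lins t M N) ⟩
          G ⊛ pow (pow G 6) e ⊛ (b ⊛ pow σ m ⊛ lins t M N)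
            ≈⟨ ≈-trans (⊛-cong (unit G₀) ≈-refl) (⊛-identityˡ _) ⟩
          b ⊛ pow σ m ⊛ lins t M N ∎

    G₁-coefficient : ∀ m → p ≡ 1 ℕ.+ 6 ℕ.* m → at G₁ m ≡ at (lins q (4 ℕ.* m) m) m [ p ]
    G₁-coefficient m e = coefficient 1 m m (4 ℕ.* m) m 4 1 1 (≡.trans (≡.sym e) (≡.sym (ℕP.*-identityˡ p))) refl
      (subst (m <_) (≡.sym e) (s≤s (ℕP.m≤m+n m _))) ModularRelations.G₁-equation (0 , refl) (0 , ℕP.*-identityˡ m) (0 , ℕP.*-identityˡ m)

    -- Modulo p the equation 1 + 6e = 0 is solved by e = 5m + 4, as 1 + 6e = 5p. Then 5e = 4p + m
    -- and 2e = p + (4m + 3), which leaves the exponents m of 1 - 4t and of τ, and 4m + 3 of 1 + 4t.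
    G₅-coefficient : ∀ m → p ≡ 5 ℕ.+ 6 ℕ.* m → at G₅ m ≡ at (lins q m (3 ℕ.+ 4 ℕ.* m)) m [ p ]
    G₅-coefficient m refl = coefficient 5 m (5 ℕ.* m ℕ.+ 4) m (3 ℕ.+ 4 ℕ.* m) 5 2 5 (l₁ m) refl
      (ℕP.m≤n⇒m≤1+n (ℕP.m≤n⇒m≤1+n (ℕP.m≤n⇒m≤1+n (ℕP.m≤n⇒m≤1+n (s≤s (ℕP.m≤m+n m _))))))
      ModularRelations.G₅-equation (4 , l₂ m) (1 , l₃ m) (4 , l₂ m)
      where
        l₁ : ∀ m → 1 ℕ.+ 6 ℕ.* (5 ℕ.* m ℕ.+ 4) ≡ 5 ℕ.* (5 ℕ.+ 6 ℕ.* m)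
        l₁ = ℕSolver.solve-∀
        l₂ : ∀ m → 5 ℕ.* (5 ℕ.* m ℕ.+ 4) ≡ 4 ℕ.* (5 ℕ.+ 6 ℕ.* m) ℕ.+ m
        l₂ = ℕSolver.solve-∀
        l₃ : ∀ m → 2 ℕ.* (5 ℕ.* m ℕ.+ 4) ≡ 1 ℕ.* (5 ℕ.+ 6 ℕ.* m) ℕ.+ (3 ℕ.+ 4 ℕ.* m)
        l₃ = ℕSolver.solve-∀

-- Finite sums and binomial coefficients with built-in powers.

module Binomials where

  open PowerSeries using (conv)

  -- Finite sums: ∑ n f = f 0 + … + f n, and diag n f sums f k l over k + l = n.

  ∑ : ℕ → (ℕ → ℤ) → ℤ
  ∑ zero    f = f 0
  ∑ (suc n) f = ∑ n f + f (suc n)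

  diag : ℕ → (ℕ → ℕ → ℤ) → ℤ
  diag zero    f = f 0 0
  diag (suc n) f = f 0 (suc n) + diag n (λ k l → f (suc k) l)

  private
    medial : ∀ a b c d → (a + b) + (c + d) ≡ (a + c) + (b + d)
    medial = solve-∀

  ∑-cong : ∀ n {f g} → (∀ k → k ≤ n → f k ≡ g k) → ∑ n f ≡ ∑ n g
  ∑-cong zero    e = e 0 z≤n
  ∑-cong (suc n) e = cong₂ _+_ (∑-cong n (λ k l → e k (ℕP.m≤n⇒m≤1+n l))) (e (suc n) ℕP.≤-refl)

  ∑-+ : ∀ n f g → ∑ n (λ k → f k + g k) ≡ ∑ n f + ∑ n g
  ∑-+ zero    f g = refl
  ∑-+ (suc n) f g = ≡.trans (cong (_+ (f (suc n) + g (suc n))) (∑-+ n f g)) (medial (∑ n f) (∑ n g) (f (suc n)) (g (suc n)))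

  ∑-* : ∀ n c f → ∑ n (λ k → c * f k) ≡ c * ∑ n f
  ∑-* zero    c f = refl
  ∑-* (suc n) c f = ≡.trans (cong (_+ c * f (suc n)) (∑-* n c f)) (≡.sym (ℤP.*-distribˡ-+ c (∑ n f) (f (suc n))))

  ∑-0 : ∀ n {f} → (∀ k → k ≤ n → f k ≡ + 0) → ∑ n f ≡ + 0
  ∑-0 zero    e = e 0 z≤n
  ∑-0 (suc n) e = cong₂ _+_ (∑-0 n (λ k l → e k (ℕP.m≤n⇒m≤1+n l))) (e (suc n) ℕP.≤-refl)

  ∑-swap : ∀ m n (f : ℕ → ℕ → ℤ) → ∑ m (λ i → ∑ n (f i)) ≡ ∑ n (λ j → ∑ m (λ i → f i j))
  ∑-swap zero    n f = refl
  ∑-swap (suc m) n f = ≡.trans (cong (_+ ∑ n (f (suc m))) (∑-swap m n f)) (≡.sym (∑-+ n (λ j → ∑ m (λ i → f i j)) (f (suc m))))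

  ∑-head : ∀ n f → ∑ (suc n) f ≡ f 0 + ∑ n (λ k → f (suc k))
  ∑-head zero    f = refl
  ∑-head (suc n) f = ≡.trans (cong (_+ f (suc (suc n))) (∑-head n f)) (ℤP.+-assoc (f 0) _ _)

  ∑-extend : ∀ {n f} j → (∀ k → n < k → f k ≡ + 0) → ∑ (j ℕ.+ n) f ≡ ∑ n f
  ∑-extend zero    z = refl
  ∑-extend {n} {f} (suc j) z = ≡.trans (cong₂ _+_ (∑-extend j z) (z (suc (j ℕ.+ n)) (s≤s (ℕP.m≤n+m n j)))) (ℤP.+-identityʳ (∑ n f))

  ∑-extend-≤ : ∀ {n m f} → n ≤ m → (∀ k → n < k → f k ≡ + 0) → ∑ m f ≡ ∑ n f
  ∑-extend-≤ {n} {m} {f} l z = subst (λ m → ∑ m f ≡ ∑ n f) (ℕP.m∸n+n≡m l) (∑-extend (m ℕ.∸ n) z)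

  ∑-drop : ∀ k J {f} → (∀ n → n < k → f n ≡ + 0) → ∑ (k ℕ.+ J) f ≡ ∑ J (λ j → f (k ℕ.+ j))
  ∑-drop zero    J z = refl
  ∑-drop (suc k) J {f} z = ≡.trans (∑-head (k ℕ.+ J) f) (≡.trans (cong (_+ ∑ (k ℕ.+ J) (λ n → f (suc n))) (z 0 (s≤s z≤n)))
    (≡.trans (ℤP.+-identityˡ _) (∑-drop k J (λ n l → z (suc n) (s≤s l)))))

  diag-cong : ∀ n {f g} → (∀ k l → k ℕ.+ l ≡ n → f k l ≡ g k l) → diag n f ≡ diag n g
  diag-cong zero    e = e 0 0 refl
  diag-cong (suc n) e = cong₂ _+_ (e 0 (suc n) refl) (diag-cong n (λ k l h → e (suc k) l (cong suc h)))

  diag-+ : ∀ n f g → diag n (λ k l → f k l + g k l) ≡ diag n f + diag n g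
  diag-+ zero    f g = refl
  diag-+ (suc n) f g = ≡.trans (cong (λ z → f 0 (suc n) + g 0 (suc n) + z) (diag-+ n _ _)) (medial (f 0 (suc n)) (g 0 (suc n)) _ _)

  diag-* : ∀ n c f → diag n (λ k l → c * f k l) ≡ c * diag n f
  diag-* zero    c f = refl
  diag-* (suc n) c f = ≡.trans (cong (λ z → c * f 0 (suc n) + z) (diag-* n c _)) (≡.sym (ℤP.*-distribˡ-+ c _ _))

  diag-last : ∀ n f → diag (suc n) f ≡ f (suc n) 0 + diag n (λ k l → f k (suc l))
  diag-last zero    f = ℤP.+-comm (f 0 1) (f 1 0)
  diag-last (suc n) f = ≡.trans (cong (λ z → f 0 (suc (suc n)) + z) (diag-last n (λ k l → f (suc k) l))) (lem (f 0 (suc (suc n))) (f (suc (suc n)) 0) _)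
    where lem : ∀ a b c → a + (b + c) ≡ b + (a + c)
          lem = solve-∀

  diag-sym : ∀ n f → diag n f ≡ diag n (λ k l → f l k)
  diag-sym zero    f = refl
  diag-sym (suc n) f = ≡.trans (cong (λ z → f 0 (suc n) + z) (diag-sym n (λ k l → f (suc k) l))) (≡.sym (diag-last n (λ k l → f l k)))

  ∑-diag : ∀ n f → ∑ n (λ k → f k (n ℕ.∸ k)) ≡ diag n f
  ∑-diag zero    f = refl
  ∑-diag (suc n) f = begin
    ∑ n (λ k → f k (suc n ℕ.∸ k)) + f (suc n) (n ℕ.∸ n)     ≡⟨ cong₂ _+_ (∑-cong n (λ k l → cong (f k) (ℕP.+-∸-assoc 1 l))) (cong (f (suc n)) (ℕP.n∸n≡0 n)) ⟩
    ∑ n (λ k → f k (suc (n ℕ.∸ k))) + f (suc n) 0           ≡⟨ cong (_+ f (suc n) 0) (∑-diag n (λ k l → f k (suc l))) ⟩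
    diag n (λ k l → f k (suc l)) + f (suc n) 0              ≡⟨ ℤP.+-comm (diag n (λ k l → f k (suc l))) (f (suc n) 0) ⟩
    f (suc n) 0 + diag n (λ k l → f k (suc l))              ≡⟨ diag-last n f ⟨
    diag (suc n) f                                          ∎
    where open ≡-Reasoning

  conv-diag : ∀ a b n → conv a b n ≡ diag n (λ i j → a i * b j)
  conv-diag a b zero    = refl
  conv-diag a b (suc n) = cong (λ z → a 0 * b (suc n) + z) (conv-diag (λ i → a (suc i)) b n)

  -- wb c n k is the coefficient of x^k in (c + x)^n.

  wb : ℤ → ℕ → ℕ → ℤ
  wb c n       zero    = c ^ n
  wb c zero    (suc k) = + 0
  wb c (suc n) (suc k) = wb c n k + c * wb c n (suc k)

  bin : ℕ → ℕ → ℤ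
  bin = wb (+ 1)

  wb-low : ∀ c n k → n < k → wb c n k ≡ + 0
  wb-low c zero    (suc k) _       = refl
  wb-low c (suc n) (suc k) (s≤s l) = ≡.trans (cong₂ (λ x y → x + c * y) (wb-low c n k l) (wb-low c n (suc k) (ℕP.m≤n⇒m≤1+n l)))
    (≡.trans (ℤP.+-identityˡ _) (ℤP.*-zeroʳ c))

  wb-diag : ∀ c n → wb c n n ≡ + 1
  wb-diag c zero    = refl
  wb-diag c (suc n) = ≡.trans (cong₂ (λ x y → x + c * y) (wb-diag c n) (wb-low c n (suc n) ℕP.≤-refl)) (cong (λ z → + 1 + z) (ℤP.*-zeroʳ c))

  -- The derivative of (c + x)^(n+1). Together with `up` and `right` it gives the term ratios of all
  -- hypergeometric sums below without denominators.
  absorb : ∀ c n k → + suc k * wb c (suc n) (suc k) ≡ + suc n * wb c n k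
  absorb c zero zero = lem c
    where lem : ∀ c → + 1 * (+ 1 + c * + 0) ≡ + 1 * + 1
          lem = solve-∀
  absorb c zero (suc k) = lem c (+ k)
    where lem : ∀ c k → (+ 2 + k) * (+ 0 + c * + 0) ≡ + 1 * + 0
          lem = solve-∀
  absorb c (suc n) zero = begin
    + 1 * (c ^ suc n + c * wb c (suc n) 1)        ≡⟨ lem₁ c (c ^ suc n) (wb c (suc n) 1) ⟩
    c ^ suc n + c * (+ 1 * wb c (suc n) 1)        ≡⟨ cong (λ z → c ^ suc n + c * z) (absorb c n zero) ⟩
    c * c ^ n + c * (+ suc n * c ^ n)             ≡⟨ lem₂ c (c ^ n) (+ n) ⟩
    + suc (suc n) * (c * c ^ n)                   ∎
    where open ≡-Reasoning
          lem₁ : ∀ c x y → + 1 * (x + c * y) ≡ x + c * (+ 1 * y)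
          lem₁ = solve-∀
          lem₂ : ∀ c x n → c * x + c * ((+ 1 + n) * x) ≡ (+ 2 + n) * (c * x)
          lem₂ = solve-∀
  absorb c (suc n) (suc k) = begin
    + suc (suc k) * (wb c (suc n) (suc k) + c * wb c (suc n) (suc (suc k)))
      ≡⟨ lem₁ c (+ k) (wb c (suc n) (suc k)) (wb c (suc n) (suc (suc k))) ⟩
    + suc k * wb c (suc n) (suc k) + wb c (suc n) (suc k) + c * (+ suc (suc k) * wb c (suc n) (suc (suc k)))
      ≡⟨ cong₂ (λ x y → x + wb c (suc n) (suc k) + c * y) (absorb c n k) (absorb c n (suc k)) ⟩
    + suc n * wb c n k + wb c (suc n) (suc k) + c * (+ suc n * wb c n (suc k))
      ≡⟨ lem₂ c (+ n) (wb c n k) (wb c n (suc k)) ⟩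
    + suc (suc n) * (wb c n k + c * wb c n (suc k)) ∎
    where open ≡-Reasoning
          lem₁ : ∀ c k x y → (+ 2 + k) * (x + c * y) ≡ (+ 1 + k) * x + x + c * ((+ 2 + k) * y)
          lem₁ = solve-∀
          lem₂ : ∀ c n x y → (+ 1 + n) * x + (x + c * y) + c * ((+ 1 + n) * y) ≡ (+ 2 + n) * (x + c * y)
          lem₂ = solve-∀

  up : ∀ c n k → (+ suc n - + k) * wb c (suc n) k ≡ c * + suc n * wb c n k
  up c n zero = lem c (c ^ n) (+ n)
    where lem : ∀ c x n → (+ 1 + n - + 0) * (c * x) ≡ c * (+ 1 + n) * x
          lem = solve-∀
  up c n (suc k) = begin
    (+ suc n - + suc k) * w                                             ≡⟨ lem₁ (+ n) (+ k) w ⟩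
    + suc n * w - + suc k * w                                           ≡⟨ cong (λ z → + suc n * w - z) (absorb c n k) ⟩
    + suc n * (wb c n k + c * wb c n (suc k)) - + suc n * wb c n k      ≡⟨ lem₂ c (+ n) (wb c n k) (wb c n (suc k)) ⟩
    c * + suc n * wb c n (suc k)                                        ∎
    where open ≡-Reasoning
          w = wb c (suc n) (suc k)
          lem₁ : ∀ n k w → (+ 1 + n - (+ 1 + k)) * w ≡ (+ 1 + n) * w - (+ 1 + k) * w
          lem₁ = solve-∀
          lem₂ : ∀ c n x y → (+ 1 + n) * (x + c * y) - (+ 1 + n) * x ≡ c * (+ 1 + n) * y
          lem₂ = solve-∀

  right : ∀ c n k → c * + suc k * wb c n (suc k) ≡ (+ n - + k) * wb c n k
  right c n k = begin
    c * + suc k * wb c n (suc k)                                        ≡⟨ lem₁ c (+ k) (wb c n k) (wb c n (suc k)) ⟩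
    + suc k * (wb c n k + c * wb c n (suc k)) - + suc k * wb c n k      ≡⟨ cong (_- + suc k * wb c n k) (absorb c n k) ⟩
    + suc n * wb c n k - + suc k * wb c n k                             ≡⟨ lem₂ (+ n) (+ k) (wb c n k) ⟩
    (+ n - + k) * wb c n k                                              ∎
    where open ≡-Reasoning
          lem₁ : ∀ c k x y → c * (+ 1 + k) * y ≡ (+ 1 + k) * (x + c * y) - (+ 1 + k) * x
          lem₁ = solve-∀
          lem₂ : ∀ n k x → (+ 1 + n) * x - (+ 1 + k) * x ≡ (n - k) * x
          lem₂ = solve-∀

  binomial-theorem : ∀ c x n K → n ≤ K → ∑ K (λ k → wb c n k * x ^ k) ≡ (c + x) ^ n
  binomial-theorem c x zero zero _ = refl
  binomial-theorem c x zero (suc K) _ = ≡.trans (cong₂ _+_ (binomial-theorem c x zero K z≤n) (ℤP.*-zeroˡ (x ^ suc K))) refl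
  binomial-theorem c x (suc n) (suc K) (s≤s l) = begin
    ∑ (suc K) (λ k → wb c (suc n) k * x ^ k)
      ≡⟨ ∑-head K _ ⟩
    wb c (suc n) 0 * + 1 + ∑ K (λ k → (wb c n k + c * wb c n (suc k)) * (x * x ^ k))
      ≡⟨ cong (λ z → wb c (suc n) 0 * + 1 + z) (≡.trans (∑-cong K (λ k _ → lem₁ c x (wb c n k) (wb c n (suc k)) (x ^ k))) (∑-+ K _ _)) ⟩
    c * c ^ n * + 1 + (∑ K (λ k → x * (wb c n k * x ^ k)) + ∑ K (λ k → c * (wb c n (suc k) * x ^ suc k)))
      ≡⟨ cong₂ (λ u v → c * c ^ n * + 1 + (u + v)) (≡.trans (∑-* K x _) (cong (x *_) (binomial-theorem c x n K l))) (∑-* K c _) ⟩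
    c * c ^ n * + 1 + (x * (c + x) ^ n + c * ∑ K (λ k → wb c n (suc k) * x ^ suc k))
      ≡⟨ lem₂ c x (c ^ n) ((c + x) ^ n) _ ⟩
    c * (c ^ n * + 1 + ∑ K (λ k → wb c n (suc k) * x ^ suc k)) + x * (c + x) ^ n
      ≡⟨ cong (λ z → c * z + x * (c + x) ^ n) (≡.trans (≡.sym (∑-head K _)) (binomial-theorem c x n (suc K) (ℕP.m≤n⇒m≤1+n l))) ⟩
    c * (c + x) ^ n + x * (c + x) ^ n
      ≡⟨ ℤP.*-distribʳ-+ ((c + x) ^ n) c x ⟨
    (c + x) ^ suc n ∎
    where open ≡-Reasoning
          lem₁ : ∀ c x a b y → (a + c * b) * (x * y) ≡ x * (a * y) + c * (b * (x * y))
          lem₁ = solve-∀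
          lem₂ : ∀ c x a y s → c * a * + 1 + (x * y + c * s) ≡ c * (a * + 1 + s) + x * y
          lem₂ = solve-∀

  -- c^E (c + x)^Q has coefficients c^(E + Q - j) bin Q j.
  wb-bin : ∀ c E Q j → j ≤ E ℕ.+ Q → bin Q j * c ^ (E ℕ.+ Q ℕ.∸ j) ≡ c ^ E * wb c Q j
  wb-bin c E Q zero l = ≡.trans (cong (_* c ^ (E ℕ.+ Q)) (ℤP.^-zeroˡ Q)) (≡.trans (ℤP.*-identityˡ _) (ℤP.^-distribˡ-+-* c E Q))
  wb-bin c E zero (suc j) l = ≡.trans (ℤP.*-zeroˡ (c ^ (E ℕ.+ 0 ℕ.∸ suc j))) (≡.sym (ℤP.*-zeroʳ (c ^ E)))
  wb-bin c E (suc Q) (suc j) l = begin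
    (bin Q j + + 1 * bin Q (suc j)) * c ^ (E ℕ.+ suc Q ℕ.∸ suc j)
      ≡⟨ cong (λ z → (bin Q j + + 1 * bin Q (suc j)) * c ^ (z ℕ.∸ suc j)) (ℕP.+-suc E Q) ⟩
    (bin Q j + + 1 * bin Q (suc j)) * c ^ (E ℕ.+ Q ℕ.∸ j)
      ≡⟨ lem₁ (bin Q j) (bin Q (suc j)) (c ^ (E ℕ.+ Q ℕ.∸ j)) ⟩
    bin Q j * c ^ (E ℕ.+ Q ℕ.∸ j) + bin Q (suc j) * c ^ (E ℕ.+ Q ℕ.∸ j)
      ≡⟨ cong₂ _+_ (wb-bin c E Q j l′) second ⟩
    c ^ E * wb c Q j + c * (c ^ E * wb c Q (suc j))
      ≡⟨ lem₂ c (c ^ E) (wb c Q j) (wb c Q (suc j)) ⟩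
    c ^ E * (wb c Q j + c * wb c Q (suc j)) ∎
    where
      open ≡-Reasoning
      l′ : j ≤ E ℕ.+ Q
      l′ = ℕP.≤-pred (subst (suc j ≤_) (ℕP.+-suc E Q) l)
      lem₁ : ∀ a b x → (a + + 1 * b) * x ≡ a * x + b * x
      lem₁ = solve-∀
      lem₂ : ∀ c e a b → e * a + c * (e * b) ≡ e * (a + c * b)
      lem₂ = solve-∀
      lem₃ : ∀ b c x → b * (c * x) ≡ c * (b * x)
      lem₃ = solve-∀
      second : bin Q (suc j) * c ^ (E ℕ.+ Q ℕ.∸ j) ≡ c * (c ^ E * wb c Q (suc j))
      second with suc j ℕ.≤? E ℕ.+ Q
      ... | yes h = ≡.trans (cong (λ z → bin Q (suc j) * c ^ z) (≡.sym (≡.trans (≡.sym (ℕP.+-∸-assoc 1 h)) refl)))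
                      (≡.trans (lem₃ (bin Q (suc j)) c (c ^ (E ℕ.+ Q ℕ.∸ suc j))) (cong (c *_) (wb-bin c E Q (suc j) h)))
      ... | no  h = ≡.trans (cong (_* c ^ (E ℕ.+ Q ℕ.∸ j)) (wb-low (+ 1) Q (suc j) Q<)) (≡.trans (ℤP.*-zeroˡ (c ^ (E ℕ.+ Q ℕ.∸ j)))
                      (≡.sym (≡.trans (cong (λ z → c * (c ^ E * z)) (wb-low c Q (suc j) Q<)) (lem₄ c (c ^ E)))))
        where
          Q< : Q < suc j
          Q< = ℕP.≤-<-trans (ℕP.m≤n+m Q E) (ℕP.≰⇒> h)
          lem₄ : ∀ c x → c * (x * + 0) ≡ + 0
          lem₄ = solve-∀

  -- Doubling and tripling that compute on successors, so that the recursion of `wb` applies at the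
  -- indices 2k and 3k without rewriting.
  two three : ℕ → ℕ
  two zero = 0
  two (suc k) = suc (suc (two k))
  three zero = 0
  three (suc k) = suc (suc (suc (three k)))

  +two : ∀ k → + two k ≡ + 2 * + k
  +two zero = refl
  +two (suc k) = ≡.trans (cong (λ z → + 2 + z) (+two k)) (lem (+ k))
    where lem : ∀ k → + 2 + + 2 * k ≡ + 2 * (+ 1 + k)
          lem = solve-∀

  +three : ∀ k → + three k ≡ + 3 * + k
  +three zero = refl
  +three (suc k) = ≡.trans (cong (λ z → + 3 + z) (+three k)) (lem (+ k))
    where lem : ∀ k → + 3 + + 3 * k ≡ + 3 * (+ 1 + k)
          lem = solve-∀

  *-cancel : ∀ n {x y} → + suc n * x ≡ + suc n * y → x ≡ y
  *-cancel n {x} {y} e = ℤP.*-cancelˡ-≡ (+ suc n) x y e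

  -- B k is C(2k,k), and T k is C(3k,k) C(2k,k) = (3k)!/k!³.
  B T : ℕ → ℤ
  B k = bin (two k) k
  T k = bin (three k) k * B k

  B-suc : ∀ k → + suc k * B (suc k) ≡ + 2 * (+ 2 * + k + + 1) * B k
  B-suc k = *-cancel k (begin
    + suc k * (+ suc k * bin (suc (suc (two k))) (suc k))          ≡⟨ cong (+ suc k *_) (absorb (+ 1) (suc (two k)) k) ⟩
    + suc k * (+ suc (suc (two k)) * bin (suc (two k)) k)          ≡⟨ cong (λ z → + suc k * ((+ 2 + z) * bin (suc (two k)) k)) (+two k) ⟩
    + suc k * ((+ 2 + + 2 * + k) * bin (suc (two k)) k)            ≡⟨ lem₁ (+ k) (bin (suc (two k)) k) ⟩
    (+ 2 + + 2 * + k) * ((+ 1 + + 2 * + k - + k) * bin (suc (two k)) k)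
      ≡⟨ cong (λ z → (+ 2 + + 2 * + k) * ((+ 1 + z - + k) * bin (suc (two k)) k)) (+two k) ⟨
    (+ 2 + + 2 * + k) * ((+ suc (two k) - + k) * bin (suc (two k)) k)
      ≡⟨ cong ((+ 2 + + 2 * + k) *_) (up (+ 1) (two k) k) ⟩
    (+ 2 + + 2 * + k) * (+ 1 * (+ 1 + + two k) * B k)              ≡⟨ cong (λ z → (+ 2 + + 2 * + k) * (+ 1 * (+ 1 + z) * B k)) (+two k) ⟩
    (+ 2 + + 2 * + k) * (+ 1 * (+ 1 + + 2 * + k) * B k)            ≡⟨ lem₂ (+ k) (B k) ⟩
    + suc k * (+ 2 * (+ 2 * + k + + 1) * B k)                      ∎)
    where open ≡-Reasoning
          lem₁ : ∀ k x → (+ 1 + k) * ((+ 2 + + 2 * k) * x) ≡ (+ 2 + + 2 * k) * ((+ 1 + + 2 * k - k) * x)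
          lem₁ = solve-∀
          lem₂ : ∀ k b → (+ 2 + + 2 * k) * (+ 1 * (+ 1 + + 2 * k) * b) ≡ (+ 1 + k) * (+ 2 * (+ 2 * k + + 1) * b)
          lem₂ = solve-∀

  T-suc : ∀ k → + suc k * (+ suc k * T (suc k)) ≡ + 3 * (+ 3 * + k + + 1) * (+ 3 * + k + + 2) * T k
  T-suc k = go (+ k) (bin (three k) k) (bin (suc (three k)) k) (bin (suc (suc (three k))) k) (bin (three (suc k)) (suc k)) (B k) (B (suc k))
               (+ three k) (+three k) (absorb (+ 1) (suc (suc (three k))) k) (up (+ 1) (suc (three k)) k) (up (+ 1) (three k) k) (B-suc k)
    where
      go : ∀ k b₀ b₁ b₂ b₃ c c′ t → t ≡ + 3 * k → (+ 1 + k) * b₃ ≡ (+ 3 + t) * b₂ → (+ 2 + t - k) * b₂ ≡ + 1 * (+ 2 + t) * b₁ →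
           (+ 1 + t - k) * b₁ ≡ + 1 * (+ 1 + t) * b₀ → (+ 1 + k) * c′ ≡ + 2 * (+ 2 * k + + 1) * c →
           (+ 1 + k) * ((+ 1 + k) * (b₃ * c′)) ≡ + 3 * (+ 3 * k + + 1) * (+ 3 * k + + 2) * (b₀ * c)
      go k b₀ b₁ b₂ b₃ c c′ _ refl e₁ e₂ e₃ e₄ = begin
        (+ 1 + k) * ((+ 1 + k) * (b₃ * c′))                            ≡⟨ l₀ k b₃ c′ ⟩
        (+ 1 + k) * b₃ * ((+ 1 + k) * c′)                              ≡⟨ cong₂ _*_ e₁ e₄ ⟩
        (+ 3 + + 3 * k) * b₂ * (+ 2 * (+ 2 * k + + 1) * c)             ≡⟨ l₁ k b₂ c ⟩
        + 3 * (+ 2 * k + + 1) * c * ((+ 2 + + 3 * k - k) * b₂)         ≡⟨ cong (+ 3 * (+ 2 * k + + 1) * c *_) e₂ ⟩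
        + 3 * (+ 2 * k + + 1) * c * (+ 1 * (+ 2 + + 3 * k) * b₁)       ≡⟨ l₂ k b₁ c ⟩
        + 3 * (+ 3 * k + + 2) * c * ((+ 1 + + 3 * k - k) * b₁)         ≡⟨ cong (+ 3 * (+ 3 * k + + 2) * c *_) e₃ ⟩
        + 3 * (+ 3 * k + + 2) * c * (+ 1 * (+ 1 + + 3 * k) * b₀)       ≡⟨ l₃ k b₀ c ⟩
        + 3 * (+ 3 * k + + 1) * (+ 3 * k + + 2) * (b₀ * c)             ∎
        where
          open ≡-Reasoning
          l₀ : ∀ k b c → (+ 1 + k) * ((+ 1 + k) * (b * c)) ≡ (+ 1 + k) * b * ((+ 1 + k) * c)
          l₀ = solve-∀
          l₁ : ∀ k b c → (+ 3 + + 3 * k) * b * (+ 2 * (+ 2 * k + + 1) * c) ≡ + 3 * (+ 2 * k + + 1) * c * ((+ 2 + + 3 * k - k) * b)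
          l₁ = solve-∀
          l₂ : ∀ k b c → + 3 * (+ 2 * k + + 1) * c * (+ 1 * (+ 2 + + 3 * k) * b) ≡ + 3 * (+ 3 * k + + 2) * c * ((+ 1 + + 3 * k - k) * b)
          l₂ = solve-∀
          l₃ : ∀ k b c → + 3 * (+ 3 * k + + 2) * c * (+ 1 * (+ 1 + + 3 * k) * b) ≡ + 3 * (+ 3 * k + + 1) * (+ 3 * k + + 2) * (b * c)
          l₃ = solve-∀

-- The recurrence of the Domb numbers and a second sum formula for them.

module DombRecurrence where

  open ThetaSeries using (sgnℕ)
  open Binomials

  bin-sym : ∀ n k l → k ℕ.+ l ≡ n → bin n k ≡ bin n l
  bin-sym zero    zero    zero    _ = refl
  bin-sym (suc n) zero    (suc l) e = ≡.trans (ℤP.^-zeroˡ (suc n)) (≡.sym (subst (λ z → bin (suc n) z ≡ + 1) (≡.sym e) (wb-diag (+ 1) (suc n))))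
  bin-sym (suc n) (suc k) zero    e = ≡.trans (subst (λ z → bin (suc n) z ≡ + 1) (≡.sym (≡.trans (≡.sym (ℕP.+-identityʳ (suc k))) e)) (wb-diag (+ 1) (suc n)))
    (≡.sym (ℤP.^-zeroˡ (suc n)))
  bin-sym (suc n) (suc k) (suc l) e = begin
    bin n k + + 1 * bin n (suc k)     ≡⟨ cong₂ (λ x y → x + + 1 * y) (bin-sym n k (suc l) e₁) (bin-sym n (suc k) l (≡.trans (≡.sym (ℕP.+-suc k l)) e₁)) ⟩
    bin n (suc l) + + 1 * bin n l     ≡⟨ lem (bin n (suc l)) (bin n l) ⟩
    bin n l + + 1 * bin n (suc l)     ∎
    where open ≡-Reasoning
          e₁ = ℕP.suc-injective e
          lem : ∀ x y → x + + 1 * y ≡ y + + 1 * x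
          lem = solve-∀

  F : ℕ → ℕ → ℤ
  F k l = bin (k ℕ.+ l) k * bin (k ℕ.+ l) k * (B k * B l)

  weighted : (ℤ → ℤ → ℤ) → ℕ → ℕ → ℤ
  weighted g k l = g (+ k) (+ l) * F k l

  -- Moments of the Domb summand with a weight polynomial in k and l. The recurrence is derived from
  -- relations between a few of these moments.
  ⟨_⟩ : (ℤ → ℤ → ℤ) → ℕ → ℤ
  ⟨ g ⟩ n = diag n (weighted g)

  Domb : ℕ → ℤ
  Domb n = diag n F

  F-suc : ∀ k l → + suc k * (+ suc k * (+ suc k * F (suc k) l)) ≡ + suc (k ℕ.+ l) * + suc (k ℕ.+ l) * (+ 2 * (+ 2 * + k + + 1)) * F k l
  F-suc k l = begin
    k′ * (k′ * (k′ * (b′ * b′ * (B (suc k) * B l))))                       ≡⟨ lem₁ k′ b′ (B (suc k)) (B l) ⟩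
    k′ * b′ * (k′ * b′) * (k′ * B (suc k) * B l)                           ≡⟨ cong₂ (λ x y → x * x * (y * B l)) (absorb (+ 1) (k ℕ.+ l) k) (B-suc k) ⟩
    n′ * b * (n′ * b) * (+ 2 * (+ 2 * + k + + 1) * B k * B l)              ≡⟨ lem₂ n′ b (+ 2 * (+ 2 * + k + + 1)) (B k) (B l) ⟩
    n′ * n′ * (+ 2 * (+ 2 * + k + + 1)) * F k l                            ∎
    where
      open ≡-Reasoning
      k′ = + suc k
      n′ = + suc (k ℕ.+ l)
      b = bin (k ℕ.+ l) k
      b′ = bin (suc (k ℕ.+ l)) (suc k)
      lem₁ : ∀ k b x y → k * (k * (k * (b * b * (x * y)))) ≡ k * b * (k * b) * (k * x * y)
      lem₁ = solve-∀
      lem₂ : ∀ n b c x y → n * b * (n * b) * (c * x * y) ≡ n * n * c * (b * b * (x * y))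
      lem₂ = solve-∀

  ⟨⟩-cong : ∀ n g h → (∀ k l → k + l ≡ + n → g k l ≡ h k l) → ⟨ g ⟩ n ≡ ⟨ h ⟩ n
  ⟨⟩-cong n g h e = diag-cong n {weighted g} {weighted h} (λ k l s → cong (_* F k l) (e (+ k) (+ l) (cong +_ s)))

  ⟨⟩-+ : ∀ n g h → ⟨ (λ k l → g k l + h k l) ⟩ n ≡ ⟨ g ⟩ n + ⟨ h ⟩ n
  ⟨⟩-+ n g h = ≡.trans (diag-cong n {weighted (λ k l → g k l + h k l)} {λ k l → weighted g k l + weighted h k l}
    (λ k l _ → ℤP.*-distribʳ-+ (F k l) (g (+ k) (+ l)) (h (+ k) (+ l)))) (diag-+ n (weighted g) (weighted h))

  ⟨⟩-* : ∀ n c g → ⟨ (λ k l → c * g k l) ⟩ n ≡ c * ⟨ g ⟩ n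
  ⟨⟩-* n c g = ≡.trans (diag-cong n {weighted (λ k l → c * g k l)} {λ k l → c * weighted g k l}
    (λ k l _ → ℤP.*-assoc c (g (+ k) (+ l)) (F k l))) (diag-* n c (weighted g))

  ⟨⟩-const : ∀ n c → ⟨ (λ _ _ → c) ⟩ n ≡ c * Domb n
  ⟨⟩-const n c = diag-* n c F

  ⟨⟩-sym : ∀ n g → ⟨ g ⟩ n ≡ ⟨ (λ k l → g l k) ⟩ n
  ⟨⟩-sym n g = ≡.trans (diag-sym n (weighted g)) (diag-cong n {λ k l → weighted g l k} {weighted (λ k l → g l k)} (λ k l s → cong (g (+ l) (+ k) *_) (F-sym k l)))
    where
      F-sym : ∀ k l → F l k ≡ F k l
      F-sym k l rewrite ℕP.+-comm l k | bin-sym (k ℕ.+ l) l k (ℕP.+-comm l k) = cong (λ z → bin (k ℕ.+ l) k * bin (k ℕ.+ l) k * z) (ℤP.*-comm (B l) (B k))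

  -- For k + l = n + 1 the summand satisfies k³ F(k,l) = (n+1)² 2(2k-1) F(k-1,l), so a factor k³
  -- lowers n by one.
  cube-shift : ∀ n (g : ℤ → ℤ → ℤ) → ⟨ (λ k l → k * (k * (k * g k l))) ⟩ (suc n) ≡ + suc n * + suc n * ⟨ (λ k l → + 2 * (+ 2 * k + + 1) * g (+ 1 + k) l) ⟩ n
  cube-shift n g = ≡.trans (cong₂ _+_ (ℤP.*-zeroˡ (F 0 (suc n))) (diag-cong n {λ k l → weighted (λ k l → k * (k * (k * g k l))) (suc k) l}
      {λ k l → + suc n * + suc n * weighted g′ k l} term)) (≡.trans (ℤP.+-identityˡ _) (diag-* n (+ suc n * + suc n) (weighted g′)))
    where
      g′ : ℤ → ℤ → ℤ
      g′ k l = + 2 * (+ 2 * k + + 1) * g (+ 1 + k) l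
      term : ∀ k l → k ℕ.+ l ≡ n → + suc k * (+ suc k * (+ suc k * g (+ suc k) (+ l))) * F (suc k) l
               ≡ + suc n * + suc n * (+ 2 * (+ 2 * + k + + 1) * g (+ 1 + + k) (+ l) * F k l)
      term k l refl = ≡.trans (lem₁ (+ suc k) (g (+ suc k) (+ l)) (F (suc k) l)) (≡.trans (cong (g (+ suc k) (+ l) *_) (F-suc k l))
          (lem₂ (+ suc (k ℕ.+ l)) (+ 2 * (+ 2 * + k + + 1)) (g (+ suc k) (+ l)) (F k l)))
        where lem₁ : ∀ k g f → k * (k * (k * g)) * f ≡ g * (k * (k * (k * f)))
              lem₁ = solve-∀
              lem₂ : ∀ n c g f → g * (n * n * c * f) ≡ n * n * (c * g * f)
              lem₂ = solve-∀

  private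
    h : ℤ → ℤ → ℤ
    h k l = + 2 * (+ 2 * k + + 1) * ((+ 1 + k) * (+ 1 + k) + + 5 * (+ 1 + k) * l + + 10 * l * l)

    -- Each monomial of (k + l)⁵ contains k³ or l³, and 5 is the least exponent with this property.
    -- The weight `h` is what the part divisible by k³ becomes under `cube-shift`.
    step₁ : ∀ n → + suc n * (+ suc n * (+ suc n * Domb (suc n))) ≡ + 2 * ⟨ h ⟩ n
    step₁ n = *-cancel n (*-cancel n (begin
      n′ * (n′ * (n′ * (n′ * (n′ * Domb (suc n)))))
        ≡⟨ lem₁ n′ (Domb (suc n)) ⟩
      n′ * n′ * n′ * n′ * n′ * Domb (suc n)
        ≡⟨ ⟨⟩-const (suc n) (n′ * n′ * n′ * n′ * n′) ⟨
      ⟨ (λ _ _ → n′ * n′ * n′ * n′ * n′) ⟩ (suc n)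
        ≡⟨ ⟨⟩-cong (suc n) (λ _ _ → n′ * n′ * n′ * n′ * n′) (λ k l → k * (k * (k * g k l)) + l * (l * (l * g l k)))
              (λ k l s → ≡.trans (cong (λ z → z * z * z * z * z) (≡.sym s)) (lem₂ k l)) ⟩
      ⟨ (λ k l → k * (k * (k * g k l)) + l * (l * (l * g l k))) ⟩ (suc n)
        ≡⟨ ⟨⟩-+ (suc n) (λ k l → k * (k * (k * g k l))) (λ k l → l * (l * (l * g l k))) ⟩
      ⟨ (λ k l → k * (k * (k * g k l))) ⟩ (suc n) + ⟨ (λ k l → l * (l * (l * g l k))) ⟩ (suc n)
        ≡⟨ cong (λ z → ⟨ (λ k l → k * (k * (k * g k l))) ⟩ (suc n) + z) (⟨⟩-sym (suc n) (λ k l → l * (l * (l * g l k)))) ⟩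
      ⟨ (λ k l → k * (k * (k * g k l))) ⟩ (suc n) + ⟨ (λ k l → k * (k * (k * g k l))) ⟩ (suc n)
        ≡⟨ cong (λ z → z + z) (cube-shift n g) ⟩
      n′ * n′ * ⟨ h ⟩ n + n′ * n′ * ⟨ h ⟩ n
        ≡⟨ lem₃ n′ (⟨ h ⟩ n) ⟩
      n′ * (n′ * (+ 2 * ⟨ h ⟩ n)) ∎))
      where
        open ≡-Reasoning
        n′ = + suc n
        g : ℤ → ℤ → ℤ
        g k l = k * k + + 5 * k * l + + 10 * l * l
        lem₁ : ∀ n d → n * (n * (n * (n * (n * d)))) ≡ n * n * n * n * n * d
        lem₁ = solve-∀
        lem₂ : ∀ k l → (k + l) * (k + l) * (k + l) * (k + l) * (k + l) ≡
          k * (k * (k * (k * k + + 5 * k * l + + 10 * l * l))) + l * (l * (l * (l * l + + 5 * l * k + + 10 * k * k)))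
        lem₂ = solve-∀
        lem₃ : ∀ n x → n * n * x + n * n * x ≡ n * (n * (+ 2 * x))
        lem₃ = solve-∀

    cubes : ℤ → ℤ → ℤ
    cubes k l = k * (k * (k * + 1)) + l * (l * (l * + 1))

    -- Symmetrised in k and l, `h` is a polynomial in k + l minus 16(k³ + l³), the one moment not
    -- determined by n alone.
    step₂ : ∀ n → + 2 * ⟨ h ⟩ n ≡ + 2 * (+ 2 * + n + + 1) * (+ 5 * + n * + n + + 5 * + n + + 2) * Domb n - + 16 * ⟨ cubes ⟩ n
    step₂ n = begin
      + 2 * ⟨ h ⟩ n
        ≡⟨ lem₁ (⟨ h ⟩ n) ⟩
      ⟨ h ⟩ n + ⟨ h ⟩ n
        ≡⟨ cong (λ z → ⟨ h ⟩ n + z) (⟨⟩-sym n h) ⟩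
      ⟨ h ⟩ n + ⟨ (λ k l → h l k) ⟩ n
        ≡⟨ ⟨⟩-+ n h (λ k l → h l k) ⟨
      ⟨ (λ k l → h k l + h l k) ⟩ n
        ≡⟨ ⟨⟩-cong n (λ k l → h k l + h l k) (λ k l → poly (+ n) + - + 16 * cubes k l) (λ k l s → ≡.trans (lem₂ k l) (cong (λ z → poly z + - + 16 * cubes k l) s)) ⟩
      ⟨ (λ k l → poly (+ n) + - + 16 * cubes k l) ⟩ n
        ≡⟨ ⟨⟩-+ n (λ _ _ → poly (+ n)) (λ k l → - + 16 * cubes k l) ⟩
      ⟨ (λ _ _ → poly (+ n)) ⟩ n + ⟨ (λ k l → - + 16 * cubes k l) ⟩ n
        ≡⟨ cong₂ _+_ (⟨⟩-const n (poly (+ n))) (⟨⟩-* n (- + 16) cubes) ⟩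
      poly (+ n) * Domb n + - + 16 * ⟨ cubes ⟩ n
        ≡⟨ lem₃ (poly (+ n) * Domb n) (⟨ cubes ⟩ n) ⟩
      poly (+ n) * Domb n - + 16 * ⟨ cubes ⟩ n ∎
      where
        open ≡-Reasoning
        poly : ℤ → ℤ
        poly n = + 2 * (+ 2 * n + + 1) * (+ 5 * n * n + + 5 * n + + 2)
        lem₁ : ∀ x → + 2 * x ≡ x + x
        lem₁ = solve-∀
        lem₂ : ∀ k l →
          + 2 * (+ 2 * k + + 1) * ((+ 1 + k) * (+ 1 + k) + + 5 * (+ 1 + k) * l + + 10 * l * l) + + 2 * (+ 2 * l + + 1) * ((+ 1 + l) * (+ 1 + l) + + 5 * (+ 1 + l) * k + + 10 * k * k)
          ≡ + 2 * (+ 2 * (k + l) + + 1) * (+ 5 * (k + l) * (k + l) + + 5 * (k + l) + + 2) + - + 16 * (k * (k * (k * + 1)) + l * (l * (l * + 1)))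
        lem₂ = solve-∀
        lem₃ : ∀ x y → x + - + 16 * y ≡ x - + 16 * y
        lem₃ = solve-∀

    -- The remaining moment consists of cubes and shifts once more. Its symmetrised weight is now
    -- 4(n + 1), constant along the diagonal, and this closes the recurrence.
    step₃ : ∀ n → ⟨ cubes ⟩ (suc n) ≡ + 4 * + suc n * + suc n * + suc n * Domb n
    step₃ n = begin
      ⟨ cubes ⟩ (suc n)
        ≡⟨ ⟨⟩-+ (suc n) k³ (λ k l → k³ l k) ⟩
      ⟨ k³ ⟩ (suc n) + ⟨ (λ k l → k³ l k) ⟩ (suc n)
        ≡⟨ cong (λ z → ⟨ k³ ⟩ (suc n) + z) (⟨⟩-sym (suc n) (λ k l → k³ l k)) ⟩
      ⟨ k³ ⟩ (suc n) + ⟨ k³ ⟩ (suc n)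
        ≡⟨ cong (λ z → z + z) (cube-shift n (λ _ _ → + 1)) ⟩
      n′ * n′ * ⟨ g ⟩ n + n′ * n′ * ⟨ g ⟩ n
        ≡⟨ ℤP.*-distribˡ-+ (n′ * n′) (⟨ g ⟩ n) (⟨ g ⟩ n) ⟨
      n′ * n′ * (⟨ g ⟩ n + ⟨ g ⟩ n)
        ≡⟨ cong (λ z → n′ * n′ * (⟨ g ⟩ n + z)) (⟨⟩-sym n g) ⟩
      n′ * n′ * (⟨ g ⟩ n + ⟨ (λ k l → g l k) ⟩ n)
        ≡⟨ cong (n′ * n′ *_) (⟨⟩-+ n g (λ k l → g l k)) ⟨
      n′ * n′ * ⟨ (λ k l → g k l + g l k) ⟩ n
        ≡⟨ cong (n′ * n′ *_) (≡.trans (⟨⟩-cong n (λ k l → g k l + g l k) (λ _ _ → + 4 * n′) (λ k l s → ≡.trans (lem₁ k l) (cong (λ z → + 4 * (+ 1 + z)) s))) (⟨⟩-const n (+ 4 * n′))) ⟩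
      n′ * n′ * (+ 4 * n′ * Domb n)
        ≡⟨ lem₂ n′ (Domb n) ⟩
      + 4 * n′ * n′ * n′ * Domb n ∎
      where
        open ≡-Reasoning
        n′ = + suc n
        k³ g : ℤ → ℤ → ℤ
        k³ k l = k * (k * (k * + 1))
        g k l = + 2 * (+ 2 * k + + 1) * + 1
        lem₁ : ∀ k l → + 2 * (+ 2 * k + + 1) * + 1 + + 2 * (+ 2 * l + + 1) * + 1 ≡ + 4 * (+ 1 + (k + l))
        lem₁ = solve-∀
        lem₂ : ∀ n d → n * n * (+ 4 * n * d) ≡ + 4 * n * n * n * d
        lem₂ = solve-∀

  Recurrence : (ℕ → ℤ) → Set
  Recurrence a = ∀ n → + suc (suc n) * (+ suc (suc n) * (+ suc (suc n) * a (suc (suc n)))) ≡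
    + 2 * (+ 2 * + n + + 3) * (+ 5 * + n * + n + + 15 * + n + + 12) * a (suc n) - + 64 * + suc n * + suc n * + suc n * a n

  Domb-recurrence : Recurrence Domb
  Domb-recurrence n = ≡.trans (step₁ (suc n)) (≡.trans (step₂ (suc n)) (≡.trans
    (cong (λ z → + 2 * (+ 2 * + suc n + + 1) * (+ 5 * + suc n * + suc n + + 5 * + suc n + + 2) * Domb (suc n) - + 16 * z) (step₃ n))
    (lem (+ n) (Domb (suc n)) (Domb n))))
    where lem : ∀ n a b → + 2 * (+ 2 * (+ 1 + n) + + 1) * (+ 5 * (+ 1 + n) * (+ 1 + n) + + 5 * (+ 1 + n) + + 2) * a - + 16 * (+ 4 * (+ 1 + n) * (+ 1 + n) * (+ 1 + n) * b)
                  ≡ + 2 * (+ 2 * n + + 3) * (+ 5 * n * n + + 15 * n + + 12) * a - + 64 * (+ 1 + n) * (+ 1 + n) * (+ 1 + n) * b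
          lem = solve-∀

  -- The factor `wb` equals C(n+2k,3k) 16^(n-k), and the last one is C(2k,k)² C(3k,k).
  r : ℕ → ℕ → ℤ
  r n k = sgnℕ k * wb (+ 16) (two k ℕ.+ n) (three k) * (B k * T k)

  R : ℕ → ℤ
  R n = ∑ n (r n)

  two+k : ∀ k → two k ℕ.+ k ≡ three k
  two+k zero = refl
  two+k (suc k) = cong (λ z → suc (suc z)) (≡.trans (ℕP.+-suc (two k) k) (cong suc (two+k k)))

  r-low : ∀ n k → n < k → r n k ≡ + 0
  r-low n k l = ≡.trans (cong (λ z → sgnℕ k * z * (B k * T k)) (wb-low (+ 16) (two k ℕ.+ n) (three k)
      (subst (two k ℕ.+ n <_) (two+k k) (ℕP.+-monoʳ-< (two k) l)))) (lem (sgnℕ k) (B k * T k))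
    where lem : ∀ x y → x * + 0 * y ≡ + 0
          lem = solve-∀

  r-up : ∀ n k → (+ suc n - + k) * r (suc n) k ≡ + 16 * (+ n + + 2 * + k + + 1) * r n k
  r-up n k rewrite ℕP.+-suc (two k) n = begin
    (+ suc n - + k) * (sgnℕ k * w′ * c)                                  ≡⟨ lem₁ (+ n) (+ k) (sgnℕ k) w′ c ⟩
    sgnℕ k * ((+ 1 + (+ 2 * + k + + n) - + 3 * + k) * w′) * c            ≡⟨ cong₂ (λ x y → sgnℕ k * ((+ 1 + (x + + n) - y) * w′) * c) (+two k) (+three k) ⟨
    sgnℕ k * ((+ suc (two k ℕ.+ n) - + three k) * w′) * c                ≡⟨ cong (λ z → sgnℕ k * z * c) (up (+ 16) (two k ℕ.+ n) (three k)) ⟩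
    sgnℕ k * (+ 16 * (+ 1 + (+ two k + + n)) * w) * c                    ≡⟨ cong (λ z → sgnℕ k * (+ 16 * (+ 1 + (z + + n)) * w) * c) (+two k) ⟩
    sgnℕ k * (+ 16 * (+ 1 + (+ 2 * + k + + n)) * w) * c                  ≡⟨ lem₂ (+ n) (+ k) (sgnℕ k) w c ⟩
    + 16 * (+ n + + 2 * + k + + 1) * (sgnℕ k * w * c)                    ∎
    where
      open ≡-Reasoning
      c = B k * T k
      w = wb (+ 16) (two k ℕ.+ n) (three k)
      w′ = wb (+ 16) (suc (two k ℕ.+ n)) (three k)
      lem₁ : ∀ n k s w c → (+ 1 + n - k) * (s * w * c) ≡ s * ((+ 1 + (+ 2 * k + n) - + 3 * k) * w) * c
      lem₁ = solve-∀
      lem₂ : ∀ n k s w c → s * (+ 16 * (+ 1 + (+ 2 * k + n)) * w) * c ≡ + 16 * (n + + 2 * k + + 1) * (s * w * c)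
      lem₂ = solve-∀

  private
    r-diag-core : ∀ (t : ℕ) x s w₀ w₁ w₂ w₃ m₁ m₂ m₃ d b b′ c c′ →
      + 3 * x ≡ + suc (suc (suc t)) → + suc (suc (suc t)) * w₃ ≡ m₃ * w₂ → + suc (suc t) * w₂ ≡ m₂ * w₁ → + suc t * w₁ ≡ m₁ * w₀ →
      x * b′ ≡ d * b → x * (x * c′) ≡ + 3 * + suc t * + suc (suc t) * c →
      x * (x * (x * (x * (- s * w₃ * (b′ * c′))))) ≡ - (d * m₃ * m₂ * m₁) * (s * w₀ * (b * c))
    r-diag-core t x s w₀ w₁ w₂ w₃ m₁ m₂ m₃ d b b′ c c′ x≡ e₃ e₂ e₁ eb ec = *-cancel 2 (*-cancel t (*-cancel (suc t) (begin
      z * (y * (+ 3 * (x * (x * (x * (x * (- s * w₃ * (b′ * c′))))))))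
        ≡⟨ l₁ x y z s w₃ b′ c′ ⟩
      - s * (y * (z * (+ 3 * x * w₃))) * (x * b′ * (x * (x * c′)))
        ≡⟨ cong₂ (λ u v → - s * u * v) w-chain (cong₂ _*_ eb ec) ⟩
      - s * (m₃ * (m₂ * (m₁ * w₀))) * (d * b * (+ 3 * y * z * c))
        ≡⟨ l₂ y z m₁ m₂ m₃ s w₀ d b c ⟩
      z * (y * (+ 3 * (- (d * m₃ * m₂ * m₁) * (s * w₀ * (b * c))))) ∎)))
      where
        open ≡-Reasoning
        y = + suc t
        z = + suc (suc t)
        swap : ∀ a b c → a * (b * c) ≡ b * (a * c)
        swap = solve-∀
        w-chain : y * (z * (+ 3 * x * w₃)) ≡ m₃ * (m₂ * (m₁ * w₀))
        w-chain = begin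
          y * (z * (+ 3 * x * w₃))       ≡⟨ cong (λ v → y * (z * v)) (≡.trans (cong (_* w₃) x≡) e₃) ⟩
          y * (z * (m₃ * w₂))            ≡⟨ cong (y *_) (swap z m₃ w₂) ⟩
          y * (m₃ * (z * w₂))            ≡⟨ cong (λ v → y * (m₃ * v)) e₂ ⟩
          y * (m₃ * (m₂ * w₁))           ≡⟨ ≡.trans (swap y m₃ (m₂ * w₁)) (cong (m₃ *_) (swap y m₂ w₁)) ⟩
          m₃ * (m₂ * (y * w₁))           ≡⟨ cong (λ v → m₃ * (m₂ * v)) e₁ ⟩
          m₃ * (m₂ * (m₁ * w₀))          ∎
        l₁ : ∀ x y z s w b c → z * (y * (+ 3 * (x * (x * (x * (x * (- s * w * (b * c)))))))) ≡ - s * (y * (z * (+ 3 * x * w))) * (x * b * (x * (x * c)))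
        l₁ = solve-∀
        l₂ : ∀ y z m₁ m₂ m₃ s w d b c → - s * (m₃ * (m₂ * (m₁ * w))) * (d * b * (+ 3 * y * z * c)) ≡ z * (y * (+ 3 * (- (d * m₃ * m₂ * m₁) * (s * w * (b * c)))))
        l₂ = solve-∀

    r-shape : ℕ → ℕ → ℕ → ℤ
    r-shape N k j = sgnℕ k * wb (+ 16) N j * (B k * T k)

  -- Along the diagonal both n + 2k and 3k grow by three, so three uses of `absorb` suffice and the
  -- difference n - k does not enter.
  r-diag : ∀ n k → + suc k * (+ suc k * (+ suc k * (+ suc k * r (suc n) (suc k)))) ≡
    - (+ 2 * (+ 2 * + k + + 1) * (+ n + + 2 * + k + + 3) * (+ n + + 2 * + k + + 2) * (+ n + + 2 * + k + + 1)) * r n k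
  r-diag n k = begin
    x * (x * (x * (x * r (suc n) (suc k))))
      ≡⟨ cong (λ N → x * (x * (x * (x * r-shape N (suc k) (three (suc k)))))) (cong (λ z → suc (suc z)) (ℕP.+-suc (two k) n)) ⟩
    x * (x * (x * (x * r-shape (suc (suc (suc M))) (suc k) (three (suc k)))))
      ≡⟨ r-diag-core (three k) x (sgnℕ k) w₀ w₁ w₂ w₃ (+ suc M) (+ suc (suc M)) (+ suc (suc (suc M))) d (B k) (B (suc k)) (T k) (T (suc k))
           (≡.sym (+three (suc k))) (absorb (+ 16) (suc (suc M)) (suc (suc (three k)))) (absorb (+ 16) (suc M) (suc (three k))) (absorb (+ 16) M (three k))
           (B-suc k) (≡.trans (T-suc k) (cong₂ (λ u v → + 3 * u * v * T k) y≡ z≡)) ⟩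
    - (d * + suc (suc (suc M)) * + suc (suc M) * + suc M) * r n k
      ≡⟨ cong (λ m → - (d * (+ 3 + m) * (+ 2 + m) * (+ 1 + m)) * r n k) (≡.trans (cong (_+ + n) (+two k)) (ℤP.+-comm (+ 2 * + k) (+ n))) ⟩
    - (d * (+ 3 + m) * (+ 2 + m) * (+ 1 + m)) * r n k
      ≡⟨ cong (λ z → - z * r n k) (≡.trans (cong₂ (λ u v → d * u * v * (+ 1 + m)) (ℤP.+-comm (+ 3) m) (ℤP.+-comm (+ 2) m)) (cong (λ v → d * (m + + 3) * (m + + 2) * v) (ℤP.+-comm (+ 1) m))) ⟩
    - (d * (m + + 3) * (m + + 2) * (m + + 1)) * r n k ∎
    where
      open ≡-Reasoning
      M = two k ℕ.+ n
      m = + n + + 2 * + k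
      x = + suc k
      d = + 2 * (+ 2 * + k + + 1)
      w₀ = wb (+ 16) M (three k)
      w₁ = wb (+ 16) (suc M) (suc (three k))
      w₂ = wb (+ 16) (suc (suc M)) (suc (suc (three k)))
      w₃ = wb (+ 16) (suc (suc (suc M))) (suc (suc (suc (three k))))
      y≡ : + 3 * + k + + 1 ≡ + suc (three k)
      y≡ = ≡.trans (ℤP.+-comm (+ 3 * + k) (+ 1)) (cong (λ v → + 1 + v) (≡.sym (+three k)))
      z≡ : + 3 * + k + + 2 ≡ + suc (suc (three k))
      z≡ = ≡.trans (ℤP.+-comm (+ 3 * + k) (+ 2)) (cong (λ v → + 2 + v) (≡.sym (+three k)))

  -- Zeilberger's certificate for the recurrence.

  G : ℕ → ℕ → ℤ
  G n zero    = + 0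
  G n (suc k) = + 6 * (+ 3 * + n + + 5) * ((+ 2 * + k + + 1) * (+ n + + 2 * + k + + 2)) * r (suc n) k

  -- A diagonal step expresses the certificate through r(n+2,k), so that it can be compared with the
  -- other terms at the same k.
  G-relation : ∀ n k → + 256 * ((+ n + + 2 * + k + + 1) * (+ n + + 2 * + k + + 2)) * G n k ≡ - + 768 * (+ 3 * + n + + 5) * (+ k * (+ k * (+ k * (+ k * r (suc (suc n)) k))))
  G-relation n zero = lem (+ n) (r (suc (suc n)) 0)
    where lem : ∀ n x → + 256 * ((n + + 2 * + 0 + + 1) * (n + + 2 * + 0 + + 2)) * + 0 ≡ - + 768 * (+ 3 * n + + 5) * (+ 0 * (+ 0 * (+ 0 * (+ 0 * x))))
          lem = solve-∀
  G-relation n (suc k) = ≡.trans (lem (+ n) (+ k) (r (suc n) k)) (cong (- + 768 * (+ 3 * + n + + 5) *_) (≡.sym (r-diag (suc n) k)))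
    where lem : ∀ n k x → + 256 * ((n + + 2 * (+ 1 + k) + + 1) * (n + + 2 * (+ 1 + k) + + 2)) * (+ 6 * (+ 3 * n + + 5) * ((+ 2 * k + + 1) * (n + + 2 * k + + 2)) * x) ≡
                    - + 768 * (+ 3 * n + + 5) * (- (+ 2 * (+ 2 * k + + 1) * (+ 1 + n + + 2 * k + + 3) * (+ 1 + n + + 2 * k + + 2) * (+ 1 + n + + 2 * k + + 1)) * x)
          lem = solve-∀

  private
    -- The multiplier 256(n+2k+1)(n+2k+2) allows both r(n,k) and r(n+1,k) to be rewritten as
    -- polynomial multiples of ρ = r(n+2,k) by `r-up`, without dividing by n + 1 - k, which vanishes
    -- at k = n + 1. What is left is the polynomial identity `core`.
    certificate : ∀ n k ρ r₁ r₀ g → (+ 2 + n - k) * ρ ≡ + 16 * (+ 1 + n + + 2 * k + + 1) * r₁ → (+ 1 + n - k) * r₁ ≡ + 16 * (n + + 2 * k + + 1) * r₀ →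
      + 256 * ((n + + 2 * k + + 1) * (n + + 2 * k + + 2)) * g ≡ - + 768 * (+ 3 * n + + 5) * (k * (k * (k * (k * ρ)))) →
      + 256 * ((n + + 2 * k + + 1) * (n + + 2 * k + + 2)) * ((+ 2 + n) * ((+ 2 + n) * ((+ 2 + n) * ρ)) - + 2 * (+ 2 * n + + 3) * (+ 5 * n * n + + 15 * n + + 12) * r₁ + + 64 * (+ 1 + n) * (+ 1 + n) * (+ 1 + n) * r₀) ≡
      + 256 * ((n + + 2 * k + + 1) * (n + + 2 * k + + 2)) * (+ 6 * (+ 3 * n + + 5) * ((+ 2 * k + + 1) * (n + + 2 * k + + 2)) * r₁ - g)
    certificate n k ρ r₁ r₀ g e₂ e₁ eg = begin
      + 256 * (p * p′) * (ρ′ - b * r₁ + c * r₀)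
        ≡⟨ expand p p′ b c ρ′ r₁ r₀ ⟩
      + 256 * (p * p′) * + 1 * ρ′ - + 16 * p * b * (+ 16 * p′ * r₁) + + 16 * p′ * c * (+ 16 * p * r₀)
        ≡⟨ cong (λ z → + 256 * (p * p′) * + 1 * ρ′ - + 16 * p * b * (+ 16 * p′ * r₁) + + 16 * p′ * c * z) (≡.sym e₁) ⟩
      + 256 * (p * p′) * + 1 * ρ′ - + 16 * p * b * (+ 16 * p′ * r₁) + + 16 * p′ * c * (u * r₁)
        ≡⟨ cong (λ z → + 256 * (p * p′) * + 1 * ρ′ - + 16 * p * b * (+ 16 * p′ * r₁) + z) (swap p′ c u r₁) ⟩
      + 256 * (p * p′) * + 1 * ρ′ - + 16 * p * b * (+ 16 * p′ * r₁) + c * u * (+ 16 * p′ * r₁)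
        ≡⟨ cong (λ z → + 256 * (p * p′) * + 1 * ρ′ - + 16 * p * b * z + c * u * z) e₂′ ⟩
      + 256 * (p * p′) * + 1 * ρ′ - + 16 * p * b * (v * ρ) + c * u * (v * ρ)
        ≡⟨ core n k ρ ⟩
      + 16 * p * f * (v * ρ) - (- + 768 * (+ 3 * n + + 5) * (k * (k * (k * (k * ρ)))))
        ≡⟨ cong₂ (λ x y → + 16 * p * f * x - y) (≡.sym e₂′) (≡.sym eg) ⟩
      + 16 * p * f * (+ 16 * p′ * r₁) - + 256 * (p * p′) * g
        ≡⟨ collect p p′ f r₁ g ⟩
      + 256 * (p * p′) * (f * r₁ - g) ∎
      where
        open ≡-Reasoning
        p = n + + 2 * k + + 1
        p′ = n + + 2 * k + + 2
        b = + 2 * (+ 2 * n + + 3) * (+ 5 * n * n + + 15 * n + + 12)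
        c = + 64 * (+ 1 + n) * (+ 1 + n) * (+ 1 + n)
        f = + 6 * (+ 3 * n + + 5) * ((+ 2 * k + + 1) * (n + + 2 * k + + 2))
        u = + 1 + n - k
        v = + 2 + n - k
        ρ′ = (+ 2 + n) * ((+ 2 + n) * ((+ 2 + n) * ρ))
        e₂′ : + 16 * p′ * r₁ ≡ v * ρ
        e₂′ = ≡.trans (cong (λ z → + 16 * z * r₁) (shift n k)) (≡.sym e₂)
          where shift : ∀ n k → n + + 2 * k + + 2 ≡ + 1 + n + + 2 * k + + 1
                shift = solve-∀
        expand : ∀ p p′ b c ρ r₁ r₀ → + 256 * (p * p′) * (ρ - b * r₁ + c * r₀) ≡ + 256 * (p * p′) * + 1 * ρ - + 16 * p * b * (+ 16 * p′ * r₁) + + 16 * p′ * c * (+ 16 * p * r₀)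
        expand = solve-∀
        swap : ∀ p′ c u r₁ → + 16 * p′ * c * (u * r₁) ≡ c * u * (+ 16 * p′ * r₁)
        swap = solve-∀
        core : ∀ n k ρ → + 256 * ((n + + 2 * k + + 1) * (n + + 2 * k + + 2)) * + 1 * ((+ 2 + n) * ((+ 2 + n) * ((+ 2 + n) * ρ)))
            - + 16 * (n + + 2 * k + + 1) * (+ 2 * (+ 2 * n + + 3) * (+ 5 * n * n + + 15 * n + + 12)) * ((+ 2 + n - k) * ρ)
            + + 64 * (+ 1 + n) * (+ 1 + n) * (+ 1 + n) * (+ 1 + n - k) * ((+ 2 + n - k) * ρ)
          ≡ + 16 * (n + + 2 * k + + 1) * (+ 6 * (+ 3 * n + + 5) * ((+ 2 * k + + 1) * (n + + 2 * k + + 2))) * ((+ 2 + n - k) * ρ) - (- + 768 * (+ 3 * n + + 5) * (k * (k * (k * (k * ρ)))))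
        core = solve-∀
        collect : ∀ p p′ f r₁ g → + 16 * p * f * (+ 16 * p′ * r₁) - + 256 * (p * p′) * g ≡ + 256 * (p * p′) * (f * r₁ - g)
        collect = solve-∀

  cancel-product : ∀ a b c {x y} → + suc c * (+ suc a * + suc b) * x ≡ + suc c * (+ suc a * + suc b) * y → x ≡ y
  cancel-product a b c {x} {y} e = *-cancel b (*-cancel a (*-cancel c (≡.trans (lem (+ suc a) (+ suc b) (+ suc c) x) (≡.trans e (≡.sym (lem (+ suc a) (+ suc b) (+ suc c) y))))))
    where lem : ∀ a b c x → c * (a * (b * x)) ≡ c * (a * b) * x
          lem = solve-∀

  telescope : ∀ K (g : ℕ → ℤ) → ∑ K (λ k → g (suc k) - g k) ≡ g (suc K) - g 0
  telescope zero    g = refl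
  telescope (suc K) g = ≡.trans (cong (_+ (g (suc (suc K)) - g (suc K))) (telescope K g)) (lem (g (suc (suc K))) (g (suc K)) (g 0))
    where lem : ∀ x y z → y - z + (x - y) ≡ x - z
          lem = solve-∀

  R-recurrence : Recurrence R
  R-recurrence n = solved (begin
    n₂ * (n₂ * (n₂ * R (suc (suc n)))) - c₁ * R (suc n) + c₀ * R n
      ≡⟨ cong₂ (λ x y → n₂ * (n₂ * (n₂ * R (suc (suc n)))) - c₁ * x + c₀ * y) (extend (suc n) 1) (extend n 2) ⟩
    n₂ * (n₂ * (n₂ * ∑ K (r (suc (suc n))))) - c₁ * ∑ K (r (suc n)) + c₀ * ∑ K (r n)
      ≡⟨ combine ⟨
    ∑ K term
      ≡⟨ ∑-cong K (λ k _ → term≡ k) ⟩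
    ∑ K (λ k → G n (suc k) - G n k)
      ≡⟨ telescope K (G n) ⟩
    + 6 * (+ 3 * + n + + 5) * ((+ 2 * + K + + 1) * (+ n + + 2 * + K + + 2)) * r (suc n) K - + 0
      ≡⟨ cong (λ z → + 6 * (+ 3 * + n + + 5) * ((+ 2 * + K + + 1) * (+ n + + 2 * + K + + 2)) * z - + 0) (r-low (suc n) K ℕP.≤-refl) ⟩
    + 6 * (+ 3 * + n + + 5) * ((+ 2 * + K + + 1) * (+ n + + 2 * + K + + 2)) * + 0 - + 0
      ≡⟨ cong (_- + 0) (ℤP.*-zeroʳ (+ 6 * (+ 3 * + n + + 5) * ((+ 2 * + K + + 1) * (+ n + + 2 * + K + + 2)))) ⟩
    + 0 ∎)
    where
      open ≡-Reasoning
      -- With this upper limit all three sums are complete, and the upper boundary term carries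
      -- r(n+1,n+2) = 0.
      K = suc (suc n)
      n₂ = + suc (suc n)
      c₁ = + 2 * (+ 2 * + n + + 3) * (+ 5 * + n * + n + + 15 * + n + + 12)
      c₀ = + 64 * + suc n * + suc n * + suc n
      extend : ∀ m j → R m ≡ ∑ (j ℕ.+ m) (r m)
      extend m j = ≡.sym (∑-extend j (r-low m))
      term : ℕ → ℤ
      term k = n₂ * (n₂ * (n₂ * r (suc (suc n)) k)) - c₁ * r (suc n) k + c₀ * r n k
      term≡ : ∀ k → term k ≡ G n (suc k) - G n k
      term≡ k = cancel-product (n ℕ.+ two k) (suc (n ℕ.+ two k)) 255
        (subst (λ z → + 256 * z * term k ≡ + 256 * z * (G n (suc k) - G n k)) factor
          (certificate (+ n) (+ k) (r (suc (suc n)) k) (r (suc n) k) (r n k) (G n k) (r-up (suc n) k) (r-up n k) (G-relation n k)))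
        where
          factor : (+ n + + 2 * + k + + 1) * (+ n + + 2 * + k + + 2) ≡ + suc (n ℕ.+ two k) * + suc (suc (n ℕ.+ two k))
          factor = ≡.trans (lem (+ n) (+ 2 * + k)) (cong (λ z → (+ 1 + (+ n + z)) * (+ 2 + (+ n + z))) (≡.sym (+two k)))
            where lem : ∀ n k → (n + k + + 1) * (n + k + + 2) ≡ (+ 1 + (n + k)) * (+ 2 + (n + k))
                  lem = solve-∀
      combine : ∑ K term ≡ n₂ * (n₂ * (n₂ * ∑ K (r (suc (suc n))))) - c₁ * ∑ K (r (suc n)) + c₀ * ∑ K (r n)
      combine = go n₂ c₁ c₀ (r (suc (suc n))) (r (suc n)) (r n) K
        where
          base : ∀ a c d x y z x′ y′ z′ → a * (a * (a * x)) - c * y + d * z + (a * (a * (a * x′)) - c * y′ + d * z′) ≡ a * (a * (a * (x + x′))) - c * (y + y′) + d * (z + z′)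
          base = solve-∀
          go : ∀ a c d (x y z : ℕ → ℤ) K → ∑ K (λ k → a * (a * (a * x k)) - c * y k + d * z k) ≡ a * (a * (a * ∑ K x)) - c * ∑ K y + d * ∑ K z
          go a c d x y z zero = refl
          go a c d x y z (suc K) = ≡.trans (cong (_+ (a * (a * (a * x (suc K))) - c * y (suc K) + d * z (suc K))) (go a c d x y z K)) (base a c d (∑ K x) (∑ K y) (∑ K z) (x (suc K)) (y (suc K)) (z (suc K)))
      solved : ∀ {x y z} → x - y + z ≡ + 0 → x ≡ y - z
      solved {x} {y} {z} e = ≡.trans (lem x y z) (≡.trans (cong (λ w → y - z + w) e) (ℤP.+-identityʳ (y - z)))
        where lem : ∀ x y z → x ≡ y - z + (x - y + z)
              lem = solve-∀

  recurrence-unique : ∀ {a b} → Recurrence a → Recurrence b → a 0 ≡ b 0 → a 1 ≡ b 1 → ∀ n → a n ≡ b n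
  recurrence-unique {a} {b} ra rb e₀ e₁ n = proj₁ (go n)
    where
      go : ∀ n → a n ≡ b n × a (suc n) ≡ b (suc n)
      go zero = e₀ , e₁
      go (suc n) with go n
      ... | h₀ , h₁ = h₁ , *-cancel (suc n) (*-cancel (suc n) (*-cancel (suc n) (≡.trans (ra n) (≡.trans
        (cong₂ (λ x y → + 2 * (+ 2 * + n + + 3) * (+ 5 * + n * + n + + 15 * + n + + 12) * x - + 64 * + suc n * + suc n * + suc n * y) h₁ h₀) (≡.sym (rb n))))))

  Domb≡R : ∀ n → Domb n ≡ R n
  Domb≡R = recurrence-unique Domb-recurrence R-recurrence refl refl

-- Clausen's formula for Legendre polynomials at the argument t with t² = 1/2.

module Legendre where

  open ThetaSeries using (sgnℕ)
  open Binomials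

  -- With t² = 1/2 and P_n the Legendre polynomials, U n = (2/t)^n P_n(t),
  -- X n = 8^n P_n(t)² and Z n = 8^n P_(n+1)(t) P_n(t) / t.

  x z u : ℕ → ℕ → ℤ
  x n k = sgnℕ k * wb (+ 8) n k * bin (k ℕ.+ n) k * B k
  z n k = sgnℕ k * wb (+ 8) n k * bin (k ℕ.+ suc n) k * B k
  u n k = sgnℕ k * wb (+ 2) n (two k) * B k

  X Z U : ℕ → ℤ
  X n = ∑ n (x n)
  Z n = ∑ n (z n)
  U n = ∑ n (u n)

  private
    shape : ∀ s w {w′} b c → w ≡ w′ → w′ ≡ + 0 → s * w * b * c ≡ + 0
    shape s _ b c refl refl = lem s b c
      where lem : ∀ s b c → s * + 0 * b * c ≡ + 0
            lem = solve-∀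

  x-low : ∀ n k → n < k → x n k ≡ + 0
  x-low n k l = shape (sgnℕ k) _ (bin (k ℕ.+ n) k) (B k) refl (wb-low (+ 8) n k l)

  z-low : ∀ n k → n < k → z n k ≡ + 0
  z-low n k l = shape (sgnℕ k) _ (bin (k ℕ.+ suc n) k) (B k) refl (wb-low (+ 8) n k l)

  u-low : ∀ n k → n < k → u n k ≡ + 0
  u-low n k l = ≡.trans (cong (λ w → sgnℕ k * w * B k) (wb-low (+ 2) n (two k) (ℕP.<-≤-trans l (k≤two k)))) (lem (sgnℕ k) (B k))
    where lem : ∀ s c → s * + 0 * c ≡ + 0
          lem = solve-∀
          k≤two : ∀ k → k ≤ two k
          k≤two zero = z≤n
          k≤two (suc k) = s≤s (ℕP.m≤n⇒m≤1+n (k≤two k))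

  ∑-linear : ∀ K a b c d (f g h i : ℕ → ℤ) → ∑ K (λ k → a * f k + b * g k + c * h k + d * i k) ≡ a * ∑ K f + b * ∑ K g + c * ∑ K h + d * ∑ K i
  ∑-linear zero    a b c d f g h i = refl
  ∑-linear (suc K) a b c d f g h i = ≡.trans (cong (_+ (a * f (suc K) + b * g (suc K) + c * h (suc K) + d * i (suc K))) (∑-linear K a b c d f g h i))
      (lem a b c d (∑ K f) (∑ K g) (∑ K h) (∑ K i) (f (suc K)) (g (suc K)) (h (suc K)) (i (suc K)))
    where lem : ∀ a b c d f g h i f′ g′ h′ i′ → a * f + b * g + c * h + d * i + (a * f′ + b * g′ + c * h′ + d * i′) ≡ a * (f + f′) + b * (g + g′) + c * (h + h′) + d * (i + i′)
          lem = solve-∀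

  private
    bin-up : ∀ n k → (+ 2 + + n) * bin (k ℕ.+ suc (suc n)) k ≡ (+ n + + k + + 2) * bin (k ℕ.+ suc n) k
    bin-up n k = begin
      (+ 2 + + n) * bin (k ℕ.+ suc (suc n)) k
        ≡⟨ cong (λ N → (+ 2 + + n) * bin N k) (ℕP.+-suc k (suc n)) ⟩
      (+ 2 + + n) * bin (suc (k ℕ.+ suc n)) k
        ≡⟨ cong (_* bin (suc (k ℕ.+ suc n)) k) (lem₁ (+ n) (+ k)) ⟩
      (+ suc (k ℕ.+ suc n) - + k) * bin (suc (k ℕ.+ suc n)) k
        ≡⟨ up (+ 1) (k ℕ.+ suc n) k ⟩
      + 1 * + suc (k ℕ.+ suc n) * bin (k ℕ.+ suc n) k
        ≡⟨ cong (_* bin (k ℕ.+ suc n) k) (lem₂ (+ n) (+ k)) ⟩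
      (+ n + + k + + 2) * bin (k ℕ.+ suc n) k ∎
      where
        open ≡-Reasoning
        lem₁ : ∀ n k → + 2 + n ≡ + 1 + (k + (+ 1 + n)) - k
        lem₁ = solve-∀
        lem₂ : ∀ n k → + 1 * (+ 1 + (k + (+ 1 + n))) ≡ n + k + + 2
        lem₂ = solve-∀

    -- The three-term Legendre recurrence times P_(n+1)(t), divided by t. Its coefficients do not
    -- involve t, so it holds term by term.
    z-term : ∀ n k → (+ 2 + + n) * z (suc n) k ≡ (+ 2 * + n + + 3) * x (suc n) k - + 8 * (+ 1 + + n) * z n k
    z-term n k = go (+ n) (+ k) (sgnℕ k) (wb (+ 8) (suc n) k) (wb (+ 8) n k) (bin (k ℕ.+ suc (suc n)) k) (bin (k ℕ.+ suc n) k) (B k) (bin-up n k) (up (+ 8) n k)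
      where
        go : ∀ n k s w₀ w₁ b₁ b₀ c → (+ 2 + n) * b₁ ≡ (n + k + + 2) * b₀ → (+ 1 + n - k) * w₀ ≡ + 8 * (+ 1 + n) * w₁ →
             (+ 2 + n) * (s * w₀ * b₁ * c) ≡ (+ 2 * n + + 3) * (s * w₀ * b₀ * c) - + 8 * (+ 1 + n) * (s * w₁ * b₀ * c)
        go n k s w₀ w₁ b₁ b₀ c e f = begin
          (+ 2 + n) * (s * w₀ * b₁ * c)                                                    ≡⟨ l₁ n s w₀ b₁ c ⟩
          s * w₀ * ((+ 2 + n) * b₁) * c                                                    ≡⟨ cong (λ y → s * w₀ * y * c) e ⟩
          s * w₀ * ((n + k + + 2) * b₀) * c                                                ≡⟨ l₂ n k s w₀ b₀ c ⟩
          (+ 2 * n + + 3) * (s * w₀ * b₀ * c) - s * ((+ 1 + n - k) * w₀) * b₀ * c          ≡⟨ cong (λ y → (+ 2 * n + + 3) * (s * w₀ * b₀ * c) - s * y * b₀ * c) f ⟩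
          (+ 2 * n + + 3) * (s * w₀ * b₀ * c) - s * (+ 8 * (+ 1 + n) * w₁) * b₀ * c        ≡⟨ l₃ n s w₀ w₁ b₀ c ⟩
          (+ 2 * n + + 3) * (s * w₀ * b₀ * c) - + 8 * (+ 1 + n) * (s * w₁ * b₀ * c)        ∎
          where
            open ≡-Reasoning
            l₁ : ∀ n s w b c → (+ 2 + n) * (s * w * b * c) ≡ s * w * ((+ 2 + n) * b) * c
            l₁ = solve-∀
            l₂ : ∀ n k s w b c → s * w * ((n + k + + 2) * b) * c ≡ (+ 2 * n + + 3) * (s * w * b * c) - s * ((+ 1 + n - k) * w) * b * c
            l₂ = solve-∀
            l₃ : ∀ n s w v b c → (+ 2 * n + + 3) * (s * w * b * c) - s * (+ 8 * (+ 1 + n) * v) * b * c ≡ (+ 2 * n + + 3) * (s * w * b * c) - + 8 * (+ 1 + n) * (s * v * b * c)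
            l₃ = solve-∀

    triple : ∀ e k s w w′ b b′ c c′ α β γ → e * k * w′ ≡ α * w → k * b′ ≡ β * b → k * c′ ≡ γ * c →
             e * (k * (k * (k * (- s * w′ * b′ * c′)))) ≡ - (α * β * γ) * (s * w * b * c)
    triple e k s w w′ b b′ c c′ α β γ p q r = begin
      e * (k * (k * (k * (- s * w′ * b′ * c′))))          ≡⟨ l₁ e k s w′ b′ c′ ⟩
      - s * (e * k * w′) * (k * b′) * (k * c′)            ≡⟨ cong₂ (λ y v → - s * y * v * (k * c′)) p q ⟩
      - s * (α * w) * (β * b) * (k * c′)                  ≡⟨ cong (λ y → - s * (α * w) * (β * b) * y) r ⟩
      - s * (α * w) * (β * b) * (γ * c)                   ≡⟨ l₂ s w b c α β γ ⟩
      - (α * β * γ) * (s * w * b * c)                     ∎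
      where
        open ≡-Reasoning
        l₁ : ∀ e k s w b c → e * (k * (k * (k * (- s * w * b * c)))) ≡ - s * (e * k * w) * (k * b) * (k * c)
        l₁ = solve-∀
        l₂ : ∀ s w b c α β γ → - s * (α * w) * (β * b) * (γ * c) ≡ - (α * β * γ) * (s * w * b * c)
        l₂ = solve-∀

    γ : ℕ → ℤ
    γ k = + 2 * (+ 2 * + k + + 1)

    bin-absorb : ∀ n k → + suc k * bin (suc k ℕ.+ suc n) (suc k) ≡ (+ n + + k + + 2) * bin (k ℕ.+ suc n) k
    bin-absorb n k = ≡.trans (absorb (+ 1) (k ℕ.+ suc n) k) (cong (_* bin (k ℕ.+ suc n) k) (lem (+ n) (+ k)))
      where lem : ∀ n k → + 1 + (k + (+ 1 + n)) ≡ n + k + + 2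
            lem = solve-∀

    bin-right : ∀ n k → + suc k * bin (suc k ℕ.+ n) (suc k) ≡ (+ 1 + + n) * bin (k ℕ.+ suc n) k
    bin-right n k = begin
      + suc k * bin (suc (k ℕ.+ n)) (suc k)             ≡⟨ cong (_* bin (suc (k ℕ.+ n)) (suc k)) (ℤP.*-identityˡ (+ suc k)) ⟨
      + 1 * + suc k * bin (suc (k ℕ.+ n)) (suc k)       ≡⟨ right (+ 1) (suc (k ℕ.+ n)) k ⟩
      (+ suc (k ℕ.+ n) - + k) * bin (suc (k ℕ.+ n)) k   ≡⟨ cong₂ (λ y N → y * bin N k) (lem (+ n) (+ k)) (≡.sym (ℕP.+-suc k n)) ⟩
      (+ 1 + + n) * bin (k ℕ.+ suc n) k                 ∎
      where open ≡-Reasoning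
            lem : ∀ n k → + 1 + (k + n) - k ≡ + 1 + n
            lem = solve-∀

    e₁ : ∀ n k → + 1 * (+ suc k * (+ suc k * (+ suc k * x (suc (suc n)) (suc k)))) ≡ - ((+ n + + k + + 3) * (+ n + + k + + 2) * γ k) * x (suc n) k
    e₁ n k = ≡.trans (triple (+ 1) (+ suc k) (sgnℕ k) (wb (+ 8) (suc n) k) _ (bin (k ℕ.+ suc (suc n)) k) _ (B k) _ (+ 2 + + n) (+ n + + k + + 3) (γ k)
        (≡.trans (cong (_* wb (+ 8) (suc (suc n)) (suc k)) (ℤP.*-identityˡ (+ suc k))) (absorb (+ 8) (suc n) k))
        (≡.trans (bin-absorb (suc n) k) (cong (_* bin (k ℕ.+ suc (suc n)) k) (lem₀ (+ n) (+ k)))) (B-suc k))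
      (go (+ n) (+ k) (sgnℕ k) (wb (+ 8) (suc n) k) (bin (k ℕ.+ suc (suc n)) k) (bin (k ℕ.+ suc n) k) (B k) (γ k) (bin-up n k))
      where
        lem₀ : ∀ n k → + 1 + n + k + + 2 ≡ n + k + + 3
        lem₀ = solve-∀
        go : ∀ n k s w b₁ b₀ c g → (+ 2 + n) * b₁ ≡ (n + k + + 2) * b₀ →
             - ((+ 2 + n) * (n + k + + 3) * g) * (s * w * b₁ * c) ≡ - ((n + k + + 3) * (n + k + + 2) * g) * (s * w * b₀ * c)
        go n k s w b₁ b₀ c g e = ≡.trans (l₁ n k s w b₁ c g) (≡.trans (cong (λ y → - ((n + k + + 3) * g) * (s * w * y * c)) e) (l₂ n k s w b₀ c g))
          where l₁ : ∀ n k s w b c g → - ((+ 2 + n) * (n + k + + 3) * g) * (s * w * b * c) ≡ - ((n + k + + 3) * g) * (s * w * ((+ 2 + n) * b) * c)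
                l₁ = solve-∀
                l₂ : ∀ n k s w b c g → - ((n + k + + 3) * g) * (s * w * ((n + k + + 2) * b) * c) ≡ - ((n + k + + 3) * (n + k + + 2) * g) * (s * w * b * c)
                l₂ = solve-∀

    e₂ : ∀ n k → + 8 * (+ suc k * (+ suc k * (+ suc k * x (suc n) (suc k)))) ≡ - ((+ 1 + + n - + k) * (+ n + + k + + 2) * γ k) * x (suc n) k
    e₂ n k = triple (+ 8) (+ suc k) (sgnℕ k) (wb (+ 8) (suc n) k) _ (bin (k ℕ.+ suc n) k) _ (B k) _ (+ 1 + + n - + k) (+ n + + k + + 2) (γ k) (right (+ 8) (suc n) k) (bin-absorb n k) (B-suc k)

    e₃ : ∀ n k → + 8 * (+ suc k * (+ suc k * (+ suc k * z n (suc k)))) ≡ - ((+ n - + k) * (+ n + + k + + 2) * γ k) * z n k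
    e₃ n k = triple (+ 8) (+ suc k) (sgnℕ k) (wb (+ 8) n k) _ (bin (k ℕ.+ suc n) k) _ (B k) _ (+ n - + k) (+ n + + k + + 2) (γ k) (right (+ 8) n k) (bin-absorb n k) (B-suc k)

    e₄ : ∀ n k → + 8 * (+ suc k * (+ suc k * (+ suc k * x n (suc k)))) ≡ - ((+ n - + k) * (+ 1 + + n) * γ k) * z n k
    e₄ n k = triple (+ 8) (+ suc k) (sgnℕ k) (wb (+ 8) n k) _ (bin (k ℕ.+ suc n) k) _ (B k) _ (+ n - + k) (+ 1 + + n) (γ k) (right (+ 8) n k) (bin-right n k) (B-suc k)

    e₅ : ∀ n k → + 8 * (+ 1 + + n) * z n k ≡ (+ 1 + + n - + k) * x (suc n) k
    e₅ n k = go (+ 8 * (+ 1 + + n)) (+ 1 + + n - + k) (sgnℕ k) (wb (+ 8) (suc n) k) (wb (+ 8) n k) (bin (k ℕ.+ suc n) k) (B k) (up (+ 8) n k)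
      where
        go : ∀ p r s w₀ w₁ b c → r * w₀ ≡ p * w₁ → p * (s * w₁ * b * c) ≡ r * (s * w₀ * b * c)
        go p r s w₀ w₁ b c e = ≡.trans (l p s w₁ b c) (≡.trans (cong (λ y → s * y * b * c) (≡.sym e)) (≡.sym (l r s w₀ b c)))
          where l : ∀ p s w b c → p * (s * w * b * c) ≡ s * (p * w) * b * c
                l = solve-∀

    -- After multiplication by (k+1)³ the four terms at k + 1 become multiples of x₁ and z at k, and
    -- the last hypothesis trades z for x₁; the rest is the polynomial identity `core`.
    x-core : ∀ n k x₂ x₁′ z′ x₀ x₁ z → let k₁ = + 1 + k ; γ = + 2 * (+ 2 * k + + 1) in
      + 1 * (k₁ * (k₁ * (k₁ * x₂))) ≡ - ((n + k + + 3) * (n + k + + 2) * γ) * x₁ →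
      + 8 * (k₁ * (k₁ * (k₁ * x₁′))) ≡ - ((+ 1 + n - k) * (n + k + + 2) * γ) * x₁ →
      + 8 * (k₁ * (k₁ * (k₁ * z′))) ≡ - ((n - k) * (n + k + + 2) * γ) * z →
      + 8 * (k₁ * (k₁ * (k₁ * x₀))) ≡ - ((n - k) * (+ 1 + n) * γ) * z →
      + 8 * (+ 1 + n) * z ≡ (+ 1 + n - k) * x₁ →
      k₁ * (k₁ * (k₁ * ((+ 2 + n) * (+ 2 + n) * x₂ + - (+ 8 * (+ 2 * n + + 3) * (+ 2 * n + + 3)) * x₁′ + + 128 * (+ 1 + n) * (+ 2 * n + + 3) * z′ + - (+ 64 * (+ 1 + n) * (+ 1 + n)) * x₀))) ≡
      k₁ * (k₁ * (k₁ * (- (+ 4 * (+ 2 * n + + 3) * (+ 2 * n + + 3)) * x₁ + + 64 * (+ 1 + n) * (+ 2 * n + + 3) * z)))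
    x-core n k x₂ x₁′ z′ x₀ x₁ z h₁ h₂ h₃ h₄ h₅ = begin
      k₁ * (k₁ * (k₁ * ((+ 2 + n) * (+ 2 + n) * x₂ + - (+ 8 * n₃ * n₃) * x₁′ + + 128 * n₁ * n₃ * z′ + - (+ 64 * n₁ * n₁) * x₀)))
        ≡⟨ expand k₁ (+ 2 + n) n₁ n₃ x₂ x₁′ z′ x₀ ⟩
      (+ 2 + n) * (+ 2 + n) * (+ 1 * (k₁ * (k₁ * (k₁ * x₂)))) - n₃ * n₃ * (+ 8 * (k₁ * (k₁ * (k₁ * x₁′)))) + (+ 16 * n₁ * n₃ * (+ 8 * (k₁ * (k₁ * (k₁ * z′)))) - + 8 * n₁ * n₁ * (+ 8 * (k₁ * (k₁ * (k₁ * x₀)))))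
        ≡⟨ cong₂ _+_ (cong₂ (λ a b → (+ 2 + n) * (+ 2 + n) * a - n₃ * n₃ * b) h₁ h₂) (cong₂ (λ a b → + 16 * n₁ * n₃ * a - + 8 * n₁ * n₁ * b) h₃ h₄) ⟩
      (+ 2 + n) * (+ 2 + n) * (- ((n + k + + 3) * (n + k + + 2) * g) * x₁) - n₃ * n₃ * (- ((+ 1 + n - k) * (n + k + + 2) * g) * x₁)
        + (+ 16 * n₁ * n₃ * (- ((n - k) * (n + k + + 2) * g) * z) - + 8 * n₁ * n₁ * (- ((n - k) * n₁ * g) * z))
        ≡⟨ cong (λ v → (+ 2 + n) * (+ 2 + n) * (- ((n + k + + 3) * (n + k + + 2) * g) * x₁) - n₃ * n₃ * (- ((+ 1 + n - k) * (n + k + + 2) * g) * x₁) + v)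
             (≡.trans (gather n₁ n₃ (n - k) (n + k + + 2) g z) (cong (λ v → (n₁ * n₁ * ((n - k) * g) - + 2 * n₃ * ((n - k) * (n + k + + 2) * g)) * v) h₅)) ⟩
      (+ 2 + n) * (+ 2 + n) * (- ((n + k + + 3) * (n + k + + 2) * g) * x₁) - n₃ * n₃ * (- ((+ 1 + n - k) * (n + k + + 2) * g) * x₁)
        + (n₁ * n₁ * ((n - k) * g) - + 2 * n₃ * ((n - k) * (n + k + + 2) * g)) * ((+ 1 + n - k) * x₁)
        ≡⟨ core n k x₁ ⟩
      k₁ * (k₁ * (k₁ * (- (+ 4 * n₃ * n₃) * x₁ + + 8 * n₃ * ((+ 1 + n - k) * x₁))))
        ≡⟨ cong (λ v → k₁ * (k₁ * (k₁ * (- (+ 4 * n₃ * n₃) * x₁ + + 8 * n₃ * v)))) (≡.sym h₅) ⟩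
      k₁ * (k₁ * (k₁ * (- (+ 4 * n₃ * n₃) * x₁ + + 8 * n₃ * (+ 8 * n₁ * z))))
        ≡⟨ cong (λ v → k₁ * (k₁ * (k₁ * (- (+ 4 * n₃ * n₃) * x₁ + v)))) (last n₁ n₃ z) ⟩
      k₁ * (k₁ * (k₁ * (- (+ 4 * n₃ * n₃) * x₁ + + 64 * n₁ * n₃ * z))) ∎
      where
        open ≡-Reasoning
        k₁ = + 1 + k
        g = + 2 * (+ 2 * k + + 1)
        n₁ = + 1 + n
        n₃ = + 2 * n + + 3
        expand : ∀ k n₂ n₁ n₃ x₂ x₁ z x₀ → k * (k * (k * (n₂ * n₂ * x₂ + - (+ 8 * n₃ * n₃) * x₁ + + 128 * n₁ * n₃ * z + - (+ 64 * n₁ * n₁) * x₀))) ≡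
          n₂ * n₂ * (+ 1 * (k * (k * (k * x₂)))) - n₃ * n₃ * (+ 8 * (k * (k * (k * x₁)))) + (+ 16 * n₁ * n₃ * (+ 8 * (k * (k * (k * z)))) - + 8 * n₁ * n₁ * (+ 8 * (k * (k * (k * x₀)))))
        expand = solve-∀
        gather : ∀ n₁ n₃ d e g z → + 16 * n₁ * n₃ * (- (d * e * g) * z) - + 8 * n₁ * n₁ * (- (d * n₁ * g) * z) ≡ (n₁ * n₁ * (d * g) - + 2 * n₃ * (d * e * g)) * (+ 8 * n₁ * z)
        gather = solve-∀
        core : ∀ n k x → (+ 2 + n) * (+ 2 + n) * (- ((n + k + + 3) * (n + k + + 2) * (+ 2 * (+ 2 * k + + 1))) * x) - (+ 2 * n + + 3) * (+ 2 * n + + 3) * (- ((+ 1 + n - k) * (n + k + + 2) * (+ 2 * (+ 2 * k + + 1))) * x)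
            + ((+ 1 + n) * (+ 1 + n) * ((n - k) * (+ 2 * (+ 2 * k + + 1))) - + 2 * (+ 2 * n + + 3) * ((n - k) * (n + k + + 2) * (+ 2 * (+ 2 * k + + 1)))) * ((+ 1 + n - k) * x)
          ≡ (+ 1 + k) * ((+ 1 + k) * ((+ 1 + k) * (- (+ 4 * (+ 2 * n + + 3) * (+ 2 * n + + 3)) * x + + 8 * (+ 2 * n + + 3) * ((+ 1 + n - k) * x))))
        core = solve-∀
        last : ∀ n₁ n₃ z → + 8 * n₃ * (+ 8 * n₁ * z) ≡ + 64 * n₁ * n₃ * z
        last = solve-∀

    -- The square of the Legendre recurrence contains the factor t² = 1 + 4y, where the k-th terms
    -- are multiples of y^k. The coefficient of y^(k+1) therefore collects terms at k + 1 and at k.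
    -- At y = -1/8 the shifted ones enter with 4y = -1/2, hence the doubled coefficients at k + 1.
    x-term : ∀ n k → (+ 2 + + n) * (+ 2 + + n) * x (suc (suc n)) (suc k) + - (+ 8 * (+ 2 * + n + + 3) * (+ 2 * + n + + 3)) * x (suc n) (suc k)
        + + 128 * (+ 1 + + n) * (+ 2 * + n + + 3) * z n (suc k) + - (+ 64 * (+ 1 + + n) * (+ 1 + + n)) * x n (suc k)
      ≡ - (+ 4 * (+ 2 * + n + + 3) * (+ 2 * + n + + 3)) * x (suc n) k + + 64 * (+ 1 + + n) * (+ 2 * + n + + 3) * z n k
    x-term n k = *-cancel k (*-cancel k (*-cancel k
      (x-core (+ n) (+ k) (x (suc (suc n)) (suc k)) (x (suc n) (suc k)) (z n (suc k)) (x n (suc k)) (x (suc n) k) (z n k) (e₁ n k) (e₂ n k) (e₃ n k) (e₄ n k) (e₅ n k))))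

    x-term₀ : ∀ n → (+ 2 + + n) * (+ 2 + + n) * x (suc (suc n)) 0 + - (+ 8 * (+ 2 * + n + + 3) * (+ 2 * + n + + 3)) * x (suc n) 0
        + + 128 * (+ 1 + + n) * (+ 2 * + n + + 3) * z n 0 + - (+ 64 * (+ 1 + + n) * (+ 1 + + n)) * x n 0 ≡ + 0
    x-term₀ n = go (+ n) ((+ 8) ^ n) ((+ 1) ^ suc (suc n)) ((+ 1) ^ suc n) ((+ 1) ^ n) (ℤP.^-zeroˡ (suc (suc n))) (ℤP.^-zeroˡ (suc n)) (ℤP.^-zeroˡ n)
      where
        go : ∀ n p a b c → a ≡ + 1 → b ≡ + 1 → c ≡ + 1 →
          (+ 2 + n) * (+ 2 + n) * (+ 1 * (+ 8 * (+ 8 * p)) * a * + 1) + - (+ 8 * (+ 2 * n + + 3) * (+ 2 * n + + 3)) * (+ 1 * (+ 8 * p) * b * + 1)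
          + + 128 * (+ 1 + n) * (+ 2 * n + + 3) * (+ 1 * p * b * + 1) + - (+ 64 * (+ 1 + n) * (+ 1 + n)) * (+ 1 * p * c * + 1) ≡ + 0
        go n p _ _ _ refl refl refl = lem n p
          where lem : ∀ n p → (+ 2 + n) * (+ 2 + n) * (+ 1 * (+ 8 * (+ 8 * p)) * + 1 * + 1) + - (+ 8 * (+ 2 * n + + 3) * (+ 2 * n + + 3)) * (+ 1 * (+ 8 * p) * + 1 * + 1)
                  + + 128 * (+ 1 + n) * (+ 2 * n + + 3) * (+ 1 * p * + 1 * + 1) + - (+ 64 * (+ 1 + n) * (+ 1 + n)) * (+ 1 * p * + 1 * + 1) ≡ + 0
                lem = solve-∀

  Z-relation : ∀ n → (+ 2 + + n) * Z (suc n) ≡ (+ 2 * + n + + 3) * X (suc n) - + 8 * (+ 1 + + n) * Z n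
  Z-relation n = begin
    (+ 2 + + n) * Z (suc n)
      ≡⟨ ∑-* (suc n) (+ 2 + + n) (z (suc n)) ⟨
    ∑ (suc n) (λ k → (+ 2 + + n) * z (suc n) k)
      ≡⟨ ∑-cong (suc n) (λ k _ → ≡.trans (z-term n k) (pad a c (x (suc n) k) (z n k))) ⟩
    ∑ (suc n) (λ k → a * x (suc n) k + - c * z n k + + 0 * z n k + + 0 * z n k)
      ≡⟨ ∑-linear (suc n) a (- c) (+ 0) (+ 0) (x (suc n)) (z n) (z n) (z n) ⟩
    a * X (suc n) + - c * ∑ (suc n) (z n) + + 0 * ∑ (suc n) (z n) + + 0 * ∑ (suc n) (z n)
      ≡⟨ pad a c (X (suc n)) (∑ (suc n) (z n)) ⟨
    a * X (suc n) - c * ∑ (suc n) (z n)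
      ≡⟨ cong (λ v → a * X (suc n) - c * v) (∑-extend 1 (z-low n)) ⟩
    a * X (suc n) - c * Z n ∎
    where
      open ≡-Reasoning
      a = + 2 * + n + + 3
      c = + 8 * (+ 1 + + n)
      pad : ∀ a c x z → a * x - c * z ≡ a * x + - c * z + + 0 * z + + 0 * z
      pad = solve-∀

  private
    conclude : ∀ e a a′ b b′ c x₂ x₁ z x₀ → a′ ≡ a + a → b′ ≡ b + b →
      e * x₂ + - a′ * x₁ + b′ * z + - c * x₀ ≡ - a * x₁ + b * z → e * x₂ ≡ a * x₁ - b * z + c * x₀
    conclude e a _ b _ c x₂ x₁ z x₀ refl refl h = ≡.trans (l₁ e a b c x₂ x₁ z x₀) (≡.trans (cong (λ v → v + (a + a) * x₁ - (b + b) * z + c * x₀) h) (l₂ a b c x₁ z x₀))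
      where l₁ : ∀ e a b c x₂ x₁ z x₀ → e * x₂ ≡ e * x₂ + - (a + a) * x₁ + (b + b) * z + - c * x₀ + (a + a) * x₁ - (b + b) * z + c * x₀
            l₁ = solve-∀
            l₂ : ∀ a b c x₁ z x₀ → - a * x₁ + b * z + (a + a) * x₁ - (b + b) * z + c * x₀ ≡ a * x₁ - b * z + c * x₀
            l₂ = solve-∀

    X-sum : ∀ n e a a′ b b′ c → a′ ≡ a + a → b′ ≡ b + b →
      e * x (suc (suc n)) 0 + - a′ * x (suc n) 0 + b′ * z n 0 + - c * x n 0 ≡ + 0 →
      (∀ k → e * x (suc (suc n)) (suc k) + - a′ * x (suc n) (suc k) + b′ * z n (suc k) + - c * x n (suc k) ≡ - a * x (suc n) k + b * z n k) →
      e * X (suc (suc n)) ≡ a * X (suc n) - b * Z n + c * X n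
    X-sum n e a a′ b b′ c a′≡ b′≡ h₀ h = conclude e a a′ b b′ c (X K) (X (suc n)) (Z n) (X n) a′≡ b′≡ (begin
      e * X K + - a′ * X (suc n) + b′ * Z n + - c * X n
        ≡⟨ cong₂ (λ v w → e * X K + - a′ * v + b′ * w + - c * X n) (≡.sym (∑-extend 1 (x-low (suc n)))) (≡.sym (∑-extend 2 (z-low n))) ⟩
      e * X K + - a′ * ∑ K (x (suc n)) + b′ * ∑ K (z n) + - c * X n
        ≡⟨ cong (λ v → e * X K + - a′ * ∑ K (x (suc n)) + b′ * ∑ K (z n) + - c * v) (≡.sym (∑-extend 2 (x-low n))) ⟩
      e * X K + - a′ * ∑ K (x (suc n)) + b′ * ∑ K (z n) + - c * ∑ K (x n)
        ≡⟨ ∑-linear K e (- a′) b′ (- c) (x K) (x (suc n)) (z n) (x n) ⟨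
      ∑ K term
        ≡⟨ ∑-head (suc n) term ⟩
      term 0 + ∑ (suc n) (λ k → term (suc k))
        ≡⟨ cong₂ _+_ h₀ (∑-cong (suc n) (λ k _ → ≡.trans (h k) (pad a b (x (suc n) k) (z n k)))) ⟩
      + 0 + ∑ (suc n) (λ k → - a * x (suc n) k + b * z n k + + 0 * z n k + + 0 * z n k)
        ≡⟨ cong (λ v → + 0 + v) (∑-linear (suc n) (- a) b (+ 0) (+ 0) (x (suc n)) (z n) (z n) (z n)) ⟩
      + 0 + (- a * X (suc n) + b * ∑ (suc n) (z n) + + 0 * ∑ (suc n) (z n) + + 0 * ∑ (suc n) (z n))
        ≡⟨ cong (λ v → + 0 + (- a * X (suc n) + b * v + + 0 * v + + 0 * v)) (∑-extend 1 (z-low n)) ⟩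
      + 0 + (- a * X (suc n) + b * Z n + + 0 * Z n + + 0 * Z n)
        ≡⟨ unpad a b (X (suc n)) (Z n) ⟩
      - a * X (suc n) + b * Z n ∎)
      where
        open ≡-Reasoning
        K = suc (suc n)
        term : ℕ → ℤ
        term k = e * x K k + - a′ * x (suc n) k + b′ * z n k + - c * x n k
        pad : ∀ a b x z → - a * x + b * z ≡ - a * x + b * z + + 0 * z + + 0 * z
        pad = solve-∀
        unpad : ∀ a b x z → + 0 + (- a * x + b * z + + 0 * z + + 0 * z) ≡ - a * x + b * z
        unpad = solve-∀

  X-relation : ∀ n → (+ 2 + + n) * (+ 2 + + n) * X (suc (suc n)) ≡
    + 4 * (+ 2 * + n + + 3) * (+ 2 * + n + + 3) * X (suc n) - + 64 * (+ 1 + + n) * (+ 2 * + n + + 3) * Z n + + 64 * (+ 1 + + n) * (+ 1 + + n) * X n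
  X-relation n = X-sum n ((+ 2 + + n) * (+ 2 + + n)) (+ 4 * n₃ * n₃) (+ 8 * n₃ * n₃) (+ 64 * n₁ * n₃) (+ 128 * n₁ * n₃) (+ 64 * n₁ * n₁)
      (double₁ n₃) (double₂ n₁ n₃) (x-term₀ n) (x-term n)
    where
      n₁ = + 1 + + n
      n₃ = + 2 * + n + + 3
      double₁ : ∀ n → + 8 * n * n ≡ + 4 * n * n + + 4 * n * n
      double₁ = solve-∀
      double₂ : ∀ m n → + 128 * m * n ≡ + 64 * m * n + + 64 * m * n
      double₂ = solve-∀

  B-suc-two : ∀ k → (+ 2 + + two k) * B (suc k) ≡ + 4 * (+ 1 + + two k) * B k
  B-suc-two k = subst (λ t → (+ 2 + t) * B (suc k) ≡ + 4 * (+ 1 + t) * B k) (≡.sym (+two k))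
      (≡.trans (l₁ (+ k) (B (suc k))) (≡.trans (cong (+ 2 *_) (B-suc k)) (l₂ (+ k) (B k))))
    where l₁ : ∀ k b → (+ 2 + + 2 * k) * b ≡ + 2 * ((+ 1 + k) * b)
          l₁ = solve-∀
          l₂ : ∀ k b → + 2 * (+ 2 * (+ 2 * k + + 1) * b) ≡ + 4 * (+ 1 + + 2 * k) * b
          l₂ = solve-∀

  private
    u-core : ∀ n τ p a b c a₁ d ω β β′ → (+ 2 + τ) * a ≡ (+ 2 + n) * a₁ → (+ 1 + τ) * a₁ ≡ (+ 1 + n) * ω → (+ 2 + τ) * b ≡ (+ 1 + n) * d →
      + 2 * (+ 1 + τ) * d ≡ (n - τ) * ω → + 2 * (+ 2 + τ) * c ≡ (n - (+ 1 + τ)) * d → (+ 2 + τ) * β′ ≡ + 4 * (+ 1 + τ) * β →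
      (+ 2 + τ) * ((+ 1 + τ) * ((+ 2 + n) * (- p * a * β′) + - (+ 2 * (+ 2 * n + + 3)) * (- p * b * β′) + + 4 * (+ 1 + n) * (- p * c * β′))) ≡
      (+ 2 + τ) * ((+ 1 + τ) * (- (+ 4 * (+ 1 + n)) * (p * ω * β)))
    u-core n τ p a b c a₁ d ω β β′ h₁ h₂ h₃ h₄ h₅ h₆ = begin
      k₂ * (k₁ * ((+ 2 + n) * (- p * a * β′) + - (+ 2 * n₃) * (- p * b * β′) + + 4 * n₁ * (- p * c * β′)))
        ≡⟨ l₁ (+ 2 + n) n₁ n₃ k₁ k₂ p a b c β′ ⟩
      - p * β′ * ((+ 2 + n) * (k₁ * (k₂ * a)) - + 2 * n₃ * (k₁ * (k₂ * b)) + + 2 * n₁ * (k₁ * (+ 2 * k₂ * c)))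
        ≡⟨ cong (λ v → - p * β′ * v) (cong₂ _+_ (cong₂ (λ x y → (+ 2 + n) * (k₁ * x) - + 2 * n₃ * (k₁ * y)) h₁ h₃) (cong (λ y → + 2 * n₁ * (k₁ * y)) h₅)) ⟩
      - p * β′ * ((+ 2 + n) * (k₁ * ((+ 2 + n) * a₁)) - + 2 * n₃ * (k₁ * (n₁ * d)) + + 2 * n₁ * (k₁ * ((n - (+ 1 + τ)) * d)))
        ≡⟨ cong (λ v → - p * β′ * v) (l₂ (+ 2 + n) n₁ n₃ (n - (+ 1 + τ)) k₁ a₁ d) ⟩
      - p * β′ * ((+ 2 + n) * (+ 2 + n) * (k₁ * a₁) + n₁ * (n - (+ 1 + τ) - n₃) * (+ 2 * k₁ * d))
        ≡⟨ cong (λ v → - p * β′ * v) (cong₂ (λ x y → (+ 2 + n) * (+ 2 + n) * x + n₁ * (n - (+ 1 + τ) - n₃) * y) h₂ h₄) ⟩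
      - p * β′ * ((+ 2 + n) * (+ 2 + n) * (n₁ * ω) + n₁ * (n - (+ 1 + τ) - n₃) * ((n - τ) * ω))
        ≡⟨ l₃ n τ p β′ ω ⟩
      - p * (n₁ * k₂ * ω) * (k₂ * β′)
        ≡⟨ cong (λ v → - p * (n₁ * k₂ * ω) * v) h₆ ⟩
      - p * (n₁ * k₂ * ω) * (+ 4 * k₁ * β)
        ≡⟨ l₄ n₁ k₁ k₂ p ω β ⟩
      k₂ * (k₁ * (- (+ 4 * n₁) * (p * ω * β))) ∎
      where
        open ≡-Reasoning
        k₁ = + 1 + τ
        k₂ = + 2 + τ
        n₁ = + 1 + n
        n₃ = + 2 * n + + 3
        l₁ : ∀ n₂ n₁ n₃ k₁ k₂ p a b c β → k₂ * (k₁ * (n₂ * (- p * a * β) + - (+ 2 * n₃) * (- p * b * β) + + 4 * n₁ * (- p * c * β))) ≡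
               - p * β * (n₂ * (k₁ * (k₂ * a)) - + 2 * n₃ * (k₁ * (k₂ * b)) + + 2 * n₁ * (k₁ * (+ 2 * k₂ * c)))
        l₁ = solve-∀
        l₂ : ∀ n₂ n₁ n₃ m k₁ a d → n₂ * (k₁ * (n₂ * a)) - + 2 * n₃ * (k₁ * (n₁ * d)) + + 2 * n₁ * (k₁ * (m * d)) ≡ n₂ * n₂ * (k₁ * a) + n₁ * (m - n₃) * (+ 2 * k₁ * d)
        l₂ = solve-∀
        l₃ : ∀ n τ p β ω → - p * β * ((+ 2 + n) * (+ 2 + n) * ((+ 1 + n) * ω) + (+ 1 + n) * (n - (+ 1 + τ) - (+ 2 * n + + 3)) * ((n - τ) * ω)) ≡
               - p * ((+ 1 + n) * (+ 2 + τ) * ω) * ((+ 2 + τ) * β)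
        l₃ = solve-∀
        l₄ : ∀ n k₁ k₂ p ω β → - p * (n * k₂ * ω) * (+ 4 * k₁ * β) ≡ k₂ * (k₁ * (- (+ 4 * n) * (p * ω * β)))
        l₄ = solve-∀

    -- For U the last coefficient of the Legendre recurrence contains 1/t² = 1 - 4w with w = (t² -
    -- 1)/(4t²), and the k-th term is a multiple of w^k. At t² = 1/2 one has -4w = 1, so the shifted
    -- and the unshifted term have the same coefficient.
    u-term : ∀ n k → (+ 2 + + n) * u (suc (suc n)) (suc k) + - (+ 2 * (+ 2 * + n + + 3)) * u (suc n) (suc k) + + 4 * (+ 1 + + n) * u n (suc k) ≡ - (+ 4 * (+ 1 + + n)) * u n k
    u-term n k = *-cancel (two k) (*-cancel (suc (two k)) (u-core (+ n) (+ two k) (sgnℕ k)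
      (w (suc (suc n)) (suc (suc t))) (w (suc n) (suc (suc t))) (w n (suc (suc t))) (w (suc n) (suc t)) (w n (suc t)) (w n t) (B k) (B (suc k))
      (absorb (+ 2) (suc n) (suc t)) (absorb (+ 2) n t) (absorb (+ 2) n (suc t)) (right (+ 2) n t) (right (+ 2) n (suc t)) (B-suc-two k)))
      where w = wb (+ 2)
            t = two k

    u-term₀ : ∀ n → (+ 2 + + n) * u (suc (suc n)) 0 + - (+ 2 * (+ 2 * + n + + 3)) * u (suc n) 0 + + 4 * (+ 1 + + n) * u n 0 ≡ + 0
    u-term₀ n = lem (+ n) ((+ 2) ^ n)
      where lem : ∀ n p → (+ 2 + n) * (+ 1 * (+ 2 * (+ 2 * p)) * + 1) + - (+ 2 * (+ 2 * n + + 3)) * (+ 1 * (+ 2 * p) * + 1) + + 4 * (+ 1 + n) * (+ 1 * p * + 1) ≡ + 0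
            lem = solve-∀

    U-sum : ∀ n e a c → e * u (suc (suc n)) 0 + - a * u (suc n) 0 + c * u n 0 ≡ + 0 →
      (∀ k → e * u (suc (suc n)) (suc k) + - a * u (suc n) (suc k) + c * u n (suc k) ≡ - c * u n k) →
      e * U (suc (suc n)) ≡ a * U (suc n) - (c + c) * U n
    U-sum n e a c h₀ h = conclude′ e a c (U K) (U (suc n)) (U n) (begin
      e * U K + - a * U (suc n) + c * U n
        ≡⟨ cong₂ (λ v w → e * U K + - a * v + c * w) (≡.sym (∑-extend 1 (u-low (suc n)))) (≡.sym (∑-extend 2 (u-low n))) ⟩
      e * U K + - a * ∑ K (u (suc n)) + c * ∑ K (u n)
        ≡⟨ pad e a c (U K) (∑ K (u (suc n))) (∑ K (u n)) ⟩
      e * U K + - a * ∑ K (u (suc n)) + c * ∑ K (u n) + + 0 * ∑ K (u n)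
        ≡⟨ ∑-linear K e (- a) c (+ 0) (u K) (u (suc n)) (u n) (u n) ⟨
      ∑ K (λ k → e * u K k + - a * u (suc n) k + c * u n k + + 0 * u n k)
        ≡⟨ ∑-cong K (λ k _ → ≡.sym (pad e a c (u K k) (u (suc n) k) (u n k))) ⟩
      ∑ K term
        ≡⟨ ∑-head (suc n) term ⟩
      term 0 + ∑ (suc n) (λ k → term (suc k))
        ≡⟨ cong₂ _+_ h₀ (≡.trans (∑-cong (suc n) (λ k _ → h k)) (∑-* (suc n) (- c) (u n))) ⟩
      + 0 + - c * ∑ (suc n) (u n)
        ≡⟨ ≡.trans (ℤP.+-identityˡ (- c * ∑ (suc n) (u n))) (cong (- c *_) (∑-extend 1 (u-low n))) ⟩
      - c * U n ∎)
      where
        open ≡-Reasoning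
        K = suc (suc n)
        term : ℕ → ℤ
        term k = e * u K k + - a * u (suc n) k + c * u n k
        pad : ∀ e a c x y z → e * x + - a * y + c * z ≡ e * x + - a * y + c * z + + 0 * z
        pad = solve-∀
        conclude′ : ∀ e a c x y z → e * x + - a * y + c * z ≡ - c * z → e * x ≡ a * y - (c + c) * z
        conclude′ e a c x y z h = ≡.trans (l₁ e a c x y z) (≡.trans (cong (λ v → v + a * y - c * z) h) (l₂ a c y z))
          where l₁ : ∀ e a c x y z → e * x ≡ e * x + - a * y + c * z + a * y - c * z
                l₁ = solve-∀
                l₂ : ∀ a c y z → - c * z + a * y - c * z ≡ a * y - (c + c) * z
                l₂ = solve-∀

  U-relation : ∀ n → (+ 2 + + n) * U (suc (suc n)) ≡ + 2 * (+ 2 * + n + + 3) * U (suc n) - (+ 4 * (+ 1 + + n) + + 4 * (+ 1 + + n)) * U n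
  U-relation n = U-sum n (+ 2 + + n) (+ 2 * (+ 2 * + n + + 3)) (+ 4 * (+ 1 + + n)) (u-term₀ n) (u-term n)

  private
    squares : ∀ m n₁ n₃ x₂ x₁ x₀ z u₂ u₁ u₀ → m * u₂ ≡ + 2 * n₃ * u₁ - (+ 4 * n₁ + + 4 * n₁) * u₀ →
      m * m * x₂ ≡ + 4 * n₃ * n₃ * x₁ - + 64 * n₁ * n₃ * z + + 64 * n₁ * n₁ * x₀ → x₁ ≡ u₁ * u₁ → x₀ ≡ u₀ * u₀ → u₁ * u₀ ≡ + 2 * z →
      m * (m * x₂) ≡ m * (m * (u₂ * u₂))
    squares m n₁ n₃ x₂ _ _ z u₂ u₁ u₀ hu hx refl refl hz = begin
      m * (m * x₂)
        ≡⟨ ℤP.*-assoc m m x₂ ⟨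
      m * m * x₂
        ≡⟨ hx ⟩
      + 4 * n₃ * n₃ * (u₁ * u₁) - + 64 * n₁ * n₃ * z + + 64 * n₁ * n₁ * (u₀ * u₀)
        ≡⟨ l₁ n₁ n₃ z u₁ u₀ ⟩
      + 4 * n₃ * n₃ * (u₁ * u₁) - + 32 * n₁ * n₃ * (+ 2 * z) + + 64 * n₁ * n₁ * (u₀ * u₀)
        ≡⟨ cong (λ v → + 4 * n₃ * n₃ * (u₁ * u₁) - + 32 * n₁ * n₃ * v + + 64 * n₁ * n₁ * (u₀ * u₀)) (≡.sym hz) ⟩
      + 4 * n₃ * n₃ * (u₁ * u₁) - + 32 * n₁ * n₃ * (u₁ * u₀) + + 64 * n₁ * n₁ * (u₀ * u₀)
        ≡⟨ l₂ n₁ n₃ u₁ u₀ ⟩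
      (+ 2 * n₃ * u₁ - (+ 4 * n₁ + + 4 * n₁) * u₀) * (+ 2 * n₃ * u₁ - (+ 4 * n₁ + + 4 * n₁) * u₀)
        ≡⟨ cong (λ v → v * v) (≡.sym hu) ⟩
      m * u₂ * (m * u₂)
        ≡⟨ l₃ m u₂ ⟩
      m * (m * (u₂ * u₂)) ∎
      where
        open ≡-Reasoning
        l₁ : ∀ n₁ n₃ z u₁ u₀ → + 4 * n₃ * n₃ * (u₁ * u₁) - + 64 * n₁ * n₃ * z + + 64 * n₁ * n₁ * (u₀ * u₀) ≡ + 4 * n₃ * n₃ * (u₁ * u₁) - + 32 * n₁ * n₃ * (+ 2 * z) + + 64 * n₁ * n₁ * (u₀ * u₀)
        l₁ = solve-∀
        l₂ : ∀ n₁ n₃ u₁ u₀ → + 4 * n₃ * n₃ * (u₁ * u₁) - + 32 * n₁ * n₃ * (u₁ * u₀) + + 64 * n₁ * n₁ * (u₀ * u₀) ≡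
               (+ 2 * n₃ * u₁ - (+ 4 * n₁ + + 4 * n₁) * u₀) * (+ 2 * n₃ * u₁ - (+ 4 * n₁ + + 4 * n₁) * u₀)
        l₂ = solve-∀
        l₃ : ∀ m u → m * u * (m * u) ≡ m * (m * (u * u))
        l₃ = solve-∀

    products : ∀ m n₁ n₃ x₁ z′ z u₂ u₁ u₀ → m * u₂ ≡ + 2 * n₃ * u₁ - (+ 4 * n₁ + + 4 * n₁) * u₀ → m * z′ ≡ n₃ * x₁ - + 8 * n₁ * z →
      x₁ ≡ u₁ * u₁ → u₁ * u₀ ≡ + 2 * z → m * (u₂ * u₁) ≡ m * (+ 2 * z′)
    products m n₁ n₃ _ z′ z u₂ u₁ u₀ hu hz′ refl hz = begin
      m * (u₂ * u₁)                                                     ≡⟨ ℤP.*-assoc m u₂ u₁ ⟨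
      m * u₂ * u₁                                                       ≡⟨ cong (_* u₁) hu ⟩
      (+ 2 * n₃ * u₁ - (+ 4 * n₁ + + 4 * n₁) * u₀) * u₁                 ≡⟨ l₁ n₁ n₃ u₁ u₀ ⟩
      + 2 * n₃ * (u₁ * u₁) - + 8 * n₁ * (u₁ * u₀)                       ≡⟨ cong (λ v → + 2 * n₃ * (u₁ * u₁) - + 8 * n₁ * v) hz ⟩
      + 2 * n₃ * (u₁ * u₁) - + 8 * n₁ * (+ 2 * z)                       ≡⟨ l₂ n₁ n₃ (u₁ * u₁) z ⟩
      + 2 * (n₃ * (u₁ * u₁) - + 8 * n₁ * z)                             ≡⟨ cong (+ 2 *_) (≡.sym hz′) ⟩
      + 2 * (m * z′)                                                    ≡⟨ l₃ m z′ ⟩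
      m * (+ 2 * z′)                                                    ∎
      where
        open ≡-Reasoning
        l₁ : ∀ n₁ n₃ u₁ u₀ → (+ 2 * n₃ * u₁ - (+ 4 * n₁ + + 4 * n₁) * u₀) * u₁ ≡ + 2 * n₃ * (u₁ * u₁) - + 8 * n₁ * (u₁ * u₀)
        l₁ = solve-∀
        l₂ : ∀ n₁ n₃ x z → + 2 * n₃ * x - + 8 * n₁ * (+ 2 * z) ≡ + 2 * (n₃ * x - + 8 * n₁ * z)
        l₂ = solve-∀
        l₃ : ∀ m z → + 2 * (m * z) ≡ m * (+ 2 * z)
        l₃ = solve-∀

    -- `X-relation` is the square of `U-relation`, and `Z-relation` is its product with U(n+1). The
    -- mixed product is carried along because the square contains U(n+1) U(n).
    clausen : ∀ n → X n ≡ U n * U n × X (suc n) ≡ U (suc n) * U (suc n) × U (suc n) * U n ≡ + 2 * Z n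
    clausen zero = refl , refl , refl
    clausen (suc n) with clausen n
    ... | h₀ , h₁ , hz = h₁ ,
      *-cancel (suc n) (*-cancel (suc n) (squares (+ 2 + + n) (+ 1 + + n) (+ 2 * + n + + 3) (X (suc (suc n))) (X (suc n)) (X n) (Z n) (U (suc (suc n))) (U (suc n)) (U n)
        (U-relation n) (X-relation n) h₁ h₀ hz)) ,
      *-cancel (suc n) (products (+ 2 + + n) (+ 1 + + n) (+ 2 * + n + + 3) (X (suc n)) (Z (suc n)) (Z n) (U (suc (suc n))) (U (suc n)) (U n) (U-relation n) (Z-relation n) h₁ hz)

  -- Clausen's formula for the Legendre polynomials at t.
  X≡U² : ∀ n → X n ≡ U n * U n
  X≡U² n = proj₁ (clausen n)

-- Reduction of the weighted Domb sum modulo p.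

module ReductionModPrime where

  open PowerSeries
  open ThetaSeries using (sgnℕ; sgnℕ²)
  open ThetaIdentities using (q)
  open EtaQuotients using (pow)
  open ModularFunctions using (cg-cancel)
  open CoefficientExtraction using (lin; lins; lins≈; at-q⊛)
  open Binomials
  open DombRecurrence
  open Legendre

  ∑-cg : ∀ {p} n {f g} → (∀ k → k ≤ n → f k ≡ g k [ p ]) → ∑ n f ≡ ∑ n g [ p ]
  ∑-cg zero    e = e 0 z≤n
  ∑-cg (suc n) e = cg-+ (∑-cg n (λ k l → e k (ℕP.m≤n⇒m≤1+n l))) (e (suc n) ℕP.≤-refl)

  cg-*ˡ : ∀ {p} c {x y} → x ≡ y [ p ] → c * x ≡ c * y [ p ]
  cg-*ˡ c h = cg-* (cg-refl {a = c}) h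

  p*≡0 : ∀ {p} x → + p * x ≡ + 0 [ p ]
  p*≡0 {p} x = cg x (≡.trans (ℤP.*-comm (+ p) x) (≡.sym (ℤP.+-identityˡ (x * + p))))

  sgn-^ : ∀ c i → (- c) ^ i ≡ sgnℕ i * c ^ i
  sgn-^ c zero = refl
  sgn-^ c (suc i) = ≡.trans (cong (- c *_) (sgn-^ c i)) (lem c (sgnℕ i) (c ^ i))
    where lem : ∀ c s x → - c * (s * x) ≡ - s * (c * x)
          lem = solve-∀

  at-lin^ : ∀ e n k → at (pow (lin e q) n) k ≡ e ^ k * bin n k
  at-lin^ e zero zero = refl
  at-lin^ e zero (suc k) = ≡.sym (ℤP.*-zeroʳ (e ^ suc k))
  at-lin^ e (suc n) k = ≡.trans (exact {a = lin e q ⊛ pow (lin e q) n} {b = pow (lin e q) n ⊕ ι e ⊛ (q ⊛ pow (lin e q) n)} k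
      (λ L → let open Ring 0 L in solve 3 (λ e q y → (con (+ 1) :+ e :* q) :* y := y :+ e :* (q :* y)) ≈-refl (ι e) q (pow (lin e q) n)))
    (≡.trans (cong (λ z → at (pow (lin e q) n) k + z) (at-ι⊛ e (q ⊛ pow (lin e q) n) k)) (go k))
    where
      go : ∀ k → at (pow (lin e q) n) k + e * at (q ⊛ pow (lin e q) n) k ≡ e ^ k * bin (suc n) k
      go zero = ≡.trans (cong₂ (λ x y → x + e * y) (at-lin^ e n 0) (ℤP.*-zeroˡ (at (pow (lin e q) n) 0)))
        (≡.trans (lem e (bin n 0)) (cong (λ z → + 1 * z) (≡.sym (ℤP.*-identityˡ (bin n 0)))))
        where lem : ∀ e b → + 1 * b + e * + 0 ≡ + 1 * b
              lem = solve-∀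
      go (suc k) = ≡.trans (cong₂ (λ x y → x + e * y) (at-lin^ e n (suc k)) (≡.trans (at-q⊛ (pow (lin e q) n) k) (at-lin^ e n k)))
        (lem e (e ^ k) (bin n k) (bin n (suc k)))
        where lem : ∀ e x a b → e * x * b + e * (x * a) ≡ e * x * (a + + 1 * b)
              lem = solve-∀

  alt : ℕ → ℕ → ℤ
  alt M m = ∑ m (λ k → sgnℕ k * (bin M k * bin m k))

  at-lins : ∀ M N m → at (lins q M N) m ≡ diag m (λ i j → (- + 4) ^ i * bin M i * ((+ 4) ^ j * bin N j))
  at-lins M N m = ≡.trans (exact {a = lins q M N} {b = pow (lin (- + 4) q) M ⊛ pow (lin (+ 4) q) N} m (λ L → lins≈ q M N))
    (≡.trans (conv-diag (at (pow (lin (- + 4) q) M)) (at (pow (lin (+ 4) q) N)) m)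
      (diag-cong m (λ i j _ → cong₂ _*_ (at-lin^ (- + 4) M i) (at-lin^ (+ 4) N j))))

  -- On i + j = m the powers of 4 collect to 4^m, and C(m,j) = C(m,i). In `at-lins₅` the alternating
  -- factor is the other one, which costs (-1)^m.
  at-lins₁ : ∀ M m → at (lins q M m) m ≡ (+ 4) ^ m * alt M m
  at-lins₁ M m = ≡.trans (at-lins M m m) (≡.trans (diag-cong m term) (≡.trans (diag-* m ((+ 4) ^ m) (λ i _ → sgnℕ i * (bin M i * bin m i)))
      (cong ((+ 4) ^ m *_) (≡.sym (∑-diag m (λ i _ → sgnℕ i * (bin M i * bin m i)))))))
    where
      term : ∀ i j → i ℕ.+ j ≡ m → (- + 4) ^ i * bin M i * ((+ 4) ^ j * bin m j) ≡ (+ 4) ^ m * (sgnℕ i * (bin M i * bin m i))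
      term i j e = ≡.trans (cong₂ (λ x y → x * bin M i * ((+ 4) ^ j * y)) (sgn-^ (+ 4) i) (≡.sym (bin-sym m i j e)))
        (≡.trans (lem (sgnℕ i) ((+ 4) ^ i) ((+ 4) ^ j) (bin M i) (bin m i))
          (cong (_* (sgnℕ i * (bin M i * bin m i))) (≡.trans (≡.sym (ℤP.^-distribˡ-+-* (+ 4) i j)) (cong ((+ 4) ^_) e))))
        where lem : ∀ s x y a b → s * x * a * (y * b) ≡ x * y * (s * (a * b))
              lem = solve-∀

  sgnℕ-+ : ∀ i j → sgnℕ (i ℕ.+ j) ≡ sgnℕ i * sgnℕ j
  sgnℕ-+ zero    j = ≡.sym (ℤP.*-identityˡ (sgnℕ j))
  sgnℕ-+ (suc i) j = ≡.trans (cong -_ (sgnℕ-+ i j)) (ℤP.neg-distribˡ-* (sgnℕ i) (sgnℕ j))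

  at-lins₅ : ∀ N m → at (lins q m N) m ≡ sgnℕ m * ((+ 4) ^ m * alt N m)
  at-lins₅ N m = ≡.trans (at-lins m N m) (≡.trans (diag-sym m _) (≡.trans (diag-cong m term)
      (≡.trans (diag-* m (sgnℕ m * (+ 4) ^ m) (λ i _ → sgnℕ i * (bin N i * bin m i)))
      (≡.trans (cong (sgnℕ m * (+ 4) ^ m *_) (≡.sym (∑-diag m (λ i _ → sgnℕ i * (bin N i * bin m i))))) (ℤP.*-assoc (sgnℕ m) ((+ 4) ^ m) (alt N m))))))
    where
      term : ∀ i j → i ℕ.+ j ≡ m → (- + 4) ^ j * bin m j * ((+ 4) ^ i * bin N i) ≡ sgnℕ m * (+ 4) ^ m * (sgnℕ i * (bin N i * bin m i))
      term i j refl = begin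
        (- + 4) ^ j * bin m j * ((+ 4) ^ i * bin N i)
          ≡⟨ cong₂ (λ x y → x * y * ((+ 4) ^ i * bin N i)) (sgn-^ (+ 4) j) (≡.sym (bin-sym m i j refl)) ⟩
        sgnℕ j * (+ 4) ^ j * bin m i * ((+ 4) ^ i * bin N i)
          ≡⟨ lem₁ (sgnℕ j) ((+ 4) ^ i) ((+ 4) ^ j) (bin N i) (bin m i) ⟩
        + 1 * sgnℕ j * ((+ 4) ^ i * (+ 4) ^ j) * (bin N i * bin m i)
          ≡⟨ cong₂ (λ x y → x * sgnℕ j * y * (bin N i * bin m i)) (≡.sym (sgnℕ² i)) (≡.sym (ℤP.^-distribˡ-+-* (+ 4) i j)) ⟩
        sgnℕ i * sgnℕ i * sgnℕ j * (+ 4) ^ m * (bin N i * bin m i)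
          ≡⟨ lem₂ (sgnℕ i) (sgnℕ j) ((+ 4) ^ m) (bin N i * bin m i) ⟩
        sgnℕ i * sgnℕ j * (+ 4) ^ m * (sgnℕ i * (bin N i * bin m i))
          ≡⟨ cong (λ x → x * (+ 4) ^ m * (sgnℕ i * (bin N i * bin m i))) (≡.sym (sgnℕ-+ i j)) ⟩
        sgnℕ m * (+ 4) ^ m * (sgnℕ i * (bin N i * bin m i)) ∎
        where open ≡-Reasoning
              lem₁ : ∀ s x y a b → s * y * b * (x * a) ≡ + 1 * s * (x * y) * (a * b)
              lem₁ = solve-∀
              lem₂ : ∀ s s′ x a → s * s * s′ * x * a ≡ s * s′ * x * (s * a)
              lem₂ = solve-∀

  -- From (-27)(-8)² = -1728 and (-24)³ = 8(-1728): the powers collected at k combine into a factor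
  -- depending only on k + i = N and e, times the 8^(N-k) that belongs to `x N k`.
  powers : ∀ e k i → (- + 27) ^ k * ((- + 8) ^ two k * (- + 24) ^ (three i ℕ.+ e)) ≡ (- + 24) ^ e * (- + 1728) ^ (k ℕ.+ i) * (+ 8) ^ i
  powers e zero zero = lem ((- + 24) ^ e)
    where lem : ∀ x → + 1 * (+ 1 * x) ≡ x * + 1 * + 1
          lem = solve-∀
  powers e zero (suc i) = ≡.trans (lem₁ ((- + 24) ^ (three i ℕ.+ e))) (≡.trans (cong (- + 13824 *_) (powers e zero i)) (lem₂ ((- + 24) ^ e) ((- + 1728) ^ i) ((+ 8) ^ i)))
    where lem₁ : ∀ x → + 1 * (+ 1 * (- + 24 * (- + 24 * (- + 24 * x)))) ≡ - + 13824 * (+ 1 * (+ 1 * x))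
          lem₁ = solve-∀
          lem₂ : ∀ x y z → - + 13824 * (x * y * z) ≡ x * (- + 1728 * y) * (+ 8 * z)
          lem₂ = solve-∀
  powers e (suc k) i = ≡.trans (lem₁ ((- + 27) ^ k) ((- + 8) ^ two k) ((- + 24) ^ (three i ℕ.+ e))) (≡.trans (cong (- + 1728 *_) (powers e k i))
      (lem₂ ((- + 24) ^ e) ((- + 1728) ^ (k ℕ.+ i)) ((+ 8) ^ i)))
    where lem₁ : ∀ x y z → - + 27 * x * (- + 8 * (- + 8 * y) * z) ≡ - + 1728 * (x * (y * z))
          lem₁ = solve-∀
          lem₂ : ∀ x y z → - + 1728 * (x * y * z) ≡ x * (- + 1728 * y) * z
          lem₂ = solve-∀

  three-+ : ∀ k i → three (k ℕ.+ i) ≡ three k ℕ.+ three i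
  three-+ zero i = refl
  three-+ (suc k) i = cong (λ z → suc (suc (suc z))) (three-+ k i)

  module ModPrime {p : ℕ} (pr : Prime p) where

    cancel-suc : ∀ k {x y} → suc k < p → + suc k * x ≡ + suc k * y [ p ] → x ≡ y [ p ]
    cancel-suc k l = cg-cancel pr (+ suc k) (λ d → ℕP.<⇒≱ l (ℕD.∣⇒≤ d))

    -- Two sequences with congruent term ratios α/c and β/c agree modulo p as long as c can be
    -- cancelled, which is assumed for k + 1 < p. The three termwise congruences below are
    -- instances.
    recurrence₁ : ∀ (c : ℕ → ℤ) (f g α β : ℕ → ℤ) → (∀ k → suc k < p → ∀ {x y} → c k * x ≡ c k * y [ p ] → x ≡ y [ p ]) →
      (∀ k → c k * f (suc k) ≡ α k * f k) → (∀ k → c k * g (suc k) ≡ β k * g k) → (∀ k → α k * f k ≡ β k * f k [ p ]) → f 0 ≡ g 0 →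
      ∀ k → k < p → f k ≡ g k [ p ]
    recurrence₁ c f g α β can hf hg αβ h₀ zero _ = ≡⇒cg h₀
    recurrence₁ c f g α β can hf hg αβ h₀ (suc k) l = can k l (cg-trans (≡⇒cg (hf k)) (cg-trans (αβ k)
      (cg-trans (cg-*ˡ (β k) (recurrence₁ c f g α β can hf hg αβ h₀ k (ℕP.<-trans ℕP.≤-refl l))) (≡⇒cg (≡.sym (hg k))))))

    module _ (N : ℕ) (3N : (+ 3 * + N + + 1) * (+ 3 * + N + + 2) ≡ + 0 [ p ]) where

      -- The term ratios agree modulo p because 3(3k+1)(3k+2) + 27(N-k)(N+k+1) = 3(3N+1)(3N+2) is
      -- divisible by p.
      T-mod : ∀ k → k < p → T k ≡ (- + 27) ^ k * (bin N k * bin (k ℕ.+ N) k) [ p ]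
      T-mod = recurrence₁ (λ k → + suc k * + suc k) T t (λ k → + 3 * (+ 3 * + k + + 1) * (+ 3 * + k + + 2)) (λ k → - (+ 27 * (+ N - + k) * + suc (k ℕ.+ N)))
          (λ k l h → cancel-suc k l (cancel-suc k l (cg-trans (≡⇒cg (≡.sym (ℤP.*-assoc (+ suc k) (+ suc k) _))) (cg-trans h (≡⇒cg (ℤP.*-assoc (+ suc k) (+ suc k) _))))))
          (λ k → ≡.trans (ℤP.*-assoc (+ suc k) (+ suc k) (T (suc k))) (T-suc k)) t-suc αβ (≡.sym (cong (λ z → + 1 * (z * z)) (ℤP.^-zeroˡ N)))
        where
          t : ℕ → ℤ
          t k = (- + 27) ^ k * (bin N k * bin (k ℕ.+ N) k)
          t-suc : ∀ k → + suc k * + suc k * t (suc k) ≡ - (+ 27 * (+ N - + k) * + suc (k ℕ.+ N)) * t k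
          t-suc k = begin
            + suc k * + suc k * (- + 27 * e * (b′ * d′))                      ≡⟨ lem₁ (+ suc k) e b′ d′ ⟩
            - + 27 * e * ((+ 1 * + suc k * b′) * (+ suc k * d′))              ≡⟨ cong₂ (λ x y → - + 27 * e * (x * y)) (right (+ 1) N k) (absorb (+ 1) (k ℕ.+ N) k) ⟩
            - + 27 * e * ((+ N - + k) * b * (+ suc (k ℕ.+ N) * d))            ≡⟨ lem₂ (+ N - + k) (+ suc (k ℕ.+ N)) e b d ⟩
            - (+ 27 * (+ N - + k) * + suc (k ℕ.+ N)) * (e * (b * d))          ∎
            where
              open ≡-Reasoning
              e = (- + 27) ^ k
              b = bin N k
              b′ = bin N (suc k)
              d = bin (k ℕ.+ N) k
              d′ = bin (suc (k ℕ.+ N)) (suc k)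
              lem₁ : ∀ k e b d → k * k * (- + 27 * e * (b * d)) ≡ - + 27 * e * ((+ 1 * k * b) * (k * d))
              lem₁ = solve-∀
              lem₂ : ∀ x y e b d → - + 27 * e * (x * b * (y * d)) ≡ - (+ 27 * x * y) * (e * (b * d))
              lem₂ = solve-∀
          αβ : ∀ k → + 3 * (+ 3 * + k + + 1) * (+ 3 * + k + + 2) * T k ≡ - (+ 27 * (+ N - + k) * + suc (k ℕ.+ N)) * T k [ p ]
          αβ k = cg-trans (≡⇒cg (lem (+ k) (+ N) (T k))) (cg-trans (cg-+ (cg-refl {a = - (+ 27 * (+ N - + k) * + suc (k ℕ.+ N)) * T k}) (cg-*ˡ (+ 3 * T k) 3N))
              (≡⇒cg (≡.trans (cong (λ z → - (+ 27 * (+ N - + k) * + suc (k ℕ.+ N)) * T k + z) (ℤP.*-zeroʳ (+ 3 * T k))) (ℤP.+-identityʳ _))))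
            where lem : ∀ k N T → + 3 * (+ 3 * k + + 1) * (+ 3 * k + + 2) * T ≡ - (+ 27 * (N - k) * (+ 1 + (k + N))) * T + + 3 * T * ((+ 3 * N + + 1) * (+ 3 * N + + 2))
                  lem = solve-∀

      T-vanish : ∀ k → k < p → N < k → T k ≡ + 0 [ p ]
      T-vanish k l N<k = cg-trans (T-mod k l) (≡⇒cg (≡.trans (cong (λ z → (- + 27) ^ k * (z * bin (k ℕ.+ N) k)) (wb-low (+ 1) N k N<k))
          (ℤP.*-zeroʳ ((- + 27) ^ k))))

    -- With Q = p - 1 - 3k the factor 3k + j + 1 is congruent to -(Q - j), so C(3k+j,j) becomes
    -- (-1)^j C(Q,j).
    wb-mod : ∀ k Q → suc (three k ℕ.+ Q) ≡ p → ∀ j → j < p → wb (+ 16) (three k ℕ.+ j) (three k) ≡ (- + 16) ^ j * bin Q j [ p ]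
    wb-mod k Q e = recurrence₁ (λ j → + suc j) f g (λ j → + 16 * + suc (three k ℕ.+ j)) (λ j → - + 16 * (+ Q - + j)) (λ j l → cancel-suc j l) f-suc g-suc αβ
        (≡.trans (cong (λ z → wb (+ 16) z (three k)) (ℕP.+-identityʳ (three k))) (≡.trans (wb-diag (+ 16) (three k)) (≡.sym (cong (+ 1 *_) (ℤP.^-zeroˡ Q)))))
      where
        f g : ℕ → ℤ
        f j = wb (+ 16) (three k ℕ.+ j) (three k)
        g j = (- + 16) ^ j * bin Q j
        f-suc : ∀ j → + suc j * f (suc j) ≡ + 16 * + suc (three k ℕ.+ j) * f j
        f-suc j = begin
          + suc j * f (suc j)
            ≡⟨ cong₂ (λ x n → x * wb (+ 16) n (three k)) (lem (+ three k) (+ j)) (ℕP.+-suc (three k) j) ⟩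
          (+ suc (three k ℕ.+ j) - + three k) * wb (+ 16) (suc (three k ℕ.+ j)) (three k)
            ≡⟨ up (+ 16) (three k ℕ.+ j) (three k) ⟩
          + 16 * + suc (three k ℕ.+ j) * f j ∎
          where open ≡-Reasoning
                lem : ∀ t j → + 1 + j ≡ + 1 + (t + j) - t
                lem = solve-∀
        g-suc : ∀ j → + suc j * g (suc j) ≡ - + 16 * (+ Q - + j) * g j
        g-suc j = ≡.trans (lem₁ (+ suc j) ((- + 16) ^ j) (bin Q (suc j))) (≡.trans (cong (- + 16 * (- + 16) ^ j *_) (right (+ 1) Q j)) (lem₂ ((- + 16) ^ j) (+ Q - + j) (bin Q j)))
          where lem₁ : ∀ k e b → k * (- + 16 * e * b) ≡ - + 16 * e * (+ 1 * k * b)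
                lem₁ = solve-∀
                lem₂ : ∀ e x b → - + 16 * e * (x * b) ≡ - + 16 * x * (e * b)
                lem₂ = solve-∀
        αβ : ∀ j → + 16 * + suc (three k ℕ.+ j) * f j ≡ - + 16 * (+ Q - + j) * f j [ p ]
        αβ j = cg-trans (≡⇒cg (≡.trans (lem (+ three k) (+ j) (+ Q) (f j)) (cong (λ z → - + 16 * (+ Q - + j) * f j + + z * (+ 16 * f j)) e)))
            (cg-trans (cg-+ (cg-refl {a = - + 16 * (+ Q - + j) * f j}) (p*≡0 (+ 16 * f j))) (≡⇒cg (ℤP.+-identityʳ _)))
          where lem : ∀ t j Q f → + 16 * (+ 1 + (t + j)) * f ≡ - + 16 * (Q - j) * f + (+ 1 + (t + Q)) * (+ 16 * f)
                lem = solve-∀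

    module _ (N e : ℕ) (p≡ : suc (three N ℕ.+ e) ≡ p) (3N : (+ 3 * + N + + 1) * (+ 3 * + N + + 2) ≡ + 0 [ p ]) where
      private
        M = three N ℕ.+ e
        scale = (- + 24) ^ e * (- + 1728) ^ N

        <p : ∀ {k} → k ≤ M → k < p
        <p {k} l = subst (k <_) p≡ (s≤s l)

        column : ℕ → ℤ
        column k = ∑ M (λ n → (- + 8) ^ (M ℕ.∸ n) * r n k)

        column-high : ∀ k → k ≤ M → N < k → column k ≡ scale * x N k [ p ]
        column-high k l N<k = cg-trans (∑-cg M {g = λ _ → + 0} (λ n _ → cg-trans
            (cg-*ˡ ((- + 8) ^ (M ℕ.∸ n)) (cg-*ˡ (sgnℕ k * wb (+ 16) (two k ℕ.+ n) (three k)) (cg-*ˡ (B k) (T-vanish N 3N k (<p l) N<k))))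
            (≡⇒cg (lem ((- + 8) ^ (M ℕ.∸ n)) (sgnℕ k * wb (+ 16) (two k ℕ.+ n) (three k)) (B k)))))
            (≡⇒cg (≡.trans (∑-0 M (λ _ _ → refl)) (≡.sym (≡.trans (cong (scale *_) (x-low N k N<k)) (ℤP.*-zeroʳ scale)))))
          where lem : ∀ a b c → a * (b * (c * + 0)) ≡ + 0
                lem = solve-∀

        -- The terms start at n = k, and with n = k + j their binomials are C(Q,j) up to sign. The
        -- weights (-8)^(M-n) and (-16)^j then make the sum over j a binomial expansion, equal to
        -- (-8)^(2k) (-8 - 16)^Q.
        column-low : ∀ k i → k ℕ.+ i ≡ N → column k ≡ scale * x N k [ p ]
        column-low k i refl = cg-trans (≡⇒cg (≡.trans (cong (λ z → ∑ z (λ n → (- + 8) ^ (M ℕ.∸ n) * r n k)) M≡) (∑-drop k J low)))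
            (cg-trans (∑-cg J term) (≡⇒cg total))
          where
            Q = three i ℕ.+ e
            J = two k ℕ.+ Q
            M≡₃ : M ≡ three k ℕ.+ Q
            M≡₃ = ≡.trans (cong (ℕ._+ e) (three-+ k i)) (ℕP.+-assoc (three k) (three i) e)
            M≡ : M ≡ k ℕ.+ J
            M≡ = ≡.trans M≡₃ (≡.trans (cong (ℕ._+ Q) (≡.trans (≡.sym (two+k k)) (ℕP.+-comm (two k) k))) (ℕP.+-assoc k (two k) Q))
            low : ∀ n → n < k → (- + 8) ^ (M ℕ.∸ n) * r n k ≡ + 0
            low n l = ≡.trans (cong ((- + 8) ^ (M ℕ.∸ n) *_) (r-low n k l)) (ℤP.*-zeroʳ ((- + 8) ^ (M ℕ.∸ n)))
            c = sgnℕ k * (B k * ((- + 27) ^ k * (bin N k * bin (k ℕ.+ N) k)))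
            J≤M : J ≤ M
            J≤M = subst (J ≤_) (≡.sym M≡) (ℕP.m≤n+m J k)
            k≤M : k ≤ M
            k≤M = subst (k ≤_) (≡.sym M≡) (ℕP.m≤m+n k J)
            index : ∀ j → two k ℕ.+ (k ℕ.+ j) ≡ three k ℕ.+ j
            index j = ≡.trans (≡.sym (ℕP.+-assoc (two k) k j)) (cong (ℕ._+ j) (two+k k))
            term : ∀ j → j ≤ J → (- + 8) ^ (M ℕ.∸ (k ℕ.+ j)) * r (k ℕ.+ j) k ≡ c * ((- + 8) ^ two k * (wb (- + 8) Q j * (- + 16) ^ j)) [ p ]
            term j l = cg-trans (cg-*ˡ ((- + 8) ^ (M ℕ.∸ (k ℕ.+ j))) (cg-* (cg-*ˡ (sgnℕ k) (cg-trans (≡⇒cg (cong (λ n → wb (+ 16) n (three k)) (index j)))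
                  (wb-mod k Q (≡.trans (cong suc (≡.sym M≡₃)) p≡) j (<p (ℕP.≤-trans l J≤M))))) (cg-*ˡ (B k) (T-mod N 3N k (<p k≤M)))))
                (≡⇒cg (≡.trans (lem₁ ((- + 8) ^ (M ℕ.∸ (k ℕ.+ j))) (sgnℕ k) ((- + 16) ^ j) (bin Q j) (B k) ((- + 27) ^ k * (bin N k * bin (k ℕ.+ N) k)))
                  (≡.trans (cong (λ z → c * (z * (- + 16) ^ j)) (≡.trans (cong (λ z → bin Q j * (- + 8) ^ z) M∸) (wb-bin (- + 8) (two k) Q j l)))
                    (cong (c *_) (ℤP.*-assoc ((- + 8) ^ two k) (wb (- + 8) Q j) ((- + 16) ^ j))))))
              where
                M∸ : M ℕ.∸ (k ℕ.+ j) ≡ J ℕ.∸ j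
                M∸ = ≡.trans (cong (ℕ._∸ (k ℕ.+ j)) M≡) (ℕP.[m+n]∸[m+o]≡n∸o k J j)
                lem₁ : ∀ a s d b B t → a * (s * (d * b) * (B * t)) ≡ s * (B * t) * (b * a * d)
                lem₁ = solve-∀
            total : ∑ J (λ j → c * ((- + 8) ^ two k * (wb (- + 8) Q j * (- + 16) ^ j))) ≡ scale * x N k
            total = begin
              ∑ J (λ j → c * ((- + 8) ^ two k * (wb (- + 8) Q j * (- + 16) ^ j)))
                ≡⟨ ≡.trans (∑-* J c _) (cong (c *_) (∑-* J ((- + 8) ^ two k) _)) ⟩
              c * ((- + 8) ^ two k * ∑ J (λ j → wb (- + 8) Q j * (- + 16) ^ j))
                ≡⟨ cong (λ z → c * ((- + 8) ^ two k * z)) (binomial-theorem (- + 8) (- + 16) Q J (ℕP.m≤n+m Q (two k))) ⟩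
              c * ((- + 8) ^ two k * (- + 24) ^ Q)
                ≡⟨ lem₁ (sgnℕ k) (B k) ((- + 27) ^ k) (bin N k) (bin (k ℕ.+ N) k) ((- + 8) ^ two k * (- + 24) ^ Q) ⟩
              sgnℕ k * (bin N k * ((- + 27) ^ k * ((- + 8) ^ two k * (- + 24) ^ Q))) * bin (k ℕ.+ N) k * B k
                ≡⟨ cong (λ z → sgnℕ k * (bin N k * z) * bin (k ℕ.+ N) k * B k) (powers e k i) ⟩
              sgnℕ k * (bin N k * (scale * (+ 8) ^ i)) * bin (k ℕ.+ N) k * B k
                ≡⟨ lem₂ (sgnℕ k) (bin N k) scale ((+ 8) ^ i) (bin (k ℕ.+ N) k) (B k) ⟩
              scale * (sgnℕ k * (bin N k * (+ 8) ^ i) * bin (k ℕ.+ N) k * B k)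
                ≡⟨ cong (λ z → scale * (sgnℕ k * z * bin (k ℕ.+ N) k * B k)) (≡.trans (cong (λ z → bin N k * (+ 8) ^ z) (≡.sym (ℕP.m+n∸m≡n k i)))
                     (≡.trans (wb-bin (+ 8) 0 N k (ℕP.m≤m+n k i)) (ℤP.*-identityˡ (wb (+ 8) N k)))) ⟩
              scale * x N k ∎
              where
                open ≡-Reasoning
                lem₁ : ∀ s B d a b y → s * (B * (d * (a * b))) * y ≡ s * (a * (d * y)) * b * B
                lem₁ = solve-∀
                lem₂ : ∀ s a c y b B → s * (a * (c * y)) * b * B ≡ c * (s * (a * y) * b * B)
                lem₂ = solve-∀

      N≤M : N ≤ M
      N≤M = ℕP.≤-trans (subst (N ≤_) (two+k N) (ℕP.m≤n+m N (two N))) (ℕP.m≤m+n (three N) e)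

      -- Summation over n comes first, for fixed k. The columns with k > N vanish because `T` does,
      -- and the others add up to X N. The cases p = 3N + 1 and p = 3N + 2 are e = 0 and e = 1.
      Domb-sum : ∑ M (λ n → (- + 8) ^ (M ℕ.∸ n) * Domb n) ≡ (- + 24) ^ e * (- + 1728) ^ N * X N [ p ]
      Domb-sum = cg-trans (≡⇒cg (≡.trans (∑-cong M row) (∑-swap M M (λ n k → (- + 8) ^ (M ℕ.∸ n) * r n k)))) (cg-trans (∑-cg M col)
          (≡⇒cg (≡.trans (∑-* M scale (x N)) (cong (scale *_) (∑-extend-≤ N≤M (x-low N))))))
        where
          row : ∀ n → n ≤ M → (- + 8) ^ (M ℕ.∸ n) * Domb n ≡ ∑ M (λ k → (- + 8) ^ (M ℕ.∸ n) * r n k)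
          row n l = ≡.trans (cong ((- + 8) ^ (M ℕ.∸ n) *_) (≡.trans (Domb≡R n) (≡.sym (∑-extend-≤ l (r-low n))))) (≡.sym (∑-* M ((- + 8) ^ (M ℕ.∸ n)) (r n)))
          col : ∀ k → k ≤ M → column k ≡ scale * x N k [ p ]
          col k l with k ℕ.≤? N
          ... | yes k≤N = column-low k (N ℕ.∸ k) (ℕP.m+[n∸m]≡n k≤N)
          ... | no  k≰N = column-high k l (ℕP.≰⇒> k≰N)

-- The value of `U` modulo p, Fermat's little theorem, and representations by quadratic forms.

module Representations where

  open PowerSeries
  open LatticeSums
  open ThetaSeries
  open ThetaIdentities hiding (q)
  open EtaQuotients
  open ModularFunctions
  open Binomials hiding (T)
  open Legendre
  open ReductionModPrime

  open Forms

  module FermatU {p : ℕ} (pr : Prime p) (p∤2 : ¬ (p ℕD.∣ 2)) where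
    open ModPrime pr

    module _ (N M m : ℕ) (N<p : N < p) (m≤N : m ≤ N)
      (hyp : ∀ k → (+ N - + 2 * k) * (+ N - (+ 1 + + 2 * k)) ≡ + 4 * (+ M - k) * (+ m - k) [ p ]) where

      private
        f g : ℕ → ℤ
        f k = wb (+ 2) N (two k) * B k
        g k = (+ 2) ^ N * (bin M k * bin m k)

        f-suc : ∀ k → (+ 2 + + two k) * (+ 2 + + two k) * f (suc k) ≡ (+ N - + two k) * (+ N - (+ 1 + + two k)) * f k
        f-suc k = *-cancel 1 (go (+ N) (+ two k) (wb (+ 2) N (two k)) (wb (+ 2) N (suc (two k))) (wb (+ 2) N (suc (suc (two k)))) (B k) (B (suc k))
            (right (+ 2) N (two k)) (right (+ 2) N (suc (two k))) (B-suc-two k))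
          where
            go : ∀ n τ w₀ w₁ w₂ b b′ → + 2 * (+ 1 + τ) * w₁ ≡ (n - τ) * w₀ → + 2 * (+ 2 + τ) * w₂ ≡ (n - (+ 1 + τ)) * w₁ → (+ 2 + τ) * b′ ≡ + 4 * (+ 1 + τ) * b →
              + 2 * ((+ 2 + τ) * (+ 2 + τ) * (w₂ * b′)) ≡ + 2 * ((n - τ) * (n - (+ 1 + τ)) * (w₀ * b))
            go n τ w₀ w₁ w₂ b b′ e₁ e₂ e₃ = begin
              + 2 * ((+ 2 + τ) * (+ 2 + τ) * (w₂ * b′))              ≡⟨ l₁ (+ 2 + τ) w₂ b′ ⟩
              + 2 * (+ 2 + τ) * w₂ * ((+ 2 + τ) * b′)                ≡⟨ cong₂ _*_ e₂ e₃ ⟩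
              (n - (+ 1 + τ)) * w₁ * (+ 4 * (+ 1 + τ) * b)           ≡⟨ l₂ (n - (+ 1 + τ)) (+ 1 + τ) w₁ b ⟩
              + 2 * (n - (+ 1 + τ)) * b * (+ 2 * (+ 1 + τ) * w₁)     ≡⟨ cong (+ 2 * (n - (+ 1 + τ)) * b *_) e₁ ⟩
              + 2 * (n - (+ 1 + τ)) * b * ((n - τ) * w₀)             ≡⟨ l₃ (n - (+ 1 + τ)) (n - τ) w₀ b ⟩
              + 2 * ((n - τ) * (n - (+ 1 + τ)) * (w₀ * b))           ∎
              where
                open ≡-Reasoning
                l₁ : ∀ k w b → + 2 * (k * k * (w * b)) ≡ + 2 * k * w * (k * b)
                l₁ = solve-∀
                l₂ : ∀ x k w b → x * w * (+ 4 * k * b) ≡ + 2 * x * b * (+ 2 * k * w)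
                l₂ = solve-∀
                l₃ : ∀ x y w b → + 2 * x * b * (y * w) ≡ + 2 * (y * x * (w * b))
                l₃ = solve-∀

        2+two : ∀ k → + 2 + + two k ≡ + 2 * + suc k
        2+two k = ≡.trans (cong (λ z → + 2 + z) (+two k)) (lem (+ k))
          where lem : ∀ k → + 2 + + 2 * k ≡ + 2 * (+ 1 + k)
                lem = solve-∀

        g-suc : ∀ k → (+ 2 + + two k) * (+ 2 + + two k) * g (suc k) ≡ + 4 * (+ M - + k) * (+ m - + k) * g k
        g-suc k = ≡.trans (cong (λ z → z * z * g (suc k)) (2+two k)) (≡.trans (l₁ (+ suc k) ((+ 2) ^ N) (bin M (suc k)) (bin m (suc k)))
            (≡.trans (cong₂ (λ x y → + 4 * (+ 2) ^ N * (x * y)) (right (+ 1) M k) (right (+ 1) m k)) (l₂ ((+ 2) ^ N) (+ M - + k) (+ m - + k) (bin M k) (bin m k))))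
          where l₁ : ∀ k e a b → + 2 * k * (+ 2 * k) * (e * (a * b)) ≡ + 4 * e * (+ 1 * k * a * (+ 1 * k * b))
                l₁ = solve-∀
                l₂ : ∀ e x y a b → + 4 * e * (x * a * (y * b)) ≡ + 4 * x * y * (e * (a * b))
                l₂ = solve-∀

        can : ∀ k → suc k < p → ∀ {x y} → (+ 2 + + two k) * (+ 2 + + two k) * x ≡ (+ 2 + + two k) * (+ 2 + + two k) * y [ p ] → x ≡ y [ p ]
        can k l {x} {y} h = one (one (subst₂ (λ a b → a ≡ b [ p ]) (eq x) (eq y) h))
          where
            eq : ∀ x → (+ 2 + + two k) * (+ 2 + + two k) * x ≡ + 2 * (+ suc k * (+ 2 * (+ suc k * x)))
            eq x = ≡.trans (cong (λ z → z * z * x) (2+two k)) (lem (+ suc k) x)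
              where lem : ∀ k x → + 2 * k * (+ 2 * k) * x ≡ + 2 * (k * (+ 2 * (k * x)))
                    lem = solve-∀
            one : ∀ {x y} → + 2 * (+ suc k * x) ≡ + 2 * (+ suc k * y) [ p ] → x ≡ y [ p ]
            one h = cancel-suc k l (cg-cancel pr (+ 2) p∤2 h)

        fg : ∀ k → k < p → f k ≡ g k [ p ]
        fg = recurrence₁ (λ k → (+ 2 + + two k) * (+ 2 + + two k)) f g (λ k → (+ N - + two k) * (+ N - (+ 1 + + two k))) (λ k → + 4 * (+ M - + k) * (+ m - + k))
          can f-suc g-suc (λ k → cg-* (subst (λ z → (+ N - z) * (+ N - (+ 1 + z)) ≡ + 4 * (+ M - + k) * (+ m - + k) [ p ]) (≡.sym (+two k)) (hyp (+ k))) (cg-refl {a = f k}))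
          (cong ((+ 2) ^ N *_) (≡.sym (cong₂ _*_ (ℤP.^-zeroˡ M) (ℤP.^-zeroˡ m))))

      -- Without sign and powers of 2, the ratio of consecutive terms of U N is (N/2 - k)((N-1)/2 -
      -- k)/(k+1)², and that of C(M,k) C(m,k) is (M-k)(m-k)/(k+1)². The hypothesis `hyp` equates the
      -- two modulo p.
      U-mod : U N ≡ (+ 2) ^ N * alt M m [ p ]
      U-mod = cg-trans (∑-cg N (λ k l → cg-trans (≡⇒cg (ℤP.*-assoc (sgnℕ k) (wb (+ 2) N (two k)) (B k))) (cg-*ˡ (sgnℕ k) (fg k (ℕP.≤-<-trans l N<p)))))
        (≡⇒cg (≡.trans (∑-extend-≤ m≤N high) (≡.trans (∑-cong m (λ k _ → lem (sgnℕ k) ((+ 2) ^ N) (bin M k * bin m k))) (∑-* m ((+ 2) ^ N) _))))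
        where
          high : ∀ k → m < k → sgnℕ k * g k ≡ + 0
          high k l = ≡.trans (cong (λ z → sgnℕ k * ((+ 2) ^ N * (bin M k * z))) (wb-low (+ 1) m k l)) (lem₀ (sgnℕ k) ((+ 2) ^ N) (bin M k))
            where lem₀ : ∀ a b c → a * (b * (c * + 0)) ≡ + 0
                  lem₀ = solve-∀
          lem : ∀ s e a → s * (e * a) ≡ e * (s * a)
          lem = solve-∀

    fermat : ∀ a → (+ a) ^ p ≡ + a [ p ]
    fermat zero = ≡⇒cg (zero^ p (λ e → ¬prime[0] (subst Prime e pr)))
      where zero^ : ∀ n → n ≢ 0 → (+ 0) ^ n ≡ + 0
            zero^ zero h = contradiction refl h
            zero^ (suc n) _ = ℤP.*-zeroˡ ((+ 0) ^ n)
    fermat (suc a) = cg-trans (≡⇒cg (≡.sym (binomial-theorem (+ 1) (+ a) p p ℕP.≤-refl))) (cg-trans (ends p refl) (cg-+ (cg-refl {a = + 1}) (fermat a)))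
      where
        ends : ∀ n → n ≡ p → ∑ n (λ k → bin n k * (+ a) ^ k) ≡ + 1 + (+ a) ^ n [ p ]
        ends zero e = contradiction (subst Prime (≡.sym e) pr) ¬prime[0]
        ends (suc n) e = cg-+ (cg-trans (∑-cg n {g = indicator} small) (≡⇒cg (total n)))
            (≡⇒cg (≡.trans (cong (_* (+ a) ^ suc n) (wb-diag (+ 1) (suc n))) (ℤP.*-identityˡ _)))
          where
            indicator : ℕ → ℤ
            indicator zero = + 1
            indicator (suc k) = + 0
            total : ∀ n → ∑ n indicator ≡ + 1
            total zero = refl
            total (suc n) = ≡.trans (ℤP.+-identityʳ _) (total n)
            small : ∀ k → k ≤ n → bin (suc n) k * (+ a) ^ k ≡ indicator k [ p ]
            small zero _ = ≡⇒cg (≡.trans (ℤP.*-identityʳ _) (ℤP.^-zeroˡ (suc n)))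
            small (suc k) l = cg-trans (cg-* (cancel-suc k (subst (suc k <_) e (s≤s l)) (cg-trans (≡⇒cg (absorb (+ 1) n k))
                (subst (λ z → + z * bin n k ≡ + suc k * + 0 [ p ]) (≡.sym e) (cg-trans (p*≡0 (bin n k)) (≡⇒cg (≡.sym (ℤP.*-zeroʳ (+ suc k))))))))
                (cg-refl {a = (+ a) ^ suc k})) (≡⇒cg (ℤP.*-zeroˡ ((+ a) ^ suc k)))

    fermat′ : ∀ a n → suc n ≡ p → ¬ (p ℕD.∣ a) → (+ a) ^ n ≡ + 1 [ p ]
    fermat′ a n e p∤a = cg-cancel pr (+ a) p∤a (cg-trans (subst (λ k → (+ a) ^ k ≡ + a [ p ]) (≡.sym e) (fermat a)) (≡⇒cg (≡.sym (ℤP.*-identityʳ (+ a)))))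

  sumℤ : ℕ → (ℤ → ℤ) → ℤ
  sumℤ zero    f = f (+ 0)
  sumℤ (suc B) f = sumℤ B f + (f (+ suc B) + f -[1+ B ])

  at-sumTo : ∀ B f n → at (sumTo B f) n ≡ sumℤ B (λ k → at (f k) n)
  at-sumTo zero    f n = refl
  at-sumTo (suc B) f n = cong (_+ (at (f (+ suc B)) n + at (f -[1+ B ]) n)) (at-sumTo B f n)

  sumℤ-cong : ∀ B {f g} → (∀ k → f k ≡ g k) → sumℤ B f ≡ sumℤ B g
  sumℤ-cong zero    e = e (+ 0)
  sumℤ-cong (suc B) e = cong₂ _+_ (sumℤ-cong B e) (cong₂ _+_ (e (+ suc B)) (e -[1+ B ]))

  sumℤ-0 : ∀ B {f} → (∀ k → ∣ k ∣ ≤ B → f k ≡ + 0) → sumℤ B f ≡ + 0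
  sumℤ-0 zero    e = e (+ 0) z≤n
  sumℤ-0 (suc B) e = cong₂ _+_ (sumℤ-0 B (λ k l → e k (ℕP.m≤n⇒m≤1+n l))) (cong₂ _+_ (e (+ suc B) ℕP.≤-refl) (e -[1+ B ] ℕP.≤-refl))

  sumℤ-pair : ∀ B c f → suc c ≤ B → (∀ k → k ≢ + suc c → k ≢ -[1+ c ] → f k ≡ + 0) → sumℤ B f ≡ f (+ suc c) + f -[1+ c ]
  sumℤ-pair (suc B) c f (s≤s l) z with B ℕ.≟ c
  ... | yes refl = ≡.trans (cong (_+ (f (+ suc c) + f -[1+ c ])) (sumℤ-0 c (λ { (+ n) h → z (+ n) (λ { refl → ℕP.<-irrefl refl h }) (λ ())
                                                                    ; -[1+ n ] h → z -[1+ n ] (λ ()) (λ { refl → ℕP.<-irrefl refl h }) })))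
                     (ℤP.+-identityˡ _)
  ... | no B≢c = ≡.trans (cong₂ _+_ (sumℤ-pair B c f (ℕP.≤∧≢⇒< l (λ e → B≢c (≡.sym e))) z)
                    (cong₂ _+_ (z (+ suc B) (λ { refl → B≢c refl }) (λ ())) (z -[1+ B ] (λ ()) (λ { refl → B≢c refl }))))
                   (ℤP.+-identityʳ _)

  sumℤ-single : ∀ B a f → ∣ a ∣ ≤ B → (∀ k → k ≢ a → f k ≡ + 0) → sumℤ B f ≡ f a
  sumℤ-single B (+ zero) f l z = go B
    where go : ∀ B → sumℤ B f ≡ f (+ 0)
          go zero = refl
          go (suc B) = ≡.trans (cong₂ _+_ (go B) (cong₂ _+_ (z (+ suc B) (λ ())) (z -[1+ B ] (λ ())))) (ℤP.+-identityʳ _)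
  sumℤ-single B (+ suc c) f l z = ≡.trans (sumℤ-pair B c f l (λ k h _ → z k h)) (≡.trans (cong (λ y → f (+ suc c) + y) (z -[1+ c ] (λ ()))) (ℤP.+-identityʳ _))
  sumℤ-single B -[1+ c ] f l z = ≡.trans (sumℤ-pair B c f l (λ k _ h → z k h)) (≡.trans (cong (_+ f -[1+ c ]) (z (+ suc c) (λ ()))) (ℤP.+-identityˡ _))

  δ-≢ : ∀ e n → e ≢ + n → δ e n ≡ + 0
  δ-≢ (+ m) n h = go m n (λ e → h (cong +_ e))
    where go : ∀ m n → m ≢ n → δℕ m n ≡ + 0
          go zero    zero    h = contradiction refl h
          go zero    (suc n) h = refl
          go (suc m) zero    h = refl
          go (suc m) (suc n) h = go m n (λ e → h (cong suc e))
  δ-≢ -[1+ m ] n h = refl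

  δ-≡ : ∀ n → δ (+ n) n ≡ + 1
  δ-≡ zero    = refl
  δ-≡ (suc n) = δ-≡ n

  -- The window C may be enlarged, so that it contains the lattice points to be counted.
  double-coefficient : ∀ {F s} n (h : Lattice._⇓_ (suc n) F s) C → Lattice._⇓_.bound h ≤ C → at s n ≡ sumℤ C (λ x → sumℤ C (λ y → at (F x y) n))
  double-coefficient {F} n h C l = ≡.trans (≡.sym (cg-0⇒≡ (coef (≈-trans (sum₂-stable (_⇓_.bounded h) l) (_⇓_.value h)) n ℕP.≤-refl)))
      (≡.trans (at-sumTo C (λ x → sumTo C (F x)) n) (sumℤ-cong C (λ x → at-sumTo C (F x) n)))
    where open Lattice (suc n)

  +-cancelˡ : ∀ i {j k} → i + j ≡ i + k → j ≡ k
  +-cancelˡ i {j} {k} e = ≡.trans (lem i j) (≡.trans (cong (_- i) e) (≡.sym (lem i k)))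
    where lem : ∀ i j → j ≡ i + j - i
          lem = solve-∀

  i*i : ∀ i → i * i ≡ + (∣ i ∣ ℕ.* ∣ i ∣)
  i*i (+ n) = ≡.sym (ℤP.pos-* n n)
  i*i -[1+ n ] = refl

  square-roots : ∀ x y → x * x ≡ y * y → x ≡ y ⊎ x ≡ - y
  square-roots x y e with ℤP.i*j≡0⇒i≡0∨j≡0 (x - y) {x + y} (≡.trans (lem x y) (≡.trans (cong (_- y * y) e) (ℤP.+-inverseʳ (y * y))))
    where lem : ∀ x y → (x - y) * (x + y) ≡ x * x - y * y
          lem = solve-∀
  ... | inj₁ h = inj₁ (≡.trans (lem x y) (≡.trans (cong (_+ y) h) (ℤP.+-identityˡ y)))
    where lem : ∀ x y → x ≡ x - y + y
          lem = solve-∀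
  ... | inj₂ h = inj₂ (≡.trans (lem x y) (≡.trans (cong (_- y) h) (ℤP.+-identityˡ (- y))))
    where lem : ∀ x y → x ≡ x + y - y
          lem = solve-∀

  -- p divides (x y₀)² - (x₀ y)², and p² = a² + 6 (x y₀ ± x₀ y)² forces the divisible factor to vanish.
  representation-unique : ∀ {p} → Prime p → ∀ x y x₀ y₀ → + p ≡ x * x + + 6 * (y * y) → + p ≡ x₀ * x₀ + + 6 * (y₀ * y₀) →
    x * x ≡ x₀ * x₀ × y * y ≡ y₀ * y₀
  representation-unique {p} pr x y x₀ y₀ e e₀ = finish
    where
      p≢0 : p ≢ 0
      p≢0 h = ¬prime[0] (subst Prime h pr)
      instance
        p-nonZero : ℕ.NonZero p
        p-nonZero = ℕ.≢-nonZero p≢0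
      cross : (x * y₀ - x₀ * y) * (x * y₀ + x₀ * y) ≡ + p * (y₀ * y₀ - y * y)
      cross = begin
        (x * y₀ - x₀ * y) * (x * y₀ + x₀ * y)                                                              ≡⟨ l₁ x y x₀ y₀ ⟩
        (x * x + + 6 * (y * y)) * (y₀ * y₀) - (x₀ * x₀ + + 6 * (y₀ * y₀)) * (y * y)                        ≡⟨ cong₂ (λ a b → a * (y₀ * y₀) - b * (y * y)) e e₀ ⟨
        + p * (y₀ * y₀) - + p * (y * y)                                                                    ≡⟨ l₂ (+ p) (y₀ * y₀) (y * y) ⟩
        + p * (y₀ * y₀ - y * y)                                                                            ∎
        where
          open ≡-Reasoning
          l₁ : ∀ x y x₀ y₀ → (x * y₀ - x₀ * y) * (x * y₀ + x₀ * y) ≡ (x * x + + 6 * (y * y)) * (y₀ * y₀) - (x₀ * x₀ + + 6 * (y₀ * y₀)) * (y * y)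
          l₁ = solve-∀
          l₂ : ∀ p a b → p * a - p * b ≡ p * (a - b)
          l₂ = solve-∀
      zero-if-divisible : ∀ a d → + p * + p ≡ a * a + + 6 * (d * d) → p ℕD.∣ ∣ d ∣ → d ≡ + 0
      zero-if-divisible a d h (divides zero d≡) = ℤP.∣i∣≡0⇒i≡0 d≡
      zero-if-divisible a d h (divides (suc c) d≡) = ⊥-elim (ℕP.<⇒≱ small big)
        where
          eqℕ : p ℕ.* p ≡ ∣ a ∣ ℕ.* ∣ a ∣ ℕ.+ 6 ℕ.* (∣ d ∣ ℕ.* ∣ d ∣)
          eqℕ = ℤP.+-injective (≡.trans (ℤP.pos-* p p) (≡.trans h (cong₂ _+_ (i*i a) (≡.trans (cong (+ 6 *_) (i*i d)) (≡.sym (ℤP.pos-* 6 (∣ d ∣ ℕ.* ∣ d ∣)))))))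
          p≤d : p ≤ ∣ d ∣
          p≤d = subst (p ≤_) (≡.sym d≡) (ℕP.m≤m+n p (c ℕ.* p))
          big : 6 ℕ.* (p ℕ.* p) ≤ p ℕ.* p
          big = ℕP.≤-trans (ℕP.*-monoʳ-≤ 6 (ℕP.*-mono-≤ p≤d p≤d)) (subst (6 ℕ.* (∣ d ∣ ℕ.* ∣ d ∣) ≤_) (≡.sym eqℕ) (ℕP.m≤n+m (6 ℕ.* (∣ d ∣ ℕ.* ∣ d ∣)) (∣ a ∣ ℕ.* ∣ a ∣)))
          small : p ℕ.* p < 6 ℕ.* (p ℕ.* p)
          small = subst (_< 6 ℕ.* (p ℕ.* p)) (ℕP.*-identityˡ (p ℕ.* p)) (ℕP.*-monoˡ-< (p ℕ.* p) {{ℕP.m*n≢0 p p}} {1} {6} (s≤s (s≤s z≤n)))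
      composition : + p * + p ≡ (x * x + + 6 * (y * y)) * (x₀ * x₀ + + 6 * (y₀ * y₀))
      composition = cong₂ _*_ e e₀
      product-zero : (x * y₀ - x₀ * y) * (x * y₀ + x₀ * y) ≡ + 0
      product-zero with euclidsLemma ∣ x * y₀ - x₀ * y ∣ ∣ x * y₀ + x₀ * y ∣ pr
        (divides ∣ y₀ * y₀ - y * y ∣ (≡.trans (≡.sym (ℤP.abs-* (x * y₀ - x₀ * y) (x * y₀ + x₀ * y))) (≡.trans (cong ∣_∣ cross)
          (≡.trans (ℤP.abs-* (+ p) (y₀ * y₀ - y * y)) (ℕP.*-comm p ∣ y₀ * y₀ - y * y ∣)))))
      ... | inj₁ h = ≡.trans (cong (_* (x * y₀ + x₀ * y)) (zero-if-divisible (x * x₀ + + 6 * (y * y₀)) (x * y₀ - x₀ * y) (≡.trans composition (lem x y x₀ y₀)) h))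
                       (ℤP.*-zeroˡ (x * y₀ + x₀ * y))
        where lem : ∀ x y x₀ y₀ → (x * x + + 6 * (y * y)) * (x₀ * x₀ + + 6 * (y₀ * y₀)) ≡
                      (x * x₀ + + 6 * (y * y₀)) * (x * x₀ + + 6 * (y * y₀)) + + 6 * ((x * y₀ - x₀ * y) * (x * y₀ - x₀ * y))
              lem = solve-∀
      ... | inj₂ h = ≡.trans (cong ((x * y₀ - x₀ * y) *_) (zero-if-divisible (x * x₀ - + 6 * (y * y₀)) (x * y₀ + x₀ * y) (≡.trans composition (lem x y x₀ y₀)) h))
                       (ℤP.*-zeroʳ (x * y₀ - x₀ * y))
        where lem : ∀ x y x₀ y₀ → (x * x + + 6 * (y * y)) * (x₀ * x₀ + + 6 * (y₀ * y₀)) ≡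
                      (x * x₀ - + 6 * (y * y₀)) * (x * x₀ - + 6 * (y * y₀)) + + 6 * ((x * y₀ + x₀ * y) * (x * y₀ + x₀ * y))
              lem = solve-∀
      y² : y * y ≡ y₀ * y₀
      y² = ≡.sym (ℤP.i-j≡0⇒i≡j (y₀ * y₀) (y * y) (ℤP.*-cancelˡ-≡ (+ p) (y₀ * y₀ - y * y) (+ 0)
             (≡.trans (≡.sym cross) (≡.trans product-zero (≡.sym (ℤP.*-zeroʳ (+ p)))))))
      finish : x * x ≡ x₀ * x₀ × y * y ≡ y₀ * y₀
      finish = (≡.trans (lem x y) (≡.trans (cong₂ (λ a b → a - + 6 * b) (≡.trans (≡.sym e) e₀) y²) (≡.sym (lem x₀ y₀)))) , y²
        where lem : ∀ x y → x * x ≡ x * x + + 6 * (y * y) - + 6 * (y * y)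
              lem = solve-∀

  ∤-multiple : ∀ d {z c} → + d * z ≡ c → ¬ (d ℕD.∣ ∣ c ∣) → ⊥
  ∤-multiple d {z} h n = n (divides ∣ z ∣ (≡.trans (cong ∣_∣ (≡.sym h)) (≡.trans (ℤP.abs-* (+ d) z) (ℕP.*-comm d ∣ z ∣))))

  -- The equation gives x² ≡ 1 modulo 6, hence x ≡ 1 or 5, and one of x and -x has the form 6k + 1.
  -- The other residues r are excluded since 6 does not divide r² - 1.
  normalize : ∀ m x y → + 1 + + 6 * m ≡ x * x + + 6 * (y * y) → Σ ℤ λ k → (+ 6 * k + + 1) * (+ 6 * k + + 1) ≡ x * x
  normalize m x y e = go (x ℤ.%ℕ 6) (x ℤ./ℕ 6) (n%ℕd<d x 6) (a≡a%ℕn+[a/ℕn]*n x 6)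
    where
      rem : ∀ t r → x ≡ r + t * + 6 → + 6 * (m - + 6 * t * t - + 2 * r * t - y * y) ≡ r * r - + 1
      rem t r refl = ≡.trans (l₁ m t r y) (≡.trans (cong (λ z → z - + 1 - (r + t * + 6) * (r + t * + 6) - + 6 * (y * y) + r * r) e) (l₂ t r y))
        where l₁ : ∀ m t r y → + 6 * (m - + 6 * t * t - + 2 * r * t - y * y) ≡ + 1 + + 6 * m - + 1 - (r + t * + 6) * (r + t * + 6) - + 6 * (y * y) + r * r
              l₁ = solve-∀
              l₂ : ∀ t r y → (r + t * + 6) * (r + t * + 6) + + 6 * (y * y) - + 1 - (r + t * + 6) * (r + t * + 6) - + 6 * (y * y) + r * r ≡ r * r - + 1
              l₂ = solve-∀
      go : ∀ r t → r < 6 → x ≡ + r + t * + 6 → Σ ℤ λ k → (+ 6 * k + + 1) * (+ 6 * k + + 1) ≡ x * x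
      go 0 t _ h = ⊥-elim (∤-multiple 6 (rem t (+ 0) h) (from-no (6 ℕD.∣? 1)))
      go 1 t _ h = t , ≡.trans (lem t) (cong (λ z → z * z) (≡.sym h))
        where lem : ∀ t → (+ 6 * t + + 1) * (+ 6 * t + + 1) ≡ (+ 1 + t * + 6) * (+ 1 + t * + 6)
              lem = solve-∀
      go 2 t _ h = ⊥-elim (∤-multiple 6 (rem t (+ 2) h) (from-no (6 ℕD.∣? 3)))
      go 3 t _ h = ⊥-elim (∤-multiple 6 (rem t (+ 3) h) (from-no (6 ℕD.∣? 8)))
      go 4 t _ h = ⊥-elim (∤-multiple 6 (rem t (+ 4) h) (from-no (6 ℕD.∣? 15)))
      go 5 t _ h = - t - + 1 , ≡.trans (lem t) (cong (λ z → z * z) (≡.sym h))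
        where lem : ∀ t → (+ 6 * (- t - + 1) + + 1) * (+ 6 * (- t - + 1) + + 1) ≡ (+ 5 + t * + 6) * (+ 5 + t * + 6)
              lem = solve-∀
      go (suc (suc (suc (suc (suc (suc r)))))) t (s≤s (s≤s (s≤s (s≤s (s≤s (s≤s ())))))) h

  -- An exponent 2 pent k + l² equals m exactly when (6k+1)² + 6l² = p. By uniqueness only k = k₀
  -- and l = ±y contribute, each with 6k₀ + 1 = ±x. These are two points because y = 0 would make
  -- the prime p a square.
  G₁-value : ∀ {p} → Prime p → ∀ m → p ≡ 1 ℕ.+ 6 ℕ.* m → ∀ x y → + p ≡ x * x + + 6 * (y * y) → at G₁ m * at G₁ m ≡ + 4 * (x * x)
  G₁-value {p} pr m p≡ x y e = value (normalize (+ m) x y (≡.trans (≡.sym +p) e)) ∣ y ∣ refl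
    where
      +p : + p ≡ + 1 + + 6 * + m
      +p = ≡.trans (cong +_ p≡) (cong (λ z → + 1 + z) (ℤP.pos-* 6 m))
      open Identities (suc m)
      h : (λ k l → tm ((+ 6 * k + + 1) * + 1) (+ 2 * pent k + + 1 * sq l)) ⇓ G₁
      h = Θ-product {λ k → + 6 * k + + 1} {𝟙} (·-adm {+ 2} (1≤ 1) pent-adm) (·-adm {+ 1} (1≤ 0) sq-adm)
      form : ∀ k l → + 2 * pent k + + 1 * sq l ≡ + m → + p ≡ (+ 6 * k + + 1) * (+ 6 * k + + 1) + + 6 * (l * l)
      form k l e = ≡.trans +p (≡.trans (cong (λ z → + 1 + + 6 * z) (≡.sym e)) (lem k l))
        where lem : ∀ k l → + 1 + + 6 * (+ 2 * (k * (+ 3 * k + + 1)) + + 1 * (l * l)) ≡ (+ 6 * k + + 1) * (+ 6 * k + + 1) + + 6 * (l * l)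
              lem = solve-∀
      value : (Σ ℤ λ k → (+ 6 * k + + 1) * (+ 6 * k + + 1) ≡ x * x) → ∀ b → ∣ y ∣ ≡ b → at G₁ m * at G₁ m ≡ + 4 * (x * x)
      value (k₀ , k₀²) zero y≡0 = contradiction (subst Prime p-square pr) (composite ∣ x ∣)
        where
          p-square : p ≡ ∣ x ∣ ℕ.* ∣ x ∣
          p-square = ℤP.+-injective (≡.trans e (≡.trans (cong (λ z → x * x + + 6 * z) (≡.trans (i*i y) (cong (λ n → + (n ℕ.* n)) y≡0))) (≡.trans (ℤP.+-identityʳ (x * x)) (i*i x))))
          divisible : ∀ n → Prime (n ℕ.* n) → ¬ (n ℕ.* n ℕD.∣ n)
          divisible zero q _ = ¬prime[0] q
          divisible (suc zero) q _ = ¬prime[1] q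
          divisible (suc (suc n)) q d = ℕP.<⇒≱ (ℕP.m<m*n (suc (suc n)) (suc (suc n)) (s≤s (s≤s z≤n))) (ℕD.∣⇒≤ d)
          composite : ∀ n → ¬ Prime (n ℕ.* n)
          composite n q with euclidsLemma n n q ℕD.∣-refl
          ... | inj₁ d = divisible n q d
          ... | inj₂ d = divisible n q d
      value (k₀ , k₀²) (suc b) y≡b = begin
        at G₁ m * at G₁ m                          ≡⟨ cong (λ z → z * z) total ⟩
        (n₀ + n₀) * (n₀ + n₀)                      ≡⟨ lem n₀ ⟩
        + 4 * (n₀ * n₀)                            ≡⟨ cong (+ 4 *_) k₀² ⟩
        + 4 * (x * x)                              ∎
        where
          open ≡-Reasoning
          n₀ = + 6 * k₀ + + 1
          lem : ∀ n → (n + n) * (n + n) ≡ + 4 * (n * n)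
          lem = solve-∀
          b² : + suc b * + suc b ≡ y * y
          b² = ≡.sym (≡.trans (i*i y) (≡.trans (cong (λ n → + (n ℕ.* n)) y≡b) (ℤP.pos-* (suc b) (suc b))))
          C = _⇓_.bound h ℕ.+ (∣ k₀ ∣ ℕ.+ suc b)
          term : ℤ → ℤ → ℤ
          term k l = (+ 6 * k + + 1) * + 1 * δ (+ 2 * pent k + + 1 * sq l) m
          support : ∀ k l → + 2 * pent k + + 1 * sq l ≡ + m → k ≡ k₀ × l * l ≡ y * y
          support k l eq = same (square-roots (+ 6 * k + + 1) n₀ (≡.trans (proj₁ uniq) (≡.sym k₀²))) , proj₂ uniq
            where
              uniq = representation-unique pr (+ 6 * k + + 1) l x y (form k l eq) e
              same : + 6 * k + + 1 ≡ n₀ ⊎ + 6 * k + + 1 ≡ - n₀ → k ≡ k₀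
              same (inj₁ s) = ℤP.*-cancelˡ-≡ (+ 6) k k₀ (+-cancelˡ (+ 1) (≡.trans (ℤP.+-comm (+ 1) (+ 6 * k)) (≡.trans s (ℤP.+-comm (+ 6 * k₀) (+ 1)))))
              same (inj₂ s) = ⊥-elim (∤-multiple 6 (≡.trans (l₁ k k₀) (≡.trans (cong (λ z → z - + 1 + + 6 * k₀) s) (l₂ k₀))) (from-no (6 ℕD.∣? 2)))
                where l₁ : ∀ k k₀ → + 6 * (k + k₀) ≡ + 6 * k + + 1 - + 1 + + 6 * k₀
                      l₁ = solve-∀
                      l₂ : ∀ k₀ → - (+ 6 * k₀ + + 1) - + 1 + + 6 * k₀ ≡ - + 2
                      l₂ = solve-∀
          term-0 : ∀ k l → ¬ (+ 2 * pent k + + 1 * sq l ≡ + m) → term k l ≡ + 0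
          term-0 k l n = ≡.trans (cong ((+ 6 * k + + 1) * + 1 *_) (δ-≢ (+ 2 * pent k + + 1 * sq l) m n)) (ℤP.*-zeroʳ ((+ 6 * k + + 1) * + 1))
          exponent : ∀ l → l * l ≡ y * y → + 2 * pent k₀ + + 1 * sq l ≡ + m
          exponent l l² = ℤP.*-cancelˡ-≡ (+ 6) _ (+ m) (+-cancelˡ (+ 1) (≡.trans (lem₁ k₀ l) (≡.trans (cong₂ (λ u v → u + + 6 * v) k₀² l²) (≡.trans (≡.sym e) +p))))
            where lem₁ : ∀ k l → + 1 + + 6 * (+ 2 * (k * (+ 3 * k + + 1)) + + 1 * (l * l)) ≡ (+ 6 * k + + 1) * (+ 6 * k + + 1) + + 6 * (l * l)
                  lem₁ = solve-∀
          term-1 : ∀ l → l * l ≡ y * y → term k₀ l ≡ n₀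
          term-1 l l² = ≡.trans (cong (λ z → n₀ * + 1 * z) (≡.trans (cong (λ z → δ z m) (exponent l l²)) (δ-≡ m))) (lem₁ n₀)
            where lem₁ : ∀ n → n * + 1 * + 1 ≡ n
                  lem₁ = solve-∀
          total : at G₁ m ≡ n₀ + n₀
          total = begin
            at G₁ m
              ≡⟨ double-coefficient m h C (ℕP.m≤m+n _ _) ⟩
            sumℤ C (λ k → sumℤ C (λ l → term k l))
              ≡⟨ sumℤ-single C k₀ _ (ℕP.≤-trans (ℕP.m≤m+n _ _) (ℕP.m≤n+m _ (_⇓_.bound h)))
                   (λ k k≢ → sumℤ-0 C (λ l _ → term-0 k l (λ eq → k≢ (proj₁ (support k l eq))))) ⟩
            sumℤ C (λ l → term k₀ l)
              ≡⟨ sumℤ-pair C b (term k₀) (ℕP.≤-trans (ℕP.m≤n+m (suc b) ∣ k₀ ∣) (ℕP.m≤n+m _ (_⇓_.bound h)))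
                   (λ l l≢+ l≢- → term-0 k₀ l (λ eq → [ l≢+ , l≢- ] (square-roots l (+ suc b) (≡.trans (proj₂ (support k₀ l eq)) (≡.sym b²))))) ⟩
            term k₀ (+ suc b) + term k₀ -[1+ b ]
              ≡⟨ cong₂ _+_ (term-1 (+ suc b) b²) (term-1 -[1+ b ] b²) ⟩
            n₀ + n₀ ∎

  -- 2 n² + 3 j² with j odd is congruent to 3 or 5 modulo 8.
  no-representation : ∀ t k l → + 1 * oct k + + 4 * tri l ≢ + 2 + + 4 * t × + 1 * oct k + + 4 * tri l ≢ + 3 + + 4 * t
  no-representation t k l = (λ e → first (k ℤ.%ℕ 2) (k ℤ./ℕ 2) (n%ℕd<d k 2) (a≡a%ℕn+[a/ℕn]*n k 2) e) , (λ e → second (k ℤ.%ℕ 2) (k ℤ./ℕ 2) (n%ℕd<d k 2) (a≡a%ℕn+[a/ℕn]*n k 2) e)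
    where
      expand : ∀ r u c → k ≡ r + u * + 2 → + 1 * oct k + + 4 * tri l ≡ c + + 4 * t →
        + 4 * (t - tri l - + 3 * u * u - + 3 * r * u - u) ≡ r * (+ 3 * r + + 2) - c
      expand r u c refl e = ≡.trans (l₁ t l r u c) (≡.trans (cong (λ z → z - c - (+ 1 * ((r + u * + 2) * (+ 3 * (r + u * + 2) + + 2)) + + 4 * (l * (+ 2 * l + + 1))) + r * (+ 3 * r + + 2)) (≡.sym e)) (l₂ l r u c))
        where l₁ : ∀ t l r u c → + 4 * (t - l * (+ 2 * l + + 1) - + 3 * u * u - + 3 * r * u - u) ≡
                     c + + 4 * t - c - (+ 1 * ((r + u * + 2) * (+ 3 * (r + u * + 2) + + 2)) + + 4 * (l * (+ 2 * l + + 1))) + r * (+ 3 * r + + 2)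
              l₁ = solve-∀
              l₂ : ∀ l r u c → + 1 * ((r + u * + 2) * (+ 3 * (r + u * + 2) + + 2)) + + 4 * (l * (+ 2 * l + + 1)) - c - (+ 1 * ((r + u * + 2) * (+ 3 * (r + u * + 2) + + 2)) + + 4 * (l * (+ 2 * l + + 1))) + r * (+ 3 * r + + 2) ≡ r * (+ 3 * r + + 2) - c
              l₂ = solve-∀
      first : ∀ r u → r < 2 → k ≡ + r + u * + 2 → + 1 * oct k + + 4 * tri l ≡ + 2 + + 4 * t → ⊥
      first 0 u _ h e = ∤-multiple 4 (expand (+ 0) u (+ 2) h e) (from-no (4 ℕD.∣? 2))
      first 1 u _ h e = ∤-multiple 4 (expand (+ 1) u (+ 2) h e) (from-no (4 ℕD.∣? 3))
      first (suc (suc r)) u (s≤s (s≤s ())) h e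
      second : ∀ r u → r < 2 → k ≡ + r + u * + 2 → + 1 * oct k + + 4 * tri l ≡ + 3 + + 4 * t → ⊥
      second 0 u _ h e = ∤-multiple 4 (expand (+ 0) u (+ 3) h e) (from-no (4 ℕD.∣? 3))
      second 1 u _ h e = ∤-multiple 4 (expand (+ 1) u (+ 3) h e) (from-no (4 ℕD.∣? 2))
      second (suc (suc r)) u (s≤s (s≤s ())) h e

  -- The exponents oct k + 4 tri l are 0 or 1 modulo 4, while m is 2 or 3. In terms of p, an
  -- exponent m would mean p = 2(3k+1)² + 3(4l+1)².
  G₅-value : ∀ m t → m ≡ 2 ℕ.+ 4 ℕ.* t ⊎ m ≡ 3 ℕ.+ 4 ℕ.* t → at G₅ m ≡ + 0
  G₅-value m t m≡ = ≡.trans (double-coefficient m h (_⇓_.bound h) ℕP.≤-refl) (sumℤ-0 (_⇓_.bound h) (λ k _ → sumℤ-0 (_⇓_.bound h) (λ l _ →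
      ≡.trans (cong (sgn k * (+ 3 * k + + 1) * + 1 *_) (δ-≢ (+ 1 * oct k + + 4 * tri l) m (none k l m≡))) (ℤP.*-zeroʳ (sgn k * (+ 3 * k + + 1) * + 1)))))
    where
      open Identities (suc m)
      h : (λ k l → tm (sgn k * (+ 3 * k + + 1) * + 1) (+ 1 * oct k + + 4 * tri l)) ⇓ G₅
      h = Θ-product {λ k → sgn k * (+ 3 * k + + 1)} {𝟙} (·-adm {+ 1} (1≤ 0) oct-adm) (·-adm {+ 4} (1≤ 3) tri-adm)
      none : ∀ k l → m ≡ 2 ℕ.+ 4 ℕ.* t ⊎ m ≡ 3 ℕ.+ 4 ℕ.* t → + 1 * oct k + + 4 * tri l ≢ + m
      none k l (inj₁ refl) e = proj₁ (no-representation (+ t) k l) (≡.trans e (cong (λ z → + 2 + z) (ℤP.pos-* 4 t)))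
      none k l (inj₂ refl) e = proj₂ (no-representation (+ t) k l) (≡.trans e (cong (λ z → + 3 + z) (ℤP.pos-* 4 t)))

-- Passage to rational numbers, and the two cases of the theorem.

open import Defs
open import Data.Nat.Combinatorics using (_C_; nCk≡nC[n∸k]; nCn≡1; nCk+nC[k+1]≡[n+1]C[k+1])
open import Data.Rational as ℚ using (ℚ; _/_; 0ℚ; mkℚ; ↥_; ↧_; ↧ₙ_)
open import Data.Rational.Properties as ℚP using ()
open import Data.Rational.Unnormalised as ℚᵘ using (mkℚᵘ)

open PowerSeries using (_≡_[_]; ≡⇒cg; cg-refl; cg-trans; cg-sym; cg-*; cg-+; at)
open ThetaSeries using (sgnℕ; sgnℕ²)
open EtaQuotients using (module Forms)
open ModularFunctions using (cg⇒∣)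
open CoefficientExtraction using (module Coefficient)
open Binomials hiding (T)
open DombRecurrence using (Domb; F)
open Legendre using (U; X; X≡U²)
open ReductionModPrime
open Representations

open Forms using (G₁; G₅)

C≡bin : ∀ n k → + (n C k) ≡ bin n k
C≡bin n zero = ≡.trans (cong +_ (≡.trans (nCk≡nC[n∸k] {0} {n} z≤n) (nCn≡1 n))) (≡.sym (ℤP.^-zeroˡ n))
C≡bin zero (suc k) = refl
C≡bin (suc n) (suc k) = ≡.trans (cong +_ (≡.sym (nCk+nC[k+1]≡[n+1]C[k+1] n k))) (cong₂ _+_ (C≡bin n k) (≡.trans (C≡bin n (suc k)) (≡.sym (ℤP.*-identityˡ (bin n (suc k))))))

two≡2* : ∀ k → 2 ℕ.* k ≡ two k
two≡2* k = ℤP.+-injective (≡.trans (ℤP.pos-* 2 k) (≡.sym (+two k)))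

three≡3* : ∀ k → 3 ℕ.* k ≡ three k
three≡3* k = ℤP.+-injective (≡.trans (ℤP.pos-* 3 k) (≡.sym (+three k)))

+sumℕ : ∀ n f → + sumℕ n f ≡ ∑ n (λ k → + f k)
+sumℕ zero f = refl
+sumℕ (suc n) f = cong (_+ + f (suc n)) (+sumℕ n f)

A≡Domb : ∀ n → + A n ≡ Domb n
A≡Domb n = ≡.trans (+sumℕ n _) (≡.trans (∑-cong n summand) (∑-diag n F))
  where
    summand : ∀ k → k ≤ n → + (((2 ℕ.* k) C k) ℕ.* ((2 ℕ.* n ∸ 2 ℕ.* k) C (n ∸ k)) ℕ.* ((n C k) ℕ.* (n C k))) ≡ F k (n ∸ k)
    summand k l = begin
      + (((2 ℕ.* k) C k) ℕ.* ((2 ℕ.* n ∸ 2 ℕ.* k) C (n ∸ k)) ℕ.* ((n C k) ℕ.* (n C k)))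
        ≡⟨ ≡.trans (ℤP.pos-* (((2 ℕ.* k) C k) ℕ.* ((2 ℕ.* n ∸ 2 ℕ.* k) C (n ∸ k))) ((n C k) ℕ.* (n C k)))
             (cong₂ _*_ (ℤP.pos-* ((2 ℕ.* k) C k) ((2 ℕ.* n ∸ 2 ℕ.* k) C (n ∸ k))) (ℤP.pos-* (n C k) (n C k))) ⟩
      + ((2 ℕ.* k) C k) * + ((2 ℕ.* n ∸ 2 ℕ.* k) C (n ∸ k)) * (+ (n C k) * + (n C k))
        ≡⟨ cong₂ (λ x y → x * y * (+ (n C k) * + (n C k))) (central k) (≡.trans (cong (λ z → + (z C (n ∸ k))) (≡.sym (ℕP.*-distribˡ-∸ 2 n k))) (central (n ∸ k))) ⟩
      B k * B (n ∸ k) * (+ (n C k) * + (n C k))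
        ≡⟨ cong (λ z → B k * B (n ∸ k) * (z * z)) (≡.trans (C≡bin n k) (cong (λ z → bin z k) (≡.sym (ℕP.m+[n∸m]≡n l)))) ⟩
      B k * B (n ∸ k) * (bin (k ℕ.+ (n ∸ k)) k * bin (k ℕ.+ (n ∸ k)) k)
        ≡⟨ ℤP.*-comm (B k * B (n ∸ k)) (bin (k ℕ.+ (n ∸ k)) k * bin (k ℕ.+ (n ∸ k)) k) ⟩
      F k (n ∸ k) ∎
      where
        open ≡-Reasoning
        central : ∀ k → + ((2 ℕ.* k) C k) ≡ B k
        central k = ≡.trans (C≡bin (2 ℕ.* k) k) (cong (λ z → bin z k) (two≡2* k))

-- x = N / E
record Fraction (x : ℚ) (N E : ℤ) : Set where
  constructor fraction
  field cross : ↥ x * E ≡ N * ↧ x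

fraction-/ : ∀ i d .{{_ : ℕ.NonZero d}} → Fraction (i / d) i (+ d)
fraction-/ i (suc d) with ℚP.toℚᵘ-fromℚᵘ (mkℚᵘ i d)
... | ℚᵘ.*≡* e = fraction (≡.trans (cong (_* + suc d) (≡.sym (ℚP.↥ᵘ-toℚᵘ (i / suc d)))) (≡.trans e (cong (i *_) (ℚP.↧ᵘ-toℚᵘ (i / suc d)))))

fraction-+ : ∀ x y {N K E} → Fraction x N E → Fraction y K E → Fraction (x ℚ.+ y) (N + K) E
fraction-+ x@(mkℚ _ dx _) y@(mkℚ _ dy _) {N} {K} {E} (fraction hx) (fraction hy) with ℚP.toℚᵘ-homo-+ x y
... | ℚᵘ.*≡* e = fraction (*-cancel dx (*-cancel dy (begin
    ↧ y * (↧ x * (↥ s * E))                                  ≡⟨ l₁ (↧ y) (↧ x) (↥ s) E ⟩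
    ↥ s * (↧ x * ↧ y) * E                                    ≡⟨ cong (_* E) homo ⟩
    (↥ x * ↧ y + ↥ y * ↧ x) * ↧ s * E                        ≡⟨ l₂ (↥ x) (↥ y) (↧ x) (↧ y) (↧ s) E ⟩
    (↥ x * E * ↧ y + ↥ y * E * ↧ x) * ↧ s                    ≡⟨ cong₂ (λ a b → (a * ↧ y + b * ↧ x) * ↧ s) hx hy ⟩
    (N * ↧ x * ↧ y + K * ↧ y * ↧ x) * ↧ s                    ≡⟨ l₃ N K (↧ x) (↧ y) (↧ s) ⟩
    ↧ y * (↧ x * ((N + K) * ↧ s))                            ∎)))
  where
    open ≡-Reasoning
    s = x ℚ.+ y
    homo : ↥ s * (↧ x * ↧ y) ≡ (↥ x * ↧ y + ↥ y * ↧ x) * ↧ s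
    homo = ≡.trans (cong₂ _*_ (≡.sym (ℚP.↥ᵘ-toℚᵘ s)) (≡.sym (ℤP.pos-* (suc dx) (suc dy)))) (≡.trans e (cong ((↥ x * ↧ y + ↥ y * ↧ x) *_) (ℚP.↧ᵘ-toℚᵘ s)))
    l₁ : ∀ a b s e → a * (b * (s * e)) ≡ s * (b * a) * e
    l₁ = solve-∀
    l₂ : ∀ x y a b s e → (x * b + y * a) * s * e ≡ (x * e * b + y * e * a) * s
    l₂ = solve-∀
    l₃ : ∀ n k a b s → (n * a * b + k * b * a) * s ≡ b * (a * ((n + k) * s))
    l₃ = solve-∀

fraction-neg : ∀ x {N E} → Fraction x N E → Fraction (ℚ.- x) (- N) E
fraction-neg x {N} {E} (fraction h) = fraction (begin
  ↥ (ℚ.- x) * E     ≡⟨ cong (_* E) (ℚP.↥-neg x) ⟩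
  - ↥ x * E         ≡⟨ ℤP.neg-distribˡ-* (↥ x) E ⟨
  - (↥ x * E)       ≡⟨ cong -_ h ⟩
  - (N * ↧ x)       ≡⟨ ℤP.neg-distribˡ-* N (↧ x) ⟩
  - N * ↧ x         ≡⟨ cong (- N *_) (ℚP.↧-neg x) ⟨
  - N * ↧ (ℚ.- x)   ∎)
  where open ≡-Reasoning

fraction-scale : ∀ x c {N E} → Fraction x N E → Fraction x (c * N) (c * E)
fraction-scale x c {N} {E} (fraction h) = fraction (≡.trans (lem (↥ x) c E) (≡.trans (cong (c *_) h) (≡.sym (ℤP.*-assoc c N (↧ x)))))
  where lem : ∀ x c e → x * (c * e) ≡ c * (x * e)
        lem = solve-∀

-- The numerator over the common denominator 8^n, in general not in lowest terms. The congruences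
-- are proved for this integer, and lowest terms enter only in `conclude`.
numerator : ℕ → ℤ
numerator n = ∑ n (λ k → (+ 8) ^ (n ∸ k) * (sign k * + A k))

+8^ : ∀ n → + (8 ℕ.^ n) ≡ (+ 8) ^ n
+8^ zero = refl
+8^ (suc n) = ≡.trans (ℤP.pos-* 8 (8 ℕ.^ n)) (cong (+ 8 *_) (+8^ n))

fraction-term : ∀ n → Fraction (term n) (sign n * + A n) ((+ 8) ^ n)
fraction-term n = subst (Fraction (term n) (sign n * + A n)) (+8^ n) (fraction-/ (sign n * + A n) (8 ℕ.^ n) {{ℕP.m^n≢0 8 n}})

fraction-sum : ∀ n → Fraction (sumℚ n term) (numerator n) ((+ 8) ^ n)
fraction-sum zero = subst (λ N → Fraction (term 0) N (+ 1)) (≡.sym (ℤP.*-identityˡ (sign 0 * + A 0))) (fraction-term 0)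
fraction-sum (suc n) = subst (λ N → Fraction (sumℚ n term ℚ.+ term (suc n)) N ((+ 8) ^ suc n)) (≡.sym step)
    (fraction-+ (sumℚ n term) (term (suc n)) (fraction-scale (sumℚ n term) (+ 8) (fraction-sum n)) (fraction-term (suc n)))
  where
    step : numerator (suc n) ≡ + 8 * numerator n + sign (suc n) * + A (suc n)
    step = cong₂ _+_ (≡.trans (∑-cong n (λ k l → ≡.trans (cong (λ e → (+ 8) ^ e * (sign k * + A k)) (ℕP.+-∸-assoc 1 l)) (ℤP.*-assoc (+ 8) ((+ 8) ^ (n ∸ k)) (sign k * + A k))))
             (∑-* n (+ 8) _))
      (≡.trans (cong (λ e → (+ 8) ^ e * (sign (suc n) * + A (suc n))) (ℕP.n∸n≡0 n)) (ℤP.*-identityˡ (sign (suc n) * + A (suc n))))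

sign≡sgnℕ : ∀ n → sign n ≡ sgnℕ n
sign≡sgnℕ zero = refl
sign≡sgnℕ (suc n) = cong -_ (sign≡sgnℕ n)

-- The sign (-1)^n is (-1)^M times (-1)^(M-n), and the latter is absorbed by 8^(M-n).
Domb-numerator : ∀ M → numerator M ≡ sgnℕ M * ∑ M (λ n → (- + 8) ^ (M ∸ n) * Domb n)
Domb-numerator M = ≡.trans (∑-cong M summand) (∑-* M (sgnℕ M) (λ n → (- + 8) ^ (M ∸ n) * Domb n))
  where
    summand : ∀ n → n ≤ M → (+ 8) ^ (M ∸ n) * (sign n * + A n) ≡ sgnℕ M * ((- + 8) ^ (M ∸ n) * Domb n)
    summand n l = begin
      e * (sign n * + A n)                                                      ≡⟨ cong₂ (λ x y → e * (x * y)) (sign≡sgnℕ n) (A≡Domb n) ⟩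
      e * (sgnℕ n * Domb n)                                                     ≡⟨ l₁ e (sgnℕ n) (Domb n) ⟩
      + 1 * sgnℕ n * e * Domb n                                                 ≡⟨ cong (λ z → z * sgnℕ n * e * Domb n) (sgnℕ² (M ∸ n)) ⟨
      sgnℕ (M ∸ n) * sgnℕ (M ∸ n) * sgnℕ n * e * Domb n                         ≡⟨ l₂ (sgnℕ (M ∸ n)) (sgnℕ n) e (Domb n) ⟩
      sgnℕ (M ∸ n) * sgnℕ n * (sgnℕ (M ∸ n) * e * Domb n)                       ≡⟨ cong₂ (λ x y → x * (y * Domb n)) (≡.trans (≡.sym (sgnℕ-+ (M ∸ n) n)) (cong sgnℕ (ℕP.m∸n+n≡m l))) (≡.sym (sgn-^ (+ 8) (M ∸ n))) ⟩
      sgnℕ M * ((- + 8) ^ (M ∸ n) * Domb n)                                     ∎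
      where
        open ≡-Reasoning
        e = (+ 8) ^ (M ∸ n)
        l₁ : ∀ e s d → e * (s * d) ≡ + 1 * s * e * d
        l₁ = solve-∀
        l₂ : ∀ s s′ e d → s * s * s′ * e * d ≡ s * s′ * (s * e * d)
        l₂ = solve-∀

^-square : ∀ a m → a ^ (m ℕ.+ m) ≡ (a * a) ^ m
^-square a m = ≡.trans (ℤP.^-distribˡ-+-* a m m) (go m)
  where
    lem : ∀ a x → a * x * (a * x) ≡ a * a * (x * x)
    lem = solve-∀
    go : ∀ m → a ^ m * a ^ m ≡ (a * a) ^ m
    go zero = refl
    go (suc m) = ≡.trans (lem a (a ^ m)) (cong (a * a *_) (go m))

prime∤^ : ∀ {p} → Prime p → ∀ a n → ¬ (p ℕD.∣ a) → ¬ (p ℕD.∣ a ℕ.^ n)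
prime∤^ pr a zero p∤a d = ¬prime[1] (subst Prime (ℕD.∣1⇒≡1 d) pr)
prime∤^ pr a (suc n) p∤a d with euclidsLemma a (a ℕ.^ n) pr d
... | inj₁ h = p∤a h
... | inj₂ h = prime∤^ pr a n p∤a h

-- Cross multiplication shows that p divides 8^n times the reduced numerator, hence the numerator
-- itself; as the fraction is in lowest terms, p is then prime to the denominator.
conclude : ∀ {p} → Prime p → ∀ x N n → ¬ (p ℕD.∣ 8) → Fraction x N ((+ 8) ^ n) → N ≡ + 0 [ p ] → (¬ (p ℕD.∣ ↧ₙ x)) × (p ℕD.∣ ∣ ↥ x ∣)
conclude {p} pr x@(mkℚ a d c) N n p∤8 (fraction h) N≡0 = p∤d , p∣a
  where
    eqℕ : ∣ a ∣ ℕ.* 8 ℕ.^ n ≡ ∣ N ∣ ℕ.* suc d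
    eqℕ = ≡.trans (≡.sym (ℤP.abs-* a (+ (8 ℕ.^ n)))) (≡.trans (cong (λ e → ∣ a * e ∣) (+8^ n)) (≡.trans (cong ∣_∣ h) (ℤP.abs-* N (+ suc d))))
    p∣a : p ℕD.∣ ∣ a ∣
    p∣a with euclidsLemma ∣ a ∣ (8 ℕ.^ n) pr (subst (p ℕD.∣_) (≡.sym eqℕ) (ℕD.∣m⇒∣m*n (suc d) (cg⇒∣ N≡0)))
    ... | inj₁ h = h
    ... | inj₂ h = contradiction h (prime∤^ pr 8 n p∤8)
    p∤d : ¬ (p ℕD.∣ suc d)
    p∤d h = ¬prime[1] (subst Prime (recompute c (p∣a , h)) pr)

too-big : ∀ {p n} → Prime p → suc n < p → ¬ (p ℕD.∣ suc n)
too-big pr l d = ℕP.<⇒≱ l (ℕD.∣⇒≤ d)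

module _ {p : ℕ} (pr : Prime p) (5≤p : 5 ≤ p) where

  p∤2 : ¬ (p ℕD.∣ 2)
  p∤2 = too-big pr (ℕP.≤-trans (s≤s (s≤s (s≤s z≤n))) 5≤p)

  p∤3 : ¬ (p ℕD.∣ 3)
  p∤3 = too-big pr (ℕP.≤-trans (s≤s (s≤s (s≤s (s≤s z≤n)))) 5≤p)

  p∤8 : ¬ (p ℕD.∣ 8)
  p∤8 = prime∤^ pr 2 3 p∤2

  p∤12 : ¬ (p ℕD.∣ 12)
  p∤12 d with euclidsLemma 4 3 pr d
  ... | inj₁ h = prime∤^ pr 2 2 p∤2 h
  ... | inj₂ h = p∤3 h

  open FermatU pr p∤2
  open ModPrime pr

  numerator₁ : ∀ m → p ≡ 1 ℕ.+ 6 ℕ.* m → ∀ x y → + p ≡ x * x + + 6 * (y * y) → numerator (p ∸ 1) ≡ + 4 * (x * x) [ p ]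
  numerator₁ m p≡ x y e = cg-trans (≡⇒cg even) (cg-trans sum (cg-trans (cg-* scale (cg-trans (≡⇒cg (X≡U² N)) (cg-* U≡ U≡)))
      (≡⇒cg (≡.trans (ℤP.*-identityˡ _) (G₁-value pr m p≡ x y e)))))
    where
      N = m ℕ.+ m
      M = three N ℕ.+ 0
      3N≡ : three N ≡ 6 ℕ.* m
      3N≡ = ≡.trans (≡.sym (three≡3* N)) (lem m)
        where lem : ∀ m → 3 ℕ.* (m ℕ.+ m) ≡ 6 ℕ.* m
              lem = ℕSolver.solve-∀
      M≡ : M ≡ 6 ℕ.* m
      M≡ = ≡.trans (ℕP.+-identityʳ (three N)) 3N≡
      p-M : suc M ≡ p
      p-M = ≡.trans (cong suc M≡) (≡.sym p≡)
      +p : + p ≡ + 1 + + 6 * + m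
      +p = ≡.trans (cong +_ p≡) (cong (λ z → + 1 + z) (ℤP.pos-* 6 m))
      3N : (+ 3 * + N + + 1) * (+ 3 * + N + + 2) ≡ + 0 [ p ]
      3N = cg-trans (≡⇒cg (≡.trans (cong (_* (+ 3 * + N + + 2)) (≡.trans (lem (+ m)) (≡.sym +p))) refl)) (p*≡0 (+ 3 * + N + + 2))
        where lem : ∀ m → + 3 * (m + m) + + 1 ≡ + 1 + + 6 * m
              lem = solve-∀
      sgn-even : ∀ m → sgnℕ (6 ℕ.* m) ≡ + 1
      sgn-even m = ≡.trans (cong sgnℕ (lem m)) (≡.trans (sgnℕ-+ (3 ℕ.* m) (3 ℕ.* m)) (sgnℕ² (3 ℕ.* m)))
        where lem : ∀ m → 6 ℕ.* m ≡ 3 ℕ.* m ℕ.+ 3 ℕ.* m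
              lem = ℕSolver.solve-∀
      even : numerator (p ∸ 1) ≡ ∑ M (λ n → (- + 8) ^ (M ∸ n) * Domb n)
      even = ≡.trans (cong numerator (cong (_∸ 1) (≡.sym p-M))) (≡.trans (Domb-numerator M)
        (≡.trans (cong (_* ∑ M (λ n → (- + 8) ^ (M ∸ n) * Domb n)) (≡.trans (cong sgnℕ M≡) (sgn-even m))) (ℤP.*-identityˡ _)))
      sum : ∑ M (λ n → (- + 8) ^ (M ∸ n) * Domb n) ≡ (- + 24) ^ 0 * (- + 1728) ^ N * X N [ p ]
      sum = Domb-sum N 0 p-M 3N
      -- Here N = 2m is even and 1728² = 12⁶, so the factor is 12^(p-1).
      scale : (- + 24) ^ 0 * (- + 1728) ^ N ≡ + 1 [ p ]
      scale = cg-trans (≡⇒cg (≡.trans (ℤP.*-identityˡ ((- + 1728) ^ N)) (≡.trans (^-square (- + 1728) m) (ℤP.^-*-assoc (+ 12) 6 m))))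
        (fermat′ 12 (6 ℕ.* m) (≡.sym p≡) p∤12)
      N<p : N < p
      N<p = subst (N <_) p-M (s≤s (N≤M N 0 p-M 3N))
      -- N/2 = m, and (N - 1)/2 = m - 1/2 is congruent to 4m because 6m + 1 is p.
      hyp : ∀ k → (+ N - + 2 * k) * (+ N - (+ 1 + + 2 * k)) ≡ + 4 * (+ (4 ℕ.* m) - k) * (+ m - k) [ p ]
      hyp k = cg-trans (≡⇒cg (≡.trans (lem (+ m) k) (cong₂ (λ a b → + 4 * (a - k) * (+ m - k) + b * (- + 2 * (+ m - k))) (≡.sym (ℤP.pos-* 4 m)) (≡.sym +p))))
          (cg-trans (cg-+ (cg-refl {a = + 4 * (+ (4 ℕ.* m) - k) * (+ m - k)}) (p*≡0 (- + 2 * (+ m - k)))) (≡⇒cg (ℤP.+-identityʳ _)))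
        where lem : ∀ m k → (m + m - + 2 * k) * (m + m - (+ 1 + + 2 * k)) ≡ + 4 * (+ 4 * m - k) * (m - k) + (+ 1 + + 6 * m) * (- + 2 * (m - k))
              lem = solve-∀
      -- The power 2^N = 4^m is exactly the factor in `at-lins₁`, so no constant is left over.
      U≡ : U N ≡ at G₁ m [ p ]
      U≡ = cg-trans (U-mod N (4 ℕ.* m) m N<p (ℕP.m≤m+n m m) hyp) (cg-trans (≡⇒cg (≡.trans (cong (_* alt (4 ℕ.* m) m) (^-square (+ 2) m)) (≡.sym (at-lins₁ (4 ℕ.* m) m))))
        (cg-sym (Coefficient.G₁-coefficient pr m p≡)))

  numerator₅ : ∀ m t → p ≡ 5 ℕ.+ 6 ℕ.* m → m ≡ 2 ℕ.+ 4 ℕ.* t ⊎ m ≡ 3 ℕ.+ 4 ℕ.* t → numerator (p ∸ 1) ≡ + 0 [ p ]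
  numerator₅ m t p≡ m≡ = cg-trans (≡⇒cg (≡.trans (cong numerator (cong (_∸ 1) (≡.sym p-M))) (Domb-numerator M)))
      (cg-trans (cg-*ˡ (sgnℕ M) (cg-trans (Domb-sum N 1 p-M 3N) (cg-*ˡ ((- + 24) ^ 1 * (- + 1728) ^ N) (cg-trans (≡⇒cg (X≡U² N)) (cg-* U≡0 U≡0)))))
        (≡⇒cg (lem₀ (sgnℕ M) ((- + 24) ^ 1 * (- + 1728) ^ N))))
    where
      lem₀ : ∀ s c → s * (c * (+ 0 * + 0)) ≡ + 0
      lem₀ = solve-∀
      N = suc (m ℕ.+ m)
      M = three N ℕ.+ 1
      p-M : suc M ≡ p
      p-M = ≡.trans (cong (λ z → suc (z ℕ.+ 1)) (≡.sym (three≡3* N))) (≡.trans (lem m) (≡.sym p≡))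
        where lem : ∀ m → suc (3 ℕ.* suc (m ℕ.+ m) ℕ.+ 1) ≡ 5 ℕ.+ 6 ℕ.* m
              lem = ℕSolver.solve-∀
      +p : + p ≡ + 5 + + 6 * + m
      +p = ≡.trans (cong +_ p≡) (cong (λ z → + 5 + z) (ℤP.pos-* 6 m))
      3N : (+ 3 * + N + + 1) * (+ 3 * + N + + 2) ≡ + 0 [ p ]
      3N = cg-trans (≡⇒cg (≡.trans (lem (+ m)) (cong (_* (+ 3 * + N + + 1)) (≡.sym +p)))) (p*≡0 (+ 3 * + N + + 1))
        where lem : ∀ m → (+ 3 * (+ 1 + (m + m)) + + 1) * (+ 3 * (+ 1 + (m + m)) + + 2) ≡ (+ 5 + + 6 * m) * (+ 3 * (+ 1 + (m + m)) + + 1)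
              lem = solve-∀
      N<p : N < p
      N<p = subst (N <_) p-M (s≤s (N≤M N 1 p-M 3N))
      -- Now (N - 1)/2 = m, and N/2 = m + 1/2 is congruent to 4m + 3 because 6m + 5 is p.
      hyp : ∀ k → (+ N - + 2 * k) * (+ N - (+ 1 + + 2 * k)) ≡ + 4 * (+ (3 ℕ.+ 4 ℕ.* m) - k) * (+ m - k) [ p ]
      hyp k = cg-trans (≡⇒cg (≡.trans (lem (+ m) k) (cong₂ (λ a b → + 4 * (+ 3 + a - k) * (+ m - k) + b * (- + 2 * (+ m - k))) (≡.sym (ℤP.pos-* 4 m)) (≡.sym +p))))
          (cg-trans (cg-+ (cg-refl {a = + 4 * (+ (3 ℕ.+ 4 ℕ.* m) - k) * (+ m - k)}) (p*≡0 (- + 2 * (+ m - k)))) (≡⇒cg (ℤP.+-identityʳ _)))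
        where lem : ∀ m k → (+ 1 + (m + m) - + 2 * k) * (+ 1 + (m + m) - (+ 1 + + 2 * k)) ≡ + 4 * (+ 3 + + 4 * m - k) * (m - k) + (+ 5 + + 6 * m) * (- + 2 * (m - k))
              lem = solve-∀
      -- The coefficient in `at-lins₅` carries the sign (-1)^m; a second factor (-1)^m removes it.
      alt≡0 : (+ 4) ^ m * alt (3 ℕ.+ 4 ℕ.* m) m ≡ + 0 [ p ]
      alt≡0 = cg-trans (≡⇒cg (≡.trans (≡.sym (ℤP.*-identityˡ y)) (≡.trans (cong (_* y) (≡.sym (sgnℕ² m))) (ℤP.*-assoc (sgnℕ m) (sgnℕ m) y))))
          (cg-trans (cg-*ˡ (sgnℕ m) (cg-trans (≡⇒cg (≡.sym (at-lins₅ (3 ℕ.+ 4 ℕ.* m) m))) (cg-trans (cg-sym (Coefficient.G₅-coefficient pr m p≡)) (≡⇒cg (G₅-value m t m≡)))))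
            (≡⇒cg (ℤP.*-zeroʳ (sgnℕ m))))
        where y = (+ 4) ^ m * alt (3 ℕ.+ 4 ℕ.* m) m
      U≡0 : U N ≡ + 0 [ p ]
      U≡0 = cg-trans (U-mod N (3 ℕ.+ 4 ℕ.* m) m N<p (ℕP.m≤n⇒m≤1+n (ℕP.m≤m+n m m)) hyp)
        (cg-trans (≡⇒cg (≡.trans (cong (λ z → + 2 * z * alt (3 ℕ.+ 4 ℕ.* m) m) (^-square (+ 2) m)) (ℤP.*-assoc (+ 2) ((+ 4) ^ m) (alt (3 ℕ.+ 4 ℕ.* m) m))))
          (cg-trans (cg-*ˡ (+ 2) alt≡0) (≡⇒cg refl)))

residue-24 : ∀ p r → p % 24 ≡ r → p ≡ r ℕ.+ (p ℕ./ 24) ℕ.* 24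
residue-24 p r e = ≡.trans (m≡m%n+[m/n]*n p 24) (cong (ℕ._+ (p ℕ./ 24) ℕ.* 24) e)

theorem3p3 : (p : ℕ) → Prime p →
    ((p % 24 ≡ 1 ⊎ p % 24 ≡ 7) →
    (x y : ℤ) → + p ≡ x * x + + 6 * (y * y) →
    sumℚ (p ∸ 1) term ≡ℚ ((+ 4 * (x * x)) / 1) [mod p ])
    × ((p % 24 ≡ 17 ⊎ p % 24 ≡ 23) →
    sumℚ (p ∸ 1) term ≡ℚ 0ℚ [mod p ])
theorem3p3 p pr = first , second
  where
    j = p ℕ./ 24
    S = sumℚ (p ∸ 1) term

    case₁ : p % 24 ≡ 1 ⊎ p % 24 ≡ 7 → Σ ℕ λ m → p ≡ 1 ℕ.+ 6 ℕ.* m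
    case₁ (inj₁ h) = 4 ℕ.* j , ≡.trans (residue-24 p 1 h) (lem j)
      where lem : ∀ j → 1 ℕ.+ j ℕ.* 24 ≡ 1 ℕ.+ 6 ℕ.* (4 ℕ.* j)
            lem = ℕSolver.solve-∀
    case₁ (inj₂ h) = 1 ℕ.+ 4 ℕ.* j , ≡.trans (residue-24 p 7 h) (lem j)
      where lem : ∀ j → 7 ℕ.+ j ℕ.* 24 ≡ 1 ℕ.+ 6 ℕ.* (1 ℕ.+ 4 ℕ.* j)
            lem = ℕSolver.solve-∀

    first : (p % 24 ≡ 1 ⊎ p % 24 ≡ 7) → (x y : ℤ) → + p ≡ x * x + + 6 * (y * y) → S ≡ℚ ((+ 4 * (x * x)) / 1) [mod p ]
    first h x y e with case₁ h
    ... | zero , p≡ = contradiction (subst Prime p≡ pr) ¬prime[1]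
    ... | suc m , p≡ = conclude pr (S ℚ.- b) (numerator (p ∸ 1) + - (E * (+ 4 * (x * x)))) (p ∸ 1) (p∤8 pr 5≤p)
        (fraction-+ S (ℚ.- b) (fraction-sum (p ∸ 1)) (fraction-neg b (subst (Fraction b (E * (+ 4 * (x * x)))) (ℤP.*-identityʳ E) (fraction-scale b E (fraction-/ (+ 4 * (x * x)) 1)))))
        (cg-trans (cg-+ (numerator₁ pr 5≤p (suc m) p≡ x y e) (neg E≡1)) (≡⇒cg (ℤP.+-inverseʳ (+ 4 * (x * x)))))
      where
        b = (+ 4 * (x * x)) / 1
        -- The sum has denominator E, so 4x² is written as 4x² E over E; by Fermat E ≡ 1 modulo p,
        -- and the difference of numerators is congruent to 4x² - 4x².
        E = (+ 8) ^ (p ∸ 1)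
        5≤p : 5 ≤ p
        5≤p = subst (5 ≤_) (≡.sym p≡) (s≤s (ℕP.≤-trans (s≤s (s≤s (s≤s (s≤s z≤n)))) (ℕP.*-monoʳ-≤ 6 (s≤s (z≤n {m})))))
        E≡1 : E ≡ + 1 [ p ]
        E≡1 = FermatU.fermat′ pr (p∤2 pr 5≤p) 8 (p ∸ 1) (≡.trans (cong (λ z → suc (z ∸ 1)) p≡) (≡.sym p≡)) (p∤8 pr 5≤p)
        neg : E ≡ + 1 [ p ] → - (E * (+ 4 * (x * x))) ≡ - (+ 4 * (x * x)) [ p ]
        neg h = cg-trans (≡⇒cg (≡.sym (ℤP.-1*i≡-i (E * (+ 4 * (x * x)))))) (cg-trans (cg-*ˡ (- + 1) (cg-* h (cg-refl {a = + 4 * (x * x)})))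
          (≡⇒cg (lem (+ 4 * (x * x)))))
          where lem : ∀ y → - + 1 * (+ 1 * y) ≡ - y
                lem = solve-∀

    case₅ : p % 24 ≡ 17 ⊎ p % 24 ≡ 23 → Σ ℕ λ m → p ≡ 5 ℕ.+ 6 ℕ.* m × (m ≡ 2 ℕ.+ 4 ℕ.* j ⊎ m ≡ 3 ℕ.+ 4 ℕ.* j)
    case₅ (inj₁ h) = 2 ℕ.+ 4 ℕ.* j , ≡.trans (residue-24 p 17 h) (lem j) , inj₁ refl
      where lem : ∀ j → 17 ℕ.+ j ℕ.* 24 ≡ 5 ℕ.+ 6 ℕ.* (2 ℕ.+ 4 ℕ.* j)
            lem = ℕSolver.solve-∀
    case₅ (inj₂ h) = 3 ℕ.+ 4 ℕ.* j , ≡.trans (residue-24 p 23 h) (lem j) , inj₂ refl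
      where lem : ∀ j → 23 ℕ.+ j ℕ.* 24 ≡ 5 ℕ.+ 6 ℕ.* (3 ℕ.+ 4 ℕ.* j)
            lem = ℕSolver.solve-∀

    second : (p % 24 ≡ 17 ⊎ p % 24 ≡ 23) → S ≡ℚ 0ℚ [mod p ]
    second h with case₅ h
    ... | m , p≡ , m≡ = conclude pr (S ℚ.- 0ℚ) (numerator (p ∸ 1) + - + 0) (p ∸ 1) (p∤8 pr 5≤p)
        (fraction-+ S (ℚ.- 0ℚ) (fraction-sum (p ∸ 1)) (fraction-neg 0ℚ {+ 0} (fraction refl)))
        (cg-+ (numerator₅ pr 5≤p m j p≡ m≡) (cg-refl {a = + 0}))
      where
        5≤p : 5 ≤ p
        5≤p = subst (5 ≤_) (≡.sym p≡) (ℕP.m≤m+n 5 (6 ℕ.* m))
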